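{- There exists $\tau_0>0$ such that for every $0<\tau\le\tau_0$ there exists $\varepsilon_0>0$ such that for every $0<\varepsilon\le \varepsilon_0$ there exists $n_0$ such that the following holds for all $n \ge n_0$ and all integers $s$ with $\tau n < s \le n/3$. If $H$ is a $3$-uniform hypergraph on $n$ vertices with no isolated vertex such that $\sigma_2(H) > 2sn - \varepsilon n^2$, then either $H$ is a subgraph of $H^2_{n,s}$ or $H$ contains a matching of size $s$.
   Context: A $3$-uniform hypergraph ($3$-graph) $H=(V,E)$ has $E$ a family of $3$-element subsets of the finite set $V$. For $v\in V$, $\deg(v)$ is the number of edges containing $v$. Two vertices are adjacent if some edge contains both of them. $\sigma_2(H)$ denotes the minimum of $\deg(u)+\deg(v)$ over all pairs of distinct adjacent vertices $u,v$. A matching of size $s$ is a set of $s$ pairwise disjoint edges; an isolated vertex lies in no edge. $H^2_{n,s}$ is the $3$-graph on $n$ vertices whose vertex set is partitioned into sets $S,T$ with $|S|=n-2s+1$, $|T|=2s-1$, and whose edges are all triples with at least two vertices in $T$. "$H$ is a subgraph of $H^2_{n,s}$" means that $V(H)$ can be partitioned into $S\cup T$ with $|S|=n-2s+1$, $|T|=2s-1$ such that every edge of $H$ has at least two vertices in $T$. -}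

module Defs where

open import Data.Nat using (ℕ; _+_; _∸_; _*_; _≤_)
open import Data.Integer using (+_)
open import Data.Rational using (ℚ; _/_)
open import Data.Fin using (Fin)
open import Data.Fin.Subset using (Subset; _∈_; _∩_; ∣_∣; Empty)
open import Data.Fin.Subset.Properties using (_∈?_)
open import Data.List using (List; length; filter)
open import Data.List.Relation.Unary.All using (All)
open import Data.List.Relation.Unary.Unique.Propositional using (Unique)
open import Data.List.Relation.Unary.AllPairs using (AllPairs)
import Data.List.Membership.Propositional as Mem
open import Data.Product using (Σ; _×_; ∃)
open import Relation.Binary.PropositionalEquality using (_≡_; _≢_)

record Hypergraph3 (n : ℕ) : Set where
  field
    edges   : List (Subset n)
    unique  : Unique edges
    uniform : All (λ e → ∣ e ∣ ≡ 3) edges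
open Hypergraph3 public

_∈E_ : ∀ {n} → Subset n → Hypergraph3 n → Set
e ∈E H = e Mem.∈ edges H

deg : ∀ {n} → Hypergraph3 n → Fin n → ℕ
deg H v = length (filter (v ∈?_) (edges H))

Adjacent : ∀ {n} → Hypergraph3 n → Fin n → Fin n → Set
Adjacent H u v = ∃ λ e → e ∈E H × u ∈ e × v ∈ e

NoIsolated : ∀ {n} → Hypergraph3 n → Set
NoIsolated H = ∀ v → ∃ λ e → e ∈E H × v ∈ e

ℕ→ℚ : ℕ → ℚ
ℕ→ℚ m = + m / 1

-- σ₂(H) > x  : the minimum of deg u + deg v over distinct adjacent pairs
-- exceeds x, i.e. every such pair has degree sum exceeding x.
σ₂> : ∀ {n} → Hypergraph3 n → ℚ → Set
σ₂> H x = ∀ u v → u ≢ v → Adjacent H u v →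
  x Data.Rational.< ℕ→ℚ (deg H u + deg H v)

HasMatching : ∀ {n} → Hypergraph3 n → ℕ → Set
HasMatching H s = Σ (List (Subset _)) λ M →
  length M ≡ s × All (_∈E H) M × AllPairs (λ e f → Empty (e ∩ f)) M

-- H is a subgraph of H²_{n,s}: there is T ⊆ V with |T| = 2s-1
-- (and S = V \ T, |S| = n-2s+1) such that every edge has ≥ 2 vertices in T
SubgraphOfH2 : ∀ {n} → Hypergraph3 n → ℕ → Set
SubgraphOfH2 {n} H s = Σ (Subset n) λ T →
  ∣ T ∣ ≡ 2 * s ∸ 1 × (∀ e → e ∈E H → 2 ≤ ∣ e ∩ T ∣)

{-# OPTIONS --safe #-}
module Submission where

-- Degrees are counted by ordered pairs, and E ≤ k² bounds the error term, where n ≤ c k and 200 k ≤ s. Let W be the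
-- set of vertices (those with w x = true) whose degree falls short of s n by more than the error, and U its complement.
-- By the Ore condition no edge has two vertices in W, so H is a subgraph of H²(n,s) if |U| < 2s. Otherwise:
-- If |U|² is at most about 2 s n, a neighbour of a vertex of W has a degree so large that a greedy matching of such
-- pairs, filled up with vertices of U, gives s disjoint triples of large degree sum; non-edges among them are then
-- exchanged for edges, each exchange affecting at most two further triples.
-- If |U|² is larger, a matching whose edges meet W is extended until at most b vertices of W are left over, and then
-- enlarged: counting the popular pairs between at most three edges of the matching and the remaining vertices, the
-- degree bound yields a local improvement until only a bounded number of edges is missing. This suffices if
-- n ≥ 3 s + 4 R₀, as one may aim at s + R₀ edges. If n is closer to 3 s, then |U| ≥ 4n/5, any triple of vertices with
-- at most one in W is covered by a positive proportion of all gadgets of nine vertices, and a small family of disjoint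
-- gadgets reserved in advance absorbs the last few triples.

open import Defs
open import Data.Nat using (ℕ; zero; suc; _+_; _*_; _∸_; _^_; _≤_; _<_; _≥_; z≤n; s≤s; _≤?_; _<?_; _≟_; _<ᵇ_; _≤ᵇ_; >-nonZero; s≤s⁻¹)
open import Data.Nat.Properties
open import Data.Nat.Tactic.RingSolver using (solve-∀)
import Data.Integer as ℤ
import Data.Integer.Properties as ℤ
open import Data.Rational using (ℚ; mkℚ; 0ℚ; 1ℚ; _-_; ↧ₙ_; toℚᵘ; fromℚᵘ)
import Data.Rational as ℚ
import Data.Rational.Properties as ℚ
open import Data.Rational.Unnormalised using (mkℚᵘ)
import Data.Rational.Unnormalised as ℚᵘ
import Data.Rational.Unnormalised.Properties as ℚᵘ
open import Data.Bool using (Bool; true; false; _∧_; _∨_; not; if_then_else_) renaming (T to IsTrue)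
open import Data.Bool.Properties using (∧-identityʳ)
open import Data.Fin using (Fin; zero; suc) renaming (_≟_ to _≟ᶠ_)
open import Data.Fin.Subset using (Subset; _∈_; _∩_; ∣_∣; Empty)
open import Data.Fin.Subset.Properties using (_∈?_; x∈p∩q⁻)
open import Data.Vec as Vec using ([]; _∷_; lookup)
open import Data.Vec.Properties using ([]=⇒lookup; lookup⇒[]=; tabulate∘lookup; tabulate-cong; lookup∘tabulate; lookup-zipWith)
open import Data.List using (List; []; _∷_; _++_; length; map; concat; allFin; tabulate; filter)
open import Data.List.Properties using (map-tabulate; length-tabulate)
open import Data.List.Membership.Propositional as Mem using (find; lose)
open import Data.List.Relation.Unary.All as All using (All; []; _∷_)
open import Data.List.Relation.Unary.AllPairs using (AllPairs; []; _∷_)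
open import Data.List.Relation.Unary.Any using (Any; here; there; any?)
open import Data.List.Relation.Unary.Unique.Propositional using (Unique)
open import Data.Product using (Σ; _×_; _,_; proj₁; proj₂; ∃-syntax)
open import Data.Sum using (_⊎_; inj₁; inj₂; [_,_]′)
open import Data.Maybe using (Maybe; just; nothing)
open import Data.Unit using (⊤; tt)
open import Data.Empty using (⊥; ⊥-elim)
open import Relation.Nullary using (Dec; yes; no; does; toSum)
open import Relation.Nullary.Decidable using (_×-dec_; ¬?; dec-true; dec-false)
open import Relation.Binary.PropositionalEquality hiding ([_]; J)
open import Function using (_∘_; case_of_)

shuffle₁ : ∀ a b → a * ((1 + b) * ((1 + b) * (1 + b))) + 6 * (9 * ((1 + b) * (1 + b))) ≡ (1 + b) * (a * ((1 + b) * (1 + b)) + 54 * (1 + b))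
shuffle₁ = solve-∀

6*[a+2*b]≡6*a+6*[2*b] : ∀ a b → 6 * (a + 2 * b) ≡ 6 * a + 6 * (2 * b)
6*[a+2*b]≡6*a+6*[2*b] = solve-∀

[1+a]*[6*b]≡6*[[1+a]*b] : ∀ a b → (1 + a) * (6 * b) ≡ 6 * ((1 + a) * b)
[1+a]*[6*b]≡6*[[1+a]*b] = solve-∀

1*[a*1]+0≡a : ∀ a → 1 * (a * 1) + 0 ≡ a
1*[a*1]+0≡a = solve-∀

a*b*[c*d]+[a*c*e+f]≡a*c*[b*d+e]+f : ∀ a b c d e f → a * b * (c * d) + (a * c * e + f) ≡ a * c * (b * d + e) + f
a*b*[c*d]+[a*c*e+f]≡a*c*[b*d+e]+f = solve-∀

a*[b*c]≡b*[a*c] : ∀ a b c → a * (b * c) ≡ b * (a * c)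
a*[b*c]≡b*[a*c] = solve-∀

a+[b+c]≡b+[a+c] : ∀ a b c → a + (b + c) ≡ b + (a + c)
a+[b+c]≡b+[a+c] = solve-∀

[a+b]*c+d≡a*c+[b*c+d] : ∀ a b c d → (a + b) * c + d ≡ a * c + (b * c + d)
[a+b]*c+d≡a*c+[b*c+d] = solve-∀

a+[b+[c+[d+e]]]≡b+[c+[d+[a+e]]] : ∀ a b c d e → a + (b + (c + (d + e))) ≡ b + (c + (d + (a + e)))
a+[b+[c+[d+e]]]≡b+[c+[d+[a+e]]] = solve-∀

a*b+a*c+[c+b]≡[1+a]*[b+c] : ∀ a b c → a * b + a * c + (c + b) ≡ (1 + a) * (b + c)
a*b+a*c+[c+b]≡[1+a]*[b+c] = solve-∀

a+b+c+2*[d+b]≡[a+d]+[c+2*b]+[b+d] : ∀ a b c d → a + b + c + 2 * (d + b) ≡ (a + d) + (c + 2 * b) + (b + d)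
a+b+c+2*[d+b]≡[a+d]+[c+2*b]+[b+d] = solve-∀

a*b+[b+[c+c*a]]≡[1+a]*[c+b]′ : ∀ c a b → a * b + (b + (c + c * a)) ≡ (1 + a) * (c + b)
a*b+[b+[c+c*a]]≡[1+a]*[c+b]′ = solve-∀

a*b+c+d+[a+c]≡d+c+[c+[a+a*b]] : ∀ a b c d → a * b + c + d + (a + c) ≡ d + c + (c + (a + a * b))
a*b+c+d+[a+c]≡d+c+[c+[a+a*b]] = solve-∀

a*b*c≡a*[c*b] : ∀ a b c → a * b * c ≡ a * (c * b)
a*b*c≡a*[c*b] = solve-∀

a+[b+[c+d]]≡b+[c+[a+d]] : ∀ a b c d → a + (b + (c + d)) ≡ b + (c + (a + d))
a+[b+[c+d]]≡b+[c+[a+d]] = solve-∀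

shuffle₂ : ∀ a d b c → a * (b + c) + (a + d) * b + d * c ≡ a * b + (a + d) * (b + c)
shuffle₂ = solve-∀

3*a*b+[b*3*a+c]≡a*b*6+c : ∀ a b c → 3 * a * b + (b * 3 * a + c) ≡ a * b * 6 + c
3*a*b+[b*3*a+c]≡a*b*6+c = solve-∀

a+b+[c+d+e]≡a+c+[b+d]+e : ∀ a b c d e → a + b + (c + d + e) ≡ a + c + (b + d) + e
a+b+[c+d+e]≡a+c+[b+d]+e = solve-∀

a+[b+[c+d]]≡a+b+c+d : ∀ a b c d → a + (b + (c + d)) ≡ a + b + c + d
a+[b+[c+d]]≡a+b+c+d = solve-∀

a+a+a≡a*3 : ∀ a → a + a + a ≡ a * 3
a+a+a≡a*3 = solve-∀

a+b+[b+c]≡a+2*b+c : ∀ a b c → a + b + (b + c) ≡ a + 2 * b + c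
a+b+[b+c]≡a+2*b+c = solve-∀

a+b+[b+[c+2*d]]≡a+c+2*[b+d] : ∀ a b c d → a + b + (b + (c + 2 * d)) ≡ a + c + 2 * (b + d)
a+b+[b+[c+2*d]]≡a+c+2*[b+d] = solve-∀

a+b+c+d≡a+c+[d+b] : ∀ a b c d → a + b + c + d ≡ a + c + (d + b)
a+b+c+d≡a+c+[d+b] = solve-∀

a+b+[c+d]≡a+d+c+b : ∀ a b c d → a + b + (c + d) ≡ a + d + c + b
a+b+[c+d]≡a+d+c+b = solve-∀

a+b+c+[d+e]≡b+c+d+[a+e] : ∀ a b c d e → a + b + c + (d + e) ≡ b + c + d + (a + e)
a+b+c+[d+e]≡b+c+d+[a+e] = solve-∀

3*a*a≡a*a*3 : ∀ a → 3 * a * a ≡ a * a * 3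
3*a*a≡a*a*3 = solve-∀

a*3+b*3+c*3+d≡1*3*a+[1*3*[b+c]+d] : ∀ a b c d → a * 3 + b * 3 + c * 3 + d ≡ 1 * 3 * a + (1 * 3 * (b + c) + d)
a*3+b*3+c*3+d≡1*3*a+[1*3*[b+c]+d] = solve-∀

a*6*b≡a*b*6 : ∀ a b → a * 6 * b ≡ a * b * 6
a*6*b≡a*b*6 = solve-∀

a+[b+[c+d]]+e≡a+b+c+d+e : ∀ a b c d e → a + (b + (c + d)) + e ≡ a + b + c + d + e
a+[b+[c+d]]+e≡a+b+c+d+e = solve-∀

shuffle₇ : ∀ a b c d e f g → a + b + c + d + e + f + g ≡ a + (b + (c + (d + 0))) + (e + 0) + (f + g)
shuffle₇ = solve-∀

shuffle₉ : ∀ a b c d e f g → a + b + c + d + (e + (f + g)) ≡ a + e + (b + f + 0) + (c + 0) + (d + g)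
shuffle₉ = solve-∀

a+[b+[c+d]]≡b+c+0+0+[a+d] : ∀ a b c d → a + (b + (c + d)) ≡ b + c + 0 + 0 + (a + d)
a+[b+[c+d]]≡b+c+0+0+[a+d] = solve-∀

a+b+[c+d]≡a+[c+[b+d]] : ∀ a b c d → a + b + (c + d) ≡ a + (c + (b + d))
a+b+[c+d]≡a+[c+[b+d]] = solve-∀

a*3+3+b≡1*3*a+[1+[1+[1+b]]] : ∀ a b → a * 3 + 3 + b ≡ 1 * 3 * a + (1 + (1 + (1 + b)))
a*3+3+b≡1*3*a+[1+[1+[1+b]]] = solve-∀

9+[9+[9+[a*3+6]]]≡a*3+33 : ∀ a → 9 + (9 + (9 + (a * 3 + 6))) ≡ a * 3 + 33
9+[9+[9+[a*3+6]]]≡a*3+33 = solve-∀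

a+b+c+d≡a+[b+[c+d]] : ∀ a b c d → a + b + c + d ≡ a + (b + (c + d))
a+b+c+d≡a+[b+[c+d]] = solve-∀

a+b+c+0+d+e≡d+[a+[b+[c+e]]] : ∀ a b c d e → a + b + c + 0 + d + e ≡ d + (a + (b + (c + e)))
a+b+c+0+d+e≡d+[a+[b+[c+e]]] = solve-∀

0+a+0+[b+0+0]+[0+0+0]≡a+b : ∀ a b → 0 + a + 0 + (b + 0 + 0) + (0 + 0 + 0) ≡ a + b
0+a+0+[b+0+0]+[0+0+0]≡a+b = solve-∀

a+b+c≡a+[b+[c+0]] : ∀ a b c → a + b + c ≡ a + (b + (c + 0))
a+b+c≡a+[b+[c+0]] = solve-∀

a*b+a*c+a*d≡a*[b+c+d] : ∀ a b c d → a * b + a * c + a * d ≡ a * (b + c + d)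
a*b+a*c+a*d≡a*[b+c+d] = solve-∀

a*b+c*b+b*b≡b*[b+c+a]′ : ∀ a c b → a * b + c * b + b * b ≡ b * (b + c + a)
a*b+c*b+b*b≡b*[b+c+a]′ = solve-∀

a+a≡a*2 : ∀ a → a + a ≡ a * 2
a+a≡a*2 = solve-∀

a+b+c+d+e≡d+[a+[b+[c+e]]] : ∀ a b c d e → a + b + c + d + e ≡ d + (a + (b + (c + e)))
a+b+c+d+e≡d+[a+[b+[c+e]]] = solve-∀

a+[b+[c+d]]≡b+c+a+d : ∀ a b c d → a + (b + (c + d)) ≡ b + c + a + d
a+[b+[c+d]]≡b+c+a+d = solve-∀

a+b+c+[d+e]≡b+a+d+[c+e] : ∀ a b c d e → a + b + c + (d + e) ≡ b + a + d + (c + e)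
a+b+c+[d+e]≡b+a+d+[c+e] = solve-∀

3+[a+b]≡a+[3+b] : ∀ a b → 3 + (a + b) ≡ a + (3 + b)
3+[a+b]≡a+[3+b] = solve-∀

a+b+c+[0+d]≡a+[b+[c+d]] : ∀ a b c d → a + b + c + (0 + d) ≡ a + (b + (c + d))
a+b+c+[0+d]≡a+[b+[c+d]] = solve-∀

a+[b+[c+[d+[e+f]]]]≡a+[c+d+e+b+f] : ∀ a b c d e f → a + (b + (c + (d + (e + f)))) ≡ a + (c + d + e + b + f)
a+[b+[c+[d+[e+f]]]]≡a+[c+d+e+b+f] = solve-∀

a*b*3≡a*3*b : ∀ a b → a * b * 3 ≡ a * 3 * b
a*b*3≡a*3*b = solve-∀

a*9≡a*3*3 : ∀ a → a * 9 ≡ a * 3 * 3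
a*9≡a*3*3 = solve-∀

a*3+b*3+c≡3*a+[3*b+c] : ∀ a b c → a * 3 + b * 3 + c ≡ 3 * a + (3 * b + c)
a*3+b*3+c≡3*a+[3*b+c] = solve-∀

a*b+[b*a+c]≡a*b*2+c : ∀ a b c → a * b + (b * a + c) ≡ a * b * 2 + c
a*b+[b*a+c]≡a*b*2+c = solve-∀

a*a*[a*a]≡a*[a*[a*[a*1]]] : ∀ a → a * a * (a * a) ≡ a * (a * (a * (a * 1)))
a*a*[a*a]≡a*[a*[a*[a*1]]] = solve-∀

a*b*[2*c]≡a*2*[b*c] : ∀ a b c → a * b * (2 * c) ≡ a * 2 * (b * c)
a*b*[2*c]≡a*2*[b*c] = solve-∀

a*[b*2]≡b*[a+a] : ∀ a b → a * (b * 2) ≡ b * (a + a)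
a*[b*2]≡b*[a+a] = solve-∀

[1+a]*[a*b]≡a*[[1+a]*b] : ∀ a b → (1 + a) * (a * b) ≡ a * ((1 + a) * b)
[1+a]*[a*b]≡a*[[1+a]*b] = solve-∀

a*b*[a+[1+c]]+b*c≡[1+a]*[b*[a+c]]′ : ∀ a c b → a * b * (a + (1 + c)) + b * c ≡ (1 + a) * (b * (a + c))
a*b*[a+[1+c]]+b*c≡[1+a]*[b*[a+c]]′ = solve-∀

1*[a+0]≡a*1 : ∀ a → 1 * (a + 0) ≡ a * 1
1*[a+0]≡a*1 = solve-∀

a*[b*c]≡b*a*c : ∀ a b c → a * (b * c) ≡ b * a * c
a*[b*c]≡b*a*c = solve-∀

a+[9+b]≡9+a+b : ∀ a b → a + (9 + b) ≡ 9 + a + b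
a+[9+b]≡9+a+b = solve-∀

a+[b+c]≡b+a+c : ∀ a b c → a + (b + c) ≡ b + a + c
a+[b+c]≡b+a+c = solve-∀

4+[a*3+[b*3+c]]≡[1+a+b]*3+[1+c] : ∀ a b c → 4 + (a * 3 + (b * 3 + c)) ≡ (1 + a + b) * 3 + (1 + c)
4+[a*3+[b*3+c]]≡[1+a+b]*3+[1+c] = solve-∀

a*3+[b*3+c]≡[a+b]*3+c : ∀ a b c → a * 3 + (b * 3 + c) ≡ (a + b) * 3 + c
a*3+[b*3+c]≡[a+b]*3+c = solve-∀

a+[b+[c+d]]≡b+[c+a]+d : ∀ a b c d → a + (b + (c + d)) ≡ b + (c + a) + d
a+[b+[c+d]]≡b+[c+a]+d = solve-∀

a+[b+c]+d≡a+b+d+c : ∀ a b c d → a + (b + c) + d ≡ a + b + d + c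
a+[b+c]+d≡a+b+d+c = solve-∀

a+b+c≡a+c+b : ∀ a b c → a + b + c ≡ a + c + b
a+b+c≡a+c+b = solve-∀

a+[b+[c+d]]≡a+c+b+d : ∀ a b c d → a + (b + (c + d)) ≡ a + c + b + d
a+[b+[c+d]]≡a+c+b+d = solve-∀

a*2+a≡a*3 : ∀ a → a * 2 + a ≡ a * 3
a*2+a≡a*3 = solve-∀

a+b+c+[d+e]≡a+b+d+[c+e] : ∀ a b c d e → a + b + c + (d + e) ≡ a + b + d + (c + e)
a+b+c+[d+e]≡a+b+d+[c+e] = solve-∀

a*a*4≡a*2*[a*2] : ∀ a → a * a * 4 ≡ a * 2 * (a * 2)
a*a*4≡a*2*[a*2] = solve-∀

a+[b+a]*3≡b*3+a*4′ : ∀ b a → a + (b + a) * 3 ≡ b * 3 + a * 4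
a+[b+a]*3≡b*3+a*4′ = solve-∀

a*b*[a*b]*3≡a*a*3*[b*b] : ∀ a b → a * b * (a * b) * 3 ≡ a * a * 3 * (b * b)
a*b*[a*b]*3≡a*a*3*[b*b] = solve-∀

a*[a*a*a]≡a*a*[a*a] : ∀ a → a * (a * a * a) ≡ a * a * (a * a)
a*[a*a*a]≡a*a*[a*a] = solve-∀

a*b*[a*b*[a*b]]≡a*a*a*[b*b*b] : ∀ a b → a * b * (a * b * (a * b)) ≡ a * a * a * (b * b * b)
a*b*[a*b*[a*b]]≡a*a*a*[b*b*b] = solve-∀

a≡1*[1*1]*[a*1] : ∀ a → a ≡ 1 * (1 * 1) * (a * 1)
a≡1*[1*1]*[a*1] = solve-∀

clear-denominator-identity : ∀ b a c → (a * (suc b * 1) + 1 * c * 1) * 1 ≡ suc b * a + c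
clear-denominator-identity = solve-∀

denominator-identity : ∀ b a → a * suc (b * 1 + 0) ≡ suc b * a
denominator-identity = solve-∀

∧-split : ∀ {a b} → a ∧ b ≡ true → a ≡ true × b ≡ true
∧-split {true} {true} _ = refl , refl

-- Polynomial inequalities over ℕ are derived from hypotheses by certificates: a nonnegative
-- combination of the hypotheses, plus a polynomial with nonnegative coefficients, gives the goal.
-- The check computes on closed normal forms, so that large coefficients do no harm.

infixl 6 _:+_
infixl 7 _:*_

data Expr : Set where
  ‵ ♯  : ℕ → Expr
  _:+_ : Expr → Expr → Expr
  _:*_ : Expr → Expr → Expr

Monomial Polynomial : Set
Monomial   = List ℕ
Polynomial = List (ℕ × Monomial)

value : List ℕ → ℕ → ℕ
value []      _       = 0
value (x ∷ ρ) zero    = x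
value (x ∷ ρ) (suc i) = value ρ i

eval : List ℕ → Expr → ℕ
eval ρ (‵ i)    = value ρ i
eval ρ (♯ k)    = k
eval ρ (e :+ f) = eval ρ e + eval ρ f
eval ρ (e :* f) = eval ρ e * eval ρ f

evalMonomial : List ℕ → Monomial → ℕ
evalMonomial ρ []      = 1
evalMonomial ρ (i ∷ m) = value ρ i * evalMonomial ρ m

evalPolynomial : List ℕ → Polynomial → ℕ
evalPolynomial ρ []            = 0
evalPolynomial ρ ((k , m) ∷ p) = k * evalMonomial ρ m + evalPolynomial ρ p

same : (m m′ : Monomial) → Maybe (m ≡ m′)
same []      []       = just refl
same []      (_ ∷ _)  = nothing
same (_ ∷ _) []       = nothing
same (i ∷ m) (j ∷ m′) with i ≟ j | same m m′
... | yes refl | just refl = just refl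
... | _        | _         = nothing

before : Monomial → Monomial → Bool
before []      _        = true
before (_ ∷ _) []       = false
before (i ∷ m) (j ∷ m′) = if i <ᵇ j then true else if j <ᵇ i then false else before m m′

insert : ℕ × Monomial → Polynomial → Polynomial
insert t       []             = t ∷ []
insert (k , m) ((l , m′) ∷ p) with same m m′
... | just _  = (k + l , m′) ∷ p
... | nothing = if before m m′ then (k , m) ∷ (l , m′) ∷ p else (l , m′) ∷ insert (k , m) p

insertVar : ℕ → Monomial → Monomial
insertVar i []      = i ∷ []
insertVar i (j ∷ m) = if i <ᵇ j then i ∷ j ∷ m else j ∷ insertVar i m

mulMonomial : Monomial → Monomial → Monomial
mulMonomial []      m′ = m′
mulMonomial (i ∷ m) m′ = insertVar i (mulMonomial m m′)

mulTerm : ℕ × Monomial → Polynomial → Polynomial → Polynomial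
mulTerm t       []             r = r
mulTerm (k , m) ((l , m′) ∷ q) r = insert (k * l , mulMonomial m m′) (mulTerm (k , m) q r)

addPolynomial mulPolynomial : Polynomial → Polynomial → Polynomial
addPolynomial []      q = q
addPolynomial (t ∷ p) q = insert t (addPolynomial p q)
mulPolynomial []      q = []
mulPolynomial (t ∷ p) q = mulTerm t q (mulPolynomial p q)

normalise : Expr → Polynomial
normalise (‵ i)       = (1 , i ∷ []) ∷ []
normalise (♯ zero)    = []
normalise (♯ (suc k)) = (suc k , []) ∷ []
normalise (e :+ f)    = addPolynomial (normalise e) (normalise f)
normalise (e :* f)    = mulPolynomial (normalise e) (normalise f)

module _ (ρ : List ℕ) where

  private
    M = evalMonomial ρ
    P = evalPolynomial ρ

  insert-correct : ∀ k m p → P (insert (k , m) p) ≡ k * M m + P p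
  insert-correct k m [] = refl
  insert-correct k m ((l , m′) ∷ p) with same m m′
  ... | just refl = [a+b]*c+d≡a*c+[b*c+d] k l (M m) (P p)
  ... | nothing with before m m′
  ...   | true  = refl
  ...   | false = trans (cong (l * M m′ +_) (insert-correct k m p)) (a+[b+c]≡b+[a+c] (l * M m′) (k * M m) (P p))

  insertVar-correct : ∀ i m → M (insertVar i m) ≡ value ρ i * M m
  insertVar-correct i [] = refl
  insertVar-correct i (j ∷ m) with i <ᵇ j
  ... | true  = refl
  ... | false = trans (cong (value ρ j *_) (insertVar-correct i m)) (a*[b*c]≡b*[a*c] (value ρ j) (value ρ i) (M m))

  mulMonomial-correct : ∀ m m′ → M (mulMonomial m m′) ≡ M m * M m′
  mulMonomial-correct []      m′ = sym (+-identityʳ _)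
  mulMonomial-correct (i ∷ m) m′ = begin
    M (insertVar i (mulMonomial m m′)) ≡⟨ insertVar-correct i (mulMonomial m m′) ⟩
    value ρ i * M (mulMonomial m m′)   ≡⟨ cong (value ρ i *_) (mulMonomial-correct m m′) ⟩
    value ρ i * (M m * M m′)           ≡⟨ sym (*-assoc (value ρ i) _ _) ⟩
    value ρ i * M m * M m′             ∎
    where open ≡-Reasoning

  mulTerm-correct : ∀ k m q r → P (mulTerm (k , m) q r) ≡ k * M m * P q + P r
  mulTerm-correct k m [] r = cong (_+ P r) (sym (*-zeroʳ (k * M m)))
  mulTerm-correct k m ((l , m′) ∷ q) r = begin
    P (insert (k * l , mulMonomial m m′) (mulTerm (k , m) q r))
      ≡⟨ insert-correct (k * l) (mulMonomial m m′) (mulTerm (k , m) q r) ⟩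
    k * l * M (mulMonomial m m′) + P (mulTerm (k , m) q r)
      ≡⟨ cong₂ (λ a b → k * l * a + b) (mulMonomial-correct m m′) (mulTerm-correct k m q r) ⟩
    k * l * (M m * M m′) + (k * M m * P q + P r)
      ≡⟨ a*b*[c*d]+[a*c*e+f]≡a*c*[b*d+e]+f k l (M m) (M m′) (P q) (P r) ⟩
    k * M m * (l * M m′ + P q) + P r ∎
    where
    open ≡-Reasoning

  addPolynomial-correct : ∀ p q → P (addPolynomial p q) ≡ P p + P q
  addPolynomial-correct []            q = refl
  addPolynomial-correct ((k , m) ∷ p) q =
    trans (insert-correct k m (addPolynomial p q))
      (trans (cong (k * M m +_) (addPolynomial-correct p q)) (sym (+-assoc (k * M m) _ _)))

  mulPolynomial-correct : ∀ p q → P (mulPolynomial p q) ≡ P p * P q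
  mulPolynomial-correct []            q = refl
  mulPolynomial-correct ((k , m) ∷ p) q =
    trans (mulTerm-correct k m q (mulPolynomial p q))
      (trans (cong (k * M m * P q +_) (mulPolynomial-correct p q)) (sym (*-distribʳ-+ (P q) (k * M m) _)))

  normalise-correct : ∀ e → P (normalise e) ≡ eval ρ e
  normalise-correct (‵ i)       = 1*[a*1]+0≡a (value ρ i)
  normalise-correct (♯ zero)    = refl
  normalise-correct (♯ (suc k)) = trans (+-identityʳ _) (*-identityʳ (suc k))
  normalise-correct (e :+ f)    =
    trans (addPolynomial-correct (normalise e) (normalise f)) (cong₂ _+_ (normalise-correct e) (normalise-correct f))
  normalise-correct (e :* f)    =
    trans (mulPolynomial-correct (normalise e) (normalise f)) (cong₂ _*_ (normalise-correct e) (normalise-correct f))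

dominated : Polynomial → Polynomial → Bool
dominated []            q              = true
dominated (_ ∷ _)       []             = false
dominated ((k , m) ∷ p) ((l , m′) ∷ q) with same m m′
... | just _  = (k ≤ᵇ l) ∧ dominated p q
... | nothing = dominated ((k , m) ∷ p) q

dominated-correct : ∀ ρ p q → dominated p q ≡ true → evalPolynomial ρ p ≤ evalPolynomial ρ q
dominated-correct ρ []            q              _  = z≤n
dominated-correct ρ ((k , m) ∷ p) ((l , m′) ∷ q) ok with same m m′
... | just refl = let k≤l , rest = ∧-split ok in
  +-mono-≤ (*-monoˡ-≤ (evalMonomial ρ m) (≤ᵇ⇒≤ k l (subst IsTrue (sym k≤l) _))) (dominated-correct ρ p q rest)
... | nothing = ≤-trans (dominated-correct ρ ((k , m) ∷ p) q ok) (m≤n+m _ _)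

Hypotheses : List ℕ → List (Expr × Expr) → Set
Hypotheses ρ []             = ⊤
Hypotheses ρ ((l , r) ∷ hs) = eval ρ l ≤ eval ρ r × Hypotheses ρ hs

lefts rights : List (Expr × Expr) → List Expr → Expr
lefts  ((l , r) ∷ hs) (m ∷ ms) = l :* m :+ lefts hs ms
lefts  _              _        = ♯ 0
rights ((l , r) ∷ hs) (m ∷ ms) = r :* m :+ rights hs ms
rights _              _        = ♯ 0

lefts≤rights : ∀ ρ hs ms → Hypotheses ρ hs → eval ρ (lefts hs ms) ≤ eval ρ (rights hs ms)
lefts≤rights ρ []             _        _        = z≤n
lefts≤rights ρ (_ ∷ _)        []       _        = z≤n
lefts≤rights ρ ((l , r) ∷ hs) (m ∷ ms) (h , hh) = +-mono-≤ (*-monoˡ-≤ (eval ρ m) h) (lefts≤rights ρ hs ms hh)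

certified : ∀ ρ hs ms K a b →
  dominated (normalise (a :* ♯ (suc K) :+ rights hs ms)) (normalise (b :* ♯ (suc K) :+ lefts hs ms)) ≡ true →
  Hypotheses ρ hs → eval ρ a ≤ eval ρ b
certified ρ hs ms K a b ok hh = *-cancelʳ-≤ _ _ (suc K) (+-cancelʳ-≤ R _ _ (begin
  eval ρ a * suc K + R   ≡⟨ normalise-correct ρ (a :* ♯ (suc K) :+ rights hs ms) ⟨
  evalPolynomial ρ (normalise (a :* ♯ (suc K) :+ rights hs ms)) ≤⟨ dominated-correct ρ (normalise (a :* ♯ (suc K) :+ rights hs ms)) _ ok ⟩
  evalPolynomial ρ (normalise (b :* ♯ (suc K) :+ lefts hs ms))  ≡⟨ normalise-correct ρ (b :* ♯ (suc K) :+ lefts hs ms) ⟩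
  eval ρ b * suc K + eval ρ (lefts hs ms)   ≤⟨ +-monoʳ-≤ (eval ρ b * suc K) (lefts≤rights ρ hs ms hh) ⟩
  eval ρ b * suc K + R   ∎))
  where
  open ≤-Reasoning
  R = eval ρ (rights hs ms)

≤-product : ∀ {a b c d} → a ≤ b → c ≤ d → a * d + b * c ≤ a * c + b * d
≤-product {a} {b} {c} {d} a≤b c≤d with m≤n⇒∃[o]m+o≡n a≤b | m≤n⇒∃[o]m+o≡n c≤d
... | x , refl | y , refl = ≤-trans (m≤m+n _ (x * y)) (≤-reflexive (shuffle₂ a x c y))

-- Finite sums; multisets are compared through the sums of all functions over them.

variable
  A B : Set

sum : (A → ℕ) → List A → ℕ
sum f []       = 0
sum f (x ∷ xs) = f x + sum f xs

size : List A → ℕ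
size = sum (λ _ → 1)

infix 4 _≈_
_≈_ : List A → List A → Set
xs ≈ ys = ∀ f → sum f xs ≡ sum f ys

equated : ∀ ρ e f → normalise e ≡ normalise f → eval ρ e ≡ eval ρ f
equated ρ e f eq = trans (sym (normalise-correct ρ e)) (trans (cong (evalPolynomial ρ) eq) (normalise-correct ρ f))

shuffle₃ : ∀ a b c d e f g h i → (a + b + c) + (d + e + f) + (g + h + i) ≡ (a + e + i) + (b + f + g) + (c + d + h)
shuffle₃ a b c d e f g h i = equated (a ∷ b ∷ c ∷ d ∷ e ∷ f ∷ g ∷ h ∷ i ∷ [])
  ((‵ 0 :+ ‵ 1 :+ ‵ 2) :+ (‵ 3 :+ ‵ 4 :+ ‵ 5) :+ (‵ 6 :+ ‵ 7 :+ ‵ 8))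
  ((‵ 0 :+ ‵ 4 :+ ‵ 8) :+ (‵ 1 :+ ‵ 5 :+ ‵ 6) :+ (‵ 2 :+ ‵ 3 :+ ‵ 7)) refl

shuffle₄ : ∀ a b c d e f g h i → (a + b + c) + (d + e + f) + (g + h + i) ≡ (a + d + g) + (b + e + h) + (c + f + i)
shuffle₄ a b c d e f g h i = equated (a ∷ b ∷ c ∷ d ∷ e ∷ f ∷ g ∷ h ∷ i ∷ [])
  ((‵ 0 :+ ‵ 1 :+ ‵ 2) :+ (‵ 3 :+ ‵ 4 :+ ‵ 5) :+ (‵ 6 :+ ‵ 7 :+ ‵ 8))
  ((‵ 0 :+ ‵ 3 :+ ‵ 6) :+ (‵ 1 :+ ‵ 4 :+ ‵ 7) :+ (‵ 2 :+ ‵ 5 :+ ‵ 8)) refl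

shuffle₅ : ∀ a b c d e f g h i → a + b + c + (d + e + f) + (g + h + i) ≡ a + f + (b + e) + (d + i) + (g + c) + h
shuffle₅ a b c d e f g h i = equated (a ∷ b ∷ c ∷ d ∷ e ∷ f ∷ g ∷ h ∷ i ∷ [])
  (‵ 0 :+ ‵ 1 :+ ‵ 2 :+ (‵ 3 :+ ‵ 4 :+ ‵ 5) :+ (‵ 6 :+ ‵ 7 :+ ‵ 8))
  (‵ 0 :+ ‵ 5 :+ (‵ 1 :+ ‵ 4) :+ (‵ 3 :+ ‵ 8) :+ (‵ 6 :+ ‵ 2) :+ ‵ 7) refl

shuffle₆ : ∀ a b c d e f g h i → a + b + c + (d + e + f) + (g + h + i) ≡ a + f + (b + i) + (d + g) + (e + h) + c
shuffle₆ a b c d e f g h i = equated (a ∷ b ∷ c ∷ d ∷ e ∷ f ∷ g ∷ h ∷ i ∷ [])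
  (‵ 0 :+ ‵ 1 :+ ‵ 2 :+ (‵ 3 :+ ‵ 4 :+ ‵ 5) :+ (‵ 6 :+ ‵ 7 :+ ‵ 8))
  (‵ 0 :+ ‵ 5 :+ (‵ 1 :+ ‵ 8) :+ (‵ 3 :+ ‵ 6) :+ (‵ 4 :+ ‵ 7) :+ ‵ 2) refl

shuffle₈ : ∀ a b c d e f g h → a + b + c + (d + e + f + g) + h ≡ a + d + (b + e + (c + f + 0)) + 0 + (g + h)
shuffle₈ a b c d e f g h = equated (a ∷ b ∷ c ∷ d ∷ e ∷ f ∷ g ∷ h ∷ [])
  (‵ 0 :+ ‵ 1 :+ ‵ 2 :+ (‵ 3 :+ ‵ 4 :+ ‵ 5 :+ ‵ 6) :+ ‵ 7)
  (‵ 0 :+ ‵ 3 :+ (‵ 1 :+ ‵ 4 :+ (‵ 2 :+ ‵ 5 :+ ♯ 0)) :+ ♯ 0 :+ (‵ 6 :+ ‵ 7)) refl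

shuffle₁₀ : ∀ a d g b e h c f i j k → a + b + c + (d + e + f + (g + h + i + 0)) + j + k ≡ b + e + h + (c + f + i + j) + (a + d + g + k)
shuffle₁₀ a d g b e h c f i j k = equated (a ∷ d ∷ g ∷ b ∷ e ∷ h ∷ c ∷ f ∷ i ∷ j ∷ k ∷ [])
  (‵ 0 :+ ‵ 3 :+ ‵ 6 :+ (‵ 1 :+ ‵ 4 :+ ‵ 7 :+ (‵ 2 :+ ‵ 5 :+ ‵ 8 :+ ♯ 0)) :+ ‵ 9 :+ ‵ 10)
  (‵ 3 :+ ‵ 4 :+ ‵ 5 :+ (‵ 6 :+ ‵ 7 :+ ‵ 8 :+ ‵ 9) :+ (‵ 0 :+ ‵ 1 :+ ‵ 2 :+ ‵ 10)) refl

shuffle₁₁ : ∀ a d i b e h c f g j → a + b + c + (d + e + f + 0) + g + (h + (i + j)) ≡ b + e + h + g + (a + d + i + (c + (f + j)))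
shuffle₁₁ a d i b e h c f g j = equated (a ∷ d ∷ i ∷ b ∷ e ∷ h ∷ c ∷ f ∷ g ∷ j ∷ [])
  (‵ 0 :+ ‵ 3 :+ ‵ 6 :+ (‵ 1 :+ ‵ 4 :+ ‵ 7 :+ ♯ 0) :+ ‵ 8 :+ (‵ 5 :+ (‵ 2 :+ ‵ 9)))
  (‵ 3 :+ ‵ 4 :+ ‵ 5 :+ ‵ 8 :+ (‵ 0 :+ ‵ 1 :+ ‵ 2 :+ (‵ 6 :+ (‵ 7 :+ ‵ 9)))) refl

shuffle₁₂ : ∀ a b c d e f g h i j → a + (b + (c + (d + (e + (f + (g + (h + (i + j)))))))) ≡ b + d + e + (c + f + g) + (a + h + i) + j
shuffle₁₂ a b c d e f g h i j = equated (a ∷ b ∷ c ∷ d ∷ e ∷ f ∷ g ∷ h ∷ i ∷ j ∷ [])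
  (‵ 0 :+ (‵ 1 :+ (‵ 2 :+ (‵ 3 :+ (‵ 4 :+ (‵ 5 :+ (‵ 6 :+ (‵ 7 :+ (‵ 8 :+ ‵ 9)))))))))
  (‵ 1 :+ ‵ 3 :+ ‵ 4 :+ (‵ 2 :+ ‵ 5 :+ ‵ 6) :+ (‵ 0 :+ ‵ 7 :+ ‵ 8) :+ ‵ 9) refl

shuffle₁₃ : ∀ a b c d g j e f h i k l m n o → a + b + c + (d + e + f + (g + h + i + (j + k + l + (m + (n + o))))) ≡ a + e + f + (b + h + i) + (c + k + l) + m + n + (d + g + j + o)
shuffle₁₃ a b c d g j e f h i k l m n o = equated (a ∷ b ∷ c ∷ d ∷ g ∷ j ∷ e ∷ f ∷ h ∷ i ∷ k ∷ l ∷ m ∷ n ∷ o ∷ [])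
  (‵ 0 :+ ‵ 1 :+ ‵ 2 :+ (‵ 3 :+ ‵ 6 :+ ‵ 7 :+ (‵ 4 :+ ‵ 8 :+ ‵ 9 :+ (‵ 5 :+ ‵ 10 :+ ‵ 11 :+ (‵ 12 :+ (‵ 13 :+ ‵ 14))))))
  (‵ 0 :+ ‵ 6 :+ ‵ 7 :+ (‵ 1 :+ ‵ 8 :+ ‵ 9) :+ (‵ 2 :+ ‵ 10 :+ ‵ 11) :+ ‵ 12 :+ ‵ 13 :+ (‵ 3 :+ ‵ 4 :+ ‵ 5 :+ ‵ 14)) refl

⟦_⟧ : Bool → ℕ
⟦ true  ⟧ = 1
⟦ false ⟧ = 0

⟦⟧≤1 : ∀ b → ⟦ b ⟧ ≤ 1
⟦⟧≤1 true  = ≤-refl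
⟦⟧≤1 false = z≤n

⟦⟧>0 : ∀ {b} → 0 < ⟦ b ⟧ → b ≡ true
⟦⟧>0 {true} _ = refl

⟦⟧-∧ : ∀ a b → ⟦ a ∧ b ⟧ ≡ ⟦ a ⟧ * ⟦ b ⟧
⟦⟧-∧ true  b = sym (+-identityʳ ⟦ b ⟧)
⟦⟧-∧ false b = refl

interchange : ∀ a b c d → a + b + (c + d) ≡ a + c + (b + d)
interchange = solve-∀

sum-cong : {f g : A → ℕ} → (∀ x → f x ≡ g x) → ∀ xs → sum f xs ≡ sum g xs
sum-cong f≡g []       = refl
sum-cong f≡g (x ∷ xs) = cong₂ _+_ (f≡g x) (sum-cong f≡g xs)

sum-mono : {f g : A → ℕ} → (∀ x → f x ≤ g x) → ∀ xs → sum f xs ≤ sum g xs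
sum-mono f≤g []       = z≤n
sum-mono f≤g (x ∷ xs) = +-mono-≤ (f≤g x) (sum-mono f≤g xs)

sum-mono-All : {f g : A → ℕ} {xs : List A} → All (λ x → f x ≤ g x) xs → sum f xs ≤ sum g xs
sum-mono-All []         = z≤n
sum-mono-All (f≤g ∷ xs) = +-mono-≤ f≤g (sum-mono-All xs)

sum-+ : (f g : A → ℕ) → ∀ xs → sum (λ x → f x + g x) xs ≡ sum f xs + sum g xs
sum-+ f g []       = refl
sum-+ f g (x ∷ xs) = trans (cong (f x + g x +_) (sum-+ f g xs)) (interchange (f x) (g x) _ _)

sum-*ˡ : ∀ k (f : A → ℕ) xs → sum (λ x → k * f x) xs ≡ k * sum f xs
sum-*ˡ k f []       = sym (*-zeroʳ k)
sum-*ˡ k f (x ∷ xs) = trans (cong (k * f x +_) (sum-*ˡ k f xs)) (sym (*-distribˡ-+ k (f x) _))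

sum-const : ∀ k (xs : List A) → sum (λ _ → k) xs ≡ k * size xs
sum-const k []       = sym (*-zeroʳ k)
sum-const k (x ∷ xs) = trans (cong (k +_) (sum-const k xs)) (sym (*-suc k (size xs)))

sum-0 : ∀ (xs : List A) → sum (λ _ → 0) xs ≡ 0
sum-0 []       = refl
sum-0 (_ ∷ xs) = sum-0 xs

sum-swap : ∀ (f : A → B → ℕ) xs ys →
  sum (λ x → sum (f x) ys) xs ≡ sum (λ y → sum (λ x → f x y) xs) ys
sum-swap f []       ys = sym (sum-0 ys)
sum-swap f (x ∷ xs) ys =
  trans (cong (sum (f x) ys +_) (sum-swap f xs ys)) (sym (sum-+ (f x) _ ys))

sum-++ : ∀ (f : A → ℕ) xs ys → sum f (xs ++ ys) ≡ sum f xs + sum f ys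
sum-++ f []       ys = refl
sum-++ f (x ∷ xs) ys = trans (cong (f x +_) (sum-++ f xs ys)) (sym (+-assoc (f x) _ _))

size≡length : ∀ (xs : List A) → size xs ≡ length xs
size≡length []       = refl
size≡length (x ∷ xs) = cong suc (size≡length xs)

select : ∀ (g : A → ℕ) k xs →
  (∃[ x ] ∃[ xs′ ] (k < g x × xs ≈ x ∷ xs′)) ⊎ All (λ x → g x ≤ k) xs
select g k [] = inj₂ []
select g k (x ∷ xs) with k <? g x
... | yes k<gx = inj₁ (x , xs , k<gx , λ f → refl)
... | no  k≮gx with select g k xs
...   | inj₂ small = inj₂ (≮⇒≥ k≮gx ∷ small)
...   | inj₁ (y , ys , k<gy , eq) =
  inj₁ (y , x ∷ ys , k<gy , λ f → trans (cong (f x +_) (eq f)) (a+[b+c]≡b+[a+c] (f x) (f y) _))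

select-heavy : ∀ (g : A → ℕ) k xs → k * size xs < sum g xs →
  ∃[ x ] ∃[ xs′ ] (k < g x × xs ≈ x ∷ xs′)
select-heavy g k xs heavy with select g k xs
... | inj₁ found = found
... | inj₂ small = ⊥-elim (<⇒≱ heavy (≤-trans (sum-mono-All small) (≤-reflexive (sum-const k xs))))

select-positive : ∀ (g : A → ℕ) xs → 0 < sum g xs → ∃[ x ] ∃[ xs′ ] (0 < g x × xs ≈ x ∷ xs′)
select-positive g xs = select-heavy g 0 xs

pairSum : (A → A → ℕ) → List A → ℕ
pairSum c []       = 0
pairSum c (x ∷ xs) = sum (c x) xs + pairSum c xs

crossSum : (A → B → ℕ) → List A → List B → ℕ
crossSum c xs ys = sum (λ x → sum (c x) ys) xs

pairs : ∀ (c : A → A → ℕ) k xs →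
  (∃[ x ] ∃[ y ] ∃[ zs ] (k < c x y × xs ≈ x ∷ y ∷ zs)) ⊎ 2 * pairSum c xs ≤ k * (size xs * size xs)
pairs c k [] = inj₂ z≤n
pairs c k (x ∷ xs) with select (c x) k xs
... | inj₁ (y , zs , big , eq) = inj₁ (x , y , zs , big , λ f → cong (f x +_) (eq f))
... | inj₂ small with pairs c k xs
...   | inj₁ (y , z , zs , big , eq) = inj₁ (y , z , x ∷ zs , big ,
          λ f → trans (cong (f x +_) (eq f)) (a+[b+[c+d]]≡b+[c+[a+d]] (f x) (f y) (f z) _))
...   | inj₂ bound = inj₂ (arith _ _ k (size xs) (≤-trans (sum-mono-All small) (≤-reflexive (sum-const k xs))) bound)
  where
  arith : ∀ S P k m → S ≤ k * m → 2 * P ≤ k * (m * m) → 2 * (S + P) ≤ k * ((1 + m) * (1 + m))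
  arith S P k m h1 h2 = certified (S ∷ P ∷ k ∷ m ∷ [])
    ((‵ 0 , ‵ 2 :* ‵ 3) ∷ (♯ 2 :* ‵ 1 , ‵ 2 :* (‵ 3 :* ‵ 3)) ∷ [])
    ((♯ 2) ∷ (♯ 1) ∷ [])
    0 (♯ 2 :* (‵ 0 :+ ‵ 1)) (‵ 2 :* ((♯ 1 :+ ‵ 3) :* (♯ 1 :+ ‵ 3))) refl (h1 , h2 , tt)
  

crossPairs : ∀ (c : A → B → ℕ) k xs ys →
  (∃[ x ] ∃[ xs′ ] ∃[ y ] ∃[ ys′ ] (k < c x y × xs ≈ x ∷ xs′ × ys ≈ y ∷ ys′))
  ⊎ crossSum c xs ys ≤ k * (size xs * size ys)
crossPairs c k xs ys with select (λ x → sum (c x) ys) (k * size ys) xs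
... | inj₁ (x , xs′ , heavy , eq) with select-heavy (c x) k ys heavy
...   | y , ys′ , big , eq′ = inj₁ (x , xs′ , y , ys′ , big , eq , eq′)
crossPairs c k xs ys | inj₂ small = inj₂ (begin
  crossSum c xs ys               ≤⟨ sum-mono-All small ⟩
  sum (λ _ → k * size ys) xs     ≡⟨ sum-const (k * size ys) xs ⟩
  k * size ys * size xs          ≡⟨ a*b*c≡a*[c*b] k (size ys) (size xs) ⟩
  k * (size xs * size ys)        ∎)
  where
  open ≤-Reasoning

pairSum-+ : ∀ (c d : A → A → ℕ) xs →
  pairSum (λ x y → c x y + d x y) xs ≡ pairSum c xs + pairSum d xs
pairSum-+ c d []       = refl
pairSum-+ c d (x ∷ xs) =
  trans (cong₂ _+_ (sum-+ (c x) (d x) xs) (pairSum-+ c d xs)) (interchange (sum (c x) xs) _ _ _)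

pairSum-ends : ∀ (g : A → ℕ) xs → pairSum (λ x y → g x + g y) xs + sum g xs ≡ size xs * sum g xs
pairSum-ends g []       = refl
pairSum-ends g (x ∷ xs) = begin
  sum (λ y → g x + g y) xs + P + (g x + S)
    ≡⟨ cong (λ s → s + P + (g x + S)) (trans (sum-+ (λ _ → g x) g xs) (cong (_+ S) (sum-const (g x) xs))) ⟩
  g x * m + S + P + (g x + S)        ≡⟨ a*b+c+d+[a+c]≡d+c+[c+[a+a*b]] (g x) m S P ⟩
  P + S + (S + (g x + g x * m))      ≡⟨ cong (_+ (S + (g x + g x * m))) (pairSum-ends g xs) ⟩
  m * S + (S + (g x + g x * m))      ≡⟨ a*b+[b+[c+c*a]]≡[1+a]*[c+b]′ (g x) m S ⟩
  suc m * (g x + S)                  ∎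
  where
  open ≡-Reasoning
  P = pairSum (λ x y → g x + g y) xs
  S = sum g xs
  m = size xs

triangle : (A → A → ℕ) → A → A → A → ℕ
triangle c x y z = c x y + c x z + c y z

triangleSum : (A → A → ℕ) → List A → ℕ
triangleSum c []       = 0
triangleSum c (x ∷ xs) = pairSum (triangle c x) xs + triangleSum c xs

-- Every pair lies in (size − 2) triangles.
triangleSum-pairSum : ∀ (c : A → A → ℕ) xs →
  triangleSum c xs + 2 * pairSum c xs ≡ size xs * pairSum c xs
triangleSum-pairSum c []       = refl
triangleSum-pairSum c (x ∷ xs) = begin
  pairSum (triangle c x) xs + T + 2 * (S + P)
    ≡⟨ cong (λ t → t + T + 2 * (S + P)) (pairSum-+ (λ y z → c x y + c x z) c xs) ⟩
  E + P + T + 2 * (S + P)            ≡⟨ a+b+c+2*[d+b]≡[a+d]+[c+2*b]+[b+d] E P T S ⟩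
  (E + S) + (T + 2 * P) + (P + S)    ≡⟨ cong₂ (λ a b → a + b + (P + S)) (pairSum-ends (c x) xs) (triangleSum-pairSum c xs) ⟩
  m * S + m * P + (P + S)            ≡⟨ a*b+a*c+[c+b]≡[1+a]*[b+c] m S P ⟩
  suc m * (S + P)                    ∎
  where
  open ≡-Reasoning
  E = pairSum (λ y z → c x y + c x z) xs
  P = pairSum c xs
  T = triangleSum c xs
  S = sum (c x) xs
  m = size xs

triangles : ∀ (c : A → A → ℕ) k xs →
  (∃[ x ] ∃[ y ] ∃[ z ] ∃[ ws ] (k < triangle c x y z × xs ≈ x ∷ y ∷ z ∷ ws))
  ⊎ 6 * triangleSum c xs ≤ k * (size xs * (size xs * size xs))
triangles c k [] = inj₂ z≤n
triangles c k (x ∷ xs) with pairs (triangle c x) k xs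
... | inj₁ (y , z , ws , big , eq) = inj₁ (x , y , z , ws , big , λ f → cong (f x +_) (eq f))
... | inj₂ P-bound with triangles c k xs
...   | inj₁ (y , z , w , ws , big , eq) = inj₁ (y , z , w , x ∷ ws , big ,
          λ f → trans (cong (f x +_) (eq f)) (a+[b+[c+[d+e]]]≡b+[c+[d+[a+e]]] (f x) (f y) (f z) (f w) _))
...   | inj₂ T-bound = inj₂ (triangles-step (pairSum (triangle c x) xs) (triangleSum c xs) k (size xs) P-bound T-bound)
  where
  triangles-step : ∀ P T k m → 2 * P ≤ k * (m * m) → 6 * T ≤ k * (m * (m * m)) → 6 * (P + T) ≤ k * ((1 + m) * ((1 + m) * (1 + m)))
  triangles-step P T k m h1 h2 = certified (P ∷ T ∷ k ∷ m ∷ [])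
    ((♯ 2 :* ‵ 0 , ‵ 2 :* (‵ 3 :* ‵ 3)) ∷ (♯ 6 :* ‵ 1 , ‵ 2 :* (‵ 3 :* (‵ 3 :* ‵ 3))) ∷ [])
    ((♯ 3) ∷ (♯ 1) ∷ [])
    0 (♯ 6 :* (‵ 0 :+ ‵ 1)) (‵ 2 :* ((♯ 1 :+ ‵ 3) :* ((♯ 1 :+ ‵ 3) :* (♯ 1 :+ ‵ 3)))) refl (h1 , h2 , tt)
  
pairs-from-triangles : ∀ (c : A → A → ℕ) xs k → 6 * triangleSum c xs ≤ k * (size xs * (size xs * size xs)) →
  2 * pairSum c xs ≤ 9 * (size xs * size xs) → 6 * pairSum c xs ≤ k * (size xs * size xs) + 54 * size xs
pairs-from-triangles c xs k T-bound P-bound = go (size xs) (pairSum c xs) (triangleSum c xs) (triangleSum-pairSum c xs) T-bound P-bound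
  where
  go : ∀ m P T → T + 2 * P ≡ m * P → 6 * T ≤ k * (m * (m * m)) → 2 * P ≤ 9 * (m * m) → 6 * P ≤ k * (m * m) + 54 * m
  go zero P T _ _ 2P≤ = ≤-trans (≤-reflexive (cong (6 *_) (n≤0⇒n≡0 {P} (*-cancelˡ-≤ 2 (≤-trans 2P≤ z≤n))))) z≤n
  go (suc m) P T eq 6T≤ 2P≤ = *-cancelˡ-≤ (suc m) (begin
    suc m * (6 * P)               ≡⟨ [1+a]*[6*b]≡6*[[1+a]*b] m P ⟩
    6 * (suc m * P)               ≡⟨ cong (6 *_) (sym eq) ⟩
    6 * (T + 2 * P)               ≡⟨ 6*[a+2*b]≡6*a+6*[2*b] T P ⟩
    6 * T + 6 * (2 * P)           ≤⟨ +-mono-≤ 6T≤ (*-monoʳ-≤ 6 2P≤) ⟩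
    k * (suc m * (suc m * suc m)) + 6 * (9 * (suc m * suc m)) ≡⟨ shuffle₁ k m ⟩
    suc m * (k * (suc m * suc m) + 54 * suc m) ∎)
    where
    open ≤-Reasoning

Triple : Set → Set
Triple V = V × V × V

hat : (A → ℕ) → Triple A → ℕ
hat f (x , y , z) = f x + f y + f z

perm132 : ∀ x y z → x + y + z ≡ x + z + y
perm132 = solve-∀
perm213 : ∀ x y z → x + y + z ≡ y + x + z
perm213 = solve-∀
perm231 : ∀ x y z → x + y + z ≡ y + z + x
perm231 = solve-∀
perm312 : ∀ x y z → x + y + z ≡ z + x + y
perm312 = solve-∀
perm321 : ∀ x y z → x + y + z ≡ z + y + x
perm321 = solve-∀

hat-cong : {f g : A → ℕ} → (∀ x → f x ≡ g x) → ∀ e → hat f e ≡ hat g e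
hat-cong f≡g (x , y , z) = cong₂ _+_ (cong₂ _+_ (f≡g x) (f≡g y)) (f≡g z)

hat-mono : {f g : A → ℕ} → (∀ x → f x ≤ g x) → ∀ e → hat f e ≤ hat g e
hat-mono f≤g (x , y , z) = +-mono-≤ (+-mono-≤ (f≤g x) (f≤g y)) (f≤g z)

hat-sum : ∀ (g : A → B → ℕ) xs e → hat (λ a → sum (g a) xs) e ≡ sum (λ x → hat (λ a → g a x) e) xs
hat-sum g xs (x , y , z) = sym (trans (sum-+ (λ t → g x t + g y t) (g z) xs) (cong (_+ _) (sum-+ (g x) (g y) xs)))

matrix : (A → B → ℕ) → Triple A → Triple B → ℕ
matrix b e f = hat (λ x → hat (b x) f) e

matrix-sym : ∀ (b : A → A → ℕ) → (∀ x y → b x y ≡ b y x) → ∀ e f → matrix b e f ≡ matrix b f e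
matrix-sym b b-sym e@(x₁ , x₂ , x₃) f@(y₁ , y₂ , y₃) =
  trans (shuffle₄ (b x₁ y₁) (b x₁ y₂) (b x₁ y₃) (b x₂ y₁) (b x₂ y₂) (b x₂ y₃) (b x₃ y₁) (b x₃ y₂) (b x₃ y₃))
        (hat-cong (λ y → hat-cong (λ x → b-sym x y) e) f)

matrix≤9 : ∀ (b : A → A → ℕ) → (∀ x y → b x y ≤ 1) → ∀ e f → matrix b e f ≤ 9
matrix≤9 b b≤1 e f = hat-mono {g = λ _ → 3} (λ x → hat-mono {g = λ _ → 1} (b≤1 x) f) e

square-sum : ∀ (c : A → A → ℕ) → (∀ x y → c x y ≡ c y x) → ∀ xs →
  sum (λ x → sum (c x) xs) xs ≡ sum (λ x → c x x) xs + 2 * pairSum c xs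
square-sum c c-sym []       = refl
square-sum c c-sym (x ∷ xs) = begin
  c x x + S + sum (λ y → c y x + sum (c y) xs) xs
    ≡⟨ cong (c x x + S +_) (trans (sum-+ (λ y → c y x) (λ y → sum (c y) xs) xs)
         (cong₂ _+_ (sum-cong (λ y → c-sym y x) xs) (square-sum c c-sym xs))) ⟩
  c x x + S + (S + (diag + 2 * P))  ≡⟨ a+b+[b+[c+2*d]]≡a+c+2*[b+d] (c x x) S diag P ⟩
  c x x + diag + 2 * (S + P)        ∎
  where
  open ≡-Reasoning
  S = sum (c x) xs
  diag = sum (λ y → c y y) xs
  P = pairSum c xs

double-sum : ∀ (b : A → A → ℕ) → (∀ x y → b x y ≡ b y x) → ∀ vs M L →
  (∀ f → sum f vs ≡ sum (hat f) M + sum f L) →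
  sum (λ x → sum (b x) vs) vs ≡
    sum (λ e → matrix b e e) M + 2 * pairSum (matrix b) M
    + 2 * sum (λ e → sum (λ y → hat (λ x → b x y) e) L) M + sum (λ x → sum (b x) L) L
double-sum b b-sym vs M L part = begin
  sum (λ x → sum (b x) vs) vs            ≡⟨ sum-cong (λ x → part (b x)) vs ⟩
  sum (λ x → F x + G x) vs               ≡⟨ sum-+ F G vs ⟩
  sum F vs + sum G vs                    ≡⟨ cong₂ _+_ (part F) (part G) ⟩
  sum (hat F) M + sum F L + (sum (hat G) M + sum G L)
    ≡⟨ cong₂ (λ s t → s + sum F L + (t + sum G L)) MM MG ⟩
  sum (λ e → sum (matrix b e) M) M + sum F L + (X + sum G L)
    ≡⟨ cong₂ (λ s t → s + t + (X + sum G L)) (square-sum (matrix b) (matrix-sym b b-sym) M) LF ⟩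
  diag + 2 * P + X + (X + sum G L)       ≡⟨ a+b+[b+c]≡a+2*b+c (diag + 2 * P) X (sum G L) ⟩
  diag + 2 * P + 2 * X + sum G L         ∎
  where
  open ≡-Reasoning
  F G : _ → ℕ
  F x = sum (hat (b x)) M
  G x = sum (b x) L
  X = sum (λ e → sum (λ y → hat (λ x → b x y) e) L) M
  P = pairSum (matrix b) M
  diag = sum (λ e → matrix b e e) M
  MM : sum (hat F) M ≡ sum (λ e → sum (matrix b e) M) M
  MM = sum-cong (λ e → hat-sum (λ x f → hat (b x) f) M e) M
  MG : sum (hat G) M ≡ X
  MG = sum-cong (hat-sum b L) M
  LF : sum F L ≡ X
  LF = trans (sum-swap (λ x e → hat (b x) e) L M)
             (sum-cong (λ e → sum-cong (λ y → hat-cong (λ x → b-sym y x) e) L) M)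

hat-const : ∀ k (M : List (Triple A)) → sum (hat (λ _ → k)) M ≡ k * 3 * size M
hat-const k M = trans (sum-cong (λ _ → a+a+a≡a*3 k) M) (sum-const (k * 3) M)

flat : List (Triple A) → List A
flat []                = []
flat ((x , y , z) ∷ M) = x ∷ y ∷ z ∷ flat M

sum-flat : ∀ (f : A → ℕ) M → sum f (flat M) ≡ sum (hat f) M
sum-flat f []                = refl
sum-flat f ((x , y , z) ∷ M) = trans (cong (λ s → f x + (f y + (f z + s))) (sum-flat f M)) (a+[b+[c+d]]≡a+b+c+d (f x) (f y) (f z) _)

pairSum-++ : ∀ (c : A → A → ℕ) xs ys → pairSum c (xs ++ ys) ≡ pairSum c xs + crossSum c xs ys + pairSum c ys
pairSum-++ c []       ys = refl
pairSum-++ c (x ∷ xs) ys = trans (cong₂ _+_ (sum-++ (c x) xs ys) (pairSum-++ c xs ys))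
  (a+b+[c+d+e]≡a+c+[b+d]+e (sum (c x) xs) (sum (c x) ys) (pairSum c xs) (crossSum c xs ys) (pairSum c ys))

double-sum-restrict : ∀ (b : A → A → ℕ) → (∀ x y → b x y ≤ 1) → ∀ vs M R →
  (∀ f → sum f vs ≡ sum (hat f) M + sum f R) →
  sum (λ x → sum (b x) vs) vs ≤ size M * size vs * 6 + sum (λ x → sum (b x) R) R
double-sum-restrict b b≤1 vs M R part = begin
  sum (λ x → sum (b x) vs) vs         ≡⟨ sum-cong (λ x → part (b x)) vs ⟩
  sum (λ x → sum (hat (b x)) M + G x) vs ≡⟨ sum-+ _ G vs ⟩
  sum (λ x → sum (hat (b x)) M) vs + sum G vs
    ≤⟨ +-monoˡ-≤ _ (sum-mono (λ x → ≤-trans (sum-mono (hat-mono {g = λ _ → 1} (b≤1 x)) M) (≤-reflexive (sum-const 3 M))) vs) ⟩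
  sum (λ x → 3 * m) vs + sum G vs     ≡⟨ cong₂ _+_ (sum-const (3 * m) vs) (part G) ⟩
  3 * m * n + (sum (hat G) M + sum G R)
    ≤⟨ +-monoʳ-≤ (3 * m * n) (+-monoˡ-≤ _ (sum-mono (hat-mono {g = λ _ → n} G≤n) M)) ⟩
  3 * m * n + (sum (hat (λ _ → n)) M + sum G R)
    ≡⟨ cong (λ s → 3 * m * n + (s + sum G R)) (hat-const n M) ⟩
  3 * m * n + (n * 3 * m + sum G R)   ≡⟨ 3*a*b+[b*3*a+c]≡a*b*6+c m n (sum G R) ⟩
  m * n * 6 + sum G R                 ∎
  where
  open ≤-Reasoning
  G : _ → ℕ
  G x = sum (b x) R
  m = size M
  n = size vs
  G≤n : ∀ x → G x ≤ n
  G≤n x = ≤-trans (sum-mono (b≤1 x) R) (≤-trans (m≤n+m _ _) (≤-reflexive (sym (part (λ _ → 1)))))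

-- Three disjoint cells of a 3 × 3 matrix are found among the cyclic diagonals once it has 7 ones.

∧₃ : Bool → Bool → Bool → Bool
∧₃ x y z = x ∧ (y ∧ z)

∧₃-bound : ∀ x y z → ∧₃ x y z ≡ false → ⟦ x ⟧ + ⟦ y ⟧ + ⟦ z ⟧ ≤ 2
∧₃-bound false y     z     _ = +-mono-≤ (⟦⟧≤1 y) (⟦⟧≤1 z)
∧₃-bound true  false z     _ = s≤s (⟦⟧≤1 z)
∧₃-bound true  true  false _ = ≤-refl

∧₃-split : ∀ {x y z} → ∧₃ x y z ≡ true → x ≡ true × y ≡ true × z ≡ true
∧₃-split {true} {true} {true} _ = refl , refl , refl

Transversal : (A → B → Bool) → Triple A → Triple B → Set
Transversal R (x₁ , x₂ , x₃) f = ∃[ y₁ ] ∃[ y₂ ] ∃[ y₃ ]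
  ((∀ g → hat g f ≡ g y₁ + g y₂ + g y₃) × R x₁ y₁ ≡ true × R x₂ y₂ ≡ true × R x₃ y₃ ≡ true)

transversal : ∀ (R : A → B → Bool) e f → 6 < matrix (λ x y → ⟦ R x y ⟧) e f → Transversal R e f
transversal R (x₁ , x₂ , x₃) (y₁ , y₂ , y₃) big
  with ∧₃ (R x₁ y₁) (R x₂ y₂) (R x₃ y₃) in d₁
... | true  = y₁ , y₂ , y₃ , (λ g → refl) , ∧₃-split d₁
... | false with ∧₃ (R x₁ y₂) (R x₂ y₃) (R x₃ y₁) in d₂
...   | true  = y₂ , y₃ , y₁ , (λ g → perm231 (g y₁) _ _) , ∧₃-split d₂
...   | false with ∧₃ (R x₁ y₃) (R x₂ y₁) (R x₃ y₂) in d₃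
...     | true  = y₃ , y₁ , y₂ , (λ g → perm312 (g y₁) _ _) , ∧₃-split d₃
...     | false = ⊥-elim (<⇒≱ big (≤-trans (≤-reflexive (shuffle₃ (r x₁ y₁) (r x₁ y₂) (r x₁ y₃) (r x₂ y₁) (r x₂ y₂) (r x₂ y₃) (r x₃ y₁) (r x₃ y₂) (r x₃ y₃)))
            (+-mono-≤ (+-mono-≤ (∧₃-bound (R x₁ y₁) _ _ d₁) (∧₃-bound (R x₁ y₂) _ _ d₂)) (∧₃-bound (R x₁ y₃) _ _ d₃))))
  where
  r : _ → _ → ℕ
  r x y = ⟦ R x y ⟧

Pairing : (A → B → Bool) → Triple A → B → B → Set
Pairing R e y y′ = ∃[ x ] ∃[ x′ ] ∃[ x″ ]
  ((∀ f → hat f e ≡ f x + f x′ + f x″) × R x y ≡ true × R x′ y′ ≡ true)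

two-of-three : ∀ x y z → 1 < ⟦ x ⟧ + ⟦ y ⟧ + ⟦ z ⟧ →
  (x ≡ true × y ≡ true) ⊎ (x ≡ true × z ≡ true) ⊎ (y ≡ true × z ≡ true)
two-of-three true  true  _     _ = inj₁ (refl , refl)
two-of-three true  false true  _ = inj₂ (inj₁ (refl , refl))
two-of-three false true  true  _ = inj₂ (inj₂ (refl , refl))
two-of-three true  false false (s≤s ())
two-of-three false true  false (s≤s ())
two-of-three false false true  (s≤s ())

one-of-three : ∀ x y z → 0 < ⟦ x ⟧ + ⟦ y ⟧ + ⟦ z ⟧ → x ≡ true ⊎ y ≡ true ⊎ z ≡ true
one-of-three true  _     _    _ = inj₁ refl
one-of-three false true  _    _ = inj₂ (inj₁ refl)
one-of-three false false true _ = inj₂ (inj₂ refl)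

three-of-three : ∀ x y z → 2 < ⟦ x ⟧ + ⟦ y ⟧ + ⟦ z ⟧ → x ≡ true × y ≡ true × z ≡ true
three-of-three true true true _ = refl , refl , refl
three-of-three true  true  false (s≤s (s≤s ()))
three-of-three true  false true  (s≤s (s≤s ()))
three-of-three true  false false (s≤s ())
three-of-three false true  true  (s≤s (s≤s ()))
three-of-three false true  false (s≤s ())
three-of-three false false true  (s≤s ())

column : (A → B → Bool) → Triple A → B → ℕ
column R e y = hat (λ x → ⟦ R x y ⟧) e

pairing : ∀ (R : A → B → Bool) e y y′ → 1 < column R e y → 0 < column R e y′ → Pairing R e y y′
pairing R (x₁ , x₂ , x₃) y y′ two one
  with two-of-three (R x₁ y) (R x₂ y) (R x₃ y) two | one-of-three (R x₁ y′) (R x₂ y′) (R x₃ y′) one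
... | inj₁ (p , q)        | inj₁ r        = x₂ , x₁ , x₃ , (λ f → perm213 (f x₁) _ _) , q , r
... | inj₁ (p , q)        | inj₂ (inj₁ r) = x₁ , x₂ , x₃ , (λ f → refl) , p , r
... | inj₁ (p , q)        | inj₂ (inj₂ r) = x₁ , x₃ , x₂ , (λ f → perm132 (f x₁) _ _) , p , r
... | inj₂ (inj₁ (p , q)) | inj₁ r        = x₃ , x₁ , x₂ , (λ f → perm312 (f x₁) _ _) , q , r
... | inj₂ (inj₁ (p , q)) | inj₂ (inj₁ r) = x₁ , x₂ , x₃ , (λ f → refl) , p , r
... | inj₂ (inj₁ (p , q)) | inj₂ (inj₂ r) = x₁ , x₃ , x₂ , (λ f → perm132 (f x₁) _ _) , p , r
... | inj₂ (inj₂ (p , q)) | inj₁ r        = x₂ , x₁ , x₃ , (λ f → perm213 (f x₁) _ _) , p , r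
... | inj₂ (inj₂ (p , q)) | inj₂ (inj₁ r) = x₃ , x₂ , x₁ , (λ f → perm321 (f x₁) _ _) , q , r
... | inj₂ (inj₂ (p , q)) | inj₂ (inj₂ r) = x₂ , x₃ , x₁ , (λ f → perm231 (f x₁) _ _) , p , r

pairing-light : ∀ (R : A → B → Bool) (w : A → ℕ) e y y′ → hat w e ≤ 1 → 2 < column R e y → 0 < column R e y′ →
  ∃[ x ] ∃[ x′ ] ∃[ x″ ] ((∀ f → hat f e ≡ f x + f x′ + f x″) × R x y ≡ true × R x′ y′ ≡ true × w x″ ≡ 0)
pairing-light R w (x₁ , x₂ , x₃) y y′ we≤1 three one
  with three-of-three (R x₁ y) (R x₂ y) (R x₃ y) three | one-of-three (R x₁ y′) (R x₂ y′) (R x₃ y′) one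
... | p , q , r | inj₁ s with w x₃ in w₃
...   | zero  = x₂ , x₁ , x₃ , (λ f → perm213 (f x₁) _ _) , q , s , w₃
...   | suc k = x₃ , x₁ , x₂ , (λ f → perm312 (f x₁) _ _) , r , s , light (w x₁) (w x₂) k we≤1
  where
  light : ∀ a b k → a + b + suc k ≤ 1 → b ≡ 0
  light a b k le = n≤0⇒n≡0 (≤-trans (≤-trans (m≤n+m b a) (m≤m+n _ k)) (s≤s⁻¹ (≤-trans (≤-reflexive (sym (+-suc (a + b) k))) le)))
pairing-light R w (x₁ , x₂ , x₃) y y′ we≤1 three one | p , q , r | inj₂ (inj₁ s) with w x₃ in w₃
...   | zero  = x₁ , x₂ , x₃ , (λ f → refl) , p , s , w₃
...   | suc k = x₃ , x₂ , x₁ , (λ f → perm321 (f x₁) _ _) , r , s , light (w x₁) (w x₂) k we≤1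
  where
  light : ∀ a b k → a + b + suc k ≤ 1 → a ≡ 0
  light a b k le = n≤0⇒n≡0 (≤-trans (≤-trans (m≤m+n a b) (m≤m+n _ k)) (s≤s⁻¹ (≤-trans (≤-reflexive (sym (+-suc (a + b) k))) le)))
pairing-light R w (x₁ , x₂ , x₃) y y′ we≤1 three one | p , q , r | inj₂ (inj₂ s) with w x₁ in w₁
...   | zero  = x₂ , x₃ , x₁ , (λ f → perm231 (f x₁) _ _) , q , s , w₁
...   | suc k = x₁ , x₃ , x₂ , (λ f → perm132 (f x₁) _ _) , p , s , n≤0⇒n≡0 (≤-trans (≤-trans (m≤n+m (w x₂) k) (m≤m+n _ (w x₃))) (s≤s⁻¹ we≤1))

heavy-columns : ∀ (R : A → B → Bool) (cap : B → ℕ) e L → sum cap L < sum (column R e) L → 3 < sum (column R e) L →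
  ∃[ y ] ∃[ y′ ] ∃[ L₀ ] (cap y < column R e y × 0 < column R e y′ × L ≈ y ∷ y′ ∷ L₀)
heavy-columns R cap e L big >3 with select (λ y → column R e y ∸ cap y) 0 L
... | inj₂ small = ⊥-elim (<⇒≱ big (sum-mono-All (capped small)))
  where
  capped : ∀ {L} → All (λ y → column R e y ∸ cap y ≤ 0) L → All (λ y → column R e y ≤ cap y) L
  capped []       = []
  capped (p ∷ ps) = m∸n≡0⇒m≤n (n≤0⇒n≡0 p) ∷ capped ps
... | inj₁ (y , L₁ , over , eq)
  with select-positive (column R e) L₁ (+-cancelˡ-< 3 0 _ (<-≤-trans >3
         (≤-trans (≤-reflexive (eq (column R e))) (+-monoˡ-≤ _ (hat-mono {g = λ _ → 1} (λ x → ⟦⟧≤1 (R x y)) e)))))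
...   | y′ , L₂ , pos , eq′ = y , y′ , L₂ , exceeds over , pos , λ f → trans (eq f) (cong (f y +_) (eq′ f))
  where
  exceeds : ∀ {a b} → 0 < a ∸ b → b < a
  exceeds {a} {b} p = ≰⇒> (λ a≤b → <⇒≱ p (≤-reflexive (m≤n⇒m∸n≡0 a≤b)))

Curried : ℕ → Set
Curried zero    = Bool
Curried (suc k) = Bool → Curried k

every : ∀ k → Curried k → Bool
every zero    b = b
every (suc k) p = every k (p true) ∧ every k (p false)

Always : ∀ k → Curried k → Set
Always zero    b = b ≡ true
Always (suc k) p = ∀ x → Always k (p x)

every-elim : ∀ k p → every k p ≡ true → Always k p
every-elim zero    b all       = all
every-elim (suc k) p all true  = every-elim k (p true) (proj₁ (∧-split all))
every-elim (suc k) p all false = every-elim k (p false) (proj₂ (∧-split {every k (p true)} all))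

∨-split : ∀ {x y} → x ∨ y ≡ true → x ≡ true ⊎ y ≡ true
∨-split {true}  _ = inj₁ refl
∨-split {false} p = inj₂ p

two-of : Bool → Bool → Bool → Bool
two-of true  y z = y ∨ z
two-of false y z = y ∧ z

two-of-split : ∀ x y z → two-of x y z ≡ true →
  (y ≡ true × z ≡ true) ⊎ (x ≡ true × z ≡ true) ⊎ (x ≡ true × y ≡ true)
two-of-split true  true  z    _ = inj₂ (inj₂ (refl , refl))
two-of-split true  false true _ = inj₂ (inj₁ (refl , refl))
two-of-split false true  true _ = inj₁ (refl , refl)

-- The Frobenius–König theorem for 3 × 3 matrices with at least 6 ones.
frobenius : (a b c d e f g h i : Bool) → Bool
frobenius a b c d e f g h i =
  ((⟦ a ⟧ + ⟦ b ⟧ + ⟦ c ⟧ + (⟦ d ⟧ + ⟦ e ⟧ + ⟦ f ⟧) + (⟦ g ⟧ + ⟦ h ⟧ + ⟦ i ⟧)) ≤ᵇ 5)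
  ∨ ((∧₃ a e i ∨ (∧₃ a f h ∨ (∧₃ b d i ∨ (∧₃ b f g ∨ (∧₃ c d h ∨ ∧₃ c e g)))))
  ∨ (two-of (∧₃ a b c) (∧₃ d e f) (∧₃ g h i) ∨ two-of (∧₃ a d g) (∧₃ b e h) (∧₃ c f i)))

frobenius-true : Always 9 frobenius
frobenius-true = every-elim 9 frobenius refl

ends : (A → ℕ) → A × A → ℕ
ends f (x , y) = f x + f y

module Matrices (R : A → A → Bool) (R-sym : ∀ x y → R x y ≡ R y x) where

  gaps : A → Triple A → ℕ
  gaps x f = hat (λ y → ⟦ not (R x y) ⟧) f

  Hot : Triple A → Triple A → Set
  Hot (x₁ , x₂ , x₃) f =
    (gaps x₂ f ≡ 0 × gaps x₃ f ≡ 0) ⊎ (gaps x₁ f ≡ 0 × gaps x₃ f ≡ 0) ⊎ (gaps x₁ f ≡ 0 × gaps x₂ f ≡ 0)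

  no-gaps : ∀ x y₁ y₂ y₃ → ∧₃ (R x y₁) (R x y₂) (R x y₃) ≡ true → gaps x (y₁ , y₂ , y₃) ≡ 0
  no-gaps x y₁ y₂ y₃ p with ∧₃-split {R x y₁} {R x y₂} {R x y₃} p
  ... | p₁ , p₂ , p₃ rewrite p₁ | p₂ | p₃ = refl

  no-gaps′ : ∀ x y₁ y₂ y₃ → ∧₃ (R y₁ x) (R y₂ x) (R y₃ x) ≡ true → gaps x (y₁ , y₂ , y₃) ≡ 0
  no-gaps′ x y₁ y₂ y₃ p = no-gaps x y₁ y₂ y₃
    (trans (cong₂ _∧_ (R-sym x y₁) (cong₂ _∧_ (R-sym x y₂) (R-sym x y₃))) p)

  adjacent : ∀ {x} f y₁ y₂ y₃ → gaps x f ≡ 0 → (∀ g → hat g f ≡ g y₁ + g y₂ + g y₃) →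
    R x y₁ ≡ true × R x y₂ ≡ true × R x y₃ ≡ true
  adjacent {x} f y₁ y₂ y₃ full eq
    with R x y₁ | R x y₂ | R x y₃ | trans (sym full) (eq (λ y → ⟦ not (R x y) ⟧))
  ... | true | true | true | _ = refl , refl , refl

  two-rows : ∀ e f → Hot e f → ∃[ x ] ∃[ x′ ] ∃[ x″ ]
    ((∀ g → hat g e ≡ g x + g x′ + g x″) × gaps x f ≡ 0 × gaps x′ f ≡ 0)
  two-rows (x₁ , x₂ , x₃) f (inj₁ (p , q))        = x₂ , x₃ , x₁ , (λ g → perm231 (g x₁) _ _) , p , q
  two-rows (x₁ , x₂ , x₃) f (inj₂ (inj₁ (p , q))) = x₁ , x₃ , x₂ , (λ g → perm132 (g x₁) _ _) , p , q
  two-rows (x₁ , x₂ , x₃) f (inj₂ (inj₂ (p , q))) = x₁ , x₂ , x₃ , (λ g → refl) , p , q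

  distinct-rows : ∀ e f f′ → Hot e f → Hot e f′ → ∃[ x ] ∃[ x′ ] ∃[ x″ ]
    ((∀ g → hat g e ≡ g x + g x′ + g x″) × gaps x f ≡ 0 × gaps x′ f′ ≡ 0)
  distinct-rows (x₁ , x₂ , x₃) f f′ (inj₁ (p , q)) (inj₁ (p′ , q′)) = x₂ , x₃ , x₁ , (λ g → perm231 (g x₁) _ _) , p , q′
  distinct-rows (x₁ , x₂ , x₃) f f′ (inj₁ (p , q)) (inj₂ (inj₁ (p′ , q′))) = x₂ , x₁ , x₃ , (λ g → perm213 (g x₁) _ _) , p , p′
  distinct-rows (x₁ , x₂ , x₃) f f′ (inj₁ (p , q)) (inj₂ (inj₂ (p′ , q′))) = x₂ , x₁ , x₃ , (λ g → perm213 (g x₁) _ _) , p , p′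
  distinct-rows (x₁ , x₂ , x₃) f f′ (inj₂ (inj₁ (p , q))) (inj₁ (p′ , q′)) = x₁ , x₂ , x₃ , (λ g → refl) , p , p′
  distinct-rows (x₁ , x₂ , x₃) f f′ (inj₂ (inj₁ (p , q))) (inj₂ (inj₁ (p′ , q′))) = x₁ , x₃ , x₂ , (λ g → perm132 (g x₁) _ _) , p , q′
  distinct-rows (x₁ , x₂ , x₃) f f′ (inj₂ (inj₁ (p , q))) (inj₂ (inj₂ (p′ , q′))) = x₁ , x₂ , x₃ , (λ g → refl) , p , q′
  distinct-rows (x₁ , x₂ , x₃) f f′ (inj₂ (inj₂ (p , q))) (inj₁ (p′ , q′)) = x₁ , x₂ , x₃ , (λ g → refl) , p , p′
  distinct-rows (x₁ , x₂ , x₃) f f′ (inj₂ (inj₂ (p , q))) (inj₂ (inj₁ (p′ , q′))) = x₁ , x₃ , x₂ , (λ g → perm132 (g x₁) _ _) , p , q′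
  distinct-rows (x₁ , x₂ , x₃) f f′ (inj₂ (inj₂ (p , q))) (inj₂ (inj₂ (p′ , q′))) = x₁ , x₂ , x₃ , (λ g → refl) , p , q′

  entries : Triple A → Triple A → ℕ
  entries = matrix (λ x y → ⟦ R x y ⟧)

  classify : ∀ e f → 5 < entries e f → Transversal R e f ⊎ (Hot e f ⊎ Hot f e)
  classify (x₁ , x₂ , x₃) (y₁ , y₂ , y₃) big
    with ∨-split (frobenius-true (R x₁ y₁) (R x₁ y₂) (R x₁ y₃) (R x₂ y₁) (R x₂ y₂) (R x₂ y₃) (R x₃ y₁) (R x₃ y₂) (R x₃ y₃))
  ... | inj₁ small = ⊥-elim (<⇒≱ big (≤ᵇ⇒≤ _ 5 (subst IsTrue (sym small) tt)))
  ... | inj₂ r with ∨-split r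
  ...   | inj₁ s = inj₁ (pick (∨-split s))
    where
    pick : _ → Transversal R (x₁ , x₂ , x₃) (y₁ , y₂ , y₃)
    pick (inj₁ p) = y₁ , y₂ , y₃ , (λ g → refl) , ∧₃-split p
    pick (inj₂ s) with ∨-split {∧₃ (R x₁ y₁) (R x₂ y₃) (R x₃ y₂)} s
    ... | inj₁ p = y₁ , y₃ , y₂ , (λ g → perm132 (g y₁) _ _) , ∧₃-split p
    ... | inj₂ s with ∨-split {∧₃ (R x₁ y₂) (R x₂ y₁) (R x₃ y₃)} s
    ...   | inj₁ p = y₂ , y₁ , y₃ , (λ g → perm213 (g y₁) _ _) , ∧₃-split p
    ...   | inj₂ s with ∨-split {∧₃ (R x₁ y₂) (R x₂ y₃) (R x₃ y₁)} s
    ...     | inj₁ p = y₂ , y₃ , y₁ , (λ g → perm231 (g y₁) _ _) , ∧₃-split p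
    ...     | inj₂ s with ∨-split {∧₃ (R x₁ y₃) (R x₂ y₁) (R x₃ y₂)} s
    ...       | inj₁ p = y₃ , y₁ , y₂ , (λ g → perm312 (g y₁) _ _) , ∧₃-split p
    ...       | inj₂ p = y₃ , y₂ , y₁ , (λ g → perm321 (g y₁) _ _) , ∧₃-split p
  ...   | inj₂ s with ∨-split {two-of (∧₃ (R x₁ y₁) (R x₁ y₂) (R x₁ y₃)) (∧₃ (R x₂ y₁) (R x₂ y₂) (R x₂ y₃)) (∧₃ (R x₃ y₁) (R x₃ y₂) (R x₃ y₃))} s
  ...     | inj₁ t = inj₂ (inj₁ (pick (two-of-split (∧₃ (R x₁ y₁) (R x₁ y₂) (R x₁ y₃)) (∧₃ (R x₂ y₁) (R x₂ y₂) (R x₂ y₃)) (∧₃ (R x₃ y₁) (R x₃ y₂) (R x₃ y₃)) t)))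
    where
    full = λ x p → no-gaps x y₁ y₂ y₃ p
    pick : _ → Hot (x₁ , x₂ , x₃) (y₁ , y₂ , y₃)
    pick (inj₁ (p , q))        = inj₁ (full x₂ p , full x₃ q)
    pick (inj₂ (inj₁ (p , q))) = inj₂ (inj₁ (full x₁ p , full x₃ q))
    pick (inj₂ (inj₂ (p , q))) = inj₂ (inj₂ (full x₁ p , full x₂ q))
  ...     | inj₂ t = inj₂ (inj₂ (pick (two-of-split (∧₃ (R x₁ y₁) (R x₂ y₁) (R x₃ y₁)) (∧₃ (R x₁ y₂) (R x₂ y₂) (R x₃ y₂)) (∧₃ (R x₁ y₃) (R x₂ y₃) (R x₃ y₃)) t)))
    where
    full = λ y p → no-gaps′ y x₁ x₂ x₃ p
    pick : _ → Hot (y₁ , y₂ , y₃) (x₁ , x₂ , x₃)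
    pick (inj₁ (p , q))        = inj₁ (full y₂ p , full y₃ q)
    pick (inj₂ (inj₁ (p , q))) = inj₂ (inj₁ (full y₁ p , full y₃ q))
    pick (inj₂ (inj₂ (p , q))) = inj₂ (inj₂ (full y₁ p , full y₂ q))

  record FourPairs (total : (A → ℕ) → ℕ) : Set where
    field
      p₁ p₂ p₃ p₄ : A × A
      spare       : A
      covers      : ∀ f → total f ≡ ends f p₁ + ends f p₂ + ends f p₃ + ends f p₄ + f spare
      related     : R (proj₁ p₁) (proj₂ p₁) ≡ true × R (proj₁ p₂) (proj₂ p₂) ≡ true
                  × R (proj₁ p₃) (proj₂ p₃) ≡ true × R (proj₁ p₄) (proj₂ p₄) ≡ true

  transitive : ∀ e f g → Hot e f → Hot e g → Hot f g → FourPairs (λ k → hat k e + hat k f + hat k g)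
  transitive e f g@(z₁ , z₂ , z₃) ef eg fg
    with distinct-rows e f g ef eg | two-rows f g fg
  ... | x , x′ , x″ , e-eq , xf , x′g | y , y′ , y″ , f-eq , yg , y′g = record
    { p₁ = x , y″ ; p₂ = x′ , z₃ ; p₃ = y , z₁ ; p₄ = y′ , z₂ ; spare = x″
    ; covers = λ k → trans (cong₂ (λ s t → s + t + hat k g) (e-eq k) (f-eq k))
        (shuffle₆ (k x) (k x′) (k x″) (k y) (k y′) (k y″) (k z₁) (k z₂) (k z₃))
    ; related = proj₂ (proj₂ (adjacent f y y′ y″ xf f-eq)) , proj₂ (proj₂ (adjacent g z₁ z₂ z₃ x′g (λ _ → refl)))
              , proj₁ (adjacent g z₁ z₂ z₃ yg (λ _ → refl)) , proj₁ (proj₂ (adjacent g z₁ z₂ z₃ y′g (λ _ → refl))) }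

  cyclic : ∀ e f g → Hot e f → Hot f g → Hot g e → FourPairs (λ k → hat k e + hat k f + hat k g)
  cyclic e f g ef fg ge with two-rows e f ef | two-rows f g fg | two-rows g e ge
  ... | x , x′ , x″ , e-eq , xf , x′f | y , y′ , y″ , f-eq , yg , _ | z , z′ , z″ , g-eq , ze , _ = record
    { p₁ = x , y″ ; p₂ = x′ , y′ ; p₃ = y , z″ ; p₄ = z , x″ ; spare = z′
    ; covers = λ k → trans (cong₂ (λ s t → s + t + hat k g) (e-eq k) (f-eq k)) (trans (cong (k x + k x′ + k x″ + (k y + k y′ + k y″) +_) (g-eq k))
        (shuffle₅ (k x) (k x′) (k x″) (k y) (k y′) (k y″) (k z) (k z′) (k z″)))
    ; related = proj₂ (proj₂ (adjacent f y y′ y″ xf f-eq)) , proj₁ (proj₂ (adjacent f y y′ y″ x′f f-eq))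
              , proj₂ (proj₂ (adjacent g z z′ z″ yg g-eq)) , proj₂ (proj₂ (adjacent e x x′ x″ ze e-eq)) }

  reorder : ∀ {s t} → (∀ k → t k ≡ s k) → FourPairs s → FourPairs t
  reorder eq F = record { FourPairs F ; covers = λ k → trans (eq k) (FourPairs.covers F k) }

  four-pairs : ∀ e f g → Hot e f ⊎ Hot f e → Hot e g ⊎ Hot g e → Hot f g ⊎ Hot g f →
    FourPairs (λ k → hat k e + hat k f + hat k g)
  four-pairs e f g (inj₁ a) (inj₁ b) (inj₁ c) = transitive e f g a b c
  four-pairs e f g (inj₁ a) (inj₁ b) (inj₂ c) = reorder (λ k → perm132 (hat k e) _ _) (transitive e g f b a c)
  four-pairs e f g (inj₁ a) (inj₂ b) (inj₁ c) = cyclic e f g a c b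
  four-pairs e f g (inj₁ a) (inj₂ b) (inj₂ c) = reorder (λ k → perm312 (hat k e) _ _) (transitive g e f b c a)
  four-pairs e f g (inj₂ a) (inj₁ b) (inj₁ c) = reorder (λ k → perm213 (hat k e) _ _) (transitive f e g a c b)
  four-pairs e f g (inj₂ a) (inj₁ b) (inj₂ c) = reorder (λ k → perm213 (hat k e) _ _) (cyclic f e g a b c)
  four-pairs e f g (inj₂ a) (inj₂ b) (inj₁ c) = reorder (λ k → perm231 (hat k e) _ _) (transitive f g e c a b)
  four-pairs e f g (inj₂ a) (inj₂ b) (inj₂ c) = reorder (λ k → perm321 (hat k e) _ _) (transitive g f e c b a)

record Improvement {V : Set} (bad : Triple V → ℕ) (w : V → ℕ) (b : ℕ) (M : List (Triple V)) (L : List V) : Set where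
  field
    M⁺      : List (Triple V)
    L⁺      : List V
    balance : ∀ f → sum (hat f) M⁺ + sum f L⁺ ≡ sum (hat f) M + sum f L
    larger  : size M⁺ ≡ suc (size M)
    sound   : sum bad M⁺ ≡ 0
    light   : sum w L⁺ ≤ b

vanishes : ∀ {a b} → a + b ≡ 0 → a ≡ 0 × b ≡ 0
vanishes {a} {b} eq = m+n≡0⇒m≡0 a eq , m+n≡0⇒n≡0 a eq

not-true : ∀ {x} → ⟦ not x ⟧ ≡ 0 → x ≡ true
not-true {true} _ = refl

true-not : ∀ {x} → x ≡ true → ⟦ not x ⟧ ≡ 0
true-not refl = refl

degreeOf : {V : Set} → List V → (V → V → V → Bool) → V → ℕ
degreeOf vs h x = sum (λ p → sum (λ q → ⟦ h x p q ⟧) vs) vs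

module Graph {V : Set} (vs : List V) (h : V → V → V → Bool)
  (h-swap : ∀ x y z → h x y z ≡ h y x z) (h-rot : ∀ x y z → h x y z ≡ h y z x)
  (h-irr : ∀ x y → h x x y ≡ false) where

  n : ℕ
  n = size vs

  h-swap₂ : ∀ x y z → h x y z ≡ h x z y
  h-swap₂ x y z = trans (h-rot x y z) (trans (h-swap y z x) (sym (h-rot x z y)))

  h-irr₂ : ∀ x y → h x y y ≡ false
  h-irr₂ x y = trans (h-rot x y y) (h-irr y x)

  degree : V → ℕ
  degree = degreeOf vs h

  nonedge : Triple V → ℕ
  nonedge (x , y , z) = ⟦ not (h x y z) ⟧

  record Packing (k : ℕ) : Set where
    field
      M     : List (Triple V)
      L     : List V
      part  : ∀ f → sum f vs ≡ sum (hat f) M + sum f L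
      count : size M ≡ k
      proper : sum nonedge M ≡ 0

  codegree : List V → V → ℕ
  codegree K t = sum (λ p → sum (λ q → ⟦ h t p q ⟧) K) K

  edge-within : ∀ (c : V → Bool) K →
    (∃[ t ] ∃[ p ] ∃[ q ] ∃[ K₀ ] (K ≈ t ∷ p ∷ q ∷ K₀ × c t ≡ true × h t p q ≡ true)) ⊎ sum (λ t → ⟦ c t ⟧ * codegree K t) K ≤ 0
  edge-within c K with select (λ t → ⟦ c t ⟧ * codegree K t) 0 K
  ... | inj₂ none = inj₂ (≤-trans (sum-mono-All none) (≤-reflexive (sum-0 K)))
  ... | inj₁ (t , K₁ , pos , eq) with c t in ct
  ...   | true with select-positive (λ p → sum (λ q → ⟦ h t p q ⟧) K) K₁
          (≤-trans pos (≤-reflexive (trans (+-identityʳ _) (trans (eq (λ p → sum (λ q → ⟦ h t p q ⟧) K))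
            (cong (_+ sum (λ p → sum (λ q → ⟦ h t p q ⟧) K) K₁) (trans (sum-cong (λ q → cong ⟦_⟧ (h-irr t q)) K) (sum-0 K)))))))
  ...     | p , K₂ , pos′ , eq′ with select-positive (λ q → ⟦ h t p q ⟧) K₂
          (≤-trans pos′ (≤-reflexive (trans (eq (λ q → ⟦ h t p q ⟧)) (trans (cong (⟦ h t p t ⟧ +_) (eq′ (λ q → ⟦ h t p q ⟧)))
            (cong₂ (λ a b → ⟦ a ⟧ + (⟦ b ⟧ + sum (λ q → ⟦ h t p q ⟧) K₂)) (trans (h-swap₂ t p t) (h-irr t p)) (h-irr₂ t p))))))
  ...       | q , K₃ , pos″ , eq″ = inj₁ (t , p , q , K₃ , (λ f → trans (eq f) (cong (f t +_) (trans (eq′ f) (cong (f p +_) (eq″ f))))) , ct , ⟦⟧>0 pos″)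

  -- A pair is popular if it forms an edge with at least four vertices of L satisfying u,
  -- so that up to four disjoint popular pairs can be completed to disjoint edges greedily.
  module Popularity (u : V → Bool) (bad : Triple V → ℕ)
    (drawn-good : ∀ z p q → u z ≡ true → h z p q ≡ true → bad (z , p , q) ≡ 0) where

    count : List V → V → V → ℕ
    count L p q = sum (λ z → ⟦ u z ∧ h z p q ⟧) L

    count-sym : ∀ L p q → count L p q ≡ count L q p
    count-sym L p q = sum-cong (λ z → cong (λ t → ⟦ u z ∧ t ⟧) (h-swap₂ z p q)) L

    count-diagonal : ∀ L p → count L p p ≡ 0
    count-diagonal L p = trans (sum-cong (λ z → trans (cong (λ t → ⟦ u z ∧ t ⟧) (h-irr₂ z p)) (never (u z))) L) (sum-0 L)
      where
      never : ∀ x → ⟦ x ∧ false ⟧ ≡ 0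
      never true  = refl
      never false = refl

    count-drop : ∀ L L′ x p q → L ≈ x ∷ L′ → ∀ k → suc k ≤ count L p q → k ≤ count L′ p q
    count-drop L L′ x p q eq k k< = +-cancelˡ-≤ 1 _ _ (≤-trans k< (≤-trans (≤-reflexive (eq _)) (+-monoˡ-≤ _ (⟦⟧≤1 (u x ∧ h x p q)))))

    Counts : ℕ → List V → List (V × V) → Set
    Counts k L = All (λ pq → k ≤ count L (proj₁ pq) (proj₂ pq))

    counts-drop : ∀ L L′ x {k ps} → L ≈ x ∷ L′ → Counts (suc k) L ps → Counts k L′ ps
    counts-drop L L′ x eq []       = []
    counts-drop L L′ x {ps = (p , q) ∷ _} eq (c ∷ cs) = count-drop L L′ x p q eq _ c ∷ counts-drop L L′ x eq cs

    popular : List V → V → V → Bool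
    popular L p q = 4 ≤ᵇ count L p q

    popular-count : ∀ L p q → popular L p q ≡ true → 4 ≤ count L p q
    popular-count L p q pop = ≤ᵇ⇒≤ 4 _ (subst IsTrue (sym pop) tt)

    popular-sym : ∀ L p q → popular L p q ≡ popular L q p
    popular-sym L p q = cong (4 ≤ᵇ_) (count-sym L p q)

    b : List V → V → V → ℕ
    b L p q = ⟦ popular L p q ⟧

    average : ∀ L → sum (λ z → ⟦ u z ⟧ * degree z) L ≤
      sum (λ z → ⟦ u z ⟧) L * sum (λ p → sum (b L p) vs) vs + n * n * 3
    average L = begin
      sum (λ z → ⟦ u z ⟧ * degree z) L
        ≡⟨ sum-cong (λ z → trans (sym (sum-*ˡ ⟦ u z ⟧ _ vs)) (sum-cong (λ p → trans (sym (sum-*ˡ ⟦ u z ⟧ _ vs))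
             (sum-cong (λ q → sym (⟦⟧-∧ (u z) (h z p q))) vs)) vs)) L ⟩
      sum (λ z → sum (λ p → sum (λ q → ⟦ u z ∧ h z p q ⟧) vs) vs) L
        ≡⟨ sum-swap (λ z p → sum (λ q → ⟦ u z ∧ h z p q ⟧) vs) L vs ⟩
      sum (λ p → sum (λ z → sum (λ q → ⟦ u z ∧ h z p q ⟧) vs) L) vs
        ≡⟨ sum-cong (λ p → sum-swap (λ z q → ⟦ u z ∧ h z p q ⟧) L vs) vs ⟩
      sum (λ p → sum (λ q → count L p q) vs) vs
        ≤⟨ sum-mono (λ p → sum-mono (λ q → bounded p q) vs) vs ⟩
      sum (λ p → sum (λ q → U * b L p q + 3) vs) vs
        ≡⟨ sum-cong (λ p → trans (sum-+ (λ q → U * b L p q) (λ _ → 3) vs)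
             (cong₂ _+_ (sum-*ˡ U (b L p) vs) (sum-const 3 vs))) vs ⟩
      sum (λ p → U * sum (b L p) vs + 3 * n) vs
        ≡⟨ trans (sum-+ (λ p → U * sum (b L p) vs) (λ _ → 3 * n) vs)
             (cong₂ _+_ (sum-*ˡ U _ vs) (sum-const (3 * n) vs)) ⟩
      U * sum (λ p → sum (b L p) vs) vs + 3 * n * n
        ≡⟨ cong (U * sum (λ p → sum (b L p) vs) vs +_) (3*a*a≡a*a*3 n) ⟩
      U * sum (λ p → sum (b L p) vs) vs + n * n * 3 ∎
      where
      open ≤-Reasoning
      U = sum (λ z → ⟦ u z ⟧) L
      ∧≤ˡ : ∀ x y → ⟦ x ∧ y ⟧ ≤ ⟦ x ⟧
      ∧≤ˡ true  y = ⟦⟧≤1 y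
      ∧≤ˡ false y = z≤n
      bounded : ∀ p q → count L p q ≤ U * b L p q + 3
      bounded p q with popular L p q in pop
      ... | true  = ≤-trans (sum-mono (λ z → ∧≤ˡ (u z) (h z p q)) L) (≤-trans (≤-reflexive (sym (*-identityʳ U))) (m≤m+n _ 3))
      ... | false = ≤-trans (≮⇒≥ (λ 4≤ → subst IsTrue pop (≤⇒≤ᵇ 4≤))) (m≤n+m 3 _)

    record Drawn (L : List V) (ps : List (V × V)) : Set where
      field
        M′      : List (Triple V)
        L′      : List V
        balance : ∀ f → sum (hat f) M′ + sum f L′ ≡ sum (ends f) ps + sum f L
        count′  : size M′ ≡ size ps
        sound   : sum bad M′ ≡ 0
        shrinks : ∀ f → sum f L′ ≤ sum f L

    draw : ∀ L ps → Counts (size ps) L ps → Drawn L ps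
    draw L [] [] = record { M′ = [] ; L′ = L ; balance = λ f → refl ; count′ = refl ; sound = refl ; shrinks = λ f → ≤-refl }
    draw L ((p , q) ∷ ps) (c ∷ cs) with select-positive (λ z → ⟦ u z ∧ h z p q ⟧) L (≤-trans (s≤s z≤n) c)
    ... | z , L₁ , pos , eq with ∧-split (⟦⟧>0 {u z ∧ h z p q} pos) | draw L₁ ps (counts-drop L L₁ z eq cs)
    ...   | uz , hz | D = record
      { M′ = (z , p , q) ∷ M′ ; L′ = L′
      ; balance = λ f → begin
          f z + f p + f q + sum (hat f) M′ + sum f L′   ≡⟨ +-assoc (f z + f p + f q) _ _ ⟩
          f z + f p + f q + (sum (hat f) M′ + sum f L′) ≡⟨ cong (f z + f p + f q +_) (balance f) ⟩
          f z + f p + f q + (sum (ends f) ps + sum f L₁) ≡⟨ a+b+c+[d+e]≡b+c+d+[a+e] (f z) (f p) (f q) (sum (ends f) ps) (sum f L₁) ⟩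
          f p + f q + sum (ends f) ps + (f z + sum f L₁) ≡⟨ cong (f p + f q + sum (ends f) ps +_) (sym (eq f)) ⟩
          f p + f q + sum (ends f) ps + sum f L          ∎
      ; count′ = cong suc count′
      ; sound = trans (cong (_+ sum bad M′) (drawn-good z p q uz hz)) sound
      ; shrinks = λ f → ≤-trans (shrinks f) (≤-trans (m≤n+m _ (f z)) (≤-reflexive (sym (eq f)))) }
      where
      open Drawn D
      open ≡-Reasoning

    improve : ∀ {w k M L} M₀ L₀ ps freed →
      (∀ f → sum (hat f) M + sum f L ≡ sum (ends f) ps + sum f freed + (sum (hat f) M₀ + sum f L₀)) →
      suc (size M) ≡ size ps + size M₀ → sum bad M₀ ≡ 0 →
      Counts (size ps) L₀ ps → sum w freed + sum w L₀ ≤ k →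
      Improvement bad w k M L
    improve {w} {k} {M} {L} M₀ L₀ ps freed eq size-eq M₀-sound counts light = record
      { M⁺ = M′ ++ M₀ ; L⁺ = freed ++ L′
      ; balance = λ f → begin
          sum (hat f) (M′ ++ M₀) + sum f (freed ++ L′)
            ≡⟨ cong₂ _+_ (sum-++ (hat f) M′ M₀) (sum-++ f freed L′) ⟩
          sum (hat f) M′ + sum (hat f) M₀ + (sum f freed + sum f L′)
            ≡⟨ a+b+[c+d]≡a+d+c+b (sum (hat f) M′) (sum (hat f) M₀) (sum f freed) (sum f L′) ⟩
          sum (hat f) M′ + sum f L′ + sum f freed + sum (hat f) M₀
            ≡⟨ cong (λ s → s + sum f freed + sum (hat f) M₀) (balance f) ⟩
          sum (ends f) ps + sum f L₀ + sum f freed + sum (hat f) M₀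
            ≡⟨ a+b+c+d≡a+c+[d+b] (sum (ends f) ps) (sum f L₀) (sum f freed) (sum (hat f) M₀) ⟩
          sum (ends f) ps + sum f freed + (sum (hat f) M₀ + sum f L₀) ≡⟨ sym (eq f) ⟩
          sum (hat f) M + sum f L ∎
      ; larger = trans (sum-++ (λ _ → 1) M′ M₀) (trans (cong (_+ size M₀) count′) (sym size-eq))
      ; sound = trans (sum-++ bad M′ M₀) (cong₂ _+_ sound M₀-sound)
      ; light = ≤-trans (≤-reflexive (sum-++ w freed L′)) (≤-trans (+-monoʳ-≤ (sum w freed) (shrinks w)) light) }
      where
      open Drawn (draw L₀ ps counts)
      open ≡-Reasoning

-- Augmenting a matching

private
  square-bound : ∀ x p r → x ≤ p + r → x * x ≤ p * p + r * x * 6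
  square-bound x p r x≤ with ≤-total x p
  ... | inj₁ x≤p = ≤-trans (*-mono-≤ x≤p x≤p) (m≤m+n _ _)
  ... | inj₂ p≤x with m≤n⇒∃[o]m+o≡n p≤x
  ...   | d , refl = small p d r (+-cancelˡ-≤ p d r x≤)
    where
    small : ∀ p d r → d ≤ r → (p + d) * (p + d) ≤ p * p + r * (p + d) * 6
    small p d r h1 = certified (p ∷ d ∷ r ∷ [])
      ((‵ 1 , ‵ 2) ∷ [])
      ((‵ 1 :+ ‵ 0 :* ♯ 2) ∷ [])
      0 ((‵ 0 :+ ‵ 1) :* (‵ 0 :+ ‵ 1)) (‵ 0 :* ‵ 0 :+ ‵ 2 :* (‵ 0 :+ ‵ 1) :* ♯ 6) refl (h1 , tt)

  combine-bounds : ∀ Z S E B N T D → Z * (S * 2) ≤ D + Z * E → D ≤ Z * B + N * 3 → N * 9 ≤ Z * T → Z * (S * 6) ≤ Z * (E * 3 + B * 3 + T)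
  combine-bounds Z S E B N T D h1 h2 h3 = certified (Z ∷ S ∷ E ∷ B ∷ N ∷ T ∷ D ∷ [])
    ((‵ 0 :* (‵ 1 :* ♯ 2) , ‵ 6 :+ ‵ 0 :* ‵ 2) ∷ (‵ 6 , ‵ 0 :* ‵ 3 :+ ‵ 4 :* ♯ 3) ∷ (‵ 4 :* ♯ 9 , ‵ 0 :* ‵ 5) ∷ [])
    ((♯ 3) ∷ (♯ 3) ∷ (♯ 1) ∷ [])
    0 (‵ 0 :* (‵ 1 :* ♯ 6)) (‵ 0 :* (‵ 2 :* ♯ 3 :+ ‵ 3 :* ♯ 3 :+ ‵ 5)) refl (h1 , h2 , h3 , tt)

  overfull : ∀ a p q r s n x E T ζ ℓ S PP PQ QQ XP XQ → S ≤ a * n * 6 + ((p + q) * 9 + (PP + PQ + QQ) * 2 + (XP + XQ) * 2) → XP ≤ (ℓ + 3) * p → XQ ≤ (ℓ + ζ + 3) * q → PP * 6 ≤ p * p * 17 + p * 54 → PQ ≤ p * q * 6 → QQ * 2 ≤ q * q * 6 → s * 6 * n ≤ E * 3 + S * 3 + T → a * 3 + p * 3 + q * 3 + ℓ ≤ n → a + p + q + r ≤ s → q * ζ ≤ q * r * 3 → q * 3 + x ≤ n → x * x ≤ p * p + r * x * 6 → 1 + (E * 3 + T + a * n * 18 + n * 33) ≤ x * x → 1 ≤ 0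
  overfull a p q r s n x E T ζ ℓ S PP PQ QQ XP XQ h1 h2 h3 h4 h5 h6 h7 h8 h9 h10 h11 h12 h13 = certified (a ∷ p ∷ q ∷ r ∷ s ∷ n ∷ x ∷ E ∷ T ∷ ζ ∷ ℓ ∷ S ∷ PP ∷ PQ ∷ QQ ∷ XP ∷ XQ ∷ [])
    ((‵ 11 , ‵ 0 :* ‵ 5 :* ♯ 6 :+ ((‵ 1 :+ ‵ 2) :* ♯ 9 :+ (‵ 12 :+ ‵ 13 :+ ‵ 14) :* ♯ 2 :+ (‵ 15 :+ ‵ 16) :* ♯ 2)) ∷ (‵ 15 , (‵ 10 :+ ♯ 3) :* ‵ 1) ∷ (‵ 16 , (‵ 10 :+ ‵ 9 :+ ♯ 3) :* ‵ 2) ∷ (‵ 12 :* ♯ 6 , ‵ 1 :* ‵ 1 :* ♯ 17 :+ ‵ 1 :* ♯ 54) ∷ (‵ 13 , ‵ 1 :* ‵ 2 :* ♯ 6) ∷ (‵ 14 :* ♯ 2 , ‵ 2 :* ‵ 2 :* ♯ 6) ∷ (‵ 4 :* ♯ 6 :* ‵ 5 , ‵ 7 :* ♯ 3 :+ ‵ 11 :* ♯ 3 :+ ‵ 8) ∷ (‵ 0 :* ♯ 3 :+ ‵ 1 :* ♯ 3 :+ ‵ 2 :* ♯ 3 :+ ‵ 10 , ‵ 5) ∷ (‵ 0 :+ ‵ 1 :+ ‵ 2 :+ ‵ 3 , ‵ 4) ∷ (‵ 2 :* ‵ 9 , ‵ 2 :* ‵ 3 :* ♯ 3) ∷ (‵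 2 :* ♯ 3 :+ ‵ 6 , ‵ 5) ∷ (‵ 6 :* ‵ 6 , ‵ 1 :* ‵ 1 :+ ‵ 3 :* ‵ 6 :* ♯ 6) ∷ (♯ 1 :+ (‵ 7 :* ♯ 3 :+ ‵ 8 :+ ‵ 0 :* ‵ 5 :* ♯ 18 :+ ‵ 5 :* ♯ 33) , ‵ 6 :* ‵ 6) ∷ [])
    ((♯ 3) ∷ (♯ 6) ∷ (♯ 6) ∷ (♯ 1) ∷ (♯ 6) ∷ (♯ 3) ∷ (♯ 1) ∷ (‵ 1 :* ♯ 6 :+ ‵ 2 :* ♯ 6 :+ ♯ 33) ∷ (‵ 5 :* ♯ 6) ∷ (♯ 6) ∷ (‵ 3 :* ♯ 6) ∷ (♯ 1) ∷ (♯ 1) ∷ [])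
    0 (♯ 1) (♯ 0) refl (h1 , h2 , h3 , h4 , h5 , h6 , h7 , h8 , h9 , h10 , h11 , h12 , h13 , tt)

module Augmentation {V : Set} (vs : List V) (h : V → V → V → Bool)
  (h-swap : ∀ x y z → h x y z ≡ h y x z) (h-rot : ∀ x y z → h x y z ≡ h y z x)
  (h-irr : ∀ x y → h x x y ≡ false)
  (w : V → Bool) (w-edge : ∀ x y z → h x y z ≡ true → ⟦ w x ⟧ + ⟦ w y ⟧ + ⟦ w z ⟧ ≤ 1) where

  open Graph vs h h-swap h-rot h-irr

  W : V → ℕ
  W x = ⟦ w x ⟧

  u : V → Bool
  u x = not (w x)

  open Popularity u nonedge (λ z p q _ hz → true-not hz)

  module _ (P Q : List (Triple V)) (L : List V) (k : ℕ)
    (P-sound : sum nonedge P ≡ 0) (Q-sound : sum nonedge Q ≡ 0) (L-light : sum W L ≤ k)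
    (freeing : sum W L < k ⊎ sum (hat W) P ≡ 0) where

    private
      M = P ++ Q
      Imp = Improvement nonedge W k M L
      R = popular L
      R-sym = popular-sym L
      open Matrices R R-sym

    M-split : ∀ f → sum f M ≡ sum f P + sum f Q
    M-split f = sum-++ f P Q

    M-sound : sum nonedge M ≡ 0
    M-sound = trans (M-split nonedge) (cong₂ _+_ P-sound Q-sound)

    rest-sound₁ : ∀ e M₀ → M ≈ e ∷ M₀ → sum nonedge M₀ ≡ 0
    rest-sound₁ e M₀ eq = proj₂ (vanishes {nonedge e} (trans (sym (eq nonedge)) M-sound))

    rest-sound₂ : ∀ e f M₀ → M ≈ e ∷ f ∷ M₀ → sum nonedge M₀ ≡ 0
    rest-sound₂ e f M₀ eq = proj₂ (vanishes {nonedge f} (rest-sound₁ e (f ∷ M₀) eq))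

    from-P : ∀ e P₀ → P ≈ e ∷ P₀ → M ≈ e ∷ (P₀ ++ Q)
    from-P e P₀ eq f = trans (M-split f) (trans (cong (_+ sum f Q) (eq f))
      (trans (+-assoc (f e) _ _) (cong (f e +_) (sym (sum-++ f P₀ Q)))))

    from-Q : ∀ e Q₀ → Q ≈ e ∷ Q₀ → M ≈ e ∷ (P ++ Q₀)
    from-Q e Q₀ eq f = trans (M-split f) (trans (cong (sum f P +_) (eq f))
      (trans (a+[b+c]≡b+[a+c] (sum f P) (f e) _) (cong (f e +_) (sym (sum-++ f P Q₀)))))

    from-P² : ∀ e f P₀ → P ≈ e ∷ f ∷ P₀ → M ≈ e ∷ f ∷ (P₀ ++ Q)
    from-P² e f P₀ eq g = trans (from-P e (f ∷ P₀) eq g) refl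

    from-Q² : ∀ e f Q₀ → Q ≈ e ∷ f ∷ Q₀ → M ≈ e ∷ f ∷ (P ++ Q₀)
    from-Q² e f Q₀ eq g = trans (M-split g) (trans (cong (sum g P +_) (eq g))
      (trans (a+[b+[c+d]]≡b+[c+[a+d]] (sum g P) (g e) (g f) _) (cong (λ s → g e + (g f + s)) (sym (sum-++ g P Q₀)))))

    from-PQ : ∀ e P₀ f Q₀ → P ≈ e ∷ P₀ → Q ≈ f ∷ Q₀ → M ≈ e ∷ f ∷ (P₀ ++ Q₀)
    from-PQ e P₀ f Q₀ eqP eqQ g = trans (M-split g) (trans (cong₂ _+_ (eqP g) (eqQ g))
      (trans (a+b+[c+d]≡a+[c+[b+d]] (g e) (sum g P₀) (g f) _) (cong (λ s → g e + (g f + s)) (sym (sum-++ g P₀ Q₀)))))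

    pop : ∀ {p q} → R p q ≡ true → 4 ≤ count L p q
    pop {p} {q} = popular-count L p q

    outside : ∀ y y′ L₀ → L ≈ y ∷ y′ ∷ L₀ → R y y′ ≡ true → Imp
    outside y y′ L₀ eq r = improve M L₀ ((y , y′) ∷ []) []
      (λ f → trans (cong (sum (hat f) M +_) (eq f)) (a+[b+[c+d]]≡b+c+0+0+[a+d] (sum (hat f) M) (f y) (f y′) (sum f L₀)))
      refl M-sound
      (≤-trans (s≤s z≤n) (count-drop (y′ ∷ L₀) L₀ y′ y y′ (λ f → refl) 2 (count-drop L (y′ ∷ L₀) y y y′ eq 3 (pop r))) ∷ [])
      (≤-trans (≤-trans (m≤n+m _ (W y + W y′)) (≤-reflexive (trans (+-assoc (W y) _ _) (sym (eq W))))) L-light)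

    one-triple : ∀ e M₀ → M ≈ e ∷ M₀ → ∀ y y′ L₀ → L ≈ y ∷ y′ ∷ L₀ → ∀ x x′ x″ →
      (∀ f → hat f e ≡ f x + f x′ + f x″) → R x y ≡ true → R x′ y′ ≡ true → W x″ + sum W L₀ ≤ k → Imp
    one-triple e M₀ eqM y y′ L₀ eqL x x′ x″ eqe r r′ light = improve M₀ L₀ ((x , y) ∷ (x′ , y′) ∷ []) (x″ ∷ [])
      (λ f → trans (cong₂ _+_ (trans (eqM (hat f)) (cong (_+ sum (hat f) M₀) (eqe f))) (eqL f))
        (shuffle₉ (f x) (f x′) (f x″) (sum (hat f) M₀) (f y) (f y′) (sum f L₀)))
      (cong suc (eqM (λ _ → 1))) (rest-sound₁ e M₀ eqM)
      (counts-drop (y′ ∷ L₀) L₀ y′ (λ f → refl) (counts-drop L (y′ ∷ L₀) y eqL (pop r ∷ pop r′ ∷ [])))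
      (≤-trans (≤-reflexive (cong (_+ sum W L₀) (+-identityʳ _))) light)

    two-triples : ∀ e f M₀ → M ≈ e ∷ f ∷ M₀ → Transversal R e f → Imp
    two-triples (x₁ , x₂ , x₃) f M₀ eqM (y₁ , y₂ , y₃ , eqf , r₁ , r₂ , r₃) =
      improve M₀ L ((x₁ , y₁) ∷ (x₂ , y₂) ∷ (x₃ , y₃) ∷ []) []
      (λ g → trans (cong (_+ sum g L) (trans (eqM (hat g)) (cong (λ s → g x₁ + g x₂ + g x₃ + (s + sum (hat g) M₀)) (eqf g))))
        (shuffle₈ (g x₁) (g x₂) (g x₃) (g y₁) (g y₂) (g y₃) (sum (hat g) M₀) (sum g L)))
      (cong suc (eqM (λ _ → 1))) (rest-sound₂ (x₁ , x₂ , x₃) f M₀ eqM)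
      (≤-trans (n≤1+n 3) (pop r₁) ∷ ≤-trans (n≤1+n 3) (pop r₂) ∷ ≤-trans (n≤1+n 3) (pop r₃) ∷ []) L-light

    freed-light : ∀ e P₀ x → P ≈ e ∷ P₀ → W x ≤ hat W e → W x + sum W L ≤ k
    freed-light e P₀ x eq x≤ = go freeing
      where
      go : _ → W x + sum W L ≤ k
      go (inj₁ room) = ≤-trans (+-monoˡ-≤ _ (⟦⟧≤1 (w x))) room
      go (inj₂ zero′) = ≤-trans (≤-reflexive (cong (_+ sum W L) (n≤0⇒n≡0 (≤-trans x≤ (≤-reflexive
            (proj₁ (vanishes {hat W e} (trans (sym (eq (hat W))) zero′)))))))) L-light

    three-triples : ∀ e f g P₀ → P ≈ e ∷ f ∷ g ∷ P₀ → 17 < triangle entries e f g → Imp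
    three-triples e f g P₀ eqP big with 6 <? entries e f | 6 <? entries e g | 6 <? entries f g
    ... | yes p | _ | _ = two-triples e f (g ∷ P₀ ++ Q) (from-P² e f (g ∷ P₀) eqP) (transversal R e f p)
    ... | no _ | yes p | _ = two-triples e g (f ∷ P₀ ++ Q) (from-P² e g (f ∷ P₀)
            (λ k → trans (eqP k) (cong (k e +_) (a+[b+c]≡b+[a+c] (k f) (k g) _)))) (transversal R e g p)
    ... | no _ | no _ | yes p = two-triples f g (e ∷ P₀ ++ Q) (from-P² f g (e ∷ P₀)
            (λ k → trans (eqP k) (a+[b+[c+d]]≡b+[c+[a+d]] (k e) (k f) (k g) _))) (transversal R f g p)
    ... | no e₁ | no e₂ | no e₃ = finish (classify e f (exact₁ _ _ _ (≮⇒≥ e₂) (≮⇒≥ e₃) big))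
                                         (classify e g (exact₂ _ _ _ (≮⇒≥ e₁) (≮⇒≥ e₃) big))
                                         (classify f g (exact₃ _ _ _ (≮⇒≥ e₁) (≮⇒≥ e₂) big))
      where
      exact₁ : ∀ a b c → b ≤ 6 → c ≤ 6 → 18 ≤ a + b + c → 6 ≤ a
      exact₁ a b c h1 h2 h3 = certified (a ∷ b ∷ c ∷ [])
        ((‵ 1 , ♯ 6) ∷ (‵ 2 , ♯ 6) ∷ (♯ 18 , ‵ 0 :+ ‵ 1 :+ ‵ 2) ∷ [])
        ((♯ 1) ∷ (♯ 1) ∷ (♯ 1) ∷ [])
        0 (♯ 6) (‵ 0) refl (h1 , h2 , h3 , tt)
      exact₂ : ∀ a b c → a ≤ 6 → c ≤ 6 → 18 ≤ a + b + c → 6 ≤ b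
      exact₂ a b c h1 h2 h3 = certified (a ∷ b ∷ c ∷ [])
        ((‵ 0 , ♯ 6) ∷ (‵ 2 , ♯ 6) ∷ (♯ 18 , ‵ 0 :+ ‵ 1 :+ ‵ 2) ∷ [])
        ((♯ 1) ∷ (♯ 1) ∷ (♯ 1) ∷ [])
        0 (♯ 6) (‵ 1) refl (h1 , h2 , h3 , tt)
      exact₃ : ∀ a b c → a ≤ 6 → b ≤ 6 → 18 ≤ a + b + c → 6 ≤ c
      exact₃ a b c h1 h2 h3 = certified (a ∷ b ∷ c ∷ [])
        ((‵ 0 , ♯ 6) ∷ (‵ 1 , ♯ 6) ∷ (♯ 18 , ‵ 0 :+ ‵ 1 :+ ‵ 2) ∷ [])
        ((♯ 1) ∷ (♯ 1) ∷ (♯ 1) ∷ [])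
        0 (♯ 6) (‵ 2) refl (h1 , h2 , h3 , tt)
      finish : _ → _ → _ → Imp
      finish (inj₁ t) _ _ = two-triples e f (g ∷ P₀ ++ Q) (from-P² e f (g ∷ P₀) eqP) t
      finish (inj₂ _) (inj₁ t) _ = two-triples e g (f ∷ P₀ ++ Q) (from-P² e g (f ∷ P₀)
            (λ k → trans (eqP k) (cong (k e +_) (a+[b+c]≡b+[a+c] (k f) (k g) _)))) t
      finish (inj₂ _) (inj₂ _) (inj₁ t) = two-triples f g (e ∷ P₀ ++ Q) (from-P² f g (e ∷ P₀)
            (λ k → trans (eqP k) (a+[b+[c+d]]≡b+[c+[a+d]] (k e) (k f) (k g) _))) t
      finish (inj₂ ef) (inj₂ eg) (inj₂ fg) = improve (P₀ ++ Q) L (p₁ ∷ p₂ ∷ p₃ ∷ p₄ ∷ []) (spare ∷ [])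
        (λ k → trans (cong (_+ sum k L) (trans (from-P² e f (g ∷ P₀) eqP (hat k)) refl))
          (trans (a+[b+[c+d]]+e≡a+b+c+d+e (hat k e) (hat k f) (hat k g) (sum (hat k) (P₀ ++ Q)) (sum k L))
          (trans (cong (λ s → s + sum (hat k) (P₀ ++ Q) + sum k L) (covers k))
            (shuffle₇ (ends k p₁) (ends k p₂) (ends k p₃) (ends k p₄) (k spare) (sum (hat k) (P₀ ++ Q)) (sum k L)))))
        (cong suc (from-P² e f (g ∷ P₀) eqP (λ _ → 1)))
        (proj₂ (vanishes {nonedge g} (rest-sound₂ e f (g ∷ P₀ ++ Q) (from-P² e f (g ∷ P₀) eqP))))
        (pop (proj₁ related) ∷ pop (proj₁ (proj₂ related)) ∷ pop (proj₁ (proj₂ (proj₂ related))) ∷ pop (proj₂ (proj₂ (proj₂ related))) ∷ [])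
        (≤-trans (≤-reflexive (cong (_+ sum W L) (+-identityʳ _))) spare-light)
        where
        open FourPairs (four-pairs e f g ef eg fg)
        spare-light : W spare + sum W L ≤ k
        spare-light = go freeing
          where
          go : _ → W spare + sum W L ≤ k
          spare≡0 : sum (hat W) P ≡ 0 → W spare ≡ 0
          spare≡0 zero′ = proj₂ (vanishes {ends W p₁ + ends W p₂ + ends W p₃ + ends W p₄} (trans (sym (covers W))
            (proj₁ (vanishes {hat W e + hat W f + hat W g} (trans (sym (a+[b+[c+d]]≡a+b+c+d (hat W e) (hat W f) (hat W g) _))
              (trans (sym (eqP (hat W))) zero′))))))
          go (inj₁ room) = ≤-trans (+-monoˡ-≤ _ (⟦⟧≤1 (w spare))) room
          go (inj₂ zero′) = ≤-trans (≤-reflexive (cong (_+ sum W L) (spare≡0 zero′))) L-light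

    private
      p = size P
      q = size Q
      ζ = sum (λ z → ⟦ u z ⟧) L
      ℓ = size L
      mat = entries

    record Bounded : Set where
      field
        none-outside : sum (λ y → sum (b L y) L) L ≡ 0
        P-stars      : sum (λ e → sum (column R e) L) P ≤ (ℓ + 3) * p
        Q-stars      : sum (λ e → sum (column R e) L) Q ≤ (ℓ + ζ + 3) * q
        PP           : pairSum mat P * 6 ≤ p * p * 17 + p * 54
        PQ           : crossSum mat P Q ≤ p * q * 6
        QQ           : pairSum mat Q * 2 ≤ q * q * 6

    L-tail-light : ∀ y y′ L₀ → L ≈ y ∷ y′ ∷ L₀ → W y + (W y′ + sum W L₀) ≤ k
    L-tail-light y y′ L₀ eq = ≤-trans (≤-reflexive (sym (eq W))) L-light

    heavy-P : ∀ e P₀ → P ≈ e ∷ P₀ → ℓ + 3 < sum (column R e) L → Imp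
    heavy-P e P₀ eqP big with heavy-columns R (λ _ → 1) e L (≤-<-trans (m≤m+n ℓ 3) big) (≤-<-trans (m≤n+m 3 ℓ) big)
    ... | y , y′ , L₀ , two , one , eqL with pairing R e y y′ two one
    ...   | x , x′ , x″ , eqe , r , r′ = one-triple e (P₀ ++ Q) (from-P e P₀ eqP) y y′ L₀ eqL x x′ x″ eqe r r′
      (≤-trans (+-monoʳ-≤ (W x″) (≤-trans (m≤n+m _ (W y + W y′)) (≤-reflexive (trans (+-assoc (W y) _ _) (sym (eqL W))))))
        (freed-light e P₀ x″ eqP (≤-trans (m≤n+m _ _) (≤-reflexive (sym (eqe W))))))

    heavy-Q : ∀ e Q₀ → Q ≈ e ∷ Q₀ → ℓ + ζ + 3 < sum (column R e) L → Imp
    heavy-Q e Q₀ eqQ big with heavy-columns R (λ y → 1 + ⟦ u y ⟧) e L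
      (≤-<-trans (≤-trans (≤-reflexive (sum-+ (λ _ → 1) (λ y → ⟦ u y ⟧) L)) (m≤m+n _ 3)) big) (≤-<-trans (m≤n+m 3 (ℓ + ζ)) big)
    ... | y , y′ , L₀ , over , one , eqL with w y in wy
    ...   | true with pairing R e y y′ over one
    ...     | x , x′ , x″ , eqe , r , r′ = one-triple e (P ++ Q₀) (from-Q e Q₀ eqQ) y y′ L₀ eqL x x′ x″ eqe r r′
      (≤-trans (+-mono-≤ (⟦⟧≤1 (w x″)) (m≤n+m _ (W y′)))
        (≤-trans (≤-reflexive (cong (λ t → ⟦ t ⟧ + (W y′ + sum W L₀)) (sym wy))) (L-tail-light y y′ L₀ eqL)))
    heavy-Q e@(e₁ , e₂ , e₃) Q₀ eqQ big | y , y′ , L₀ , over , one , eqL | false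
      with pairing-light R W e y y′ (w-edge e₁ e₂ e₃ (not-true (proj₁ (vanishes {nonedge e} (trans (sym (eqQ nonedge)) Q-sound))))) over one
    ...     | x , x′ , x″ , eqe , r , r′ , wx″ = one-triple e (P ++ Q₀) (from-Q e Q₀ eqQ) y y′ L₀ eqL x x′ x″ eqe r r′
      (≤-trans (≤-reflexive (cong (_+ sum W L₀) wx″))
        (≤-trans (≤-trans (m≤n+m _ (W y + W y′)) (≤-reflexive (+-assoc (W y) _ _))) (L-tail-light y y′ L₀ eqL)))

    improve-or-bound : Imp ⊎ Bounded
    improve-or-bound with select (λ y → sum (b L y) L) 0 L
    ... | inj₁ (y , L₁ , pos , eq) with select-positive (b L y) L₁
            (≤-trans pos (≤-reflexive (trans (eq (b L y)) (cong (λ t → ⟦ 4 ≤ᵇ t ⟧ + sum (b L y) L₁) (count-diagonal L y)))))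
    ...   | y′ , L₀ , pos′ , eq′ = inj₁ (outside y y′ L₀ (λ f → trans (eq f) (cong (f y +_) (eq′ f))) (⟦⟧>0 pos′))
    improve-or-bound | inj₂ none with select (λ e → sum (column R e) L) (ℓ + 3) P
    ... | inj₁ (e , P₀ , big , eq) = inj₁ (heavy-P e P₀ eq big)
    ... | inj₂ P-small with select (λ e → sum (column R e) L) (ℓ + ζ + 3) Q
    ...   | inj₁ (e , Q₀ , big , eq) = inj₁ (heavy-Q e Q₀ eq big)
    ...   | inj₂ Q-small with pairs mat 9 P | triangles mat 17 P
    ...     | inj₁ (e , f , _ , big , _) | _ = ⊥-elim (<⇒≱ big (matrix≤9 (b L) (λ x y → ⟦⟧≤1 (R x y)) e f))
    ...     | inj₂ _ | inj₁ (e , f , g , P₀ , big , eq) = inj₁ (three-triples e f g P₀ eq big)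
    ...     | inj₂ nine | inj₂ tri with crossPairs mat 6 P Q
    ...       | inj₁ (e , P₀ , f , Q₀ , big , eq , eq′) =
                  inj₁ (two-triples e f (P₀ ++ Q₀) (from-PQ e P₀ f Q₀ eq eq′) (transversal R e f big))
    ...       | inj₂ cross with pairs mat 6 Q
    ...         | inj₁ (e , f , Q₀ , big , eq) =
                    inj₁ (two-triples e f (P ++ Q₀) (from-Q² e f Q₀ eq) (transversal R e f big))
    ...         | inj₂ six = inj₂ record
      { none-outside = n≤0⇒n≡0 (≤-trans (sum-mono-All none) (≤-reflexive (sum-0 L)))
      ; P-stars = ≤-trans (sum-mono-All P-small) (≤-reflexive (sum-const _ P))
      ; Q-stars = ≤-trans (sum-mono-All Q-small) (≤-reflexive (sum-const _ Q))
      
      ; PP = turn 6 (pairSum mat P) (≤-trans (pairs-from-triangles mat P 17 tri nine) (≤-reflexive (cong₂ _+_ (*-comm 17 (p * p)) (*-comm 54 p))))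
      ; PQ = ≤-trans cross (≤-reflexive (*-comm 6 (p * q)))
      ; QQ = turn 2 (pairSum mat Q) (≤-trans six (≤-reflexive (*-comm 6 (q * q)))) }
      where
      turn : ∀ k a {c} → k * a ≤ c → a * k ≤ c
      turn k a = ≤-trans (≤-reflexive (*-comm a k))

    augment : ∀ (A : List (Triple V)) → (∀ f → sum f vs ≡ sum (hat f) A + (sum (hat f) M + sum f L)) →
      ∀ s E T x r → (∀ z → w z ≡ false → s * n * 2 ≤ degree z + E) →
      n * n * 9 ≤ ζ * T → 0 < ζ → size A + p + q + r ≤ s → q * ζ ≤ q * r * 3 → q * 3 + x ≤ n → x ≤ p + r →
      E * 3 + T + size A * n * 18 + n * 33 < x * x → Imp
    augment A part s E T x r rich T-large ζ>0 sizes Q-few Q-room x≤ err = case improve-or-bound of λ where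
        (inj₁ imp) → imp
        (inj₂ B)   → ⊥-elim (<⇒≱ {0} {1} (s≤s z≤n) (contradictory B))
      where
      S = sum (λ x → sum (b L x) vs) vs
      rest = flat M ++ L
      star = λ e → sum (column R e) L

      part-rest : ∀ f → sum f rest ≡ sum (hat f) M + sum f L
      part-rest f = trans (sum-++ f (flat M) L) (cong (_+ sum f L) (sum-flat f M))

      total-degree : ζ * (s * n * 2) ≤ sum (λ z → ⟦ u z ⟧ * degree z) L + ζ * E
      total-degree = begin
        ζ * (s * n * 2)                                  ≡⟨ trans (*-comm ζ _) (sym (sum-*ˡ (s * n * 2) _ L)) ⟩
        sum (λ z → s * n * 2 * ⟦ u z ⟧) L                ≤⟨ sum-mono pointwise L ⟩
        sum (λ z → ⟦ u z ⟧ * degree z + E * ⟦ u z ⟧) L   ≡⟨ trans (sum-+ _ _ L) (cong (sum (λ z → ⟦ u z ⟧ * degree z) L +_) (trans (sum-*ˡ E _ L) (*-comm E ζ))) ⟩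
        sum (λ z → ⟦ u z ⟧ * degree z) L + ζ * E         ∎
        where
        open ≤-Reasoning
        pointwise : ∀ z → s * n * 2 * ⟦ u z ⟧ ≤ ⟦ u z ⟧ * degree z + E * ⟦ u z ⟧
        pointwise z with w z in wz
        ... | true  = ≤-trans (≤-reflexive (*-zeroʳ (s * n * 2))) z≤n
        ... | false = ≤-trans (≤-reflexive (*-identityʳ _)) (≤-trans (rich z wz)
              (≤-reflexive (cong₂ _+_ (sym (+-identityʳ (degree z))) (sym (*-identityʳ E)))))

      degrees : s * 6 * n ≤ E * 3 + S * 3 + T
      degrees = ≤-trans (≤-reflexive (a*6*b≡a*b*6 s n)) (*-cancelˡ-≤ ζ {{>-nonZero ζ>0}} (combine-bounds ζ (s * n) E S (n * n) T _ total-degree (average L) T-large))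

      diagonal : sum (λ e → mat e e) M ≤ (p + q) * 9
      diagonal = ≤-trans (sum-mono (λ e → matrix≤9 (b L) (λ x y → ⟦⟧≤1 (R x y)) e e) M)
        (≤-trans (≤-reflexive (trans (sum-const 9 M) (*-comm 9 (size M)))) (≤-reflexive (cong (_* 9) (M-split (λ _ → 1)))))

      contradictory : Bounded → 1 ≤ 0
      contradictory B = overfull (size A) p q r s n x E T ζ ℓ S (pairSum mat P) (crossSum mat P Q) (pairSum mat Q) (sum star P) (sum star Q)
        S-bound (≤-trans P-stars ≤-refl) Q-stars PP PQ QQ degrees
        (≤-reflexive (trans (a*3+b*3+c*3+d≡1*3*a+[1*3*[b+c]+d] (size A) p q ℓ) (sym (trans (part (λ _ → 1)) (cong₂ (λ a m → a + (m + ℓ)) (hat-const 1 A)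
          (trans (hat-const 1 M) (cong (3 *_) (M-split (λ _ → 1)))))))))
        sizes Q-few Q-room (square-bound x p r x≤) err
        where
        open Bounded B
        S-bound : S ≤ size A * n * 6 + ((p + q) * 9 + (pairSum mat P + crossSum mat P Q + pairSum mat Q) * 2 + (sum star P + sum star Q) * 2)
        S-bound = begin
          S ≤⟨ double-sum-restrict (b L) (λ x y → ⟦⟧≤1 (R x y)) vs A rest (λ f → trans (part f) (cong (sum (hat f) A +_) (sym (part-rest f)))) ⟩
          size A * n * 6 + sum (λ x → sum (b L x) rest) rest
            ≡⟨ cong (size A * n * 6 +_) (double-sum (b L) (λ x y → cong ⟦_⟧ (R-sym x y)) rest M L part-rest) ⟩
          size A * n * 6 + (sum (λ e → mat e e) M + 2 * pairSum mat M + 2 * sum star M + sum (λ y → sum (b L y) L) L)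
            ≤⟨ +-monoʳ-≤ (size A * n * 6) (+-mono-≤ (+-mono-≤ (+-mono-≤ diagonal
                 (≤-reflexive (trans (*-comm 2 (pairSum mat M)) (cong (_* 2) (pairSum-++ mat P Q)))))
                 (≤-reflexive (trans (*-comm 2 (sum star M)) (cong (_* 2) (M-split star))))) (≤-reflexive none-outside)) ⟩
          size A * n * 6 + ((p + q) * 9 + (pairSum mat P + crossSum mat P Q + pairSum mat Q) * 2 + (sum star P + sum star Q) * 2 + 0)
            ≡⟨ cong (size A * n * 6 +_) (+-identityʳ _) ⟩
          size A * n * 6 + ((p + q) * 9 + (pairSum mat P + crossSum mat P Q + pairSum mat Q) * 2 + (sum star P + sum star Q) * 2) ∎
          where open ≤-Reasoning

-- Exchanging non-edges for edges

-- Disjoint cells of two 3 × 3 matrices: two disjoint cells of the first one leave only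
-- two positions that meet both of them, and the second matrix has a further entry.

test : ∀ {C : Set} x → (x ≡ true → C) → (x ≡ false → C) → C
test true  yes′ no′ = yes′ refl
test false yes′ no′ = no′ refl

Crossing : (R R′ : A → B → Bool) → Triple A → Triple B → Set
Crossing R R′ e f = ∃[ x ] ∃[ x′ ] ∃[ x″ ] ∃[ y ] ∃[ y′ ] ∃[ y″ ]
  ((∀ g → hat g e ≡ g x + g x′ + g x″) × (∀ g → hat g f ≡ g y + g y′ + g y″) × R x y ≡ true × R′ x′ y′ ≡ true)

crossing : ∀ (R R′ : A → B → Bool) e f →
  3 < matrix (λ x y → ⟦ R x y ⟧) e f → 2 < matrix (λ x y → ⟦ R′ x y ⟧) e f → Crossing R R′ e f
crossing {A = A} {B = B} R R′ e@(e₁ , e₂ , e₃) f big big′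
  with heavy-columns (λ y x → R x y) (λ _ → 1) f (e₁ ∷ e₂ ∷ e₃ ∷ [])
         (≤-trans big (≤-reflexive (as-list (λ x → hat (λ y → ⟦ R x y ⟧) f)))) (≤-trans big (≤-reflexive (as-list (λ x → hat (λ y → ⟦ R x y ⟧) f))))
  where
  as-list : ∀ (g : _ → ℕ) → g e₁ + g e₂ + g e₃ ≡ g e₁ + (g e₂ + (g e₃ + 0))
  as-list g = a+b+c≡a+[b+[c+0]] (g e₁) (g e₂) (g e₃)
... | x , x′ , L₀ , two , one , eqL with pairing (λ y x → R x y) f x x′ two one
...   | y , y′ , y″ , eqf , r , r′ = finish L₀ eqL
  where
  finish : ∀ L₀ → (e₁ ∷ e₂ ∷ e₃ ∷ []) ≈ x ∷ x′ ∷ L₀ → Crossing R R′ e f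
  finish [] eq = case eq (λ _ → 1) of λ ()
  finish (_ ∷ _ ∷ _) eq = case eq (λ _ → 1) of λ ()
  finish (x″ ∷ []) eq = search
    where
    eqe : ∀ g → hat g e ≡ g x + g x′ + g x″
    eqe g = trans (a+b+c≡a+[b+[c+0]] (g e₁) (g e₂) (g e₃)) (trans (eq g) (sym (a+b+c≡a+[b+[c+0]] (g x) (g x′) (g x″))))
    e′ : Triple A
    e′ = x , x′ , x″
    f′ : Triple B
    f′ = y , y′ , y″
    big″ : 2 < matrix (λ x y → ⟦ R′ x y ⟧) e′ f′
    big″ = ≤-trans big′ (≤-reflexive (trans (eqe (λ x → hat (λ y → ⟦ R′ x y ⟧) f)) (hat-cong (λ x → eqf (λ y → ⟦ R′ x y ⟧)) e′)))
    search : Crossing R R′ e f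
    search =
      test (R′ x y) (λ c₁ → x′ , x , x″ , y′ , y , y″ , (λ g → trans (eqe g) (perm213 (g x) _ _)) , (λ g → trans (eqf g) (perm213 (g y) _ _)) , r′ , c₁) λ c₁ →
      test (R′ x y″) (λ c₂ → x′ , x , x″ , y′ , y″ , y , (λ g → trans (eqe g) (perm213 (g x) _ _)) , (λ g → trans (eqf g) (perm231 (g y) _ _)) , r′ , c₂) λ c₂ →
      test (R′ x″ y) (λ c₃ → x′ , x″ , x , y′ , y , y″ , (λ g → trans (eqe g) (perm231 (g x) _ _)) , (λ g → trans (eqf g) (perm213 (g y) _ _)) , r′ , c₃) λ c₃ →
      test (R′ x′ y′) (λ c₄ → x , x′ , x″ , y , y′ , y″ , eqe , eqf , r , c₄) λ c₄ →
      test (R′ x′ y″) (λ c₅ → x , x′ , x″ , y , y″ , y′ , eqe , (λ g → trans (eqf g) (perm132 (g y) _ _)) , r , c₅) λ c₅ →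
      test (R′ x″ y′) (λ c₆ → x , x″ , x′ , y , y′ , y″ , (λ g → trans (eqe g) (perm132 (g x) _ _)) , eqf , r , c₆) λ c₆ →
      test (R′ x″ y″) (λ c₇ → x , x″ , x′ , y , y″ , y′ , (λ g → trans (eqe g) (perm132 (g x) _ _)) , (λ g → trans (eqf g) (perm132 (g y) _ _)) , r , c₇) λ c₇ →
      ⊥-elim (<⇒≱ (subst (2 <_) (value′ c₁ c₂ c₃ c₄ c₅ c₆ c₇) big″) (+-mono-≤ (⟦⟧≤1 (R′ x y′)) (⟦⟧≤1 (R′ x′ y))))
      where
      value′ : R′ x y ≡ false → R′ x y″ ≡ false → R′ x″ y ≡ false → R′ x′ y′ ≡ false → R′ x′ y″ ≡ false → R′ x″ y′ ≡ false → R′ x″ y″ ≡ false → matrix (λ x y → ⟦ R′ x y ⟧) e′ f′ ≡ ⟦ R′ x y′ ⟧ + ⟦ R′ x′ y ⟧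
      value′ c₁ c₂ c₃ c₄ c₅ c₆ c₇ rewrite c₁ | c₂ | c₃ | c₄ | c₅ | c₆ | c₇ = 0+a+0+[b+0+0]+[0+0+0]≡a+b ⟦ R′ x y′ ⟧ ⟦ R′ x′ y ⟧

module Exchange {V : Set} (vs : List V) (h : V → V → V → Bool)
  (h-swap : ∀ x y z → h x y z ≡ h y x z) (h-rot : ∀ x y z → h x y z ≡ h y z x)
  (h-irr : ∀ x y → h x x y ≡ false) where

  open Graph vs h h-swap h-rot h-irr

  record Exchanged (M : List (Triple V)) (L : List V) : Set where
    field
      M⁺      : List (Triple V)
      L⁺      : List V
      balance : ∀ f → sum (hat f) M⁺ + sum f L⁺ ≡ sum (hat f) M + sum f L
      larger  : size M⁺ ≡ suc (size M)
      sound   : ∀ g → (∀ e → nonedge e ≡ 0 → g e ≡ 0) → sum g M⁺ ≤ sum g M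

  module _ (M : List (Triple V)) (x y z : V) (L : List V) where

    private
      T : Triple V
      T = (x , y , z)
      L° : List V
      L° = x ∷ y ∷ z ∷ L
      Result = Exchanged M L°

    b : V → V → ℕ
    b p q = hat (λ t → ⟦ h t p q ⟧) T

    b≤3 : ∀ p q → b p q ≤ 3
    b≤3 p q = hat-mono {g = λ _ → 1} (λ t → ⟦⟧≤1 (h t p q)) T

    b-sym : ∀ p q → b p q ≡ b q p
    b-sym p q = hat-cong (λ t → cong ⟦_⟧ (h-swap₂ t p q)) T

    replace : ∀ M₀ L₀ N → sum nonedge N ≡ 0 → size N + size M₀ ≡ suc (size M) → (∀ g → sum g M₀ ≤ sum g M) →
      (∀ f → sum (hat f) N + sum (hat f) M₀ + sum f L₀ ≡ sum (hat f) M + sum f L°) → Result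
    replace M₀ L₀ N N-sound sizes M₀-sound eq = record
      { M⁺ = N ++ M₀ ; L⁺ = L₀
      ; balance = λ f → trans (cong (_+ sum f L₀) (sum-++ (hat f) N M₀)) (eq f)
      ; larger = trans (sum-++ (λ _ → 1) N M₀) sizes
      ; sound = λ g edge → ≤-trans (≤-reflexive (trans (sum-++ g N M₀) (cong (_+ sum g M₀) (vanishing g edge N N-sound)))) (M₀-sound g) }
      where
      vanishing : ∀ g → (∀ e → nonedge e ≡ 0 → g e ≡ 0) → ∀ N → sum nonedge N ≡ 0 → sum g N ≡ 0
      vanishing g edge []      _  = refl
      vanishing g edge (e ∷ N) eq = let a , b = vanishes {nonedge e} eq in cong₂ _+_ (edge e a) (vanishing g edge N b)

    inside : ∀ p q r L₀ → L° ≈ p ∷ q ∷ r ∷ L₀ → h p q r ≡ true → Result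
    inside p q r L₀ eq hpqr = replace M L₀ ((p , q , r) ∷ []) (cong (_+ 0) (true-not hpqr)) refl (λ g → ≤-refl)
      (λ f → trans (a+b+c+0+d+e≡d+[a+[b+[c+e]]] (f p) (f q) (f r) (sum (hat f) M) (sum f L₀)) (cong (sum (hat f) M +_) (sym (eq f))))

    no-edge-inside : Result ⊎ sum (λ p → sum (b p) L°) L° ≡ 0
    no-edge-inside = case edge-within (λ _ → true) L° of λ where
        (inj₁ (t , p , q , L₀ , eq , _ , htpq)) → inj₁ (inside t p q L₀ eq htpq)
        (inj₂ none) → inj₂ (n≤0⇒n≡0 (≤-trans (≤-reflexive (by-vertex L°)) (≤-trans (three-terms (codegree L°))
          (≤-trans (≤-reflexive (sum-cong (λ t → sym (+-identityʳ (codegree L° t))) L°)) none))))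
      where
      three-terms : ∀ g → hat g T ≤ sum g L°
      three-terms g = ≤-trans (m≤m+n _ (sum g L)) (≤-reflexive (a+b+c+d≡a+[b+[c+d]] (g x) (g y) (g z) (sum g L)))
      by-vertex : ∀ K → sum (λ p → sum (b p) K) K ≡ hat (codegree K) T
      by-vertex K = trans (sum-cong (λ p → sym (hat-sum (λ t q → ⟦ h t p q ⟧) K T)) K)
                          (sym (hat-sum (λ t p → sum (λ q → ⟦ h t p q ⟧) K) K T))

    rest-sound : ∀ e M₀ → M ≈ e ∷ M₀ → ∀ g → sum g M₀ ≤ sum g M
    rest-sound e M₀ eq g = ≤-trans (m≤n+m _ (g e)) (≤-reflexive (sym (eq g)))

    cell : V → V → V → Bool
    cell ℓ a t = h t a ℓ

    cross : ∀ e M₀ → M ≈ e ∷ M₀ → ∀ ℓ ℓ′ L₀ → L ≈ ℓ ∷ ℓ′ ∷ L₀ → Crossing (cell ℓ) (cell ℓ′) e T → Result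
    cross e M₀ eqM ℓ ℓ′ L₀ eqL (a , a′ , a″ , t , t′ , t″ , eqe , eqT , r , r′) =
      replace M₀ (a″ ∷ t″ ∷ L₀) ((t , a , ℓ) ∷ (t′ , a′ , ℓ′) ∷ []) (cong₂ (λ i j → i + (j + 0)) (true-not r) (true-not r′))
        (cong suc (sym (eqM (λ _ → 1)))) (rest-sound e M₀ eqM)
        (λ f → trans (shuffle₁₁ (f t) (f t′) (f t″) (f a) (f a′) (f a″) (f ℓ) (f ℓ′) (sum (hat f) M₀) (sum f L₀))
          (sym (cong₂ _+_ (trans (eqM (hat f)) (cong (_+ sum (hat f) M₀) (eqe f)))
            (trans (a+[b+[c+d]]≡a+b+c+d (f x) (f y) (f z) (sum f L)) (cong₂ _+_ (eqT f) (eqL f))))))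

    star : ∀ e M₀ → M ≈ e ∷ M₀ → Result ⊎ sum (λ ℓ → hat (λ a → b a ℓ) e) L ≤ size L * 3 + 6
    star e M₀ eqM with select (λ ℓ → matrix (λ a t → ⟦ cell ℓ a t ⟧) e T) 3 L
    ... | inj₂ small = inj₂ (≤-trans (sum-mono-All small) (≤-trans (≤-reflexive (trans (sum-const 3 L) (*-comm 3 (size L)))) (m≤m+n _ 6)))
    ... | inj₁ (ℓ , L₁ , big , eq) with select (λ ℓ → matrix (λ a t → ⟦ cell ℓ a t ⟧) e T) 2 L₁
    ...   | inj₁ (ℓ′ , L₀ , big′ , eq′) = inj₁ (cross e M₀ eqM ℓ ℓ′ L₀ (λ f → trans (eq f) (cong (f ℓ +_) (eq′ f)))
              (crossing (cell ℓ) (cell ℓ′) e T big big′))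
    ...   | inj₂ small = inj₂ (≤-trans (≤-reflexive (eq (λ ℓ → hat (λ a → b a ℓ) e)))
              (≤-trans (+-mono-≤ (hat-mono {g = λ _ → 3} (λ a → b≤3 a ℓ) e) (≤-trans (sum-mono-All small) (≤-reflexive (sum-const 2 L₁))))
              (subst (λ k → 9 + 2 * size L₁ ≤ k * 3 + 6) (sym (eq (λ _ → 1))) (few (size L₁)))))
      where
      few : ∀ k → 9 + 2 * k ≤ (1 + k) * 3 + 6
      few k = certified (k ∷ [])
        ([])
        ([])
        0 (♯ 9 :+ ♯ 2 :* ‵ 0) ((♯ 1 :+ ‵ 0) :* ♯ 3 :+ ♯ 6) refl (tt)

    link : V × V → V → Bool
    link (a , c) t = h t a c

    rainbow : ∀ e₁ e₂ e₃ f f₁ f₂ f₃ M₀ → (∀ g → hat g f ≡ g f₁ + g f₂ + g f₃) → M ≈ (e₁ , e₂ , e₃) ∷ f ∷ M₀ →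
      Transversal link ((e₁ , f₁) , (e₂ , f₂) , (e₃ , f₃)) T → Result
    rainbow e₁ e₂ e₃ f f₁ f₂ f₃ M₀ eqf eqM (t₁ , t₂ , t₃ , eqT , r₁ , r₂ , r₃) =
      replace M₀ L ((t₁ , e₁ , f₁) ∷ (t₂ , e₂ , f₂) ∷ (t₃ , e₃ , f₃) ∷ [])
        (cong₂ (λ i j → i + j) (true-not r₁) (cong₂ (λ i j → i + (j + 0)) (true-not r₂) (true-not r₃)))
        (cong suc (sym (eqM (λ _ → 1))))
        (λ g → ≤-trans (m≤n+m _ (g (e₁ , e₂ , e₃) + g f)) (≤-reflexive (trans (+-assoc (g (e₁ , e₂ , e₃)) _ _) (sym (eqM g)))))
        (λ g → trans (shuffle₁₀ (g t₁) (g t₂) (g t₃) (g e₁) (g e₂) (g e₃) (g f₁) (g f₂) (g f₃) (sum (hat g) M₀) (sum g L))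
          (sym (cong₂ _+_ (trans (eqM (hat g)) (cong (λ s → g e₁ + g e₂ + g e₃ + (s + sum (hat g) M₀)) (eqf g)))
            (trans (a+[b+[c+d]]≡a+b+c+d (g x) (g y) (g z) (sum g L)) (cong (_+ sum g L) (eqT g))))))

    -- The 27 cells split into 9 disjoint transversals, three for each cyclic shift of f.
    latin : ∀ e f M₀ → M ≈ e ∷ f ∷ M₀ → 18 < matrix b e f → Result
    latin (e₁ , e₂ , e₃) (f₁ , f₂ , f₃) M₀ eqM big with 6 <? S₁ | 6 <? S₂ | 6 <? S₃
      where
      S : Triple (V × V) → ℕ
      S D = matrix (λ d t → ⟦ link d t ⟧) D T
      S₁ = S ((e₁ , f₁) , (e₂ , f₂) , (e₃ , f₃))
      S₂ = S ((e₁ , f₂) , (e₂ , f₃) , (e₃ , f₁))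
      S₃ = S ((e₁ , f₃) , (e₂ , f₁) , (e₃ , f₂))
    ... | yes s | _ | _ = rainbow e₁ e₂ e₃ _ f₁ f₂ f₃ M₀ (λ g → refl) eqM (transversal link _ T s)
    ... | _ | yes s | _ = rainbow e₁ e₂ e₃ _ f₂ f₃ f₁ M₀ (λ g → perm231 (g f₁) _ _) eqM (transversal link _ T s)
    ... | _ | _ | yes s = rainbow e₁ e₂ e₃ _ f₃ f₁ f₂ M₀ (λ g → perm312 (g f₁) _ _) eqM (transversal link _ T s)
    ... | no s₁ | no s₂ | no s₃ = ⊥-elim (<⇒≱ big (≤-trans
      (≤-reflexive (shuffle₃ (b e₁ f₁) (b e₁ f₂) (b e₁ f₃) (b e₂ f₁) (b e₂ f₂) (b e₂ f₃) (b e₃ f₁) (b e₃ f₂) (b e₃ f₃)))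
      (+-mono-≤ (+-mono-≤ (≮⇒≥ s₁) (≮⇒≥ s₂)) (≮⇒≥ s₃))))

    exchange-count : ∀ m n l D dg P X → D ≤ dg + P * 2 + X * 2 → dg ≤ m * 27 → P * 2 ≤ m * m * 18 → X ≤ (l * 3 + 33) * m → m * 3 + 3 + l ≤ n → 1 + (m * n * 6 + n * 93) ≤ D → 1 ≤ 0
    exchange-count m n l D dg P X h1 h2 h3 h4 h5 h6 = certified (m ∷ n ∷ l ∷ D ∷ dg ∷ P ∷ X ∷ [])
      ((‵ 3 , ‵ 4 :+ ‵ 5 :* ♯ 2 :+ ‵ 6 :* ♯ 2) ∷ (‵ 4 , ‵ 0 :* ♯ 27) ∷ (‵ 5 :* ♯ 2 , ‵ 0 :* ‵ 0 :* ♯ 18) ∷ (‵ 6 , (‵ 2 :* ♯ 3 :+ ♯ 33) :* ‵ 0) ∷ (‵ 0 :* ♯ 3 :+ ♯ 3 :+ ‵ 2 , ‵ 1) ∷ (♯ 1 :+ (‵ 0 :* ‵ 1 :* ♯ 6 :+ ‵ 1 :* ♯ 93) , ‵ 3) ∷ [])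
      ((♯ 1) ∷ (♯ 1) ∷ (♯ 1) ∷ (♯ 2) ∷ (‵ 0 :* ♯ 6 :+ ♯ 93) ∷ (♯ 1) ∷ [])
      279 (♯ 1) (♯ 0) refl (h1 , h2 , h3 , h4 , h5 , h6 , tt)

    exchange : (∀ f → sum f vs ≡ sum (hat f) M + sum f L°) →
      size M * n * 6 + n * 93 < degree x + degree y + degree z → Result
    exchange part big = case no-edge-inside of λ where
        (inj₁ res)  → res
        (inj₂ none) → case select star-sum (size L * 3 + 33) M of λ where
          (inj₁ (e , M₀ , heavy , eq)) → case star e M₀ eq of λ where
            (inj₁ res)   → res
            (inj₂ light) → ⊥-elim (<⇒≱ heavy (star-bound e light))
          (inj₂ stars) → case pairs (matrix b) 18 M of λ where
            (inj₁ (e , f , M₀ , heavy , eq)) → latin e f M₀ eq heavy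
            (inj₂ few) → ⊥-elim (<⇒≱ {0} {1} (s≤s z≤n) (count none stars few))
      where
      star-sum : Triple V → ℕ
      star-sum e = sum (λ ℓ → hat (λ a → b a ℓ) e) L°
      star-bound : ∀ e → sum (λ ℓ → hat (λ a → b a ℓ) e) L ≤ size L * 3 + 6 → star-sum e ≤ size L * 3 + 33
      star-bound e light = ≤-trans (+-mono-≤ (nine x) (+-mono-≤ (nine y) (+-mono-≤ (nine z) light)))
        (≤-reflexive (9+[9+[9+[a*3+6]]]≡a*3+33 (size L)))
        where
        nine : ∀ ℓ → hat (λ a → b a ℓ) e ≤ 9
        nine ℓ = hat-mono {g = λ _ → 3} (λ a → b≤3 a ℓ) e
      count : _ → _ → _ → 1 ≤ 0
      count none stars few = exchange-count (size M) n (size L) _ (sum (λ e → matrix b e e) M) (pairSum (matrix b) M) (sum star-sum M)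
        (≤-reflexive (begin
          degree x + degree y + degree z ≡⟨ hat-sum (λ t p → sum (λ q → ⟦ h t p q ⟧) vs) vs T ⟩
          sum (λ p → hat (λ t → sum (λ q → ⟦ h t p q ⟧) vs) T) vs ≡⟨ sum-cong (λ p → hat-sum (λ t q → ⟦ h t p q ⟧) vs T) vs ⟩
          sum (λ p → sum (b p) vs) vs ≡⟨ double-sum b b-sym vs M L° part ⟩
          sum (λ e → matrix b e e) M + 2 * pairSum (matrix b) M + 2 * sum star-sum M + sum (λ p → sum (b p) L°) L°
            ≡⟨ cong₂ _+_ (cong₂ (λ s t → sum (λ e → matrix b e e) M + s + t) (*-comm 2 (pairSum (matrix b) M)) (*-comm 2 (sum star-sum M))) none ⟩
          sum (λ e → matrix b e e) M + pairSum (matrix b) M * 2 + sum star-sum M * 2 + 0 ≡⟨ +-identityʳ _ ⟩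
          sum (λ e → matrix b e e) M + pairSum (matrix b) M * 2 + sum star-sum M * 2 ∎))
        (≤-trans (sum-mono (λ e → hat-mono {g = λ _ → 9} (λ a → hat-mono {g = λ _ → 3} (b≤3 a) e) e) M) (≤-reflexive (trans (sum-const 27 M) (*-comm 27 (size M)))))
        (≤-trans (≤-reflexive (*-comm (pairSum (matrix b) M) 2)) (≤-trans few (≤-reflexive (*-comm 18 (size M * size M)))))
        (≤-trans (sum-mono-All stars) (≤-reflexive (sum-const _ M)))
        (≤-reflexive (trans (a*3+3+b≡1*3*a+[1+[1+[1+b]]] (size M) (size L)) (sym (trans (part (λ _ → 1)) (cong (_+ size L°) (hat-const 1 M))))))
        big
        where
        open ≡-Reasoning

-- Covering W by edges

≈-member : ∀ (f : A → ℕ) L x L′ → L ≈ x ∷ L′ → f x ≤ sum f L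
≈-member f L x L′ eq = ≤-trans (m≤m+n _ _) (≤-reflexive (sym (eq f)))

private

  cover-count : ∀ a j s n x K E T U m S P X → s * n * 4 + U * U ≤ S + T + (E * 2 + n * U * 2) → S ≤ a * n * 6 + (j * 9 + P * 2 + X * 2) → P * 2 ≤ j * j * 4 → X ≤ (m + 3) * j → j * 2 + m ≤ U → j + U ≤ s * 3 + K → U ≤ n → j ≤ n → (n * 41) * U + (U * 60) * (s * 2 + x) ≤ (n * 41) * (s * 2 + x) + (U * 60) * U → n * 41 ≤ U * 60 → s * 2 + x ≤ U → 1 + (a * n * 6 + n * 15 + K * n * 2 + T + E * 2) * 20 ≤ n * x → 1 ≤ 0
  cover-count a j s n x K E T U m S P X h1 h2 h3 h4 h5 h6 h7 h8 h9 h10 h11 h12 = certified (a ∷ j ∷ s ∷ n ∷ x ∷ K ∷ E ∷ T ∷ U ∷ m ∷ S ∷ P ∷ X ∷ [])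
    ((‵ 2 :* ‵ 3 :* ♯ 4 :+ ‵ 8 :* ‵ 8 , ‵ 10 :+ ‵ 7 :+ (‵ 6 :* ♯ 2 :+ ‵ 3 :* ‵ 8 :* ♯ 2)) ∷ (‵ 10 , ‵ 0 :* ‵ 3 :* ♯ 6 :+ (‵ 1 :* ♯ 9 :+ ‵ 11 :* ♯ 2 :+ ‵ 12 :* ♯ 2)) ∷ (‵ 11 :* ♯ 2 , ‵ 1 :* ‵ 1 :* ♯ 4) ∷ (‵ 12 , (‵ 9 :+ ♯ 3) :* ‵ 1) ∷ (‵ 1 :* ♯ 2 :+ ‵ 9 , ‵ 8) ∷ (‵ 1 :+ ‵ 8 , ‵ 2 :* ♯ 3 :+ ‵ 5) ∷ (‵ 8 , ‵ 3) ∷ (‵ 1 , ‵ 3) ∷ ((‵ 3 :* ♯ 41) :* ‵ 8 :+ (‵ 8 :* ♯ 60) :* (‵ 2 :* ♯ 2 :+ ‵ 4) , (‵ 3 :* ♯ 41) :* (‵ 2 :* ♯ 2 :+ ‵ 4) :+ (‵ 8 :* ♯ 60) :* ‵ 8) ∷ (‵ 3 :* ♯ 41 , ‵ 8 :* ♯ 60) ∷ (‵ 2 :* ♯ 2 :+ ‵ 4 , ‵ 8) ∷ (♯ 1 :+ (‵ 0 :* ‵ 3 :* ♯ 6 :+ ‵ 3 :* ♯ 15 :+ ‵ 5 :* ‵ 3 :* ♯ 2 :+ ‵ 7 :+ ‵ 6 :* ♯ 2) :* ♯ 20 , ‵ 3 :* ‵ 4) ∷ [])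
    ((♯ 20) ∷ (♯ 20) ∷ (♯ 20) ∷ (♯ 40) ∷ (‵ 1 :* ♯ 40) ∷ (‵ 8 :* ♯ 40) ∷ (‵ 5 :* ♯ 40) ∷ (♯ 300) ∷ (♯ 1) ∷ (‵ 4) ∷ (‵ 3) ∷ (♯ 1) ∷ [])
    0 (♯ 1) (♯ 0) refl (h1 , h2 , h3 , h4 , h5 , h6 , h7 , h8 , h9 , h10 , h11 , h12 , tt)

module Covering {V : Set} (vs : List V) (h : V → V → V → Bool)
  (h-swap : ∀ x y z → h x y z ≡ h y x z) (h-rot : ∀ x y z → h x y z ≡ h y z x)
  (h-irr : ∀ x y → h x x y ≡ false)
  (w : V → Bool) (w-edge : ∀ x y z → h x y z ≡ true → ⟦ w x ⟧ + ⟦ w y ⟧ + ⟦ w z ⟧ ≤ 1) where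

  open Graph vs h h-swap h-rot h-irr

  u : V → Bool
  u x = not (w x)

  U : ℕ
  U = sum (λ x → ⟦ u x ⟧) vs

  w≤u+u : ∀ x p q → h x p q ≡ true → w x ≡ true → w p ≡ false × w q ≡ false
  w≤u+u x p q hx wx with w x | w p | w q | w-edge x p q hx
  ... | true | false | false | _ = refl , refl
  ... | true | true  | _     | s≤s ()
  ... | true | false | true  | s≤s ()

  unwedged : Triple V → ℕ
  unwedged (x , y , z) = ⟦ not (w x ∧ h x y z) ⟧

  wedge : ∀ {x y z} → unwedged (x , y , z) ≡ 0 → w x ≡ true × h x y z ≡ true
  wedge eq = ∧-split (not-true eq)

  module _ (M : List (Triple V)) (L : List V) (M-wedged : sum unwedged M ≡ 0) where

    open Popularity w unwedged (λ z p q wz hz → true-not (cong₂ _∧_ wz hz))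

    private
      R = popular L
      j = size M
      m = sum (λ x → ⟦ u x ⟧) L
      Imp = Improvement unwedged (λ _ → 0) 0 M L

    open Matrices R (popular-sym L) using (entries)

    R-off-W : ∀ p q → R p q ≡ true → w p ≡ false × w q ≡ false
    R-off-W p q r with select-positive (λ z → ⟦ w z ∧ h z p q ⟧) L (≤-trans (s≤s z≤n) (popular-count L p q r))
    ... | z , _ , pos , _ = let wz , hz = ∧-split (⟦⟧>0 {w z ∧ h z p q} pos) in w≤u+u z p q hz wz

    R-W : ∀ p q → w p ≡ true → R p q ≡ false
    R-W p q wp with R p q in r
    ... | false = refl
    ... | true  = case trans (sym wp) (proj₁ (R-off-W p q r)) of λ ()

    R-W′ : ∀ p q → w q ≡ true → R p q ≡ false
    R-W′ p q wq = trans (popular-sym L p q) (R-W q p wq)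

    rest-wedged : ∀ e M₀ → M ≈ e ∷ M₀ → unwedged e ≡ 0 × sum unwedged M₀ ≡ 0
    rest-wedged e M₀ eq = vanishes {unwedged e} (trans (sym (eq unwedged)) M-wedged)

    cover-outside : ∀ y y′ L₀ → L ≈ y ∷ y′ ∷ L₀ → R y y′ ≡ true → Imp
    cover-outside y y′ L₀ eq r = improve M L₀ ((y , y′) ∷ []) []
      (λ f → trans (cong (sum (hat f) M +_) (eq f)) (a+[b+[c+d]]≡b+c+0+0+[a+d] (sum (hat f) M) (f y) (f y′) (sum f L₀)))
      refl M-wedged
      (≤-trans (s≤s z≤n) (count-drop (y′ ∷ L₀) L₀ y′ y y′ (λ f → refl) 2 (count-drop L (y′ ∷ L₀) y y y′ eq 3 (popular-count L y y′ r))) ∷ [])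
      (≤-reflexive (sum-0 L₀))

    cover-star : ∀ e M₀ → M ≈ e ∷ M₀ → m + 3 < sum (column R e) L → Imp
    cover-star e M₀ eqM big with heavy-columns R (λ y → ⟦ u y ⟧) e L (≤-<-trans (m≤m+n m 3) big) (≤-<-trans (m≤n+m 3 m) big)
    ... | y , y′ , L₀ , over , one , eqL with w y in wy
    ...   | true = ⊥-elim (<⇒≱ over (≤-reflexive (hat-cong {g = λ _ → 0} (λ x → cong ⟦_⟧ (R-W′ x y wy)) e)))
    ...   | false with pairing R e y y′ over one
    ...     | x , x′ , x″ , eqe , r , r′ = improve M₀ L₀ ((x , y) ∷ (x′ , y′) ∷ []) (x″ ∷ [])
      (λ f → trans (cong₂ _+_ (trans (eqM (hat f)) (cong (_+ sum (hat f) M₀) (eqe f))) (eqL f))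
        (shuffle₉ (f x) (f x′) (f x″) (sum (hat f) M₀) (f y) (f y′) (sum f L₀)))
      (cong suc (eqM (λ _ → 1))) (proj₂ (rest-wedged e M₀ eqM))
      (counts-drop (y′ ∷ L₀) L₀ y′ (λ f → refl) (counts-drop L (y′ ∷ L₀) y eqL (popular-count L x y r ∷ popular-count L x′ y′ r′ ∷ [])))
      (≤-reflexive (sum-0 L₀))

    wedge-entries : ∀ e f → unwedged e ≡ 0 → unwedged f ≡ 0 → entries e f ≤ 4
    wedge-entries (x₁ , x₂ , x₃) (y₁ , y₂ , y₃) we wf
      rewrite R-W x₁ y₁ (proj₁ (wedge {x₁} we)) | R-W x₁ y₂ (proj₁ (wedge {x₁} we)) | R-W x₁ y₃ (proj₁ (wedge {x₁} we))
            | R-W′ x₂ y₁ (proj₁ (wedge {y₁} wf)) | R-W′ x₃ y₁ (proj₁ (wedge {y₁} wf))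
      = +-mono-≤ (+-mono-≤ (⟦⟧≤1 (R x₂ y₂)) (⟦⟧≤1 (R x₂ y₃))) (+-mono-≤ (⟦⟧≤1 (R x₃ y₂)) (⟦⟧≤1 (R x₃ y₃)))

    record Uncoverable : Set where
      field
        none-outside : sum (λ y → sum (b L y) L) L ≡ 0
        stars        : sum (λ e → sum (column R e) L) M ≤ (m + 3) * j
        pairwise     : pairSum entries M * 2 ≤ j * j * 4

    cover-or-bound : Imp ⊎ Uncoverable
    cover-or-bound with select (λ y → sum (b L y) L) 0 L
    ... | inj₁ (y , L₁ , pos , eq) with select-positive (b L y) L₁
            (≤-trans pos (≤-reflexive (trans (eq (b L y)) (cong (λ t → ⟦ 4 ≤ᵇ t ⟧ + sum (b L y) L₁) (count-diagonal L y)))))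
    ...   | y′ , L₀ , pos′ , eq′ = inj₁ (cover-outside y y′ L₀ (λ f → trans (eq f) (cong (f y +_) (eq′ f))) (⟦⟧>0 pos′))
    cover-or-bound | inj₂ none with select (λ e → sum (column R e) L) (m + 3) M
    ... | inj₁ (e , M₀ , big , eq) = inj₁ (cover-star e M₀ eq big)
    ... | inj₂ small with pairs entries 4 M
    ...   | inj₁ (e , f , M₀ , big , eq) = ⊥-elim (<⇒≱ big (wedge-entries e f (proj₁ (rest-wedged e (f ∷ M₀) eq))
              (proj₁ (vanishes {unwedged f} (proj₂ (rest-wedged e (f ∷ M₀) eq))))))
    ...   | inj₂ four = inj₂ record
      { none-outside = n≤0⇒n≡0 (≤-trans (sum-mono-All none) (≤-reflexive (sum-0 L)))
      ; stars = ≤-trans (sum-mono-All small) (≤-reflexive (sum-const _ M))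
      ; pairwise = ≤-trans (≤-reflexive (*-comm (pairSum entries M) 2)) (≤-trans four (≤-reflexive (*-comm 4 (j * j)))) }

    hat-u : ∀ e → unwedged e ≡ 0 → hat (λ x → ⟦ u x ⟧) e ≡ 2
    hat-u (x , y , z) we with wedge {x} {y} {z} we
    ... | wx , hxyz with w≤u+u x y z hxyz wx
    ...   | wy , wz rewrite wx | wy | wz = refl

    2j≤ : j * 2 ≤ sum (hat (λ x → ⟦ u x ⟧)) M
    2j≤ = ≤-trans (≤-reflexive (trans (*-comm j 2) (sym (sum-const 2 M)))) (sum-mono-All (go M M-wedged))
      where
      go : ∀ N → sum unwedged N ≡ 0 → All (λ e → 2 ≤ hat (λ x → ⟦ u x ⟧) e) N
      go []      _  = []
      go (e ∷ N) eq = let p , q = vanishes {unwedged e} eq in ≤-reflexive (sym (hat-u e p)) ∷ go N q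

    cover : ∀ (A : List (Triple V)) → (∀ f → sum f vs ≡ sum (hat f) A + (sum (hat f) M + sum f L)) →
      ∀ s E T x K → (∀ z → w z ≡ true → s * n * 4 + U * U ≤ degree z + (E * 2 + n * U * 2)) →
      let ζ = sum (λ z → ⟦ w z ⟧) L in 0 < ζ → n * n * 3 ≤ ζ * T →
      j + U ≤ s * 3 + K → n * 41 ≤ U * 60 → s * 2 + x ≤ U →
      (size A * n * 6 + n * 15 + K * n * 2 + T + E * 2) * 20 < n * x → Imp
    cover A part s E T x K rich ζ>0 T-large j-small U-big U-big′ err = case cover-or-bound of λ where
        (inj₁ imp) → imp
        (inj₂ B)   → ⊥-elim (<⇒≱ {0} {1} (s≤s z≤n) (contradictory B))
      where
      S = sum (λ x → sum (b L x) vs) vs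
      ζ = sum (λ z → ⟦ w z ⟧) L
      F = s * n * 4 + U * U
      rest = flat M ++ L

      part-rest : ∀ f → sum f rest ≡ sum (hat f) M + sum f L
      part-rest f = trans (sum-++ f (flat M) L) (cong (_+ sum f L) (sum-flat f M))

      total-degree : ζ * F ≤ sum (λ z → ⟦ w z ⟧ * degree z) L + ζ * (E * 2 + n * U * 2)
      total-degree = begin
        ζ * F                         ≡⟨ trans (*-comm ζ F) (sym (sum-*ˡ F _ L)) ⟩
        sum (λ z → F * ⟦ w z ⟧) L      ≤⟨ sum-mono pointwise L ⟩
        sum (λ z → ⟦ w z ⟧ * degree z + (E * 2 + n * U * 2) * ⟦ w z ⟧) L
          ≡⟨ trans (sum-+ _ _ L) (cong (sum (λ z → ⟦ w z ⟧ * degree z) L +_) (trans (sum-*ˡ (E * 2 + n * U * 2) _ L) (*-comm (E * 2 + n * U * 2) ζ))) ⟩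
        sum (λ z → ⟦ w z ⟧ * degree z) L + ζ * (E * 2 + n * U * 2) ∎
        where
        open ≤-Reasoning
        pointwise : ∀ z → F * ⟦ w z ⟧ ≤ ⟦ w z ⟧ * degree z + (E * 2 + n * U * 2) * ⟦ w z ⟧
        pointwise z with w z in wz
        ... | false = ≤-trans (≤-reflexive (*-zeroʳ F)) z≤n
        ... | true  = ≤-trans (≤-reflexive (*-identityʳ F)) (≤-trans (rich z wz)
              (≤-reflexive (cong₂ _+_ (sym (+-identityʳ (degree z))) (sym (*-identityʳ (E * 2 + n * U * 2))))))

      degrees : F ≤ S + T + (E * 2 + n * U * 2)
      degrees = *-cancelˡ-≤ ζ {{>-nonZero ζ>0}} (begin
        ζ * F                                                    ≤⟨ total-degree ⟩
        sum (λ z → ⟦ w z ⟧ * degree z) L + ζ * G                  ≤⟨ +-monoˡ-≤ (ζ * G) (≤-trans (average L) (+-monoʳ-≤ (ζ * S) T-large)) ⟩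
        ζ * S + ζ * T + ζ * G                                    ≡⟨ a*b+a*c+a*d≡a*[b+c+d] ζ S T G ⟩
        ζ * (S + T + G)                                          ∎)
        where
        open ≤-Reasoning
        G = E * 2 + n * U * 2

      diagonal : sum (λ e → entries e e) M ≤ j * 9
      diagonal = ≤-trans (sum-mono (λ e → matrix≤9 (b L) (λ x y → ⟦⟧≤1 (R x y)) e e) M) (≤-reflexive (trans (sum-const 9 M) (*-comm 9 j)))

      j≤n : j ≤ n
      j≤n = ≤-trans (≤-trans (m≤m+n j (2 * j)) (≤-trans (≤-reflexive (sym (hat-const 1 M))) (≤-trans (m≤m+n _ (size L)) (m≤n+m _ (sum (hat (λ _ → 1)) A))))) (≤-reflexive (sym (part (λ _ → 1))))

      contradictory : Uncoverable → 1 ≤ 0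
      contradictory B = cover-count (size A) j s n x K E T U m S (pairSum entries M) (sum (λ e → sum (column R e) L) M)
        degrees S-bound pairwise stars
        (≤-trans (+-monoˡ-≤ m 2j≤) (≤-trans (m≤n+m _ (sum (hat (λ x → ⟦ u x ⟧)) A)) (≤-reflexive (sym (part (λ x → ⟦ u x ⟧))))))
        j-small (sum-mono (λ x → ⟦⟧≤1 (u x)) vs) j≤n (≤-product U-big U-big′) U-big U-big′ err
        where
        open Uncoverable B
        S-bound : S ≤ size A * n * 6 + (j * 9 + pairSum entries M * 2 + sum (λ e → sum (column R e) L) M * 2)
        S-bound = begin
          S ≤⟨ double-sum-restrict (b L) (λ x y → ⟦⟧≤1 (R x y)) vs A rest (λ f → trans (part f) (cong (sum (hat f) A +_) (sym (part-rest f)))) ⟩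
          size A * n * 6 + sum (λ x → sum (b L x) rest) rest
            ≡⟨ cong (size A * n * 6 +_) (double-sum (b L) (λ x y → cong ⟦_⟧ (popular-sym L x y)) rest M L part-rest) ⟩
          size A * n * 6 + (sum (λ e → entries e e) M + 2 * pairSum entries M + 2 * sum (λ e → sum (column R e) L) M + sum (λ y → sum (b L y) L) L)
            ≤⟨ +-monoʳ-≤ (size A * n * 6) (+-mono-≤ (+-mono-≤ (+-mono-≤ diagonal
                 (≤-reflexive (*-comm 2 (pairSum entries M)))) (≤-reflexive (*-comm 2 (sum (λ e → sum (column R e) L) M)))) (≤-reflexive none-outside)) ⟩
          size A * n * 6 + (j * 9 + pairSum entries M * 2 + sum (λ e → sum (column R e) L) M * 2 + 0)
            ≡⟨ cong (size A * n * 6 +_) (+-identityʳ _) ⟩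
          size A * n * 6 + (j * 9 + pairSum entries M * 2 + sum (λ e → sum (column R e) L) M * 2) ∎
          where open ≤-Reasoning

private
  square-complement : ∀ D U W n → D + W * W ≤ n * n → n ≤ W + U → W + U ≤ n → D + U * U ≤ n * U * 2
  square-complement D U W n h1 h2 h3 = certified (D ∷ U ∷ W ∷ n ∷ [])
    ((‵ 0 :+ ‵ 2 :* ‵ 2 , ‵ 3 :* ‵ 3) ∷ (‵ 3 , ‵ 2 :+ ‵ 1) ∷ (‵ 2 :+ ‵ 1 , ‵ 3) ∷ [])
    ((♯ 1) ∷ (‵ 2 :+ ‵ 3) ∷ (‵ 1) ∷ [])
    0 (‵ 0 :+ ‵ 1 :* ‵ 1) (‵ 3 :* ‵ 1 :* ♯ 2) refl (h1 , h2 , h3 , tt)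
  W-rich-count : ∀ s n U E a b → s * n * 4 ≤ a + b + E * 2 → b + U * U ≤ n * U * 2 → s * n * 4 + U * U ≤ a + (E * 2 + n * U * 2)
  W-rich-count s n U E a b h1 h2 = certified (s ∷ n ∷ U ∷ E ∷ a ∷ b ∷ [])
    ((‵ 0 :* ‵ 1 :* ♯ 4 , ‵ 4 :+ ‵ 5 :+ ‵ 3 :* ♯ 2) ∷ (‵ 5 :+ ‵ 2 :* ‵ 2 , ‵ 1 :* ‵ 2 :* ♯ 2) ∷ [])
    ((♯ 1) ∷ (♯ 1) ∷ [])
    0 (‵ 0 :* ‵ 1 :* ♯ 4 :+ ‵ 2 :* ‵ 2) (‵ 4 :+ (‵ 3 :* ♯ 2 :+ ‵ 1 :* ‵ 2 :* ♯ 2)) refl (h1 , h2 , tt)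
  greedy-count : ∀ s n j U E a b X → s * n * 4 ≤ a + b + E * 2 → a ≤ j * j → b ≤ U * U + X * 2 → X + j * j ≤ j * n → 1 + (j + U) ≤ s * 3 → s * 2 ≤ U → s * 3 ≤ n → (j + U) * n + (s * 3) * (s * 3) ≤ (j + U) * (s * 3) + (s * 3) * n → (j + U) * (s * 3) + (s * 3) * (j + U) ≤ (j + U) * (j + U) + (s * 3) * (s * 3) → (s * 2) * n + U * (s * 3) ≤ (s * 2) * (s * 3) + U * n → 1 + E * 2 ≤ s * n → 1 ≤ 0
  greedy-count s n j U E a b X h1 h2 h3 h4 h5 h6 h7 h8 h9 h10 h11 = certified (s ∷ n ∷ j ∷ U ∷ E ∷ a ∷ b ∷ X ∷ [])
    ((‵ 0 :* ‵ 1 :* ♯ 4 , ‵ 5 :+ ‵ 6 :+ ‵ 4 :* ♯ 2) ∷ (‵ 5 , ‵ 2 :* ‵ 2) ∷ (‵ 6 , ‵ 3 :* ‵ 3 :+ ‵ 7 :* ♯ 2) ∷ (‵ 7 :+ ‵ 2 :* ‵ 2 , ‵ 2 :* ‵ 1) ∷ (♯ 1 :+ (‵ 2 :+ ‵ 3) , ‵ 0 :* ♯ 3) ∷ (‵ 0 :* ♯ 2 , ‵ 3) ∷ (‵ 0 :* ♯ 3 , ‵ 1) ∷ ((‵ 2 :+ ‵ 3) :* ‵ 1 :+ (‵ 0 :* ♯ 3) :* (‵ 0 :* ♯ 3) , (‵ 2 :+ ‵ 3) :* (‵ 0 :* ♯ 3) :+ (‵ 0 :* ♯ 3) :* ‵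 1) ∷ ((‵ 2 :+ ‵ 3) :* (‵ 0 :* ♯ 3) :+ (‵ 0 :* ♯ 3) :* (‵ 2 :+ ‵ 3) , (‵ 2 :+ ‵ 3) :* (‵ 2 :+ ‵ 3) :+ (‵ 0 :* ♯ 3) :* (‵ 0 :* ♯ 3)) ∷ ((‵ 0 :* ♯ 2) :* ‵ 1 :+ ‵ 3 :* (‵ 0 :* ♯ 3) , (‵ 0 :* ♯ 2) :* (‵ 0 :* ♯ 3) :+ ‵ 3 :* ‵ 1) ∷ (♯ 1 :+ ‵ 4 :* ♯ 2 , ‵ 0 :* ‵ 1) ∷ [])
    ((♯ 2) ∷ (♯ 2) ∷ (♯ 2) ∷ (♯ 4) ∷ (‵ 3 :* ♯ 4 :+ ♯ 8) ∷ (♯ 12) ∷ (‵ 3) ∷ (♯ 4) ∷ (♯ 2) ∷ (♯ 3) ∷ (♯ 2) ∷ [])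
    9 (♯ 1) (♯ 0) refl (h1 , h2 , h3 , h4 , h5 , h6 , h7 , h8 , h9 , h10 , h11 , tt)

sum-zero : ∀ {f : A → ℕ} → (∀ x → f x ≡ 0) → ∀ xs → sum f xs ≡ 0
sum-zero f≡0 xs = trans (sum-cong f≡0 xs) (sum-0 xs)

false-true : ∀ {C : Set} {b} → b ≡ false → b ≡ true → C
false-true refl ()

module Degrees {V : Set} (vs : List V) (h : V → V → V → Bool)
  (h-swap : ∀ x y z → h x y z ≡ h y x z) (h-rot : ∀ x y z → h x y z ≡ h y z x)
  (h-irr : ∀ x y → h x x y ≡ false)
  (w : V → Bool) (w-edge : ∀ x y z → h x y z ≡ true → ⟦ w x ⟧ + ⟦ w y ⟧ + ⟦ w z ⟧ ≤ 1)
  (complete : ∀ x → ∃[ vs′ ] (vs ≈ x ∷ vs′)) (covered : ∀ x → ∃[ p ] ∃[ q ] (h x p q ≡ true))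
  (s E : ℕ) (adjacent-rich : ∀ x y z → h x y z ≡ true → s * size vs * 4 ≤ degreeOf vs h x + degreeOf vs h y + E * 2) where

  open Graph vs h h-swap h-rot h-irr
  open Covering vs h h-swap h-rot h-irr w w-edge

  Wn : ℕ
  Wn = sum (λ x → ⟦ w x ⟧) vs

  w+u : ∀ x → ⟦ w x ⟧ + ⟦ u x ⟧ ≡ 1
  w+u x with w x
  ... | true  = refl
  ... | false = refl

  Wn+U : Wn + U ≡ n
  Wn+U = trans (sym (sum-+ _ _ vs)) (sum-cong w+u vs)

  not-both-W : ∀ x p q → h x p q ≡ true → w p ≡ true → w q ≡ false
  not-both-W x p q hx wp = proj₁ (w≤u+u p q x (trans (sym (h-rot x p q)) hx) wp)

  degree-bound : ∀ x → degree x + U * U ≤ n * U * 2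
  degree-bound x = square-complement (degree x) U Wn n squares (≤-reflexive (sym Wn+U)) (≤-reflexive Wn+U)
    where
    pointwise : ∀ p q → ⟦ h x p q ⟧ + ⟦ w p ⟧ * ⟦ w q ⟧ ≤ 1
    pointwise p q with h x p q in hx | w p in wp | w q in wq
    ... | true  | true  | true  = false-true (not-both-W x p q hx wp) wq
    ... | true  | true  | false = ≤-refl
    ... | true  | false | _     = ≤-refl
    ... | false | true  | true  = ≤-refl
    ... | false | true  | false = z≤n
    ... | false | false | _     = z≤n
    squares : degree x + Wn * Wn ≤ n * n
    squares = begin
      degree x + Wn * Wn ≡⟨ cong (degree x +_) (trans (sym (sum-*ˡ Wn _ vs)) (sum-cong (λ p → trans (*-comm Wn ⟦ w p ⟧) (sym (sum-*ˡ ⟦ w p ⟧ _ vs))) vs)) ⟩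
      degree x + sum (λ p → sum (λ q → ⟦ w p ⟧ * ⟦ w q ⟧) vs) vs ≡⟨ trans (sym (sum-+ _ _ vs)) (sum-cong (λ p → sym (sum-+ _ _ vs)) vs) ⟩
      sum (λ p → sum (λ q → ⟦ h x p q ⟧ + ⟦ w p ⟧ * ⟦ w q ⟧) vs) vs ≤⟨ sum-mono (λ p → sum-mono (pointwise p) vs) vs ⟩
      sum (λ _ → n) vs ≡⟨ sum-const n vs ⟩
      n * n ∎
      where open ≤-Reasoning

  W-rich : ∀ z → w z ≡ true → s * n * 4 + U * U ≤ degree z + (E * 2 + n * U * 2)
  W-rich z _ with covered z
  ... | p , q , hz = W-rich-count s n U E (degree z) (degree p) (adjacent-rich z p q hz) (degree-bound p)

  mixed : List V → V → ℕ
  mixed K x = sum (λ p → ⟦ w p ⟧ * sum (λ q → ⟦ h x p q ⟧) K) K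

  codegree-split : ∀ K x → codegree K x ≤ sum (λ p → ⟦ u p ⟧) K * sum (λ p → ⟦ u p ⟧) K + mixed K x * 2
  codegree-split K x = begin
    codegree K x
      ≤⟨ sum-mono (λ p → sum-mono (pointwise p) K) K ⟩
    sum (λ p → sum (λ q → ⟦ u p ⟧ * ⟦ u q ⟧ + (⟦ w p ⟧ * ⟦ h x p q ⟧ + ⟦ w q ⟧ * ⟦ h x q p ⟧)) K) K
      ≡⟨ trans (sum-cong (λ p → trans (sum-+ _ _ K) (cong₂ _+_ (sum-*ˡ ⟦ u p ⟧ _ K) (sum-+ _ _ K))) K) (trans (sum-+ _ _ K) (cong₂ _+_ (trans (sum-cong (λ p → *-comm ⟦ u p ⟧ uK) K) (sum-*ˡ uK _ K)) (sum-+ _ _ K))) ⟩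
    uK * uK + (sum (λ p → sum (λ q → ⟦ w p ⟧ * ⟦ h x p q ⟧) K) K + sum (λ p → sum (λ q → ⟦ w q ⟧ * ⟦ h x q p ⟧) K) K)
      ≡⟨ cong (uK * uK +_) (cong₂ _+_ (sum-cong (λ p → sum-*ˡ ⟦ w p ⟧ _ K) K)
           (trans (sum-swap (λ p q → ⟦ w q ⟧ * ⟦ h x q p ⟧) K K) (sum-cong (λ q → sum-*ˡ ⟦ w q ⟧ _ K) K))) ⟩
    uK * uK + (mixed K x + mixed K x)   ≡⟨ cong (uK * uK +_) (a+a≡a*2 (mixed K x)) ⟩
    uK * uK + mixed K x * 2 ∎
    where
    open ≤-Reasoning
    uK = sum (λ p → ⟦ u p ⟧) K
    pointwise : ∀ p q → ⟦ h x p q ⟧ ≤ ⟦ u p ⟧ * ⟦ u q ⟧ + (⟦ w p ⟧ * ⟦ h x p q ⟧ + ⟦ w q ⟧ * ⟦ h x q p ⟧)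
    pointwise p q with w p | w q
    ... | false | false = ⟦⟧≤1 (h x p q)
    ... | true  | _     = ≤-trans (≤-reflexive (sym (+-identityʳ _))) (m≤m+n _ _)
    ... | false | true  = ≤-reflexive (trans (cong ⟦_⟧ (h-swap₂ x p q)) (sym (+-identityʳ _)))

  mixed-W : ∀ K x → w x ≡ true → mixed K x ≡ 0
  mixed-W K x wx = sum-zero (λ p → test (w p) (λ wp → trans (cong (⟦ w p ⟧ *_) (sum-zero (λ q → absent p q wp) K)) (*-zeroʳ ⟦ w p ⟧))
                                              (λ wp → cong (λ b → ⟦ b ⟧ * sum (λ q → ⟦ h x p q ⟧) K) wp)) K
    where
    absent : ∀ p q → w p ≡ true → ⟦ h x p q ⟧ ≡ 0
    absent p q wp with h x p q in hx
    ... | false = refl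
    ... | true  = false-true (proj₁ (w≤u+u x p q hx wx)) wp

  W-degree : ∀ x → w x ≡ true → degree x ≤ U * U
  W-degree x wx = ≤-trans (codegree-split vs x) (≤-reflexive (trans (cong (λ m → U * U + m * 2) (mixed-W vs x wx)) (+-identityʳ _)))

  -- Sparse coverings extend: an uncovered w has a small degree, so its neighbours have large degrees and hence
  -- uncovered links containing vertices of W, whose further neighbours are then uncovered with such links as well.
  module _ (M : List (Triple V)) (L : List V) (part : ∀ f → sum f vs ≡ sum (hat f) M + sum f L) where

    degree-outside : ∀ x → degree x ≤ size M * n * 6 + codegree L x
    degree-outside x = double-sum-restrict (λ p q → ⟦ h x p q ⟧) (λ p q → ⟦⟧≤1 (h x p q)) vs M L part

    uL≤U : sum (λ p → ⟦ u p ⟧) L ≤ U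
    uL≤U = ≤-trans (m≤n+m _ (sum (hat (λ p → ⟦ u p ⟧)) M)) (≤-reflexive (sym (part _)))

    sparse-count : ∀ A s n E U a b m j X → s * n * 4 ≤ a + b + E * 2 → a ≤ j * n * 6 → b ≤ j * n * 6 + X → X ≤ m * m + A * 2 → A ≤ 0 → m * m ≤ U * U → 1 + (j * n * 12 + U * U + E * 2) ≤ s * n * 4 → 1 ≤ 0
    sparse-count A s n E U a b m j X h1 h2 h3 h4 h5 h6 h7 = certified (A ∷ s ∷ n ∷ E ∷ U ∷ a ∷ b ∷ m ∷ j ∷ X ∷ [])
      ((‵ 1 :* ‵ 2 :* ♯ 4 , ‵ 5 :+ ‵ 6 :+ ‵ 3 :* ♯ 2) ∷ (‵ 5 , ‵ 8 :* ‵ 2 :* ♯ 6) ∷ (‵ 6 , ‵ 8 :* ‵ 2 :* ♯ 6 :+ ‵ 9) ∷ (‵ 9 , ‵ 7 :* ‵ 7 :+ ‵ 0 :* ♯ 2) ∷ (‵ 0 , ♯ 0) ∷ (‵ 7 :* ‵ 7 , ‵ 4 :* ‵ 4) ∷ (♯ 1 :+ (‵ 8 :* ‵ 2 :* ♯ 12 :+ ‵ 4 :* ‵ 4 :+ ‵ 3 :* ♯ 2) , ‵ 1 :* ‵ 2 :* ♯ 4) ∷ [])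
      ((♯ 1) ∷ (♯ 1) ∷ (♯ 1) ∷ (♯ 1) ∷ (♯ 2) ∷ (♯ 1) ∷ (♯ 1) ∷ [])
      0 (♯ 1) (♯ 0) refl (h1 , h2 , h3 , h4 , h5 , h6 , h7 , tt)

    sparse-cover : (∃[ z ] ∃[ L′ ] (L ≈ z ∷ L′ × w z ≡ true)) → size M * n * 12 + U * U + E * 2 < s * n * 4 →
      ∃[ z ] ∃[ p ] ∃[ q ] ∃[ L₀ ] (L ≈ z ∷ p ∷ q ∷ L₀ × w z ≡ true × h z p q ≡ true)
    sparse-cover (z , L′ , eqz , wz) small with edge-within w L
    ... | inj₁ found = found
    ... | inj₂ none = ⊥-elim absurd
      where
      Member : V → Set
      Member x = ∀ f → f x ≤ sum f L
      silent : ∀ x → Member x → w x ≡ true → codegree L x ≡ 0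
      silent x mem wx = n≤0⇒n≡0 (≤-trans (≤-trans (≤-reflexive (trans (sym (+-identityʳ _)) (cong (λ b → ⟦ b ⟧ * codegree L x) (sym wx))))
        (mem (λ t → ⟦ w t ⟧ * codegree L t))) none)
      low : ∀ x → Member x → w x ≡ true → degree x ≤ size M * n * 6
      low x mem wx = ≤-trans (degree-outside x) (≤-reflexive (trans (cong (size M * n * 6 +_) (silent x mem wx)) (+-identityʳ _)))
      neighbour : ∀ x z → Member z → w z ≡ true → (∃[ q ] (h z x q ≡ true)) →
        ∃[ z′ ] ∃[ q ] (Member z′ × Member q × w z′ ≡ true × h x z′ q ≡ true)
      neighbour x z mem wz (q , hz) with select (λ p → ⟦ w p ⟧ * sum (λ q → ⟦ h x p q ⟧) L) 0 L
      ... | inj₂ nothing′ = ⊥-elim (<⇒≱ {0} {1} (s≤s z≤n) (sparse-count (mixed L x) s n E U (degree z) (degree x) (sum (λ p → ⟦ u p ⟧) L) (size M) (codegree L x)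
              (adjacent-rich z x q hz) (low z mem wz) (degree-outside x) (codegree-split L x)
              (≤-trans (sum-mono-All nothing′) (≤-reflexive (sum-0 L))) (*-mono-≤ uL≤U uL≤U) small))
      ... | inj₁ (p , L₁ , pos , eq) with w p in wp
      ...   | true with select-positive (λ q → ⟦ h x p q ⟧) L (≤-trans pos (≤-reflexive (+-identityʳ _)))
      ...     | q′ , L₂ , pos′ , eq′ = p , q′ , (λ f → ≈-member f L p L₁ eq) , (λ f → ≈-member f L q′ L₂ eq′) , wp , ⟦⟧>0 pos′
      absurd : ⊥
      absurd with neighbour (proj₁ (covered z)) z (λ f → ≈-member f L z L′ eqz) wz (proj₂ (covered z))
      ... | z₁ , q₁ , mem-z₁ , mem-q₁ , wz₁ , h₁ with neighbour q₁ z₁ mem-z₁ wz₁ (proj₁ (covered z) , trans (sym (h-rot _ z₁ q₁)) h₁)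
      ...   | z₂ , q₂ , mem-z₂ , mem-q₂ , wz₂ , h₂ = <⇒≱ {0} {1} (s≤s z≤n) (begin
        1                    ≡⟨ cong ⟦_⟧ (sym (trans (h-swap z₂ q₁ q₂) h₂)) ⟩
        ⟦ h z₂ q₁ q₂ ⟧       ≤⟨ mem-q₂ (λ r → ⟦ h z₂ q₁ r ⟧) ⟩
        sum (λ r → ⟦ h z₂ q₁ r ⟧) L  ≤⟨ mem-q₁ (λ p → sum (λ r → ⟦ h z₂ p r ⟧) L) ⟩
        codegree L z₂        ≡⟨ silent z₂ mem-z₂ wz₂ ⟩
        0                    ∎)
        where open ≤-Reasoning

  pairDegree : V → V → ℕ
  pairDegree y x = sum (λ r → ⟦ h y x r ⟧) vs

  unpaired : V × V → ℕ
  unpaired (x , y) = ⟦ not (w y ∧ (1 ≤ᵇ pairDegree y x)) ⟧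

  paired : ∀ x y → unpaired (x , y) ≡ 0 → w y ≡ true × w x ≡ false × ∃[ r ] (h y x r ≡ true)
  paired x y eq with ∧-split (not-true {w y ∧ (1 ≤ᵇ pairDegree y x)} eq)
  ... | wy , pos with select-positive (λ r → ⟦ h y x r ⟧) vs (≤ᵇ⇒≤ 1 _ (subst IsTrue (sym pos) tt))
  ...   | r , _ , pos′ , _ = wy , proj₁ (w≤u+u y x r (⟦⟧>0 pos′) wy) , r , ⟦⟧>0 pos′

  module _ (G : List (V × V)) (L : List V) (part : ∀ f → sum f vs ≡ sum (ends f) G + sum f L) (G-paired : sum unpaired G ≡ 0) where

    private
      j = size G

    G-All : ∀ {P : V × V → Set} → (∀ x y → unpaired (x , y) ≡ 0 → P (x , y)) → All P G
    G-All {P} imp = go G G-paired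
      where
      go : ∀ G′ → sum unpaired G′ ≡ 0 → All P G′
      go []            _  = []
      go ((x , y) ∷ G′) eq = let a , b = vanishes {unpaired (x , y)} eq in imp x y a ∷ go G′ b

    ends-w : sum (ends (λ x → ⟦ w x ⟧)) G ≡ j
    ends-w = ≤-antisym (sum-mono-All (G-All (λ x y eq → ≤-reflexive (value′ x y eq)))) (sum-mono-All (G-All (λ x y eq → ≤-reflexive (sym (value′ x y eq)))))
      where
      value′ : ∀ x y → unpaired (x , y) ≡ 0 → ⟦ w x ⟧ + ⟦ w y ⟧ ≡ 1
      value′ x y eq with paired x y eq
      ... | wy , wx , _ rewrite wy | wx = refl

    Extension : Set
    Extension = ∃[ x ] ∃[ y ] ∃[ L₀ ] (L ≈ x ∷ y ∷ L₀ × unpaired (x , y) ≡ 0)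

    extend : s * 2 ≤ U → s * 3 ≤ n → E * 2 < s * n → j + U < s * 3 →
      Extension
    extend U-big n-big E-small few with select (λ y → ⟦ w y ⟧ * sum (pairDegree y) L) 0 L
    ... | inj₁ (y , L₁ , pos , eq) = found (w y) refl
      where
      found : ∀ b → w y ≡ b → Extension
      found false wy = ⊥-elim (<⇒≱ pos (≤-reflexive (cong (λ b → ⟦ b ⟧ * sum (pairDegree y) L) wy)))
      found true wy with select-positive (pairDegree y) L₁ (≤-trans pos (≤-reflexive
          (trans (trans (cong (λ b → ⟦ b ⟧ * sum (pairDegree y) L) wy) (+-identityʳ _)) (trans (eq (pairDegree y)) (cong (_+ sum (pairDegree y) L₁) (sum-zero (λ r → cong ⟦_⟧ (h-irr y r)) vs))))))
      ... | x , L₂ , pos′ , eq′ = x , y , L₂ ,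
          (λ f → trans (eq f) (trans (cong (f y +_) (eq′ f)) (a+[b+c]≡b+[a+c] (f y) (f x) _))) ,
          true-not (cong₂ _∧_ wy (positive pos′))
        where
        positive : ∀ {k} → 0 < k → (1 ≤ᵇ k) ≡ true
        positive {suc k} _ = refl
    ... | inj₂ none with select (λ z → ⟦ w z ⟧) 0 L
    ...   | inj₂ all-U = ⊥-elim (<⇒≱ few (≤-trans n-big (≤-reflexive (trans (sym Wn+U) (cong (_+ U)
              (trans (part (λ x → ⟦ w x ⟧)) (trans (cong₂ _+_ ends-w (n≤0⇒n≡0 (≤-trans (sum-mono-All all-U) (≤-reflexive (sum-0 L))))) (+-identityʳ j))))))))
    ...   | inj₁ (z , L′ , pos , eqz) = ⊥-elim (<⇒≱ {0} {1} (s≤s z≤n)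
              (greedy-count s n j U E (degree z) (degree x) (mixed vs x)
                (adjacent-rich z x (proj₁ (proj₂ (covered z))) (proj₂ (proj₂ (covered z)))) z-low
                (codegree-split vs x) mixed-low few U-big n-big (≤-product (<⇒≤ few) n-big) (≤-product (<⇒≤ few) (<⇒≤ few)) (≤-product U-big n-big) E-small))
      where
      x = proj₁ (covered z)
      wz : w z ≡ true
      wz = ⟦⟧>0 pos
      none-sum : sum (λ y → ⟦ w y ⟧ * sum (pairDegree y) L) L ≡ 0
      none-sum = n≤0⇒n≡0 (≤-trans (sum-mono-All none) (≤-reflexive (sum-0 L)))
      z-silent : sum (pairDegree z) L ≡ 0
      z-silent = n≤0⇒n≡0 (≤-trans (≤-reflexive (trans (sym (+-identityʳ _)) (cong (λ b → ⟦ b ⟧ * sum (pairDegree z) L) (sym wz))))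
        (≤-trans (≈-member (λ y → ⟦ w y ⟧ * sum (pairDegree y) L) L z L′ eqz) (≤-reflexive none-sum)))
      z-low : degree z ≤ j * j
      z-low = begin
        sum (pairDegree z) vs                               ≡⟨ trans (part (pairDegree z)) (trans (cong (sum (ends (pairDegree z)) G +_) z-silent) (+-identityʳ _)) ⟩
        sum (ends (pairDegree z)) G                         ≤⟨ sum-mono-All (G-All only-x) ⟩
        sum (λ _ → j) G                            ≡⟨ sum-const j G ⟩
        j * j                                      ∎
        where
        open ≤-Reasoning
        c-W : ∀ y → w y ≡ true → pairDegree z y ≡ 0
        c-W y wy = sum-zero (λ r → test (h z y r) (λ hz → false-true (proj₁ (w≤u+u z y r hz wz)) wy) (cong ⟦_⟧)) vs
        c≤j : ∀ p → pairDegree z p ≤ j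
        c≤j p = begin
          pairDegree z p ≡⟨ part (λ r → ⟦ h z p r ⟧) ⟩
          sum (ends (λ r → ⟦ h z p r ⟧)) G + sum (λ r → ⟦ h z p r ⟧) L
            ≤⟨ +-mono-≤ (sum-mono-All (G-All one)) (≤-trans (sum-mono below L) (≤-reflexive z-silent)) ⟩
          sum (λ _ → 1) G + 0 ≡⟨ +-identityʳ _ ⟩
          j ∎
          where
          one : ∀ a b → unpaired (a , b) ≡ 0 → ⟦ h z p a ⟧ + ⟦ h z p b ⟧ ≤ 1
          one a b eq with paired a b eq
          ... | wb , _ = ≤-trans (+-monoʳ-≤ ⟦ h z p a ⟧ (≤-reflexive (test (h z p b) (λ hz → false-true (proj₂ (w≤u+u z p b hz wz)) wb) (cong ⟦_⟧))))
                           (≤-trans (≤-reflexive (+-identityʳ _)) (⟦⟧≤1 (h z p a)))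
          below : ∀ r → ⟦ h z p r ⟧ ≤ pairDegree z r
          below r = ≤-trans (≤-reflexive (cong ⟦_⟧ (h-swap₂ z p r)))
            (≈-member (λ t → ⟦ h z r t ⟧) vs p (proj₁ (complete p)) (proj₂ (complete p)))
        only-x : ∀ a b → unpaired (a , b) ≡ 0 → pairDegree z a + pairDegree z b ≤ j
        only-x a b eq = ≤-trans (+-mono-≤ (c≤j a) (≤-reflexive (c-W b (proj₁ (paired a b eq))))) (≤-reflexive (+-identityʳ j))
      link : V → ℕ
      link p = sum (λ q → ⟦ h x p q ⟧) vs
      mixed-low : mixed vs x + j * j ≤ j * n
      mixed-low = begin
        mixed vs x + j * j                         ≡⟨ cong (_+ j * j) (part (λ p → ⟦ w p ⟧ * link p)) ⟩
        sum (ends (λ p → ⟦ w p ⟧ * link p)) G + sum (λ p → ⟦ w p ⟧ * link p) L + j * j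
          ≤⟨ +-monoˡ-≤ (j * j) (+-mono-≤ (≤-trans (sum-mono-All (G-All G-term)) (≤-reflexive (sum-const U G))) L-term) ⟩
        U * j + wL * j + j * j                     ≡⟨ a*b+c*b+b*b≡b*[b+c+a]′ U wL j ⟩
        j * (j + wL + U)                           ≡⟨ cong (j *_) (trans (cong (_+ U) (trans (cong (_+ wL) (sym ends-w)) (sym (part (λ p → ⟦ w p ⟧))))) Wn+U) ⟩
        j * n                                      ∎
        where
        open ≤-Reasoning
        wL = sum (λ p → ⟦ w p ⟧) L
        link≤U : ∀ p → w p ≡ true → link p ≤ U
        link≤U p wp = sum-mono (λ q → test (h x p q) (λ hx → subst₂ _≤_ (cong ⟦_⟧ (sym hx)) (cong (λ b → ⟦ not b ⟧) (sym (not-both-W x p q hx wp))) ≤-refl)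
                                 (λ hx → subst (_≤ ⟦ u q ⟧) (cong ⟦_⟧ (sym hx)) z≤n)) vs
        G-term : ∀ a b → unpaired (a , b) ≡ 0 → ⟦ w a ⟧ * link a + ⟦ w b ⟧ * link b ≤ U
        G-term a b eq with paired a b eq
        ... | wb , wa , _ = ≤-trans (≤-reflexive (cong₂ (λ s t → ⟦ s ⟧ * link a + ⟦ t ⟧ * link b) wa wb))
                              (≤-trans (≤-reflexive (+-identityʳ _)) (link≤U b wb))
        L-term : sum (λ p → ⟦ w p ⟧ * link p) L ≤ wL * j
        L-term = begin
          sum (λ p → ⟦ w p ⟧ * link p) L
            ≡⟨ sum-cong (λ p → trans (cong (⟦ w p ⟧ *_) (part (λ q → ⟦ h x p q ⟧))) (*-distribˡ-+ ⟦ w p ⟧ _ _)) L ⟩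
          sum (λ p → ⟦ w p ⟧ * sum (ends (λ q → ⟦ h x p q ⟧)) G + ⟦ w p ⟧ * sum (λ q → ⟦ h x p q ⟧) L) L
            ≡⟨ sum-+ _ _ L ⟩
          sum (λ p → ⟦ w p ⟧ * sum (ends (λ q → ⟦ h x p q ⟧)) G) L + sum (λ p → ⟦ w p ⟧ * sum (λ q → ⟦ h x p q ⟧) L) L
            ≤⟨ +-mono-≤ (sum-mono (λ p → G-link p) L) (≤-trans (sum-mono (λ p → *-monoʳ-≤ ⟦ w p ⟧ (sum-mono (below p) L)) L) (≤-reflexive none-sum)) ⟩
          sum (λ p → j * ⟦ w p ⟧) L + 0 ≡⟨ trans (+-identityʳ _) (trans (sum-*ˡ j _ L) (*-comm j wL)) ⟩
          wL * j ∎
          where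
          below : ∀ p q → ⟦ h x p q ⟧ ≤ pairDegree p q
          below p q = ≤-trans (≤-reflexive (cong ⟦_⟧ (h-rot x p q))) (≈-member (λ t → ⟦ h p q t ⟧) vs x (proj₁ (complete x)) (proj₂ (complete x)))
          G-link : ∀ p → ⟦ w p ⟧ * sum (ends (λ q → ⟦ h x p q ⟧)) G ≤ j * ⟦ w p ⟧
          G-link p with w p in wp
          ... | false = z≤n
          ... | true  = ≤-trans (≤-reflexive (+-identityʳ _)) (≤-trans (sum-mono-All (G-All one)) (≤-reflexive (sym (*-identityʳ j))))
            where
            one : ∀ a b → unpaired (a , b) ≡ 0 → ⟦ h x p a ⟧ + ⟦ h x p b ⟧ ≤ 1
            one a b eq with paired a b eq
            ... | wb , _ = ≤-trans (+-monoʳ-≤ ⟦ h x p a ⟧ (≤-reflexive (test (h x p b) (λ hx → false-true (not-both-W x p b hx wp) wb) (cong ⟦_⟧))))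
                             (≤-trans (≤-reflexive (+-identityʳ _)) (⟦⟧≤1 (h x p a)))

-- The case of small U

private
  strong-degree : ∀ s n U E a b → U * U + E * 4 + n * 200 ≤ s * n * 2 → s * n * 4 ≤ a + b + E * 2 → a ≤ U * U → s * n * 2 + E * 2 + n * 200 ≤ b
  strong-degree s n U E a b h1 h2 h3 = certified (s ∷ n ∷ U ∷ E ∷ a ∷ b ∷ [])
    ((‵ 2 :* ‵ 2 :+ ‵ 3 :* ♯ 4 :+ ‵ 1 :* ♯ 200 , ‵ 0 :* ‵ 1 :* ♯ 2) ∷ (‵ 0 :* ‵ 1 :* ♯ 4 , ‵ 4 :+ ‵ 5 :+ ‵ 3 :* ♯ 2) ∷ (‵ 4 , ‵ 2 :* ‵ 2) ∷ [])
    ((♯ 1) ∷ (♯ 1) ∷ (♯ 1) ∷ [])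
    0 (‵ 0 :* ‵ 1 :* ♯ 2 :+ ‵ 3 :* ♯ 2 :+ ‵ 1 :* ♯ 200) (‵ 5) refl (h1 , h2 , h3 , tt)
  good-sum : ∀ s n E a b c → s * n * 2 + E * 2 + n * 200 ≤ a → s * n * 2 + E * 2 + n * 200 ≤ b → s * n * 2 + E * 2 + n * 200 ≤ c → s * n * 6 + n * 100 ≤ a + b + c
  good-sum s n E a b c h1 h2 h3 = certified (s ∷ n ∷ E ∷ a ∷ b ∷ c ∷ [])
    ((‵ 0 :* ‵ 1 :* ♯ 2 :+ ‵ 2 :* ♯ 2 :+ ‵ 1 :* ♯ 200 , ‵ 3) ∷ (‵ 0 :* ‵ 1 :* ♯ 2 :+ ‵ 2 :* ♯ 2 :+ ‵ 1 :* ♯ 200 , ‵ 4) ∷ (‵ 0 :* ‵ 1 :* ♯ 2 :+ ‵ 2 :* ♯ 2 :+ ‵ 1 :* ♯ 200 , ‵ 5) ∷ [])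
    ((♯ 1) ∷ (♯ 1) ∷ (♯ 1) ∷ [])
    0 (‵ 0 :* ‵ 1 :* ♯ 6 :+ ‵ 1 :* ♯ 100) (‵ 3 :+ ‵ 4 :+ ‵ 5) refl (h1 , h2 , h3 , tt)
  good-wedge : ∀ s n E a b c → s * n * 4 ≤ a + b + E * 2 → s * n * 2 + E * 2 + n * 200 ≤ c → s * n * 6 + n * 100 ≤ a + b + c
  good-wedge s n E a b c h1 h2 = certified (s ∷ n ∷ E ∷ a ∷ b ∷ c ∷ [])
    ((‵ 0 :* ‵ 1 :* ♯ 4 , ‵ 3 :+ ‵ 4 :+ ‵ 2 :* ♯ 2) ∷ (‵ 0 :* ‵ 1 :* ♯ 2 :+ ‵ 2 :* ♯ 2 :+ ‵ 1 :* ♯ 200 , ‵ 5) ∷ [])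
    ((♯ 1) ∷ (♯ 1) ∷ [])
    0 (‵ 0 :* ‵ 1 :* ♯ 6 :+ ‵ 1 :* ♯ 100) (‵ 3 :+ ‵ 4 :+ ‵ 5) refl (h1 , h2 , tt)
  room-for-triples : ∀ q k s U l → s * 3 ≤ q + U → U ≤ l + q → q + k ≤ s → q + k * 3 ≤ l
  room-for-triples q k s U l h1 h2 h3 = certified (q ∷ k ∷ s ∷ U ∷ l ∷ [])
    ((‵ 2 :* ♯ 3 , ‵ 0 :+ ‵ 3) ∷ (‵ 3 , ‵ 4 :+ ‵ 0) ∷ (‵ 0 :+ ‵ 1 , ‵ 2) ∷ [])
    ((♯ 1) ∷ (♯ 1) ∷ (♯ 3) ∷ [])
    0 (‵ 0 :+ ‵ 1 :* ♯ 3) (‵ 4) refl (h1 , h2 , h3 , tt)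

module Ore {V : Set} (vs : List V) (h : V → V → V → Bool)
  (h-swap : ∀ x y z → h x y z ≡ h y x z) (h-rot : ∀ x y z → h x y z ≡ h y z x)
  (h-irr : ∀ x y → h x x y ≡ false)
  (w : V → Bool) (w-edge : ∀ x y z → h x y z ≡ true → ⟦ w x ⟧ + ⟦ w y ⟧ + ⟦ w z ⟧ ≤ 1)
  (complete : ∀ x → ∃[ vs′ ] (vs ≈ x ∷ vs′)) (covered : ∀ x → ∃[ p ] ∃[ q ] (h x p q ≡ true))
  (s E : ℕ) (adjacent-rich : ∀ x y z → h x y z ≡ true → s * size vs * 4 ≤ degreeOf vs h x + degreeOf vs h y + E * 2)
  (rich : ∀ x → w x ≡ false → s * size vs * 2 ≤ degreeOf vs h x + E)
  (U-large : s * 2 ≤ sum (λ x → ⟦ not (w x) ⟧) vs) (n-large : s * 3 ≤ size vs) where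

  open Graph vs h h-swap h-rot h-irr
  open Covering vs h h-swap h-rot h-irr w w-edge
  open Degrees vs h h-swap h-rot h-irr w w-edge complete covered s E adjacent-rich
  open Exchange vs h h-swap h-rot h-irr

  take-U : ∀ L → 0 < sum (λ x → ⟦ u x ⟧) L →
    ∃[ x ] ∃[ L′ ] (L ≈ x ∷ L′ × w x ≡ false × sum (λ x → ⟦ u x ⟧) L ≡ suc (sum (λ x → ⟦ u x ⟧) L′))
  take-U L pos with select-positive (λ x → ⟦ u x ⟧) L pos
  ... | x , L′ , ux , eq with w x in wx
  ...   | false = x , L′ , eq , wx , trans (eq (λ x → ⟦ u x ⟧)) (cong (λ b → ⟦ not b ⟧ + sum (λ x → ⟦ u x ⟧) L′) wx)

  module _ (E-small : E * 2 < s * n) (U-small : U * U + E * 4 + n * 200 ≤ s * n * 2) where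

    n>0 : 0 < n
    n>0 = n≢0⇒n>0 (λ n≡0 → <⇒≱ E-small (≤-trans (≤-reflexive (trans (cong (s *_) n≡0) (*-zeroʳ s))) z≤n))

    strong : ∀ x → w x ≡ false → s * n * 2 + E * 2 + n * 200 ≤ degree x
    strong x wx with select (λ p → ⟦ w p ⟧ * sum (λ q → ⟦ h x p q ⟧) vs) 0 vs
    ... | inj₂ none = ⊥-elim (<⇒≱ {0} {1} (s≤s z≤n) (isolated s n U E (degree x) (mixed vs x) (rich x wx) (codegree-split vs x)
            (≤-trans (sum-mono-All none) (≤-reflexive (sum-0 vs))) U-small n>0))
      where
      isolated : ∀ s n U E d m → s * n * 2 ≤ d + E → d ≤ U * U + m * 2 → m ≤ 0 → U * U + E * 4 + n * 200 ≤ s * n * 2 → 1 ≤ n → 1 ≤ 0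
      isolated s n U E d m h1 h2 h3 h4 h5 = certified (s ∷ n ∷ U ∷ E ∷ d ∷ m ∷ [])
        ((‵ 0 :* ‵ 1 :* ♯ 2 , ‵ 4 :+ ‵ 3) ∷ (‵ 4 , ‵ 2 :* ‵ 2 :+ ‵ 5 :* ♯ 2) ∷ (‵ 5 , ♯ 0) ∷ (‵ 2 :* ‵ 2 :+ ‵ 3 :* ♯ 4 :+ ‵ 1 :* ♯ 200 , ‵ 0 :* ‵ 1 :* ♯ 2) ∷ (♯ 1 , ‵ 1) ∷ [])
        ((♯ 1) ∷ (♯ 1) ∷ (♯ 2) ∷ (♯ 1) ∷ (♯ 200) ∷ [])
        199 (♯ 1) (♯ 0) refl (h1 , h2 , h3 , h4 , h5 , tt)
    ... | inj₁ (p , _ , pos , _) with w p in wp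
    ...   | true with select-positive (λ q → ⟦ h x p q ⟧) vs (≤-trans pos (≤-reflexive (+-identityʳ _)))
    ...     | q , _ , pos′ , _ = strong-degree s n U E (degree p) (degree x) U-small
                (adjacent-rich p x q (trans (h-swap p x q) (⟦⟧>0 pos′))) (W-degree p wp)

    poor : Triple V → ℕ
    poor e = ⟦ not (s * n * 6 + n * 100 ≤ᵇ hat degree e) ⟧

    poor≡0 : ∀ e → s * n * 6 + n * 100 ≤ hat degree e → poor e ≡ 0
    poor≡0 e le with s * n * 6 + n * 100 ≤ᵇ hat degree e | ≤⇒≤ᵇ le
    ... | true | _ = refl

    poor≡0⁻¹ : ∀ e → poor e ≡ 0 → s * n * 6 + n * 100 ≤ hat degree e
    poor≡0⁻¹ e eq = ≤ᵇ⇒≤ _ _ (subst IsTrue (sym (not-true eq)) tt)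

    record Good (L : List V) (total : (V → ℕ) → ℕ) (k uses : ℕ) : Set where
      field
        N     : List (Triple V)
        L′    : List V
        split : ∀ f → sum (hat f) N + sum f L′ ≡ total f + sum f L
        count : size N ≡ k
        good  : sum poor N ≡ 0
        used  : sum (λ x → ⟦ u x ⟧) L ≤ sum (λ x → ⟦ u x ⟧) L′ + uses

    triples-in-U : ∀ k L → k * 3 ≤ sum (λ x → ⟦ u x ⟧) L → Good L (λ _ → 0) k (k * 3)
    triples-in-U zero L _ = record { N = [] ; L′ = L ; split = λ f → refl ; count = refl ; good = refl ; used = m≤m+n _ _ }
    triples-in-U (suc k) L big with take-U L (≤-trans (s≤s z≤n) big)
    ... | x , L₁ , eq₁ , wx , c₁ with take-U L₁ (≤-trans (s≤s z≤n) (s≤s⁻¹ (≤-trans big (≤-reflexive c₁))))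
    ...   | y , L₂ , eq₂ , wy , c₂ with take-U L₂ (≤-trans (s≤s z≤n) (s≤s⁻¹ (≤-trans (s≤s⁻¹ (≤-trans big (≤-reflexive c₁))) (≤-reflexive c₂))))
    ...     | z , L₃ , eq₃ , wz , c₃ = record
      { N = (x , y , z) ∷ N ; L′ = L′
      ; split = λ f → trans (+-assoc (f x + f y + f z) _ _) (trans (cong (f x + f y + f z +_) (split f))
          (trans (a+b+c+[0+d]≡a+[b+[c+d]] (f x) (f y) (f z) (sum f L₃)) (sym (trans (eq₁ f) (cong (f x +_) (trans (eq₂ f) (cong (f y +_) (eq₃ f))))))))
      ; count = cong suc count
      ; good = cong₂ _+_ (poor≡0 (x , y , z) (good-sum s n E (degree x) (degree y) (degree z) (strong x wx) (strong y wy) (strong z wz))) good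
      ; used = ≤-trans (≤-reflexive (trans c₁ (cong suc (trans c₂ (cong suc c₃))))) (≤-trans (+-monoʳ-≤ 3 used) (≤-reflexive (3+[a+b]≡a+[3+b] (sum (λ x → ⟦ u x ⟧) L′) (k * 3)))) }
      where
      open Good (triples-in-U k L₃ (s≤s⁻¹ (≤-trans (s≤s⁻¹ (≤-trans (s≤s⁻¹ (≤-trans big (≤-reflexive c₁))) (≤-reflexive c₂))) (≤-reflexive c₃))))

    complete-pairs : ∀ G L → sum unpaired G ≡ 0 → size G ≤ sum (λ x → ⟦ u x ⟧) L → Good L (λ f → sum (ends f) G) (size G) (size G)
    complete-pairs [] L _ _ = record { N = [] ; L′ = L ; split = λ f → refl ; count = refl ; good = refl ; used = m≤m+n _ _ }
    complete-pairs ((x , y) ∷ G) L ok big with take-U L (≤-trans (s≤s z≤n) big)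
    ... | z , L₁ , eq₁ , wz , c₁ with paired x y (proj₁ (vanishes {unpaired (x , y)} ok))
    ...   | wy , wx , r , hyx = record
      { N = (y , x , z) ∷ N ; L′ = L′
      ; split = λ f → trans (+-assoc (f y + f x + f z) _ _) (trans (cong (f y + f x + f z +_) (split f))
          (trans (a+b+c+[d+e]≡b+a+d+[c+e] (f y) (f x) (f z) (sum (ends f) G) (sum f L₁)) (cong (f x + f y + sum (ends f) G +_) (sym (eq₁ f)))))
      ; count = cong suc count
      ; good = cong₂ _+_ (poor≡0 (y , x , z) (good-wedge s n E (degree y) (degree x) (degree z) (adjacent-rich y x r hyx) (strong z wz))) good
      ; used = ≤-trans (≤-reflexive c₁) (≤-trans (s≤s used) (≤-reflexive (sym (+-suc _ (size G))))) }
      where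
      open Good (complete-pairs G L₁ (proj₂ (vanishes {unpaired (x , y)} ok)) (s≤s⁻¹ (≤-trans big (≤-reflexive c₁))))

    greedy : ∀ k → k ≤ s * 3 ∸ U → ∃[ G ] ∃[ L ] ((∀ f → sum f vs ≡ sum (ends f) G + sum f L) × size G ≡ k × sum unpaired G ≡ 0)
    greedy zero _ = [] , vs , (λ f → refl) , refl , refl
    greedy (suc k) k< with greedy k (≤-trans (n≤1+n k) k<)
    ... | G , L , part , refl , ok with extend G L part ok U-large n-large E-small (≤-trans (+-monoˡ-≤ U k<) (≤-reflexive (m∸n+n≡m (<⇒≤ (m∸n≢0⇒n<m {s * 3} {U} (λ eq → <⇒≱ {0} {suc k} (s≤s z≤n) (≤-trans k< (≤-reflexive eq))))))))
    ...   | x , y , L₀ , eq , ok′ = (x , y) ∷ G , L₀ ,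
            (λ f → trans (part f) (trans (cong (sum (ends f) G +_) (eq f)) (a+[b+[c+d]]≡b+c+a+d (sum (ends f) G) (f x) (f y) (sum f L₀)))) ,
            refl , cong₂ _+_ ok′ ok

    -- Non-edges of large degree sum are exchanged for edges one after the other.
    repair : ∀ r M L → (∀ f → sum f vs ≡ sum (hat f) M + sum f L) → size M ≡ s → sum nonedge M ≤ r →
      sum (λ e → nonedge e * poor e) M ≡ 0 → Packing s
    repair r M L part sizes few ok with select nonedge 0 M
    ... | inj₂ none = record { M = M ; L = L ; part = part ; count = sizes ; proper = n≤0⇒n≡0 (≤-trans (sum-mono-All none) (≤-reflexive (sum-0 M))) }
    repair zero M L part sizes few ok | inj₁ (e , M₀ , pos , eq) =
      ⊥-elim (<⇒≱ pos (≤-trans (≈-member nonedge M e M₀ eq) few))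
    repair (suc r) M L part sizes few ok | inj₁ (e@(x , y , z) , M₀ , pos , eq) =
      repair r M⁺ L⁺ (λ f → trans (part f) (trans (regroup f) (sym (balance f))))
        (trans larger (trans (sym (eq (λ _ → 1))) sizes))
        (≤-trans (sound nonedge (λ _ p → p)) (s≤s⁻¹ (≤-trans (≤-trans (+-monoˡ-≤ (sum nonedge M₀) pos) (≤-reflexive (sym (eq nonedge)))) few)))
        (n≤0⇒n≡0 (≤-trans (sound (λ e → nonedge e * poor e) (λ e p → cong (_* poor e) p)) (≤-reflexive (proj₂ ok′))))
      where
      ok′ : nonedge e * poor e ≡ 0 × sum (λ e → nonedge e * poor e) M₀ ≡ 0
      ok′ = vanishes {nonedge e * poor e} (trans (sym (eq (λ e → nonedge e * poor e))) ok)
      not-poor : ∀ a b → 0 < a → a * b ≡ 0 → b ≡ 0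
      not-poor (suc a) b _ p = m+n≡0⇒m≡0 b p
      regroup : ∀ f → sum (hat f) M + sum f L ≡ sum (hat f) M₀ + sum f (x ∷ y ∷ z ∷ L)
      regroup f = trans (cong (_+ sum f L) (eq (hat f))) (a+b+c+d+e≡d+[a+[b+[c+e]]] (f x) (f y) (f z) (sum (hat f) M₀) (sum f L))
      enough : ∀ m s n D → 1 + m ≤ s → s * n * 6 + n * 100 ≤ D → 1 ≤ n → 1 + (m * n * 6 + n * 93) ≤ D
      enough m s n D h1 h2 h3 = certified (m ∷ s ∷ n ∷ D ∷ [])
        ((♯ 1 :+ ‵ 0 , ‵ 1) ∷ (‵ 1 :* ‵ 2 :* ♯ 6 :+ ‵ 2 :* ♯ 100 , ‵ 3) ∷ (♯ 1 , ‵ 2) ∷ [])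
        ((‵ 2 :* ♯ 6) ∷ (♯ 1) ∷ (♯ 1) ∷ [])
        0 (♯ 1 :+ (‵ 0 :* ‵ 2 :* ♯ 6 :+ ‵ 2 :* ♯ 93)) (‵ 3) refl (h1 , h2 , h3 , tt)
      open Exchanged (exchange M₀ x y z L (λ f → trans (part f) (regroup f))
        (enough (size M₀) s n (degree x + degree y + degree z) (≤-reflexive (trans (sym (eq (λ _ → 1))) sizes))
          (poor≡0⁻¹ e (not-poor (nonedge e) (poor e) pos (proj₁ ok′))) n>0))

    dense-packing : Packing s
    dense-packing with greedy (s * 3 ∸ U) ≤-refl
    ... | G , L , part , G-size , ok = repair _ (B.N ++ C.N) C.L′ total sizes ≤-refl
          (trans (sum-++ _ B.N C.N) (cong₂ _+_ (quiet B.N B.good) (quiet C.N C.good)))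
      where
      q = s * 3 ∸ U
      uL = sum (λ x → ⟦ u x ⟧) L
      q-small : ∀ q s U → q + U ≤ s * 3 → s * 2 ≤ U → q ≤ s
      q-small q s U h1 h2 = certified (q ∷ s ∷ U ∷ [])
        ((‵ 0 :+ ‵ 2 , ‵ 1 :* ♯ 3) ∷ (‵ 1 :* ♯ 2 , ‵ 2) ∷ [])
        ((♯ 1) ∷ (♯ 1) ∷ [])
        0 (‵ 0) (‵ 1) refl (h1 , h2 , tt)
      q≤s : q ≤ s
      q≤s with ≤-total U (s * 3)
      ... | inj₁ le = q-small q s U (≤-reflexive (m∸n+n≡m le)) U-large
      ... | inj₂ ge = ≤-trans (≤-reflexive (m≤n⇒m∸n≡0 ge)) z≤n
      uG : sum (ends (λ x → ⟦ u x ⟧)) G ≡ q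
      uG = trans (halve G ok) G-size
        where
        halve : ∀ G → sum unpaired G ≡ 0 → sum (ends (λ x → ⟦ u x ⟧)) G ≡ size G
        halve [] _ = refl
        halve ((x , y) ∷ G) ok with vanishes {unpaired (x , y)} ok
        ... | a , b with paired x y a
        ...   | wy , wx , _ rewrite wy | wx = cong suc (halve G b)
      uL-eq : uL + q ≡ U
      uL-eq = trans (+-comm uL q) (trans (cong (_+ uL) (sym uG)) (sym (part (λ x → ⟦ u x ⟧))))
      room : q + (s ∸ q) * 3 ≤ uL
      room = room-for-triples q (s ∸ q) s U uL (≤-trans (m≤n+m∸n (s * 3) U) (≤-reflexive (+-comm U q))) (≤-reflexive (sym uL-eq))
        (≤-reflexive (m+[n∸m]≡n q≤s))
      module B = Good (complete-pairs G L ok (≤-trans (≤-reflexive G-size) (≤-trans (m≤m+n q _) room)))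
      module C = Good (triples-in-U (s ∸ q) B.L′ (+-cancelˡ-≤ q _ _ (≤-trans room (≤-trans B.used
        (≤-reflexive (trans (cong (sum (λ x → ⟦ u x ⟧) B.L′ +_) G-size) (+-comm _ q)))))))
      total : ∀ f → sum f vs ≡ sum (hat f) (B.N ++ C.N) + sum f C.L′
      total f = begin
        sum f vs                                   ≡⟨ part f ⟩
        sum (ends f) G + sum f L                   ≡⟨ sym (B.split f) ⟩
        sum (hat f) B.N + sum f B.L′               ≡⟨ cong (sum (hat f) B.N +_) (sym (C.split f)) ⟩
        sum (hat f) B.N + (sum (hat f) C.N + sum f C.L′) ≡⟨ sym (+-assoc (sum (hat f) B.N) _ _) ⟩
        sum (hat f) B.N + sum (hat f) C.N + sum f C.L′   ≡⟨ cong (_+ sum f C.L′) (sym (sum-++ (hat f) B.N C.N)) ⟩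
        sum (hat f) (B.N ++ C.N) + sum f C.L′      ∎
        where open ≡-Reasoning
      sizes : size (B.N ++ C.N) ≡ s
      sizes = trans (sum-++ (λ _ → 1) B.N C.N) (trans (cong₂ _+_ (trans B.count G-size) C.count) (m+[n∸m]≡n q≤s))
      quiet : ∀ N → sum poor N ≡ 0 → sum (λ e → nonedge e * poor e) N ≡ 0
      quiet []      _  = refl
      quiet (e ∷ N) eq = let a , b = vanishes {poor e} eq in
        cong₂ _+_ (trans (cong (nonedge e *_) a) (*-zeroʳ (nonedge e))) (quiet N b)

-- The case of large U

private
  U-gap : ∀ s n U k → k * 200 ≤ s → s * 3 ≤ n → s * n * 2 ≤ U * U + k * k * 5 → 1 + U ≤ s * 2 + k * 20 → 1 ≤ 0
  U-gap s n U k h1 h2 h3 h4 = certified (s ∷ n ∷ U ∷ k ∷ [])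
    ((‵ 3 :* ♯ 200 , ‵ 0) ∷ (‵ 0 :* ♯ 3 , ‵ 1) ∷ (‵ 0 :* ‵ 1 :* ♯ 2 , ‵ 2 :* ‵ 2 :+ ‵ 3 :* ‵ 3 :* ♯ 5) ∷ (♯ 1 :+ ‵ 2 , ‵ 0 :* ♯ 2 :+ ‵ 3 :* ♯ 20) ∷ [])
    ((‵ 2 :* ♯ 50400 :+ ‵ 3 :* ♯ 12600 :+ ‵ 1 :* ♯ 47999 :+ ‵ 0 :* ♯ 63 :+ ♯ 68570) ∷ (‵ 2 :* ♯ 352800 :+ ‵ 0 :* ♯ 21 :+ ♯ 479990) ∷ (♯ 504000) ∷ (‵ 2 :* ♯ 504000 :+ ‵ 1 :* ♯ 479990 :+ ♯ 685700) ∷ [])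
    685699 (♯ 1) (♯ 0) refl (h1 , h2 , h3 , h4 , tt)

  step-error : ∀ E n a k K → E ≤ k * k → a * n * 18 ≤ k * k → (K * 6 + 33) * n ≤ k * k → 1 ≤ k → 1 + ((E + K * n * 2) * 3 + k * k + a * n * 18 + n * 33) ≤ (k * 10) * (k * 10)
  step-error E n a k K h1 h2 h3 h4 = certified (E ∷ n ∷ a ∷ k ∷ K ∷ [])
    ((‵ 0 , ‵ 3 :* ‵ 3) ∷ (‵ 2 :* ‵ 1 :* ♯ 18 , ‵ 3 :* ‵ 3) ∷ ((‵ 4 :* ♯ 6 :+ ♯ 33) :* ‵ 1 , ‵ 3 :* ‵ 3) ∷ (♯ 1 , ‵ 3) ∷ [])
    ((♯ 3) ∷ (♯ 1) ∷ (♯ 1) ∷ (‵ 3 :+ ♯ 1) ∷ [])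
    0 (♯ 1 :+ ((‵ 0 :+ ‵ 4 :* ‵ 1 :* ♯ 2) :* ♯ 3 :+ ‵ 3 :* ‵ 3 :+ ‵ 2 :* ‵ 1 :* ♯ 18 :+ ‵ 1 :* ♯ 33)) ((‵ 3 :* ♯ 10) :* (‵ 3 :* ♯ 10)) refl (h1 , h2 , h3 , h4 , tt)
  shifted-rich : ∀ S s K n E d → S ≤ s + K → s * n * 2 ≤ d + E → S * n * 2 ≤ d + (E + K * n * 2)
  shifted-rich S s K n E d h1 h2 = certified (S ∷ s ∷ K ∷ n ∷ E ∷ d ∷ [])
    ((‵ 0 , ‵ 1 :+ ‵ 2) ∷ (‵ 1 :* ‵ 3 :* ♯ 2 , ‵ 5 :+ ‵ 4) ∷ [])
    ((‵ 3 :* ♯ 2) ∷ (♯ 1) ∷ [])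
    0 (‵ 0 :* ‵ 3 :* ♯ 2) (‵ 5 :+ (‵ 4 :+ ‵ 2 :* ‵ 3 :* ♯ 2)) refl (h1 , h2 , tt)
  many-U : ∀ ζ W L n a m b S R → n ≤ a * 3 + m * 3 + L → L ≤ ζ + W → W ≤ b → b + S * 3 ≤ n → a + m + R ≤ S → R * 3 ≤ ζ
  many-U ζ W L n a m b S R h1 h2 h3 h4 h5 = certified (ζ ∷ W ∷ L ∷ n ∷ a ∷ m ∷ b ∷ S ∷ R ∷ [])
    ((‵ 3 , ‵ 4 :* ♯ 3 :+ ‵ 5 :* ♯ 3 :+ ‵ 2) ∷ (‵ 2 , ‵ 0 :+ ‵ 1) ∷ (‵ 1 , ‵ 6) ∷ (‵ 6 :+ ‵ 7 :* ♯ 3 , ‵ 3) ∷ (‵ 4 :+ ‵ 5 :+ ‵ 8 , ‵ 7) ∷ [])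
    ((♯ 1) ∷ (♯ 1) ∷ (♯ 1) ∷ (♯ 1) ∷ (♯ 3) ∷ [])
    0 (‵ 8 :* ♯ 3) (‵ 0) refl (h1 , h2 , h3 , h4 , h5 , tt)
  exact-U : ∀ ζ W L n a m b S r → a * 3 + m * 3 + L ≤ n → ζ + W ≤ L → b ≤ W → n ≤ b + S * 3 → S ≤ a + m + r → ζ ≤ r * 3
  exact-U ζ W L n a m b S r h1 h2 h3 h4 h5 = certified (ζ ∷ W ∷ L ∷ n ∷ a ∷ m ∷ b ∷ S ∷ r ∷ [])
    ((‵ 4 :* ♯ 3 :+ ‵ 5 :* ♯ 3 :+ ‵ 2 , ‵ 3) ∷ (‵ 0 :+ ‵ 1 , ‵ 2) ∷ (‵ 6 , ‵ 1) ∷ (‵ 3 , ‵ 6 :+ ‵ 7 :* ♯ 3) ∷ (‵ 7 , ‵ 4 :+ ‵ 5 :+ ‵ 8) ∷ [])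
    ((♯ 1) ∷ (♯ 1) ∷ (♯ 1) ∷ (♯ 1) ∷ (♯ 3) ∷ [])
    0 (‵ 0) (‵ 8 :* ♯ 3) refl (h1 , h2 , h3 , h4 , h5 , tt)
  enough-P : ∀ a p r S k → S ≤ a + p + r → a ≤ k → k * 11 ≤ S → k * 10 ≤ p + r
  enough-P a p r S k h1 h2 h3 = certified (a ∷ p ∷ r ∷ S ∷ k ∷ [])
    ((‵ 3 , ‵ 0 :+ ‵ 1 :+ ‵ 2) ∷ (‵ 0 , ‵ 4) ∷ (‵ 4 :* ♯ 11 , ‵ 3) ∷ [])
    ((♯ 1) ∷ (♯ 1) ∷ (♯ 1) ∷ [])
    0 (‵ 4 :* ♯ 10) (‵ 1 :+ ‵ 2) refl (h1 , h2 , h3 , tt)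
  room-n : ∀ S n k b → b + S * 3 ≤ n → k * 11 ≤ S → k * 10 ≤ n
  room-n S n k b h1 h2 = certified (S ∷ n ∷ k ∷ b ∷ [])
    ((‵ 3 :+ ‵ 0 :* ♯ 3 , ‵ 1) ∷ (‵ 2 :* ♯ 11 , ‵ 0) ∷ [])
    ((♯ 10) ∷ (♯ 30) ∷ [])
    32 (‵ 2 :* ♯ 10) (‵ 1) refl (h1 , h2 , tt)
  Q-bound : ∀ q W w n U b S s K k → q + w ≤ W → b ≤ w → W + U ≤ n → n ≤ b + S * 3 → S ≤ s + K → s * 2 + k * 20 ≤ U → K * 2 ≤ k → q * 3 + k * 10 ≤ n
  Q-bound q W w n U b S s K k h1 h2 h3 h4 h5 h6 h7 = certified (q ∷ W ∷ w ∷ n ∷ U ∷ b ∷ S ∷ s ∷ K ∷ k ∷ [])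
    ((‵ 0 :+ ‵ 2 , ‵ 1) ∷ (‵ 5 , ‵ 2) ∷ (‵ 1 :+ ‵ 4 , ‵ 3) ∷ (‵ 3 , ‵ 5 :+ ‵ 6 :* ♯ 3) ∷ (‵ 6 , ‵ 7 :+ ‵ 8) ∷ (‵ 7 :* ♯ 2 :+ ‵ 9 :* ♯ 20 , ‵ 4) ∷ (‵ 8 :* ♯ 2 , ‵ 9) ∷ [])
    ((♯ 3) ∷ (♯ 2) ∷ (♯ 3) ∷ (♯ 2) ∷ (♯ 6) ∷ (♯ 3) ∷ (♯ 3) ∷ [])
    0 (‵ 0 :* ♯ 3 :+ ‵ 9 :* ♯ 10) (‵ 3) refl (h1 , h2 , h3 , h4 , h5 , h6 , h7 , tt)
  PQ-bound : ∀ p q r a W w n U b S s K k → q + w ≤ W → b ≤ w → W + U ≤ n → n ≤ b + S * 3 → S ≤ s + K → s * 2 + k * 20 ≤ U → K * 2 ≤ k → S ≤ a + p + q + r → a ≤ k → k * 10 ≤ p + r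
  PQ-bound p q r a W w n U b S s K k h1 h2 h3 h4 h5 h6 h7 h8 h9 = certified (p ∷ q ∷ r ∷ a ∷ W ∷ w ∷ n ∷ U ∷ b ∷ S ∷ s ∷ K ∷ k ∷ [])
    ((‵ 1 :+ ‵ 5 , ‵ 4) ∷ (‵ 8 , ‵ 5) ∷ (‵ 4 :+ ‵ 7 , ‵ 6) ∷ (‵ 6 , ‵ 8 :+ ‵ 9 :* ♯ 3) ∷ (‵ 9 , ‵ 10 :+ ‵ 11) ∷ (‵ 10 :* ♯ 2 :+ ‵ 12 :* ♯ 20 , ‵ 7) ∷ (‵ 11 :* ♯ 2 , ‵ 12) ∷ (‵ 9 , ‵ 3 :+ ‵ 0 :+ ‵ 1 :+ ‵ 2) ∷ (‵ 3 , ‵ 12) ∷ [])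
    ((♯ 5) ∷ (♯ 5) ∷ (♯ 5) ∷ (♯ 5) ∷ (♯ 10) ∷ (♯ 5) ∷ (♯ 5) ∷ (♯ 5) ∷ (♯ 5) ∷ [])
    8 (‵ 12 :* ♯ 10) (‵ 0 :+ ‵ 2) refl (h1 , h2 , h3 , h4 , h5 , h6 , h7 , h8 , h9 , tt)

  cover-size : ∀ j U W wL n b S s K → j + wL ≤ W → W + U ≤ n → n ≤ b + S * 3 → 1 + b ≤ wL → S ≤ s + K → j + U ≤ s * 3 + K * 3
  cover-size j U W wL n b S s K h1 h2 h3 h4 h5 = certified (j ∷ U ∷ W ∷ wL ∷ n ∷ b ∷ S ∷ s ∷ K ∷ [])
    ((‵ 0 :+ ‵ 3 , ‵ 2) ∷ (‵ 2 :+ ‵ 1 , ‵ 4) ∷ (‵ 4 , ‵ 5 :+ ‵ 6 :* ♯ 3) ∷ (♯ 1 :+ ‵ 5 , ‵ 3) ∷ (‵ 6 , ‵ 7 :+ ‵ 8) ∷ [])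
    ((♯ 1) ∷ (♯ 1) ∷ (♯ 1) ∷ (♯ 1) ∷ (♯ 3) ∷ [])
    0 (‵ 0 :+ ‵ 1) (‵ 7 :* ♯ 3 :+ ‵ 8 :* ♯ 3) refl (h1 , h2 , h3 , h4 , h5 , tt)
  cover-error : ∀ a n K k E s → E ≤ k * k → a * n * 18 ≤ k * k → (K * 6 + 33) * n ≤ k * k → k * 200 ≤ s → s * 3 ≤ n → 1 ≤ k → 1 + (a * n * 6 + n * 15 + (K * 3) * n * 2 + k * k + E * 2) * 20 ≤ n * (k * 20)
  cover-error a n K k E s h1 h2 h3 h4 h5 h6 = certified (a ∷ n ∷ K ∷ k ∷ E ∷ s ∷ [])
    ((‵ 4 , ‵ 3 :* ‵ 3) ∷ (‵ 0 :* ‵ 1 :* ♯ 18 , ‵ 3 :* ‵ 3) ∷ ((‵ 2 :* ♯ 6 :+ ♯ 33) :* ‵ 1 , ‵ 3 :* ‵ 3) ∷ (‵ 3 :* ♯ 200 , ‵ 5) ∷ (‵ 5 :* ♯ 3 , ‵ 1) ∷ (♯ 1 , ‵ 3) ∷ [])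
    ((♯ 72000) ∷ (♯ 12000) ∷ (♯ 36000) ∷ (‵ 3 :* ♯ 780 :+ ♯ 9) ∷ (‵ 3 :* ♯ 260 :+ ♯ 3) ∷ (♯ 1800) ∷ [])
    1799 (♯ 1 :+ (‵ 0 :* ‵ 1 :* ♯ 6 :+ ‵ 1 :* ♯ 15 :+ (‵ 2 :* ♯ 3) :* ‵ 1 :* ♯ 2 :+ ‵ 3 :* ‵ 3 :+ ‵ 4 :* ♯ 2) :* ♯ 20) (‵ 1 :* (‵ 3 :* ♯ 20)) refl (h1 , h2 , h3 , h4 , h5 , h6 , tt)
  sparse-error : ∀ j n U E s k K → j + U ≤ s * 3 + K * 3 → 1 + U * 60 ≤ n * 41 → s * n * 2 ≤ U * U + k * k * 5 → E ≤ k * k → (K * 6 + 33) * n ≤ k * k → k * 200 ≤ s → s * 3 ≤ n → s * 2 ≤ U → 1 + (j * n * 12 + U * U + E * 2) ≤ s * n * 4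
  sparse-error j n U E s k K h1 h2 h3 h4 h5 h6 h7 h8 = certified (j ∷ n ∷ U ∷ E ∷ s ∷ k ∷ K ∷ [])
    ((‵ 0 :+ ‵ 2 , ‵ 4 :* ♯ 3 :+ ‵ 6 :* ♯ 3) ∷ (♯ 1 :+ ‵ 2 :* ♯ 60 , ‵ 1 :* ♯ 41) ∷ (‵ 4 :* ‵ 1 :* ♯ 2 , ‵ 2 :* ‵ 2 :+ ‵ 5 :* ‵ 5 :* ♯ 5) ∷ (‵ 3 , ‵ 5 :* ‵ 5) ∷ ((‵ 6 :* ♯ 6 :+ ♯ 33) :* ‵ 1 , ‵ 5 :* ‵ 5) ∷ (‵ 5 :* ♯ 200 , ‵ 4) ∷ (‵ 4 :* ♯ 3 , ‵ 1) ∷ (‵ 4 :* ♯ 2 , ‵ 2) ∷ [])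
    ((‵ 1 :* ♯ 18238800) ∷ (‵ 2 :* ♯ 400001 :+ ♯ 1519900) ∷ (♯ 22480160) ∷ (♯ 3039800) ∷ (♯ 9119400) ∷ (‵ 5 :* ♯ 622800 :+ ‵ 4 :* ♯ 3114) ∷ (‵ 4 :* ♯ 1038) ∷ (‵ 1 :* ♯ 1838759) ∷ [])
    1519899 (♯ 1 :+ (‵ 0 :* ‵ 1 :* ♯ 12 :+ ‵ 2 :* ‵ 2 :+ ‵ 3 :* ♯ 2)) (‵ 4 :* ‵ 1 :* ♯ 4) refl (h1 , h2 , h3 , h4 , h5 , h6 , h7 , h8 , tt)

module Dense {V : Set} (vs : List V) (h : V → V → V → Bool)
  (h-swap : ∀ x y z → h x y z ≡ h y x z) (h-rot : ∀ x y z → h x y z ≡ h y z x)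
  (h-irr : ∀ x y → h x x y ≡ false)
  (w : V → Bool) (w-edge : ∀ x y z → h x y z ≡ true → ⟦ w x ⟧ + ⟦ w y ⟧ + ⟦ w z ⟧ ≤ 1)
  (complete : ∀ x → ∃[ vs′ ] (vs ≈ x ∷ vs′)) (covered : ∀ x → ∃[ p ] ∃[ q ] (h x p q ≡ true))
  (s E : ℕ) (adjacent-rich : ∀ x y z → h x y z ≡ true → s * size vs * 4 ≤ degreeOf vs h x + degreeOf vs h y + E * 2)
  (rich : ∀ x → w x ≡ false → s * size vs * 2 ≤ degreeOf vs h x + E)
  (n-large : s * 3 ≤ size vs)
  (k K R₀ : ℕ) (k>0 : 1 ≤ k) (s-large : k * 200 ≤ s) (E-small : E ≤ k * k)
  (U-dense : s * size vs * 2 ≤ sum (λ x → ⟦ not (w x) ⟧) vs * sum (λ x → ⟦ not (w x) ⟧) vs + k * k * 5)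
  (K-small : (K * 6 + 33) * size vs ≤ k * k) (2K≤k : K * 2 ≤ k) (R₀-large : size vs * size vs * 3 ≤ R₀ * (k * k))
  (S b : ℕ) (b+3S : b + S * 3 ≡ size vs) (S≤ : S ≤ s + K) (S-large : k * 11 ≤ S) (R₀≤b : R₀ ≤ b) where

  open Graph vs h h-swap h-rot h-irr
  open Covering vs h h-swap h-rot h-irr w w-edge
  open Degrees vs h h-swap h-rot h-irr w w-edge complete covered s E adjacent-rich
  open Augmentation vs h h-swap h-rot h-irr w w-edge hiding (u)

  U-above : s * 2 + k * 20 ≤ U
  U-above = ≮⇒≥ (λ lt → <⇒≱ {0} {1} (s≤s z≤n) (U-gap s n U k s-large n-large U-dense lt))

  splitW : ∀ M → ∃[ P ] ∃[ Q ] (M ≈ P ++ Q × sum (hat W) P ≡ 0 × size Q ≤ sum (hat W) Q)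
  splitW [] = [] , [] , (λ f → refl) , refl , z≤n
  splitW (e ∷ M) with splitW M
  ... | P , Q , eq , P-zero , Q-pos with hat W e in we
  ...   | zero  = e ∷ P , Q , (λ f → cong (f e +_) (eq f)) , cong₂ _+_ we P-zero , Q-pos
  ...   | suc i = P , e ∷ Q , (λ f → trans (cong (f e +_) (trans (eq f) (sum-++ f P Q)))
                    (trans (a+[b+c]≡b+[a+c] (f e) (sum f P) (sum f Q)) (sym (sum-++ f P (e ∷ Q))))) , P-zero ,
                  +-mono-≤ (≤-trans (s≤s z≤n) (≤-reflexive (sym we))) Q-pos

  module _ (A : List (Triple V)) (A-small : size A * n * 18 ≤ k * k) (A≤k : size A ≤ k) where

    private
      a = size A

    record State (m : ℕ) : Set where
      field
        M     : List (Triple V)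
        L     : List V
        part  : ∀ f → sum f vs ≡ sum (hat f) A + (sum (hat f) M + sum f L)
        count : size M ≡ m
        proper : sum nonedge M ≡ 0
        light : sum W L ≤ b

      vertices : a * 3 + m * 3 + size L ≡ n
      vertices = trans (trans (a*3+b*3+c≡3*a+[3*b+c] a m (size L)) (cong₂ (λ s t → s + (t + size L)) (sym (hat-const 1 A)) (trans (cong (3 *_) (sym count)) (sym (hat-const 1 M)))))
                       (sym (part (λ _ → 1)))

      U+W : sum (λ x → ⟦ u x ⟧) L + sum W L ≡ size L
      U+W = trans (sym (sum-+ (λ x → ⟦ u x ⟧) W L)) (sum-cong (λ x → trans (+-comm ⟦ u x ⟧ _) (w+u x)) L)

    step : ∀ m → a + m + R₀ ≤ S → State m → State (suc m)
    step m room st = go (m≤n⇒m<n∨m≡n light)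
      where
      open State st
      ζ = sum (λ x → ⟦ u x ⟧) L
      r = S ∸ (a + m)
      a+m≤S : a + m ≤ S
      a+m≤S = ≤-trans (m≤m+n _ R₀) room
      S-eq : S ≡ a + m + r
      S-eq = sym (m+[n∸m]≡n a+m≤S)
      ζ-large : R₀ * 3 ≤ ζ
      ζ-large = many-U ζ (sum W L) (size L) n a m b S R₀ (≤-reflexive (sym vertices)) (≤-reflexive (sym U+W)) light (≤-reflexive b+3S) room
      rich′ : ∀ z → w z ≡ false → S * n * 2 ≤ degree z + (E + K * n * 2)
      rich′ z wz = shifted-rich S s K n E (degree z) S≤ (rich z wz)
      T-large : n * n * 9 ≤ ζ * (k * k)
      T-large = ≤-trans (≤-reflexive (a*9≡a*3*3 (n * n))) (≤-trans (*-monoˡ-≤ 3 R₀-large) (≤-trans (≤-reflexive (a*b*3≡a*3*b R₀ (k * k))) (*-monoˡ-≤ (k * k) ζ-large)))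
      n>0 : 0 < n
      n>0 = ≤-trans k>0 (≤-trans (≤-trans (m≤m*n k 200) s-large) (≤-trans (m≤m*n s 3) n-large))
      ζ>0 : 0 < ζ
      ζ>0 = n≢0⇒n>0 (λ ζ≡0 → <⇒≱ (*-mono-≤ n>0 n>0) (≤-trans (≤-trans (m≤m*n (n * n) 9) T-large) (≤-reflexive (cong (_* (k * k)) ζ≡0))))
      finish : ∀ P Q → M ≈ P ++ Q → Improvement nonedge W b (P ++ Q) L → State (suc m)
      finish P Q eq imp = record
        { M = M⁺ ; L = L⁺
        ; part = λ f → trans (part f) (cong (sum (hat f) A +_) (trans (cong (_+ sum f L) (eq (hat f))) (sym (balance f))))
        ; count = trans larger (cong suc (trans (sym (eq (λ _ → 1))) count)) ; proper = sound ; light = light⁺ }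
        where open Improvement imp renaming (light to light⁺)
      error = step-error E n a k K E-small A-small K-small k>0
      go : sum W L < b ⊎ sum W L ≡ b → State (suc m)
      go (inj₁ few) = finish M [] (λ f → sym (trans (sum-++ f M []) (+-identityʳ _)))
        (augment M [] L b proper refl light (inj₁ few) A
          (λ f → trans (part f) (cong (λ s → sum (hat f) A + (s + sum f L)) (sym (trans (sum-++ (hat f) M []) (+-identityʳ _)))))
          S (E + K * n * 2) (k * k) (k * 10) r rich′ T-large ζ>0
          (≤-reflexive (trans (cong (λ m → a + m + 0 + r) count) (trans (cong (_+ r) (+-identityʳ _)) (sym S-eq))))
          z≤n (room-n S n k b (≤-reflexive b+3S) S-large)
          (enough-P a (size M) r S k (≤-reflexive (trans S-eq (cong (λ m → a + m + r) (sym count)))) A≤k S-large) error)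
      go (inj₂ full) with splitW M
      ... | P , Q , eq , P-zero , Q-pos = finish P Q eq
        (augment P Q L b (proj₁ PQ-edges) (proj₂ PQ-edges) light (inj₂ P-zero) A
          (λ f → trans (part f) (cong (λ s → sum (hat f) A + (s + sum f L)) (eq (hat f))))
          S (E + K * n * 2) (k * k) (k * 10) r rich′ T-large ζ>0
          (≤-reflexive (sym sizes))
          (≤-trans (*-monoʳ-≤ (size Q) ζ-exact) (≤-reflexive (sym (*-assoc (size Q) r 3))))
          (Q-bound (size Q) Wn (sum W L) n U b S s K k Q+W (≤-reflexive (sym full)) (≤-reflexive Wn+U) (≤-reflexive (sym b+3S)) S≤ U-above 2K≤k)
          (PQ-bound (size P) (size Q) r a Wn (sum W L) n U b S s K k Q+W (≤-reflexive (sym full)) (≤-reflexive Wn+U) (≤-reflexive (sym b+3S)) S≤ U-above 2K≤k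
            (≤-reflexive sizes) A≤k) error)
        where
        PQ-edges = vanishes {sum nonedge P} (trans (sym (trans (eq nonedge) (sum-++ nonedge P Q))) proper)
        PQ-size : m ≡ size P + size Q
        PQ-size = trans (sym count) (trans (eq (λ _ → 1)) (sum-++ (λ _ → 1) P Q))
        sizes : S ≡ a + size P + size Q + r
        sizes = trans S-eq (cong (_+ r) (trans (cong (a +_) PQ-size) (sym (+-assoc a _ _))))
        ζ-exact : ζ ≤ r * 3
        ζ-exact = exact-U ζ (sum W L) (size L) n a m b S r (≤-reflexive vertices) (≤-reflexive U+W) (≤-reflexive (sym full)) (≤-reflexive (sym b+3S)) (≤-reflexive S-eq)
        Q+W : size Q + sum W L ≤ Wn
        Q+W = ≤-trans (+-monoˡ-≤ (sum W L) (≤-trans Q-pos (≤-trans (m≤n+m _ (sum (hat W) P)) (≤-reflexive (sym (trans (eq (hat W)) (sum-++ (hat W) P Q)))))))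
          (≤-trans (m≤n+m _ (sum (hat W) A)) (≤-reflexive (sym (part W))))

    steps : ∀ i m → a + (m + i) + R₀ ≤ suc S → State m → State (m + i)
    steps zero    m _    st = subst State (sym (+-identityʳ m)) st
    steps (suc i) m room st = subst State (sym (+-suc m i)) (step (m + i) (s≤s⁻¹ (≤-trans (≤-reflexive (cong (_+ R₀) (trans (sym (+-suc a (m + i))) (cong (a +_) (sym (+-suc m i)))))) room))
      (steps i m (≤-trans (≤-trans (+-monoˡ-≤ R₀ (+-monoʳ-≤ a (+-monoʳ-≤ m (n≤1+n i)))) room) ≤-refl) st))

    record CoverState : Set where
      field
        M     : List (Triple V)
        L     : List V
        part  : ∀ f → sum f vs ≡ sum (hat f) A + (sum (hat f) M + sum f L)
        wedges : sum unwedged M ≡ 0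

      j+W : size M + sum W L ≤ Wn
      j+W = ≤-trans (+-monoˡ-≤ (sum W L) (go M wedges)) (≤-trans (m≤n+m _ (sum (hat W) A)) (≤-reflexive (sym (part W))))
        where
        go : ∀ N → sum unwedged N ≡ 0 → size N ≤ sum (hat W) N
        go []      _  = z≤n
        go (e@(x , y , z) ∷ N) eq with vanishes {unwedged e} eq
        ... | p , q rewrite proj₁ (wedge {x} {y} {z} p) = s≤s (≤-trans (go N q) (m≤n+m _ (W y + W z)))

    Coverable : Set
    Coverable = n * 41 ≤ U * 60 ⊎ (∀ f → sum (hat f) A ≡ 0)

    Grown : List (Triple V) → Set
    Grown M = Σ CoverState (λ st′ → size (CoverState.M st′) ≡ suc (size M))

    cover-step : Coverable → (st : CoverState) → b < sum W (CoverState.L st) → Grown (CoverState.M st)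
    cover-step dense st many = go dense
      where
      open CoverState st
      j = size M
      j-small : j + U ≤ s * 3 + K * 3
      j-small = cover-size j U Wn (sum W L) n b S s K j+W (≤-reflexive Wn+U) (≤-reflexive (sym b+3S)) many S≤
      finish : Improvement unwedged (λ _ → 0) 0 M L → Grown M
      finish imp = record { M = M⁺ ; L = L⁺ ; part = λ f → trans (part f) (cong (sum (hat f) A +_) (sym (balance f))) ; wedges = sound } , larger
        where open Improvement imp
      dense-case : n * 41 ≤ U * 60 → Grown M
      dense-case U-big = finish (cover M L wedges A part s E (k * k) (k * 20) (K * 3) W-rich
          (≤-trans (s≤s z≤n) many)
          (≤-trans R₀-large (*-monoˡ-≤ (k * k) (≤-trans R₀≤b (<⇒≤ many))))
          j-small U-big U-above (cover-error a n K k E s E-small A-small K-small s-large n-large k>0))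
      part₀ : (∀ f → sum (hat f) A ≡ 0) → ∀ f → sum f vs ≡ sum (hat f) M + sum f L
      part₀ none f = trans (part f) (cong (_+ (sum (hat f) M + sum f L)) (none f))
      add-edge : (∃[ z ] ∃[ p ] ∃[ q ] ∃[ L₀ ] (L ≈ z ∷ p ∷ q ∷ L₀ × w z ≡ true × h z p q ≡ true)) → Grown M
      add-edge (x , p , q , L₀ , eq , wx , hx) = record
        { M = (x , p , q) ∷ M ; L = L₀
        ; part = λ f → trans (part f) (trans (cong (λ l → sum (hat f) A + (sum (hat f) M + l)) (eq f)) (a+[b+[c+[d+[e+f]]]]≡a+[c+d+e+b+f] (sum (hat f) A) (sum (hat f) M) (f x) (f p) (f q) (sum f L₀)))
        ; wedges = cong₂ _+_ (true-not (cong₂ _∧_ wx hx)) wedges } , refl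
      some-W : ∃[ z ] ∃[ L′ ] (L ≈ z ∷ L′ × w z ≡ true)
      some-W = let z , L′ , wz , eqz = select-positive W L (≤-trans (s≤s z≤n) many) in z , L′ , eqz , ⟦⟧>0 wz
      sparse-case : (∀ f → sum (hat f) A ≡ 0) → U * 60 < n * 41 → Grown M
      sparse-case none U-less = add-edge (sparse-cover M L (part₀ none) some-W
        (sparse-error j n U E s k K j-small U-less U-dense E-small K-small s-large n-large (≤-trans (m≤m+n _ _) U-above)))
      go : Coverable → Grown M
      go (inj₁ U-big) = dense-case U-big
      go (inj₂ none) = [ dense-case , (λ U-less → sparse-case none (≰⇒> U-less)) ]′ (toSum (n * 41 ≤? U * 60))

    initial : Coverable → ∀ fuel → (st : CoverState) → n ≤ fuel + size (CoverState.M st) → Σ ℕ (λ q → q ≤ Wn × State q)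
    initial dense fuel st enough with sum W (CoverState.L st) ≤? b
    ... | yes light = size M , ≤-trans (m≤m+n _ _) j+W , record { M = M ; L = L ; part = part ; count = refl ; proper = all-edges M wedges ; light = light }
      where
      open CoverState st
      all-edges : ∀ N → sum unwedged N ≡ 0 → sum nonedge N ≡ 0
      all-edges []      _  = refl
      all-edges (e@(x , y , z) ∷ N) eq = let p , q = vanishes {unwedged e} eq in cong₂ _+_ (true-not (proj₂ (wedge {x} {y} {z} p))) (all-edges N q)
    initial dense zero st enough | no heavy = ⊥-elim (heavy (≤-trans (+-cancelˡ-≤ (size M) _ _ (≤-trans j+W
        (≤-trans (≤-trans (m≤m+n Wn U) (≤-reflexive Wn+U)) (≤-trans enough (m≤m+n _ 0))))) z≤n))
      where open CoverState st
    initial dense (suc fuel) st enough | no heavy with cover-step dense st (≰⇒> heavy)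
    ... | st′ , larger = initial dense fuel st′ (≤-trans enough (≤-reflexive (trans (sym (+-suc fuel _)) (cong (fuel +_) (sym larger)))))

-- Absorption

bernoulli : ∀ m j → m ^ j * (m + j) ≤ m * suc m ^ j
bernoulli m zero    = ≤-reflexive (1*[a+0]≡a*1 m)
bernoulli m (suc j) = begin
  m * m ^ j * (m + suc j)                            ≤⟨ m≤m+n _ (m ^ j * j) ⟩
  m * m ^ j * (m + suc j) + m ^ j * j                ≡⟨ a*b*[a+[1+c]]+b*c≡[1+a]*[b*[a+c]]′ m j (m ^ j) ⟩
  suc m * (m ^ j * (m + j))                          ≤⟨ *-monoʳ-≤ (suc m) (bernoulli m j) ⟩
  suc m * (m * suc m ^ j)                            ≡⟨ [1+a]*[a*b]≡a*[[1+a]*b] m (suc m ^ j) ⟩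
  m * (suc m * suc m ^ j)                            ∎
  where
  open ≤-Reasoning

doubling : ∀ m → 0 < m → m ^ m * 2 ≤ suc m ^ m
doubling m m>0 = *-cancelˡ-≤ m {{>-nonZero m>0}} (≤-trans (≤-reflexive (a*[b*2]≡b*[a+a] m (m ^ m))) (bernoulli m m))

growth : ∀ m → 0 < m → ∀ i → m ^ (m * i) * 2 ^ i ≤ suc m ^ (m * i)
growth m m>0 zero    = ≤-reflexive (trans (cong (λ j → m ^ j * 1) (*-zeroʳ m)) (sym (cong (suc m ^_) (*-zeroʳ m))))
growth m m>0 (suc i) = begin
  m ^ (m * suc i) * (2 * 2 ^ i)               ≡⟨ cong (_* (2 * 2 ^ i)) (split m) ⟩
  m ^ m * m ^ (m * i) * (2 * 2 ^ i)           ≡⟨ a*b*[2*c]≡a*2*[b*c] (m ^ m) (m ^ (m * i)) (2 ^ i) ⟩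
  m ^ m * 2 * (m ^ (m * i) * 2 ^ i)           ≤⟨ *-mono-≤ (doubling m m>0) (growth m m>0 i) ⟩
  suc m ^ m * suc m ^ (m * i)                 ≡⟨ sym (split (suc m)) ⟩
  suc m ^ (m * suc i)                         ∎
  where
  open ≤-Reasoning
  split : ∀ x → x ^ (m * suc i) ≡ x ^ m * x ^ (m * i)
  split x = trans (cong (x ^_) (*-suc m i)) (^-distribˡ-+-* x m (m * i))

i<2^i : ∀ i → i < 2 ^ i
i<2^i zero    = s≤s z≤n
i<2^i (suc i) = ≤-trans (s≤s (i<2^i i)) (≤-trans (+-monoˡ-≤ (2 ^ i) (≤-trans (s≤s z≤n) (i<2^i i))) (≤-reflexive (cong (2 ^ i +_) (sym (+-identityʳ _)))))

exponential : ∀ m → 0 < m → ∀ i N → N < suc i * suc i * (suc i * suc i) → N * m ^ (m * (i * 4)) < suc m ^ (m * (i * 4))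
exponential m m>0 i N small = begin-strict
  N * m ^ (m * (i * 4))                              <⟨ *-monoˡ-< (m ^ (m * (i * 4))) {{>-nonZero (m^n>0 m {{>-nonZero m>0}} (m * (i * 4)))}} (<-≤-trans small fourth) ⟩
  2 ^ (i * 4) * m ^ (m * (i * 4))                    ≡⟨ *-comm (2 ^ (i * 4)) _ ⟩
  m ^ (m * (i * 4)) * 2 ^ (i * 4)                    ≤⟨ growth m m>0 (i * 4) ⟩
  suc m ^ (m * (i * 4))                              ∎
  where
  open ≤-Reasoning
  fourth : suc i * suc i * (suc i * suc i) ≤ 2 ^ (i * 4)
  fourth = ≤-trans (*-mono-≤ (*-mono-≤ (i<2^i i) (i<2^i i)) (*-mono-≤ (i<2^i i) (i<2^i i)))
    (≤-reflexive (trans (a*a*[a*a]≡a*[a*[a*[a*1]]] (2 ^ i)) (^-*-assoc 2 i 4)))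

prod : List A → List B → List (A × B)
prod []       ys = []
prod (x ∷ xs) ys = map (x ,_) ys ++ prod xs ys

sum-map : ∀ (f : B → ℕ) (g : A → B) xs → sum f (map g xs) ≡ sum (f ∘ g) xs
sum-map f g []       = refl
sum-map f g (x ∷ xs) = cong (f (g x) +_) (sum-map f g xs)

sum-prod : ∀ (f : A × B → ℕ) xs ys → sum f (prod xs ys) ≡ sum (λ x → sum (λ y → f (x , y)) ys) xs
sum-prod f []       ys = refl
sum-prod f (x ∷ xs) ys = trans (sum-++ f (map (x ,_) ys) (prod xs ys)) (cong₂ _+_ (sum-map f (x ,_) ys) (sum-prod f xs ys))

sum-*ʳ : ∀ k (f : A → ℕ) xs → sum (λ x → f x * k) xs ≡ sum f xs * k
sum-*ʳ k f xs = trans (sum-cong (λ x → *-comm (f x) k) xs) (trans (sum-*ˡ k f xs) (*-comm k (sum f xs)))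

private
  eighth : ∀ n X C C′ → n * n ≤ C * 4 → C ≤ X * n * 2 + C′ → X * 16 ≤ n → n * n ≤ C′ * 8
  eighth n X C C′ h1 h2 h3 = certified (n ∷ X ∷ C ∷ C′ ∷ [])
    ((‵ 0 :* ‵ 0 , ‵ 2 :* ♯ 4) ∷ (‵ 2 , ‵ 1 :* ‵ 0 :* ♯ 2 :+ ‵ 3) ∷ (‵ 1 :* ♯ 16 , ‵ 0) ∷ [])
    ((♯ 2) ∷ (♯ 8) ∷ (‵ 0) ∷ [])
    0 (‵ 0 :* ‵ 0) (‵ 3 :* ♯ 8) refl (h1 , h2 , h3 , tt)
  quarter : ∀ n X C C′ → n ≤ C * 2 → C ≤ X + C′ → X * 16 ≤ n → n ≤ C′ * 4
  quarter n X C C′ h1 h2 h3 = certified (n ∷ X ∷ C ∷ C′ ∷ [])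
    ((‵ 0 , ‵ 2 :* ♯ 2) ∷ (‵ 2 , ‵ 1 :+ ‵ 3) ∷ (‵ 1 :* ♯ 16 , ‵ 0) ∷ [])
    ((♯ 8) ∷ (♯ 16) ∷ (♯ 1) ∷ [])
    6 (‵ 0) (‵ 3 :* ♯ 4) refl (h1 , h2 , h3 , tt)

module Absorption {V : Set} (vs : List V) (h : V → V → V → Bool)
  (h-swap : ∀ x y z → h x y z ≡ h y x z) (h-rot : ∀ x y z → h x y z ≡ h y z x)
  (h-irr : ∀ x y → h x x y ≡ false) (w : V → Bool)
  (complete : ∀ x → ∃[ vs′ ] (vs ≈ x ∷ vs′)) where

  open Graph vs h h-swap h-rot h-irr

  Gadget : Set
  Gadget = Triple (Triple V)

  common : V → V → ℕ
  common a x = sum (λ p → sum (λ q → ⟦ h a p q ∧ h x p q ⟧) vs) vs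

  compatible : V → V → Bool
  compatible a x = n * n ≤ᵇ common a x * 4

  u : V → Bool
  u x = not (w x)

  covers : Gadget → Triple V → Bool
  covers ((_ , p₁ , p₂) , (_ , q₁ , q₂) , (_ , r₁ , r₂)) (x , y , z) = ∧₃ (h x p₁ p₂) (h y q₁ q₂) (h z r₁ r₂)

  -- The three edges of a gadget; their first vertices form an edge as well, which is used when
  -- the first vertices are exchanged for the three vertices to be absorbed.
  faulty : Gadget → ℕ
  faulty (e@(a , _) , f@(b , _) , g@(c , _)) = nonedge e + nonedge f + nonedge g + nonedge (a , b , c)

  uncovered : List Gadget → Triple V → Bool
  uncovered []      t = true
  uncovered (g ∷ F) t = not (covers g t) ∧ uncovered F t

  restrict : ∀ (b : V → V → ℕ) → (∀ x y → b x y ≤ 1) → ∀ X R → (∀ f → sum f vs ≡ sum f X + sum f R) →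
    sum (λ x → sum (b x) vs) vs ≤ size X * n * 2 + sum (λ x → sum (b x) R) R
  restrict b b≤1 X R part = begin
    sum (λ x → sum (b x) vs) vs                        ≡⟨ trans (sum-cong (λ x → part (b x)) vs) (sum-+ _ _ vs) ⟩
    sum (λ x → sum (b x) X) vs + sum (λ x → sum (b x) R) vs
      ≤⟨ +-mono-≤ (≤-trans (sum-mono (λ x → sum-mono (b≤1 x) X) vs) (≤-reflexive (sum-const (size X) vs)))
           (≤-trans (≤-reflexive (part (λ x → sum (b x) R))) (+-monoˡ-≤ _ (≤-trans (sum-mono R-part X) (≤-reflexive (sum-const n X))))) ⟩
    size X * n + (n * size X + S)                      ≡⟨ a*b+[b*a+c]≡a*b*2+c (size X) n S ⟩
    size X * n * 2 + S                                 ∎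
    where
    open ≤-Reasoning
    S = sum (λ x → sum (b x) R) R
    R-part : ∀ x → sum (b x) R ≤ n
    R-part x = ≤-trans (sum-mono (b≤1 x) R) (≤-trans (m≤n+m _ (size X)) (≤-reflexive (sym (part (λ _ → 1)))))

  module _ (T : List (Triple V)) where

    weight : (Triple V → Bool) → ℕ
    weight κ = sum (λ t → ⟦ κ t ⟧) T

    pick-pair : ∀ X R → (∀ f → sum f vs ≡ sum f X + sum f R) → size X * 16 ≤ n → ∀ a (φ : Triple V → V) κ →
      (∀ t → κ t ≡ true → n * n ≤ common a (φ t) * 4) → 0 < n → 0 < weight κ →
      ∃[ p ] ∃[ q ] ∃[ R′ ] (R ≈ p ∷ q ∷ R′ × h a p q ≡ true × weight κ ≤ weight (λ t → κ t ∧ h (φ t) p q) * 16)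
    pick-pair X R part X-small a φ κ compat n>0 κ>0 = second (select-heavy F (weight κ * n) R heavy)
      where
      g : V → V → Triple V → ℕ
      g p q t = ⟦ κ t ∧ (h a p q ∧ h (φ t) p q) ⟧
      F : V → ℕ
      F p = sum (λ q → sum (g p q) T) R * 16
      R≤n : size R ≤ n
      R≤n = ≤-trans (m≤n+m _ (size X)) (≤-reflexive (sym (part (λ _ → 1))))
      per-item : ∀ t → ⟦ κ t ⟧ * (n * n) ≤ sum (λ p → sum (λ q → g p q t) R) R * 8
      per-item t with κ t in κt
      ... | false = z≤n
      ... | true  = ≤-trans (≤-reflexive (+-identityʳ _)) (eighth n (size X) (common a (φ t)) _ (compat t κt)
                      (restrict (λ p q → ⟦ h a p q ∧ h (φ t) p q ⟧) (λ p q → ⟦⟧≤1 (h a p q ∧ h (φ t) p q)) X R part) X-small)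
      total : weight κ * (n * n) ≤ sum (λ p → sum (λ q → sum (g p q) T) R) R * 8
      total = begin
        weight κ * (n * n)                           ≡⟨ sym (sum-*ʳ (n * n) (λ t → ⟦ κ t ⟧) T) ⟩
        sum (λ t → ⟦ κ t ⟧ * (n * n)) T              ≤⟨ sum-mono per-item T ⟩
        sum (λ t → sum (λ p → sum (λ q → g p q t) R) R * 8) T
          ≡⟨ sum-*ʳ 8 (λ t → sum (λ p → sum (λ q → g p q t) R) R) T ⟩
        sum (λ t → sum (λ p → sum (λ q → g p q t) R) R) T * 8
          ≡⟨ cong (_* 8) (trans (sum-swap (λ t p → sum (λ q → g p q t) R) T R) (sum-cong (λ p → sum-swap (λ t q → g p q t) T R) R)) ⟩
        sum (λ p → sum (λ q → sum (g p q) T) R) R * 8 ∎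
        where open ≤-Reasoning
      heavy : weight κ * n * size R < sum F R
      heavy = begin-strict
        weight κ * n * size R                        ≤⟨ ≤-trans (*-monoʳ-≤ (weight κ * n) R≤n) (≤-reflexive (*-assoc (weight κ) n n)) ⟩
        weight κ * (n * n)                           <⟨ m<m*n (weight κ * (n * n)) 2 {{>-nonZero (*-mono-≤ κ>0 (*-mono-≤ n>0 n>0))}} (s≤s (s≤s z≤n)) ⟩
        weight κ * (n * n) * 2                       ≤⟨ *-monoˡ-≤ 2 total ⟩
        sum (λ p → sum (λ q → sum (g p q) T) R) R * 8 * 2 ≡⟨ *-assoc (sum (λ p → sum (λ q → sum (g p q) T) R) R) 8 2 ⟩
        sum (λ p → sum (λ q → sum (g p q) T) R) R * 16 ≡⟨ sym (sum-*ʳ 16 (λ p → sum (λ q → sum (g p q) T) R) R) ⟩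
        sum F R                                      ∎
        where
        open ≤-Reasoning
      g-diagonal : ∀ p → sum (g p p) T ≡ 0
      g-diagonal p = sum-zero (λ t → never (κ t) (h a p p) (h (φ t) p p) (h-irr₂ a p)) T
        where
        never : ∀ x y z → y ≡ false → ⟦ x ∧ (y ∧ z) ⟧ ≡ 0
        never true  .false z refl = refl
        never false y      z _    = refl
      second : ∃[ p ] ∃[ R₁ ] (weight κ * n < F p × R ≈ p ∷ R₁) → _
      second (p , R₁ , big , eq) = third (select-heavy (λ q → sum (g p q) T * 16) (weight κ) R₁ (begin-strict
          weight κ * size R₁           ≤⟨ *-monoʳ-≤ (weight κ) (≤-trans (≤-trans (n≤1+n _) (≤-reflexive (sym (eq (λ _ → 1))))) R≤n) ⟩
          weight κ * n                 <⟨ big ⟩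
          sum (λ q → sum (g p q) T) R * 16  ≡⟨ cong (_* 16) (trans (eq (λ q → sum (g p q) T)) (cong (_+ sum (λ q → sum (g p q) T) R₁) (g-diagonal p))) ⟩
          sum (λ q → sum (g p q) T) R₁ * 16 ≡⟨ sym (sum-*ʳ 16 (λ q → sum (g p q) T) R₁) ⟩
          sum (λ q → sum (g p q) T * 16) R₁ ∎))
        where
        open ≤-Reasoning
        third : ∃[ q ] ∃[ R₂ ] (weight κ < sum (g p q) T * 16 × R₁ ≈ q ∷ R₂) → _
        third (q , R₂ , big′ , eq′) = p , q , R₂ , (λ f → trans (eq f) (cong (f p +_) (eq′ f))) , edge ,
            ≤-trans (<⇒≤ big′) (*-monoˡ-≤ 16 (sum-mono (λ t → forget (κ t) (h a p q) (h (φ t) p q)) T))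
          where
          forget : ∀ x y z → ⟦ x ∧ (y ∧ z) ⟧ ≤ ⟦ x ∧ z ⟧
          forget true  true  z = ≤-refl
          forget true  false z = z≤n
          forget false y     z = z≤n
          edge : h a p q ≡ true
          never : ∀ x y z → y ≡ false → ⟦ x ∧ (y ∧ z) ⟧ ≡ 0
          never true  .false z refl = refl
          never false y      z _    = refl
          edge = test (h a p q) (λ hapq → hapq) (λ hapq → ⊥-elim (<⇒≱ big′
            (≤-trans (≤-reflexive (cong (_* 16) (sum-zero (λ t → never (κ t) (h a p q) (h (φ t) p q) hapq) T))) z≤n)))

    pick-vertex : ∀ X R → (∀ f → sum f vs ≡ sum f X + sum f R) → size X * 16 ≤ n → ∀ (φ : Triple V → V) κ →
      (∀ x → n ≤ sum (λ c → ⟦ u c ∧ compatible c x ⟧) vs * 2) → 0 < n → 0 < weight κ →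
      ∃[ c ] ∃[ R′ ] (R ≈ c ∷ R′ × w c ≡ false × weight κ ≤ weight (λ t → κ t ∧ compatible c (φ t)) * 8)
    pick-vertex X R part X-small φ κ many n>0 κ>0 = finish (select-heavy (λ c → sum (g c) T * 8) (weight κ) R heavy)
      where
      g : V → Triple V → ℕ
      g c t = ⟦ κ t ∧ (u c ∧ compatible c (φ t)) ⟧
      R≤n : size R ≤ n
      R≤n = ≤-trans (m≤n+m _ (size X)) (≤-reflexive (sym (part (λ _ → 1))))
      per-item : ∀ t → ⟦ κ t ⟧ * n ≤ sum (λ c → g c t) R * 4
      per-item t with κ t
      ... | false = z≤n
      ... | true  = ≤-trans (≤-reflexive (+-identityʳ n)) (quarter n (size X) _ _ (many (φ t))
                      (≤-trans (≤-reflexive (part _)) (+-monoˡ-≤ _ (sum-mono (λ c → ⟦⟧≤1 (u c ∧ compatible c (φ t))) X))) X-small)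
      heavy : weight κ * size R < sum (λ c → sum (g c) T * 8) R
      heavy = begin-strict
        weight κ * size R                            ≤⟨ *-monoʳ-≤ (weight κ) R≤n ⟩
        weight κ * n                                 <⟨ m<m*n (weight κ * n) 2 {{>-nonZero (*-mono-≤ κ>0 n>0)}} (s≤s (s≤s z≤n)) ⟩
        weight κ * n * 2                             ≡⟨ cong (_* 2) (sym (sum-*ʳ n (λ t → ⟦ κ t ⟧) T)) ⟩
        sum (λ t → ⟦ κ t ⟧ * n) T * 2                ≤⟨ *-monoˡ-≤ 2 (sum-mono per-item T) ⟩
        sum (λ t → sum (λ c → g c t) R * 4) T * 2
          ≡⟨ cong (_* 2) (trans (sum-*ʳ 4 (λ t → sum (λ c → g c t) R) T) (cong (_* 4) (sum-swap (λ t c → g c t) T R))) ⟩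
        sum (λ c → sum (g c) T) R * 4 * 2            ≡⟨ *-assoc (sum (λ c → sum (g c) T) R) 4 2 ⟩
        sum (λ c → sum (g c) T) R * 8                ≡⟨ sym (sum-*ʳ 8 (λ c → sum (g c) T) R) ⟩
        sum (λ c → sum (g c) T * 8) R                ∎
        where
        open ≤-Reasoning
      finish : ∃[ c ] ∃[ R′ ] (weight κ < sum (g c) T * 8 × R ≈ c ∷ R′) → _
      finish (c , R′ , big , eq) = c , R′ , eq , c-in-U ,
          ≤-trans (<⇒≤ big) (*-monoˡ-≤ 8 (sum-mono (λ t → forget (κ t) (u c) (compatible c (φ t))) T))
        where
        forget : ∀ x y z → ⟦ x ∧ (y ∧ z) ⟧ ≤ ⟦ x ∧ z ⟧
        forget true  true  z = ≤-refl
        forget true  false z = z≤n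
        forget false y     z = z≤n
        c-in-U : w c ≡ false
        never : ∀ x y z → y ≡ true → ⟦ x ∧ (not y ∧ z) ⟧ ≡ 0
        never true  .true z refl = refl
        never false y     z _    = refl
        c-in-U = test (w c) (λ wc → ⊥-elim (<⇒≱ big
          (≤-trans (≤-reflexive (cong (_* 8) (sum-zero (λ t → never (κ t) (w c) (compatible c (φ t)) wc) T))) z≤n))) (λ wc → wc)

    pick-edge : ∀ X R → (∀ f → sum f vs ≡ sum f X + sum f R) → size X * 16 ≤ n → ∀ c →
      n * n ≤ sum (λ p → sum (λ q → ⟦ u p ∧ (u q ∧ h c p q) ⟧) vs) vs * 4 → 0 < n →
      ∃[ a ] ∃[ b ] ∃[ R′ ] (R ≈ a ∷ b ∷ R′ × w a ≡ false × w b ≡ false × h c a b ≡ true)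
    pick-edge X R part X-small c rich n>0 = second (select-positive (λ p → sum (g p) R) R (*-cancelʳ-< _ 0 _ (<-≤-trans (*-mono-≤ n>0 n>0)
        (eighth n (size X) _ _ rich (restrict g (λ p q → ⟦⟧≤1 (u p ∧ (u q ∧ h c p q))) X R part) X-small))))
      where
      g : V → V → ℕ
      g p q = ⟦ u p ∧ (u q ∧ h c p q) ⟧
      g-diagonal : ∀ p → g p p ≡ 0
      g-diagonal p = trans (cong (λ b → ⟦ u p ∧ (u p ∧ b) ⟧) (h-irr₂ c p)) (never (u p))
        where
        never : ∀ x → ⟦ x ∧ (x ∧ false) ⟧ ≡ 0
        never true  = refl
        never false = refl
      not-false : ∀ {x} → not x ≡ true → x ≡ false
      not-false {false} _ = refl
      second : ∃[ a ] ∃[ R₁ ] (0 < sum (g a) R × R ≈ a ∷ R₁) → _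
      second (a , R₁ , pos , eq) = third (select-positive (g a) R₁ (≤-trans pos (≤-reflexive (trans (eq (g a)) (cong (_+ sum (g a) R₁) (g-diagonal a))))))
        where
        third : ∃[ b ] ∃[ R₂ ] (0 < g a b × R₁ ≈ b ∷ R₂) → _
        third (b , R₂ , pos′ , eq′) = let ua , rest = ∧-split {u a} (⟦⟧>0 {u a ∧ (u b ∧ h c a b)} pos′) ; ub , hcab = ∧-split {u b} rest in
          a , b , R₂ , (λ f → trans (eq f) (cong (f a +_) (eq′ f))) , not-false ua , not-false ub , hcab

private
  shrink : ∀ N N′ a b c d → N′ + d ≤ N → N ≤ a * 8 → a ≤ b * 16 → b ≤ c * 16 → c ≤ d * 16 → N′ * 32768 ≤ N * 32767
  shrink N N′ a b c d h1 h2 h3 h4 h5 = certified (N ∷ N′ ∷ a ∷ b ∷ c ∷ d ∷ [])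
    ((‵ 1 :+ ‵ 5 , ‵ 0) ∷ (‵ 0 , ‵ 2 :* ♯ 8) ∷ (‵ 2 , ‵ 3 :* ♯ 16) ∷ (‵ 3 , ‵ 4 :* ♯ 16) ∷ (‵ 4 , ‵ 5 :* ♯ 16) ∷ [])
    ((♯ 32768) ∷ (♯ 1) ∷ (♯ 8) ∷ (♯ 128) ∷ (♯ 2048) ∷ [])
    0 (‵ 1 :* ♯ 32768) (‵ 0 :* ♯ 32767) refl (h1 , h2 , h3 , h4 , h5 , tt)

module Families {V : Set} (vs : List V) (h : V → V → V → Bool)
  (h-swap : ∀ x y z → h x y z ≡ h y x z) (h-rot : ∀ x y z → h x y z ≡ h y z x)
  (h-irr : ∀ x y → h x x y ≡ false) (w : V → Bool)
  (complete : ∀ x → ∃[ vs′ ] (vs ≈ x ∷ vs′)) where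

  open Graph vs h h-swap h-rot h-irr
  open Absorption vs h h-swap h-rot h-irr w complete

  cube : List (Triple V)
  cube = prod vs (prod vs vs)

  cube-size : size cube ≡ n * (n * n)
  cube-size = trans (sum-prod (λ _ → 1) vs (prod vs vs)) (trans (sum-const (size (prod vs vs)) vs)
    (trans (*-comm (size (prod vs vs)) n) (cong (n *_) (trans (sum-prod (λ _ → 1) vs vs) (sum-const n vs)))))

  cube-member : ∀ (g : Triple V → ℕ) t → g t ≤ sum g cube
  cube-member g (x , y , z) = ≤-trans (member (λ z → g (x , y , z)) z) (≤-trans (member (λ y → sum (λ z → g (x , y , z)) vs) y)
    (≤-trans (≤-reflexive (sym (sum-prod (λ yz → g (x , yz)) vs vs))) (≤-trans (member (λ x → sum (λ yz → g (x , yz)) (prod vs vs)) x)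
      (≤-reflexive (sym (sum-prod g vs (prod vs vs)))))))
    where
    member : ∀ (f : V → ℕ) x → f x ≤ sum f vs
    member f x = ≈-member f vs x (proj₁ (complete x)) (proj₂ (complete x))

  admissible : Triple V → Bool
  admissible (x , y , z) = u x ∧ u y

  target : List Gadget → Triple V → Bool
  target F t = admissible t ∧ uncovered F t

  needy : List Gadget → ℕ
  needy F = weight cube (target F)

  Covering-family : List Gadget → Set
  Covering-family F = ∀ t → admissible t ≡ true → ∃[ g ] ∃[ F′ ] (F ≈ g ∷ F′ × covers g t ≡ true)

  covered-by : ∀ F t → uncovered F t ≡ false → ∃[ g ] ∃[ F′ ] (F ≈ g ∷ F′ × covers g t ≡ true)
  covered-by (g ∷ F) t unc with covers g t in cov
  ... | true  = g , F , (λ f → refl) , cov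
  ... | false with covered-by F t unc
  ...   | g′ , F′ , eq , cov′ = g′ , g ∷ F′ , (λ f → trans (cong (f g +_) (eq f)) (a+[b+c]≡b+[a+c] (f g) (f g′) _)) , cov′

  covering : ∀ F → needy F ≡ 0 → Covering-family F
  covering F none t adm = covered-by F t (finish (admissible t) (uncovered F t) adm (n≤0⇒n≡0 (≤-trans (cube-member (λ t → ⟦ target F t ⟧) t) (≤-reflexive none))))
    where
    finish : ∀ a b → a ≡ true → ⟦ a ∧ b ⟧ ≡ 0 → b ≡ false
    finish .true false refl _ = refl

  private
    gadget-count : Always 6 (λ a b c d e f → (⟦ a ∧ (not (∧₃ d e f) ∧ b) ⟧ + ⟦ ((((a ∧ b) ∧ c) ∧ d) ∧ e) ∧ f ⟧) ≤ᵇ ⟦ a ∧ b ⟧)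
    gadget-count = every-elim 6 _ refl

    move₁ : ∀ X R x R′ → (∀ f → sum f vs ≡ sum f X + sum f R) → R ≈ x ∷ R′ → ∀ f → sum f vs ≡ sum f (x ∷ X) + sum f R′
    move₁ X R x R′ part eq f = trans (part f) (trans (cong (sum f X +_) (eq f)) (a+[b+c]≡b+a+c (sum f X) (f x) (sum f R′)))

    move₂ : ∀ X R x y R′ → (∀ f → sum f vs ≡ sum f X + sum f R) → R ≈ x ∷ y ∷ R′ → ∀ f → sum f vs ≡ sum f (x ∷ y ∷ X) + sum f R′
    move₂ X R x y R′ part eq f = trans (part f) (trans (cong (sum f X +_) (eq f)) (a+[b+[c+d]]≡b+[c+a]+d (sum f X) (f x) (f y) (sum f R′)))

    inherit : ∀ {a b} k → 0 < a → a ≤ b * k → 0 < b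
    inherit {a} {zero}  k a>0 a≤ = ⊥-elim (<⇒≱ a>0 a≤)
    inherit {a} {suc b} k a>0 a≤ = s≤s z≤n

  module _ (n>0 : 0 < n)
    (compatible-U : ∀ a x → w a ≡ false → w x ≡ false → n * n ≤ common a x * 4)
    (many-compatible : ∀ x → n ≤ sum (λ c → ⟦ u c ∧ compatible c x ⟧) vs * 2)
    (U-links : ∀ c → w c ≡ false → n * n ≤ sum (λ p → sum (λ q → ⟦ u p ∧ (u q ∧ h c p q) ⟧) vs) vs * 4) where

    -- 32768 = 8 · 16³: the choice of c keeps an eighth of the needy triples, that of each of the three pairs a sixteenth.
    NewGadget : List Gadget → List V → Set
    NewGadget F R = ∃[ g ] ∃[ R′ ] ((∀ f → sum f R ≡ hat (hat f) g + sum f R′) × faulty g ≡ 0 × needy (g ∷ F) * 32768 ≤ needy F * 32767)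

    new-gadget : ∀ F X R → (∀ f → sum f vs ≡ sum f X + sum f R) → (9 + size X) * 16 ≤ n → 0 < needy F → NewGadget F R
    new-gadget F X R part room pos = with-c (pick-vertex cube X R part small (λ t → proj₂ (proj₂ t)) κ₀ many-compatible n>0 pos)
      where
      small : size X * 16 ≤ n
      small = ≤-trans (*-monoˡ-≤ 16 (m≤n+m (size X) 9)) room
      κ₀ : Triple V → Bool
      κ₀ = target F
      with-c : ∃[ c ] ∃[ R₁ ] (R ≈ c ∷ R₁ × w c ≡ false × weight cube κ₀ ≤ weight cube (λ t → κ₀ t ∧ compatible c (proj₂ (proj₂ t))) * 8) → NewGadget F R
      with-c (c , R₁ , eq₁ , wc , le₁) = with-ab (pick-edge cube (c ∷ X) R₁ (move₁ X R c R₁ part eq₁) small₁ c (U-links c wc) n>0)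
        where
        small₁ : size (c ∷ X) * 16 ≤ n
        small₁ = ≤-trans (*-monoˡ-≤ 16 (m≤n+m (1 + size X) 8)) room
        κ₁ : Triple V → Bool
        κ₁ t = κ₀ t ∧ compatible c (proj₂ (proj₂ t))
        pos₁ : 0 < weight cube κ₁
        pos₁ = inherit 8 pos le₁
        with-ab : ∃[ a ] ∃[ b ] ∃[ R₂ ] (R₁ ≈ a ∷ b ∷ R₂ × w a ≡ false × w b ≡ false × h c a b ≡ true) → NewGadget F R
        with-ab (a , b , R₂ , eq₂ , wa , wb , hcab) = with-p (pick-pair cube X₂ R₂ part₂ small₂ a proj₁ κ₁ compat-a n>0 pos₁)
          where
          X₂ = a ∷ b ∷ c ∷ X
          part₂ : ∀ f → sum f vs ≡ sum f X₂ + sum f R₂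
          part₂ = move₂ (c ∷ X) R₁ a b R₂ (move₁ X R c R₁ part eq₁) eq₂
          small₂ : size X₂ * 16 ≤ n
          small₂ = ≤-trans (*-monoˡ-≤ 16 (m≤n+m (3 + size X) 6)) room
          in-U : ∀ x y z → u x ∧ z ≡ true → w x ≡ false
          in-U x y z eq with w x
          ... | false = refl
          ... | true  = sym eq
          compat-a : ∀ t → κ₁ t ≡ true → n * n ≤ common a (proj₁ t) * 4
          compat-a (x , y , z) eq = compatible-U a x wa (in-U x y (u y) (proj₁ (∧-split {u x ∧ u y} (proj₁ (∧-split {κ₀ (x , y , z)} eq)))))
          with-p : ∃[ p₁ ] ∃[ p₂ ] ∃[ R₃ ] (R₂ ≈ p₁ ∷ p₂ ∷ R₃ × h a p₁ p₂ ≡ true × weight cube κ₁ ≤ weight cube (λ t → κ₁ t ∧ h (proj₁ t) p₁ p₂) * 16) → NewGadget F R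
          with-p (p₁ , p₂ , R₃ , eq₃ , hp , le₂) = with-q (pick-pair cube X₃ R₃ part₃ small₃ b (λ t → proj₁ (proj₂ t)) κ₂ compat-b n>0 pos₂)
            where
            X₃ = p₁ ∷ p₂ ∷ X₂
            part₃ : ∀ f → sum f vs ≡ sum f X₃ + sum f R₃
            part₃ = move₂ X₂ R₂ p₁ p₂ R₃ part₂ eq₃
            small₃ : size X₃ * 16 ≤ n
            small₃ = ≤-trans (*-monoˡ-≤ 16 (m≤n+m (5 + size X) 4)) room
            κ₂ : Triple V → Bool
            κ₂ t = κ₁ t ∧ h (proj₁ t) p₁ p₂
            pos₂ : 0 < weight cube κ₂
            pos₂ = inherit 16 pos₁ le₂
            compat-b : ∀ t → κ₂ t ≡ true → n * n ≤ common b (proj₁ (proj₂ t)) * 4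
            compat-b (x , y , z) eq = compatible-U b y wb (in-U y x true (trans (∧-identityʳ (u y))
              (proj₂ (∧-split {u x} (proj₁ (∧-split {u x ∧ u y} (proj₁ (∧-split {κ₀ (x , y , z)} (proj₁ (∧-split {κ₁ (x , y , z)} eq))))))))))
            with-q : ∃[ q₁ ] ∃[ q₂ ] ∃[ R₄ ] (R₃ ≈ q₁ ∷ q₂ ∷ R₄ × h b q₁ q₂ ≡ true × weight cube κ₂ ≤ weight cube (λ t → κ₂ t ∧ h (proj₁ (proj₂ t)) q₁ q₂) * 16) → NewGadget F R
            with-q (q₁ , q₂ , R₄ , eq₄ , hq , le₃) = with-r (pick-pair cube X₄ R₄ part₄ small₄ c (λ t → proj₂ (proj₂ t)) κ₃ compat-c n>0 pos₃)
              where
              X₄ = q₁ ∷ q₂ ∷ X₃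
              part₄ : ∀ f → sum f vs ≡ sum f X₄ + sum f R₄
              part₄ = move₂ X₃ R₃ q₁ q₂ R₄ part₃ eq₄
              small₄ : size X₄ * 16 ≤ n
              small₄ = ≤-trans (*-monoˡ-≤ 16 (m≤n+m (7 + size X) 2)) room
              κ₃ : Triple V → Bool
              κ₃ t = κ₂ t ∧ h (proj₁ (proj₂ t)) q₁ q₂
              pos₃ : 0 < weight cube κ₃
              pos₃ = inherit 16 pos₂ le₃
              compat-c : ∀ t → κ₃ t ≡ true → n * n ≤ common c (proj₂ (proj₂ t)) * 4
              compat-c t@(x , y , z) eq = ≤ᵇ⇒≤ _ _ (subst IsTrue (sym (proj₂ (∧-split {κ₀ t} (proj₁ (∧-split {κ₁ t} (proj₁ (∧-split {κ₂ t} eq))))))) tt)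
              with-r : ∃[ r₁ ] ∃[ r₂ ] ∃[ R₅ ] (R₄ ≈ r₁ ∷ r₂ ∷ R₅ × h c r₁ r₂ ≡ true × weight cube κ₃ ≤ weight cube (λ t → κ₃ t ∧ h (proj₂ (proj₂ t)) r₁ r₂) * 16) → NewGadget F R
              with-r (r₁ , r₂ , R₅ , eq₅ , hr , le₄) = g , R₅ , split ,
                  cong₂ _+_ (cong₂ _+_ (cong₂ _+_ (true-not hp) (true-not hq)) (true-not hr)) (true-not (trans (sym (h-rot c a b)) hcab)) ,
                  shrink (needy F) (needy (g ∷ F)) (weight cube κ₁) (weight cube κ₂) (weight cube κ₃) (weight cube κ₄) fewer le₁ le₂ le₃ le₄
                where
                g : Gadget
                g = (a , p₁ , p₂) , (b , q₁ , q₂) , (c , r₁ , r₂)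
                κ₄ : Triple V → Bool
                κ₄ t = κ₃ t ∧ h (proj₂ (proj₂ t)) r₁ r₂
                fewer : needy (g ∷ F) + weight cube κ₄ ≤ needy F
                fewer = ≤-trans (≤-reflexive (sym (sum-+ _ _ cube))) (sum-mono (λ (x , y , z) → ≤ᵇ⇒≤ _ _ (subst IsTrue
                  (sym (gadget-count (u x ∧ u y) (uncovered F (x , y , z)) (compatible c z) (h x p₁ p₂) (h y q₁ q₂) (h z r₁ r₂))) tt)) cube)
                split : ∀ f → sum f R ≡ hat (hat f) g + sum f R₅
                split f = trans (eq₁ f) (trans (cong (f c +_) (trans (eq₂ f) (cong (λ s → f a + (f b + s)) (trans (eq₃ f)
                    (cong (λ s → f p₁ + (f p₂ + s)) (trans (eq₄ f) (cong (λ s → f q₁ + (f q₂ + s)) (eq₅ f))))))))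
                  (shuffle₁₂ (f c) (f a) (f b) (f p₁) (f p₂) (f q₁) (f q₂) (f r₁) (f r₂) (sum f R₅)))

    -- A variable m keeps the numeral 32767 from being unfolded.
    module _ (m : ℕ) (m-eq : m ≡ 32767) where

      record Family (R : List V) (k : ℕ) : Set where
        field
          F     : List Gadget
          R′    : List V
          split : ∀ f → sum f R ≡ sum (hat (hat f)) F + sum f R′
          small : size F ≤ k
          sound : sum faulty F ≡ 0
          cover : Covering-family F

      grow : ∀ i F X R R₀ → (∀ f → sum f vs ≡ sum f X + sum f R) → (∀ f → sum f R₀ ≡ sum (hat (hat f)) F + sum f R) → sum faulty F ≡ 0 →
        (i * 9 + size X) * 16 ≤ n → needy F * m ^ i < suc m ^ i → Family R₀ (size F + i)
      grow zero F X R R₀ part split sound room few = record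
        { F = F ; R′ = R ; split = split ; small = m≤m+n _ 0 ; sound = sound ; cover = covering F (n<1⇒n≡0 (≤-trans (≤-reflexive (cong suc (sym (*-identityʳ _)))) few)) }
      grow (suc i) F X R R₀ part split sound room few with needy F in eqN
      ... | zero  = record { F = F ; R′ = R ; split = split ; small = m≤m+n _ _ ; sound = sound ; cover = covering F eqN }
      ... | suc N = next (new-gadget F X R part (≤-trans (*-monoˡ-≤ 16 (+-monoˡ-≤ (size X) (m≤m+n 9 (i * 9)))) room) (≤-trans (s≤s z≤n) (≤-reflexive (sym eqN))))
        where
        next : NewGadget F R → Family R₀ (size F + suc i)
        next (g , R₁ , g-split , g-sound , shrunk) = subst (Family R₀) (sym (+-suc (size F) i))
          (grow i (g ∷ F) (flat (flat (g ∷ [])) ++ X) R₁ R₀ part₁ split₁ (cong₂ _+_ g-sound sound) room₁ few₁)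
          where
          part₁ : ∀ f → sum f vs ≡ sum f (flat (flat (g ∷ [])) ++ X) + sum f R₁
          part₁ f = trans (part f) (trans (cong (sum f X +_) (g-split f)) (trans (a+[b+c]≡b+a+c (sum f X) (hat (hat f) g) (sum f R₁))
            (cong (_+ sum f R₁) (sym (trans (sum-++ f (flat (flat (g ∷ []))) X) (cong (_+ sum f X)
              (trans (sum-flat f (flat (g ∷ []))) (trans (sum-flat (hat f) (g ∷ [])) (+-identityʳ _)))))))))
          split₁ : ∀ f → sum f R₀ ≡ sum (hat (hat f)) (g ∷ F) + sum f R₁
          split₁ f = trans (split f) (trans (cong (sum (hat (hat f)) F +_) (g-split f)) (a+[b+c]≡b+a+c (sum (hat (hat f)) F) (hat (hat f) g) (sum f R₁)))
          room₁ : (i * 9 + size (flat (flat (g ∷ [])) ++ X)) * 16 ≤ n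
          room₁ = ≤-trans (≤-reflexive (cong (_* 16) (a+[9+b]≡9+a+b (i * 9) (size X)))) room
          shrunk′ : needy (g ∷ F) * suc m ≤ suc N * m
          shrunk′ = subst₂ _≤_ (cong (λ k → needy (g ∷ F) * suc k) (sym m-eq)) (cong₂ _*_ eqN (sym m-eq)) shrunk
          few₁ : needy (g ∷ F) * m ^ i < suc m ^ i
          few₁ = *-cancelˡ-< (suc m) _ _ (begin-strict
            suc m * (needy (g ∷ F) * m ^ i)   ≡⟨ a*[b*c]≡b*a*c (suc m) (needy (g ∷ F)) (m ^ i) ⟩
            needy (g ∷ F) * suc m * m ^ i     ≤⟨ *-monoˡ-≤ (m ^ i) shrunk′ ⟩
            suc N * m * m ^ i                 ≡⟨ *-assoc (suc N) m (m ^ i) ⟩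
            suc N * (m * m ^ i)               <⟨ few ⟩
            suc m * suc m ^ i                 ∎)
            where
            open ≤-Reasoning

      record Reserve (k J : ℕ) : Set where
        field
          ℱ     : List (List Gadget)
          R     : List V
          part  : ∀ f → sum f vs ≡ sum (λ F → sum (hat (hat f)) F) ℱ + sum f R
          many  : size ℱ ≡ J
          small : sum size ℱ ≤ J * k
          good  : All (λ F → sum faulty F ≡ 0 × Covering-family F) ℱ

      used : List (List Gadget) → List V
      used []      = []
      used (F ∷ ℱ) = flat (flat F) ++ used ℱ

      sum-used : ∀ f ℱ → sum f (used ℱ) ≡ sum (λ F → sum (hat (hat f)) F) ℱ
      sum-used f []      = refl
      sum-used f (F ∷ ℱ) = trans (sum-++ f (flat (flat F)) (used ℱ)) (cong₂ _+_ (trans (sum-flat f (flat F)) (sum-flat (hat f) F)) (sum-used f ℱ))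

      size-used : ∀ ℱ → size (used ℱ) ≡ sum size ℱ * 9
      size-used ℱ = trans (sum-used (λ _ → 1) ℱ) (trans (sum-cong (λ F → trans (sum-const 9 F) (*-comm 9 (size F))) ℱ) (sum-*ʳ 9 size ℱ))

      reserve : ∀ k J → n * (n * n) * m ^ k < suc m ^ k → (suc J * k) * 9 * 16 ≤ n → Reserve k J
      reserve k zero    _   _    = record { ℱ = [] ; R = vs ; part = λ f → refl ; many = refl ; small = z≤n ; good = [] }
      reserve k (suc J) pow room = record
        { ℱ = F ∷ ℱ ; R = R′ ; part = λ f → trans (part f) (trans (cong (sum (λ F → sum (hat (hat f)) F) ℱ +_) (split f)) (a+[b+c]≡b+a+c (sum (λ F → sum (hat (hat f)) F) ℱ) (sum (hat (hat f)) F) (sum f R′)))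
        ; many = cong suc many ; small = +-mono-≤ fsmall small ; good = (sound , cover) ∷ good }
        where
        open Reserve (reserve k J pow (≤-trans (*-monoˡ-≤ 16 (*-monoˡ-≤ 9 (m≤n+m (suc J * k) k))) room))
        room′ : (k * 9 + size (used ℱ)) * 16 ≤ n
        room′ = ≤-trans (*-monoˡ-≤ 16 (≤-trans (+-monoʳ-≤ (k * 9) (≤-trans (≤-reflexive (size-used ℱ)) (*-monoˡ-≤ 9 small)))
          (≤-trans (≤-reflexive (sym (*-distribʳ-+ 9 k (J * k)))) (*-monoˡ-≤ 9 (m≤n+m (suc J * k) k))))) room
        open Family (grow k [] (used ℱ) R R (λ f → trans (part f) (cong (_+ sum f R) (sym (sum-used f ℱ)))) (λ f → refl) refl room′
          (≤-<-trans (*-monoˡ-≤ (m ^ k) (≤-trans (sum-mono (λ t → ⟦⟧≤1 (target [] t)) cube) (≤-reflexive cube-size))) pow)) renaming (small to fsmall)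

      record Absorbed (ℱ : List (List Gadget)) (Ts : List (Triple V)) : Set where
        field
          N       : List (Triple V)
          balance : ∀ f → sum (hat f) N ≡ sum (λ F → sum (hat (hat f)) F) ℱ + sum (hat f) Ts
          count   : size N ≡ sum size ℱ * 3 + size Ts
          proper   : sum nonedge N ≡ 0

      family-edges : ∀ F → sum faulty F ≡ 0 → sum nonedge (flat F) ≡ 0
      family-edges []      _  = refl
      family-edges (g@(e₁@(a , _) , e₂@(b , _) , e₃@(c , _)) ∷ F) eq with vanishes {faulty g} eq
      ... | g-ok , rest with vanishes {nonedge e₁ + nonedge e₂ + nonedge e₃} g-ok
      ...   | e-ok , _ with vanishes {nonedge e₁ + nonedge e₂} e-ok
      ...     | e₁₂ , e₃-ok with vanishes {nonedge e₁} e₁₂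
      ...       | e₁-ok , e₂-ok = cong₂ _+_ e₁-ok (cong₂ _+_ e₂-ok (cong₂ _+_ e₃-ok (family-edges F rest)))

      flat-size : ∀ (F : List Gadget) → size (flat F) ≡ size F * 3
      flat-size F = trans (sum-flat (λ _ → 1) F) (trans (sum-const 3 F) (*-comm 3 (size F)))

      absorb : ∀ ℱ Ts → All (λ F → sum faulty F ≡ 0 × Covering-family F) ℱ → All (λ t → admissible t ≡ true) Ts → size Ts ≤ size ℱ → Absorbed ℱ Ts
      absorb [] [] _ _ _ = record { N = [] ; balance = λ f → refl ; count = refl ; proper = refl }
      absorb (F ∷ ℱ) [] ((sound , _) ∷ good) [] _ = record
        { N = flat F ++ N
        ; balance = λ f → trans (sum-++ (hat f) (flat F) N) (trans (cong₂ _+_ (sum-flat (hat f) F) (balance f)) (sym (+-assoc (sum (hat (hat f)) F) _ _)))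
        ; count = trans (sum-++ (λ _ → 1) (flat F) N) (trans (cong₂ _+_ (flat-size F) count) (a*3+[b*3+c]≡[a+b]*3+c (size F) (sum size ℱ) 0))
        ; proper = trans (sum-++ nonedge (flat F) N) (cong₂ _+_ (family-edges F sound) proper) }
        where
        open Absorbed (absorb ℱ [] good [] z≤n)
      absorb (F ∷ ℱ) (t@(x , y , z) ∷ Ts) ((sound , cover) ∷ good) (adm ∷ adms) (s≤s le) = use (cover t adm)
        where
        open Absorbed (absorb ℱ Ts good adms le)
        use : ∃[ g ] ∃[ F′ ] (F ≈ g ∷ F′ × covers g t ≡ true) → Absorbed (F ∷ ℱ) (t ∷ Ts)
        use (g@((a , p₁ , p₂) , (b , q₁ , q₂) , (c , r₁ , r₂)) , F′ , eq , cov) with ∧₃-split {h x p₁ p₂} {h y q₁ q₂} {h z r₁ r₂} cov | vanishes {faulty g} (trans (sym (eq faulty)) sound)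
        ... | hx , hy , hz | g-ok , rest = record
          { N = (a , b , c) ∷ (x , p₁ , p₂) ∷ (y , q₁ , q₂) ∷ (z , r₁ , r₂) ∷ flat F′ ++ N
          ; balance = λ f → trans (cong (λ s → f a + f b + f c + (f x + f p₁ + f p₂ + (f y + f q₁ + f q₂ + (f z + f r₁ + f r₂ + s))))
                (trans (sum-++ (hat f) (flat F′) N) (cong₂ _+_ (sum-flat (hat f) F′) (balance f))))
              (trans (shuffle₁₃ (f a) (f b) (f c) (f x) (f y) (f z) (f p₁) (f p₂) (f q₁) (f q₂) (f r₁) (f r₂) (sum (hat (hat f)) F′) (sum (λ F → sum (hat (hat f)) F) ℱ) (sum (hat f) Ts))
                (cong (λ s → s + sum (λ F → sum (hat (hat f)) F) ℱ + (f x + f y + f z + sum (hat f) Ts)) (sym (eq (hat (hat f))))))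
          ; count = trans (cong (4 +_) (trans (sum-++ (λ _ → 1) (flat F′) N) (cong₂ _+_ (flat-size F′) count)))
              (trans (4+[a*3+[b*3+c]]≡[1+a+b]*3+[1+c] (size F′) (sum size ℱ) (size Ts)) (cong (λ s → (s + sum size ℱ) * 3 + (1 + size Ts)) (sym (eq (λ _ → 1)))))
          ; proper = cong₂ _+_ (proj₂ (vanishes {nonedge (a , p₁ , p₂) + nonedge (b , q₁ , q₂) + nonedge (c , r₁ , r₂)} g-ok))
              (cong₂ _+_ (true-not hx) (cong₂ _+_ (true-not hy) (cong₂ _+_ (true-not hz)
                (trans (sum-++ nonedge (flat F′) N) (cong₂ _+_ (family-edges F′ rest) proper))))) }

private
  near-U : ∀ s n U k R → s * n * 2 ≤ U * U + k * k * 5 → n ≤ s * 3 + R * 4 → k * 600 ≤ n → R * n ≤ k * k → 1 + U * 5 ≤ n * 4 → 1 ≤ k → 1 ≤ 0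
  near-U s n U k R h1 h2 h3 h4 h5 h6 = certified (s ∷ n ∷ U ∷ k ∷ R ∷ [])
    ((‵ 0 :* ‵ 1 :* ♯ 2 , ‵ 2 :* ‵ 2 :+ ‵ 3 :* ‵ 3 :* ♯ 5) ∷ (‵ 1 , ‵ 0 :* ♯ 3 :+ ‵ 4 :* ♯ 4) ∷ (‵ 3 :* ♯ 600 , ‵ 1) ∷ (‵ 4 :* ‵ 1 , ‵ 3 :* ‵ 3) ∷ (♯ 1 :+ ‵ 2 :* ♯ 5 , ‵ 1 :* ♯ 4) ∷ (♯ 1 , ‵ 3) ∷ [])
    ((♯ 1800) ∷ (‵ 1 :* ♯ 1200) ∷ (‵ 3 :* ♯ 23 :+ ‵ 1 :* ♯ 48 :+ ♯ 29065) ∷ (♯ 4800) ∷ (‵ 2 :* ♯ 360 :+ ‵ 1 :* ♯ 288) ∷ (‵ 1 :* ♯ 28777 :+ ♯ 17439000) ∷ [])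
    17438999 (♯ 1) (♯ 0) refl (h1 , h2 , h3 , h4 , h5 , h6 , tt)
  common-bound : ∀ s n D D′ C E k R → s * n * 4 ≤ D + D′ + E * 2 → D + D′ ≤ n * n + C → E ≤ k * k → n ≤ s * 3 + R * 4 → k * 600 ≤ n → R * n ≤ k * k → n * n ≤ C * 4
  common-bound s n D D′ C E k R h1 h2 h3 h4 h5 h6 = certified (s ∷ n ∷ D ∷ D′ ∷ C ∷ E ∷ k ∷ R ∷ [])
    ((‵ 0 :* ‵ 1 :* ♯ 4 , ‵ 2 :+ ‵ 3 :+ ‵ 5 :* ♯ 2) ∷ (‵ 2 :+ ‵ 3 , ‵ 1 :* ‵ 1 :+ ‵ 4) ∷ (‵ 5 , ‵ 6 :* ‵ 6) ∷ (‵ 1 , ‵ 0 :* ♯ 3 :+ ‵ 7 :* ♯ 4) ∷ (‵ 6 :* ♯ 600 , ‵ 1) ∷ (‵ 7 :* ‵ 1 , ‵ 6 :* ‵ 6) ∷ [])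
    ((♯ 540000) ∷ (♯ 540000) ∷ (♯ 1080000) ∷ (‵ 1 :* ♯ 720000) ∷ (‵ 6 :* ♯ 6600 :+ ‵ 1 :* ♯ 11) ∷ (♯ 2880000) ∷ [])
    179988 (‵ 1 :* ‵ 1) (‵ 4 :* ♯ 4) refl (h1 , h2 , h3 , h4 , h5 , h6 , tt)
  W-degree-bound : ∀ s n D D′ E k R → s * n * 4 ≤ D + D′ + E * 2 → D′ ≤ n * n → E ≤ k * k → n ≤ s * 3 + R * 4 → k * 600 ≤ n → R * n ≤ k * k → n * n ≤ D * 4
  W-degree-bound s n D D′ E k R h1 h2 h3 h4 h5 h6 = certified (s ∷ n ∷ D ∷ D′ ∷ E ∷ k ∷ R ∷ [])
    ((‵ 0 :* ‵ 1 :* ♯ 4 , ‵ 2 :+ ‵ 3 :+ ‵ 4 :* ♯ 2) ∷ (‵ 3 , ‵ 1 :* ‵ 1) ∷ (‵ 4 , ‵ 5 :* ‵ 5) ∷ (‵ 1 , ‵ 0 :* ♯ 3 :+ ‵ 6 :* ♯ 4) ∷ (‵ 5 :* ♯ 600 , ‵ 1) ∷ (‵ 6 :* ‵ 1 , ‵ 5 :* ‵ 5) ∷ [])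
    ((♯ 540000) ∷ (♯ 540000) ∷ (♯ 1080000) ∷ (‵ 1 :* ♯ 720000) ∷ (‵ 5 :* ♯ 6600 :+ ‵ 1 :* ♯ 11) ∷ (♯ 2880000) ∷ [])
    179988 (‵ 1 :* ‵ 1) (‵ 2 :* ♯ 4) refl (h1 , h2 , h3 , h4 , h5 , h6 , tt)
  UU-bound : ∀ s n D C E k R U W X → s * n * 2 ≤ D + E → D ≤ C + X * 2 → X ≤ W * n → W + U ≤ n → n * 4 ≤ U * 5 → E ≤ k * k → n ≤ s * 3 + R * 4 → k * 600 ≤ n → R * n ≤ k * k → n * n ≤ C * 4
  UU-bound s n D C E k R U W X h1 h2 h3 h4 h5 h6 h7 h8 h9 = certified (s ∷ n ∷ D ∷ C ∷ E ∷ k ∷ R ∷ U ∷ W ∷ X ∷ [])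
    ((‵ 0 :* ‵ 1 :* ♯ 2 , ‵ 2 :+ ‵ 4) ∷ (‵ 2 , ‵ 3 :+ ‵ 9 :* ♯ 2) ∷ (‵ 9 , ‵ 8 :* ‵ 1) ∷ (‵ 8 :+ ‵ 7 , ‵ 1) ∷ (‵ 1 :* ♯ 4 , ‵ 7 :* ♯ 5) ∷ (‵ 4 , ‵ 5 :* ‵ 5) ∷ (‵ 1 , ‵ 0 :* ♯ 3 :+ ‵ 6 :* ♯ 4) ∷ (‵ 5 :* ♯ 600 , ‵ 1) ∷ (‵ 6 :* ‵ 1 , ‵ 5 :* ‵ 5) ∷ [])
    ((♯ 1080000) ∷ (♯ 1080000) ∷ (♯ 2160000) ∷ (‵ 1 :* ♯ 2160000) ∷ (‵ 1 :* ♯ 432000) ∷ (♯ 1080000) ∷ (‵ 1 :* ♯ 720000) ∷ (‵ 5 :* ♯ 6600 :+ ‵ 1 :* ♯ 11) ∷ (♯ 2880000) ∷ [])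
    287988 (‵ 1 :* ‵ 1) (‵ 3 :* ♯ 4) refl (h1 , h2 , h3 , h4 , h5 , h6 , h7 , h8 , h9 , tt)
  twice : ∀ s n D D′ E → s * n * 2 ≤ D + E → s * n * 2 ≤ D′ + E → s * n * 4 ≤ D + D′ + E * 2
  twice s n D D′ E h1 h2 = certified (s ∷ n ∷ D ∷ D′ ∷ E ∷ [])
    ((‵ 0 :* ‵ 1 :* ♯ 2 , ‵ 2 :+ ‵ 4) ∷ (‵ 0 :* ‵ 1 :* ♯ 2 , ‵ 3 :+ ‵ 4) ∷ [])
    ((♯ 1) ∷ (♯ 1) ∷ [])
    0 (‵ 0 :* ‵ 1 :* ♯ 4) (‵ 2 :+ ‵ 3 :+ ‵ 4 :* ♯ 2) refl (h1 , h2 , tt)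
  S-upper : ∀ b S n s R → b + S * 3 ≤ n → n ≤ s * 3 + R * 4 → R ≤ b → S ≤ s + R
  S-upper b S n s R h1 h2 h3 = certified (b ∷ S ∷ n ∷ s ∷ R ∷ [])
    ((‵ 0 :+ ‵ 1 :* ♯ 3 , ‵ 2) ∷ (‵ 2 , ‵ 3 :* ♯ 3 :+ ‵ 4 :* ♯ 4) ∷ (‵ 4 , ‵ 0) ∷ [])
    ((♯ 1) ∷ (♯ 1) ∷ (♯ 1) ∷ [])
    2 (‵ 1) (‵ 3 :+ ‵ 4) refl (h1 , h2 , h3 , tt)
  S-lower : ∀ b S n k R → n ≤ b + S * 3 → b ≤ R + 2 → k * 600 ≤ n → R + 2 ≤ k * 10 → k * 11 ≤ S
  S-lower b S n k R h1 h2 h3 h4 = certified (b ∷ S ∷ n ∷ k ∷ R ∷ [])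
    ((‵ 2 , ‵ 0 :+ ‵ 1 :* ♯ 3) ∷ (‵ 0 , ‵ 4 :+ ♯ 2) ∷ (‵ 3 :* ♯ 600 , ‵ 2) ∷ (‵ 4 :+ ♯ 2 , ‵ 3 :* ♯ 10) ∷ [])
    ((♯ 11) ∷ (♯ 11) ∷ (♯ 11) ∷ (♯ 11) ∷ [])
    589 (‵ 3 :* ♯ 11) (‵ 1) refl (h1 , h2 , h3 , h4 , tt)
  absorbing-count : ∀ s S a m R b t n → s * 3 ≤ n → n ≤ b + S * 3 → b ≤ R → S ≤ a + m + R → a + m + t ≤ s → t ≤ R * 2
  absorbing-count s S a m R b t n h1 h2 h3 h4 h5 = certified (s ∷ S ∷ a ∷ m ∷ R ∷ b ∷ t ∷ n ∷ [])
    ((‵ 0 :* ♯ 3 , ‵ 7) ∷ (‵ 7 , ‵ 5 :+ ‵ 1 :* ♯ 3) ∷ (‵ 5 , ‵ 4) ∷ (‵ 1 , ‵ 2 :+ ‵ 3 :+ ‵ 4) ∷ (‵ 2 :+ ‵ 3 :+ ‵ 6 , ‵ 0) ∷ [])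
    ((♯ 1) ∷ (♯ 1) ∷ (♯ 1) ∷ (♯ 3) ∷ (♯ 3) ∷ [])
    2 (‵ 6) (‵ 4 :* ♯ 2) refl (h1 , h2 , h3 , h4 , h5 , tt)
  absorbing-U : ∀ s S a m R b t ζ W l n → s * 3 ≤ n → b ≤ R → a + m + t ≤ s → a + m + R ≤ S → n ≤ a * 3 + m * 3 + l → b + S * 3 ≤ n → l ≤ ζ + W → W ≤ b → t * 2 ≤ ζ
  absorbing-U s S a m R b t ζ W l n h1 h2 h3 h4 h5 h6 h7 h8 = certified (s ∷ S ∷ a ∷ m ∷ R ∷ b ∷ t ∷ ζ ∷ W ∷ l ∷ n ∷ [])
    ((‵ 0 :* ♯ 3 , ‵ 10) ∷ (‵ 5 , ‵ 4) ∷ (‵ 2 :+ ‵ 3 :+ ‵ 6 , ‵ 0) ∷ (‵ 2 :+ ‵ 3 :+ ‵ 4 , ‵ 1) ∷ (‵ 10 , ‵ 2 :* ♯ 3 :+ ‵ 3 :* ♯ 3 :+ ‵ 9) ∷ (‵ 5 :+ ‵ 1 :* ♯ 3 , ‵ 10) ∷ (‵ 9 , ‵ 7 :+ ‵ 8) ∷ (‵ 8 , ‵ 5) ∷ [])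
    ((♯ 6) ∷ (♯ 6) ∷ (♯ 18) ∷ (♯ 6) ∷ (♯ 8) ∷ (♯ 2) ∷ (♯ 8) ∷ (♯ 8) ∷ [])
    8 (‵ 6 :* ♯ 2) (‵ 7) refl (h1 , h2 , h3 , h4 , h5 , h6 , h7 , h8 , tt)
  reserve-room : ∀ J m c i k n → (J * m * 216 * c) * i ≤ k → k * 600 ≤ n → 1 ≤ J → 1 ≤ c → ((1 + J) * (m * (i * 4))) * 9 * 16 ≤ n
  reserve-room J m c i k n h1 h2 h3 h4 = certified (J ∷ m ∷ c ∷ i ∷ k ∷ n ∷ [])
    (((‵ 0 :* ‵ 1 :* ♯ 216 :* ‵ 2) :* ‵ 3 , ‵ 4) ∷ (‵ 4 :* ♯ 600 , ‵ 5) ∷ (♯ 1 , ‵ 0) ∷ (♯ 1 , ‵ 2) ∷ [])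
    ((♯ 1200) ∷ (♯ 2) ∷ (‵ 2 :* ‵ 3 :* ‵ 1 :* ♯ 129600) ∷ (‵ 0 :* ‵ 3 :* ‵ 1 :* ♯ 129600 :+ ‵ 3 :* ‵ 1 :* ♯ 129600) ∷ [])
    224 (((♯ 1 :+ ‵ 0) :* (‵ 1 :* (‵ 3 :* ♯ 4))) :* ♯ 9 :* ♯ 16) (‵ 5) refl (h1 , h2 , h3 , h4 , tt)
  forty : ∀ n U → n * 4 ≤ U * 5 → n * 41 ≤ U * 60
  forty n U h1 = certified (n ∷ U ∷ [])
    ((‵ 0 :* ♯ 4 , ‵ 1 :* ♯ 5) ∷ [])
    ((♯ 41) ∷ [])
    3 (‵ 0 :* ♯ 41) (‵ 1 :* ♯ 60) refl (h1 , tt)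
  half : ∀ n U → n * 4 ≤ U * 5 → n ≤ U * 2
  half n U h1 = certified (n ∷ U ∷ [])
    ((‵ 0 :* ♯ 4 , ‵ 1 :* ♯ 5) ∷ [])
    ((♯ 1) ∷ [])
    3 (‵ 0) (‵ 1 :* ♯ 2) refl (h1 , tt)
  absorber-size : ∀ a J m i c k n → a ≤ (J * (m * (i * 4))) * 3 → (J * m * 216 * c) * i ≤ k → (J * m * 216 * i) * n ≤ (J * m * 216 * i) * (c * k) → a * n * 18 ≤ k * k
  absorber-size a J m i c k n h1 h2 h3 = certified (a ∷ J ∷ m ∷ i ∷ c ∷ k ∷ n ∷ [])
    ((‵ 0 , (‵ 1 :* (‵ 2 :* (‵ 3 :* ♯ 4))) :* ♯ 3) ∷ ((‵ 1 :* ‵ 2 :* ♯ 216 :* ‵ 4) :* ‵ 3 , ‵ 5) ∷ ((‵ 1 :* ‵ 2 :* ♯ 216 :* ‵ 3) :* ‵ 6 , (‵ 1 :* ‵ 2 :* ♯ 216 :* ‵ 3) :* (‵ 4 :* ‵ 5)) ∷ [])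
    ((‵ 6 :* ♯ 18) ∷ (‵ 5) ∷ (♯ 1) ∷ [])
    0 (‵ 0 :* ‵ 6 :* ♯ 18) (‵ 5 :* ‵ 5) refl (h1 , h2 , h3 , tt)
  absorber-count : ∀ a J m i c k → a ≤ (J * (m * (i * 4))) * 3 → (J * m * 216 * c) * i ≤ k → 1 ≤ c → a ≤ k
  absorber-count a J m i c k h1 h2 h3 = certified (a ∷ J ∷ m ∷ i ∷ c ∷ k ∷ [])
    ((‵ 0 , (‵ 1 :* (‵ 2 :* (‵ 3 :* ♯ 4))) :* ♯ 3) ∷ ((‵ 1 :* ‵ 2 :* ♯ 216 :* ‵ 4) :* ‵ 3 , ‵ 5) ∷ (♯ 1 , ‵ 4) ∷ [])
    ((‵ 4 :* ♯ 18) ∷ (♯ 1) ∷ (‵ 0 :* ♯ 18) ∷ [])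
    17 (‵ 0) (‵ 5) refl (h1 , h2 , h3 , tt)
  early : ∀ a q W U n S b R k → q ≤ W → W + U ≤ n → n * 4 ≤ U * 5 → a ≤ k → n ≤ b + S * 3 → b ≤ R → R ≤ k * 10 → k * 600 ≤ n → a + q + R ≤ S
  early a q W U n S b R k h1 h2 h3 h4 h5 h6 h7 h8 = certified (a ∷ q ∷ W ∷ U ∷ n ∷ S ∷ b ∷ R ∷ k ∷ [])
    ((‵ 1 , ‵ 2) ∷ (‵ 2 :+ ‵ 3 , ‵ 4) ∷ (‵ 4 :* ♯ 4 , ‵ 3 :* ♯ 5) ∷ (‵ 0 , ‵ 8) ∷ (‵ 4 , ‵ 6 :+ ‵ 5 :* ♯ 3) ∷ (‵ 6 , ‵ 7) ∷ (‵ 7 , ‵ 8 :* ♯ 10) ∷ (‵ 8 :* ♯ 600 , ‵ 4) ∷ [])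
    ((♯ 590) ∷ (♯ 590) ∷ (♯ 118) ∷ (♯ 590) ∷ (♯ 131) ∷ (♯ 131) ∷ (♯ 721) ∷ (♯ 13) ∷ [])
    589 (‵ 0 :+ ‵ 1 :+ ‵ 7) (‵ 5) refl (h1 , h2 , h3 , h4 , h5 , h6 , h7 , h8 , tt)
  late : ∀ a m S s R → a + m + R + 2 ≤ S → S ≤ s + R → a + m ≤ s
  late a m S s R h1 h2 = certified (a ∷ m ∷ S ∷ s ∷ R ∷ [])
    ((‵ 0 :+ ‵ 1 :+ ‵ 4 :+ ♯ 2 , ‵ 2) ∷ (‵ 2 , ‵ 3 :+ ‵ 4) ∷ [])
    ((♯ 1) ∷ (♯ 1) ∷ [])
    0 (‵ 0 :+ ‵ 1) (‵ 3) refl (h1 , h2 , tt)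
  third : ∀ s a m t n l → s * 3 ≤ n → a + m + t ≤ s → n ≤ a * 3 + m * 3 + l → t * 3 ≤ l
  third s a m t n l h1 h2 h3 = certified (s ∷ a ∷ m ∷ t ∷ n ∷ l ∷ [])
    ((‵ 0 :* ♯ 3 , ‵ 4) ∷ (‵ 1 :+ ‵ 2 :+ ‵ 3 , ‵ 0) ∷ (‵ 4 , ‵ 1 :* ♯ 3 :+ ‵ 2 :* ♯ 3 :+ ‵ 5) ∷ [])
    ((♯ 1) ∷ (♯ 3) ∷ (♯ 1) ∷ [])
    0 (‵ 3 :* ♯ 3) (‵ 5) refl (h1 , h2 , h3 , tt)

  fourth-power : ∀ n c k D i → n ≤ c * k → k < D * suc i → c * D * (c * D) * (c * D) ≤ suc i → 0 < c →
    n * (n * n) < suc i * suc i * (suc i * suc i)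
  fourth-power n c k D i n≤ k< big c>0 = begin-strict
    n * (n * n)                                 <⟨ *-mono-< n< (*-mono-< n< n<) ⟩
    X * (X * X)                                 ≡⟨ a*b*[a*b*[a*b]]≡a*a*a*[b*b*b] (c * D) (suc i) ⟩
    c * D * (c * D) * (c * D) * (suc i * suc i * suc i) ≤⟨ *-monoˡ-≤ (suc i * suc i * suc i) big ⟩
    suc i * (suc i * suc i * suc i)             ≡⟨ a*[a*a*a]≡a*a*[a*a] (suc i) ⟩
    suc i * suc i * (suc i * suc i)             ∎
    where
    open ≤-Reasoning
    X = c * D * suc i
    n< : n < X
    n< = ≤-<-trans n≤ (<-≤-trans (*-monoʳ-< c {{>-nonZero c>0}} k<) (≤-reflexive (sym (*-assoc c D (suc i)))))

module Assembly {V : Set} (vs : List V) (h : V → V → V → Bool)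
  (h-swap : ∀ x y z → h x y z ≡ h y x z) (h-rot : ∀ x y z → h x y z ≡ h y z x)
  (h-irr : ∀ x y → h x x y ≡ false)
  (w : V → Bool) (w-edge : ∀ x y z → h x y z ≡ true → ⟦ w x ⟧ + ⟦ w y ⟧ + ⟦ w z ⟧ ≤ 1)
  (complete : ∀ x → ∃[ vs′ ] (vs ≈ x ∷ vs′)) (covered : ∀ x → ∃[ p ] ∃[ q ] (h x p q ≡ true))
  (s E : ℕ) (adjacent-rich : ∀ x y z → h x y z ≡ true → s * size vs * 4 ≤ degreeOf vs h x + degreeOf vs h y + E * 2)
  (rich : ∀ x → w x ≡ false → s * size vs * 2 ≤ degreeOf vs h x + E)
  (U-large : s * 2 ≤ sum (λ x → ⟦ not (w x) ⟧) vs) (n-large : s * 3 ≤ size vs)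
  (k c : ℕ) (k>0 : 1 ≤ k) (c>0 : 1 ≤ c) (s-large : k * 200 ≤ s) (n≤ck : size vs ≤ c * k) (E-small : E ≤ k * k)
  (U-dense : s * size vs * 2 ≤ sum (λ x → ⟦ not (w x) ⟧) vs * sum (λ x → ⟦ not (w x) ⟧) vs + k * k * 5) where

  open Graph vs h h-swap h-rot h-irr
  open Covering vs h h-swap h-rot h-irr w w-edge
  open Degrees vs h h-swap h-rot h-irr w w-edge complete covered s E adjacent-rich
  open Ore vs h h-swap h-rot h-irr w w-edge complete covered s E adjacent-rich rich U-large n-large using (take-U)

  R₀ : ℕ
  R₀ = c * c * 3

  R₀-large : n * n * 3 ≤ R₀ * (k * k)
  R₀-large = ≤-trans (*-monoˡ-≤ 3 (*-mono-≤ n≤ck n≤ck)) (≤-reflexive (a*b*[a*b]*3≡a*a*3*[b*b] c k))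

  truncate : ∀ i j → Packing (i + j) → Packing j
  truncate zero    j P = P
  truncate (suc i) j P = truncate i j (go (Packing.M P) refl)
    where
    open Packing P
    go : ∀ M′ → M ≡ M′ → Packing (i + j)
    go [] refl = case count of λ ()
    go (e@(x , y , z) ∷ M′) refl = record { M = M′ ; L = x ∷ y ∷ z ∷ L
      ; part = λ f → trans (part f) (a+b+c+d+e≡d+[a+[b+[c+e]]] (f x) (f y) (f z) (sum (hat f) M′) (sum f L))
      ; count = suc-injective count ; proper = proj₂ (vanishes {nonedge e} proper) }

  n-600 : k * 600 ≤ n
  n-600 = ≤-trans (≤-reflexive (sym (*-assoc k 200 3))) (≤-trans (*-monoˡ-≤ 3 s-large) n-large)

  module _ (R₀-small : (R₀ * 6 + 33) * n ≤ k * k) (2R₀≤k : R₀ * 2 ≤ k) where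

    -- Here there is room for R₀ superfluous triples.
    roomy : s * 3 + R₀ * 4 ≤ n → Packing s
    roomy room = finish (initial (inj₂ (λ f → refl)) n
        record { M = [] ; L = vs ; part = λ f → refl ; wedges = refl } (m≤m+n n 0))
      where
      S = s + R₀
      b = n ∸ S * 3
      S-room : R₀ + S * 3 ≤ n
      S-room = ≤-trans (≤-reflexive (a+[b+a]*3≡b*3+a*4′ s R₀)) room
      k11≤s : k * 11 ≤ s
      k11≤s = ≤-trans (*-monoʳ-≤ k (m≤m+n 11 189)) s-large
      module D = Dense vs h h-swap h-rot h-irr w w-edge complete covered s E adjacent-rich rich n-large k R₀ R₀ k>0 s-large E-small U-dense
        R₀-small 2R₀≤k R₀-large S b (m∸n+n≡m (≤-trans (m≤n+m _ R₀) S-room)) ≤-refl (≤-trans k11≤s (m≤m+n s R₀))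
        (+-cancelʳ-≤ (S * 3) R₀ b (≤-trans S-room (≤-reflexive (sym (m∸n+n≡m (≤-trans (m≤n+m _ R₀) S-room))))))
      initial = D.initial [] z≤n z≤n
      pack : ∀ j → D.State [] z≤n z≤n j → Packing j
      pack j st = record { M = M ; L = L ; part = part ; count = count ; proper = proper }
        where open D.State st
      finish : Σ ℕ (λ q → q ≤ Wn × D.State [] z≤n z≤n q) → Packing s
      finish (q , _ , st) = [ prolong , cut ]′ (≤-total q s)
        where
        prolong : q ≤ s → Packing s
        prolong q≤s = subst Packing (m+[n∸m]≡n q≤s) (pack _ (D.steps [] z≤n z≤n (s ∸ q) q
          (≤-trans (≤-reflexive (cong (_+ R₀) (m+[n∸m]≡n q≤s))) (n≤1+n _)) st))
        cut : s ≤ q → Packing s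
        cut s≤q = truncate (q ∸ s) s (subst Packing (sym (m∸n+n≡m s≤q)) (pack q st))

    module _ (tight : n ≤ s * 3 + R₀ * 4) (m : ℕ) (m-eq : m ≡ 32767) (m>0 : 0 < m)
      (D : ℕ) (D-eq : D ≡ (R₀ + 2) * 2 * m * 216 * c) (D-small : D * suc (c * D * (c * D) * (c * D)) ≤ k)
      (R₀-hundred : R₀ + 2 ≤ k * 10) where

      R₀n : R₀ * n ≤ k * k
      R₀n = ≤-trans (*-monoˡ-≤ n (≤-trans (m≤m*n R₀ 6) (m≤m+n _ 33))) R₀-small

      n>0 : 0 < n
      n>0 = ≤-trans (≤-trans k>0 (m≤m*n k 600)) n-600

      U-four-fifths : n * 4 ≤ U * 5
      U-four-fifths = ≮⇒≥ (λ lt → <⇒≱ {0} {1} (s≤s z≤n) (near-U s n U k R₀ U-dense tight n-600 R₀n lt k>0))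

      U-forty-one : n * 41 ≤ U * 60
      U-forty-one = forty n U U-four-fifths

      open Absorption vs h h-swap h-rot h-irr w complete using (common; compatible; Gadget; faulty)
      open Families vs h h-swap h-rot h-irr w complete

      degrees-common : ∀ x y → degree x + degree y ≤ n * n + common x y
      degrees-common x y = begin
        degree x + degree y
          ≡⟨ trans (sym (sum-+ _ _ vs)) (sum-cong (λ p → sym (sum-+ _ _ vs)) vs) ⟩
        sum (λ p → sum (λ q → ⟦ h x p q ⟧ + ⟦ h y p q ⟧) vs) vs
          ≤⟨ sum-mono (λ p → sum-mono (λ q → both (h x p q) (h y p q)) vs) vs ⟩
        sum (λ p → sum (λ q → 1 + ⟦ h x p q ∧ h y p q ⟧) vs) vs
          ≡⟨ trans (sum-cong (λ p → sum-+ (λ _ → 1) _ vs) vs) (trans (sum-+ (λ _ → n) _ vs) (cong (_+ common x y) (sum-const n vs))) ⟩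
        n * n + common x y ∎
        where
        open ≤-Reasoning
        both : ∀ a b → ⟦ a ⟧ + ⟦ b ⟧ ≤ 1 + ⟦ a ∧ b ⟧
        both true  b = ≤-refl
        both false b = ≤-trans (⟦⟧≤1 b) (≤-reflexive refl)

      common-large : ∀ x y → s * n * 4 ≤ degree x + degree y + E * 2 → n * n ≤ common x y * 4
      common-large x y sum-large = common-bound s n (degree x) (degree y) (common x y) E k R₀ sum-large (degrees-common x y) E-small tight n-600 R₀n

      compatible-U : ∀ a x → w a ≡ false → w x ≡ false → n * n ≤ common a x * 4
      compatible-U a x wa wx = common-large a x (twice s n (degree a) (degree x) E (rich a wa) (rich x wx))

      is-compatible : ∀ c x → n * n ≤ common c x * 4 → compatible c x ≡ true
      is-compatible c x le with compatible c x | ≤⇒≤ᵇ le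
      ... | true | _ = refl

      many-compatible : ∀ x → n ≤ sum (λ c → ⟦ u c ∧ compatible c x ⟧) vs * 2
      many-compatible x = test (w x) W-case U-case
        where
        U-case : w x ≡ false → _
        U-case wx = ≤-trans (half n U U-four-fifths) (*-monoˡ-≤ 2 (sum-mono pointwise vs))
          where
          pointwise : ∀ c → ⟦ u c ⟧ ≤ ⟦ u c ∧ compatible c x ⟧
          pointwise c = test (w c) (λ wc → subst (λ b → ⟦ not b ⟧ ≤ ⟦ not b ∧ compatible c x ⟧) (sym wc) z≤n)
            (λ wc → subst₂ (λ b d → ⟦ not b ⟧ ≤ ⟦ not b ∧ d ⟧) (sym wc) (sym (is-compatible c x (compatible-U c x wc wx))) ≤-refl)
        W-case : w x ≡ true → _
        W-case wx = ≮⇒≥ (λ few → <⇒≱ (*-mono-< few few) (≤-trans degree-large (≤-trans (*-monoˡ-≤ 4 degree-square) (≤-reflexive (a*a*4≡a*2*[a*2] (sum (λ c → ⟦ u c ∧ compatible c x ⟧) vs))))))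
          where
          degree-large : n * n ≤ degree x * 4
          degree-large = W-degree-bound s n (degree x) (degree (proj₁ (covered x))) E k R₀
            (adjacent-rich x (proj₁ (covered x)) (proj₁ (proj₂ (covered x))) (proj₂ (proj₂ (covered x))))
            (≤-trans (sum-mono (λ p → sum-mono (λ q → ⟦⟧≤1 (h (proj₁ (covered x)) p q)) vs) vs) (≤-reflexive (sum-const n vs))) E-small tight n-600 R₀n
          neighbour : ∀ p q → h x p q ≡ true → u p ∧ compatible p x ≡ true
          neighbour p q hx = cong₂ _∧_ (cong not (proj₁ (w≤u+u x p q hx wx)))
            (is-compatible p x (common-large p x (adjacent-rich p x q (trans (h-swap p x q) hx))))
          pointwise : ∀ p q → ⟦ h x p q ⟧ ≤ ⟦ u p ∧ compatible p x ⟧ * ⟦ u q ∧ compatible q x ⟧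
          pointwise p q = test (h x p q)
            (λ hx → subst₂ _≤_ (cong ⟦_⟧ (sym hx)) (cong₂ (λ a b → ⟦ a ⟧ * ⟦ b ⟧) (sym (neighbour p q hx)) (sym (neighbour q p (trans (sym (h-swap₂ x p q)) hx)))) ≤-refl)
            (λ hx → subst (λ b → ⟦ b ⟧ ≤ ⟦ u p ∧ compatible p x ⟧ * ⟦ u q ∧ compatible q x ⟧) (sym hx) z≤n)
          degree-square : degree x ≤ sum (λ c → ⟦ u c ∧ compatible c x ⟧) vs * sum (λ c → ⟦ u c ∧ compatible c x ⟧) vs
          degree-square = ≤-trans (sum-mono (λ p → sum-mono (pointwise p) vs) vs)
            (≤-reflexive (trans (sum-cong (λ p → sum-*ˡ ⟦ u p ∧ compatible p x ⟧ _ vs) vs) (sum-*ʳ (sum (λ c → ⟦ u c ∧ compatible c x ⟧) vs) (λ p → ⟦ u p ∧ compatible p x ⟧) vs)))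

      U-links : ∀ c → w c ≡ false → n * n ≤ sum (λ p → sum (λ q → ⟦ u p ∧ (u q ∧ h c p q) ⟧) vs) vs * 4
      U-links c wc = UU-bound s n (degree c) UU E k R₀ U Wn (Wn * n) (rich c wc) split ≤-refl (≤-reflexive Wn+U) U-four-fifths E-small tight n-600 R₀n
        where
        UU = sum (λ p → sum (λ q → ⟦ u p ∧ (u q ∧ h c p q) ⟧) vs) vs
        pointwise : ∀ p q → ⟦ h c p q ⟧ ≤ ⟦ u p ∧ (u q ∧ h c p q) ⟧ + (⟦ w p ⟧ + ⟦ w q ⟧)
        pointwise p q with w p | w q
        ... | false | false = m≤m+n _ _
        ... | true  | _     = ≤-trans (⟦⟧≤1 (h c p q)) (s≤s z≤n)
        ... | false | true  = ⟦⟧≤1 (h c p q)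
        split : degree c ≤ UU + Wn * n * 2
        split = ≤-trans (sum-mono (λ p → sum-mono (pointwise p) vs) vs) (≤-reflexive
          (trans (sum-cong (λ p → trans (sum-+ _ _ vs) (cong (sum (λ q → ⟦ u p ∧ (u q ∧ h c p q) ⟧) vs +_)
            (trans (sum-+ (λ _ → ⟦ w p ⟧) (λ q → ⟦ w q ⟧) vs) (cong (_+ Wn) (sum-const ⟦ w p ⟧ vs))))) vs)
          (trans (sum-+ _ _ vs) (cong (UU +_) (trans (sum-+ (λ p → ⟦ w p ⟧ * n) (λ _ → Wn) vs)
            (trans (cong₂ _+_ (sum-*ʳ n (λ p → ⟦ w p ⟧) vs) (sum-const Wn vs)) (a+a≡a*2 (Wn * n))))))))

      record Gathered (L : List V) (t : ℕ) : Set where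
        field
          Ts    : List (Triple V)
          split : Σ (List V) (λ L′ → ∀ f → sum f L ≡ sum (hat f) Ts + sum f L′)
          count : size Ts ≡ t
          good  : All (λ t → admissible t ≡ true) Ts

      -- Pairs in U are chosen first, then completed by arbitrary vertices.
      gather : ∀ t L → t * 2 ≤ sum (λ x → ⟦ u x ⟧) L → t * 3 ≤ size L → Gathered L t
      gather t L U-many L-many = finish (U-pairs t L U-many)
        where
        UPairs : ℕ → List V → Set
        UPairs t L = ∃[ ps ] ∃[ L′ ] ((∀ f → sum f L ≡ sum (ends f) ps + sum f L′) × size ps ≡ t × All (λ p → w (proj₁ p) ≡ false × w (proj₂ p) ≡ false) ps)
        U-pairs : ∀ t L → t * 2 ≤ sum (λ x → ⟦ u x ⟧) L → UPairs t L
        U-pairs zero L _ = [] , L , (λ f → refl) , refl , []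
        U-pairs (suc t) L big with take-U L (≤-trans (s≤s z≤n) big)
        ... | x , L₁ , eq₁ , wx , c₁ with take-U L₁ (≤-trans (s≤s z≤n) (s≤s⁻¹ (≤-trans big (≤-reflexive c₁))))
        ...   | y , L₂ , eq₂ , wy , c₂ with U-pairs t L₂ (s≤s⁻¹ (≤-trans (s≤s⁻¹ (≤-trans big (≤-reflexive c₁))) (≤-reflexive c₂)))
        ...     | ps , L₃ , eq₃ , cnt , ok = (x , y) ∷ ps , L₃ ,
                  (λ f → trans (eq₁ f) (trans (cong (f x +_) (trans (eq₂ f) (cong (f y +_) (eq₃ f)))) (a+[b+[c+d]]≡a+b+c+d (f x) (f y) (sum (ends f) ps) (sum f L₃)))) ,
                  cong suc cnt , (wx , wy) ∷ ok
        attach : ∀ ps L → All (λ p → w (proj₁ p) ≡ false × w (proj₂ p) ≡ false) ps → size ps ≤ size L →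
          ∃[ Ts ] ∃[ L′ ] ((∀ f → sum (ends f) ps + sum f L ≡ sum (hat f) Ts + sum f L′) × size Ts ≡ size ps × All (λ t → admissible t ≡ true) Ts)
        attach [] L [] _ = [] , L , (λ f → refl) , refl , []
        attach ((x , y) ∷ ps) (z ∷ L) ((wx , wy) ∷ ok) (s≤s le) with attach ps L ok le
        ... | Ts , L′ , eq , cnt , adm = (x , y , z) ∷ Ts , L′ ,
              (λ f → trans (a+b+c+[d+e]≡a+b+d+[c+e] (f x) (f y) (sum (ends f) ps) (f z) (sum f L)) (trans (cong (f x + f y + f z +_) (eq f)) (sym (+-assoc (f x + f y + f z) _ _)))) ,
              cong suc cnt , cong₂ (λ a b → not a ∧ not b) wx wy ∷ adm
        finish : UPairs t L → Gathered L t
        finish (ps , L₁ , eq , cnt , ok) = build (attach ps L₁ ok (+-cancelˡ-≤ (t * 2) _ _ (≤-trans (≤-reflexive (trans (cong (t * 2 +_) cnt) (a*2+a≡a*3 t)))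
            (≤-trans L-many (≤-reflexive (trans (eq (λ _ → 1)) (cong (_+ size L₁) (trans (ends-const ps) (cong (_* 2) cnt)))))))))
          where
          ends-const : ∀ ps → sum (ends {A = V} (λ _ → 1)) ps ≡ size ps * 2
          ends-const ps = trans (sum-const 2 ps) (*-comm 2 (size ps))
          build : (∃[ Ts ] ∃[ L′ ] ((∀ f → sum (ends f) ps + sum f L₁ ≡ sum (hat f) Ts + sum f L′) × size Ts ≡ size ps × All (λ t → admissible t ≡ true) Ts)) → Gathered L t
          build (Ts , L′ , eq′ , cnt′ , adm) = record { Ts = Ts ; split = L′ , (λ f → trans (eq f) (eq′ f)) ; count = trans cnt′ cnt ; good = adm }

      J : ℕ
      J = (R₀ + 2) * 2

      D>0 : 0 < D
      D>0 = n≢0⇒n>0 (λ D≡0 → <⇒≱ (*-mono-≤ (*-mono-≤ (*-mono-≤ J>0 m>0) (s≤s {0} {215} z≤n)) c>0) (≤-trans (≤-reflexive (trans (sym D-eq) D≡0)) z≤n))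
        where
        J>0 : 0 < J
        J>0 = *-mono-≤ (≤-trans (s≤s {0} {1} z≤n) (m≤n+m 2 R₀)) (s≤s {0} {1} z≤n)

      module _ (i : ℕ) (Di≤k : D * i ≤ k) (k<Di : k < D * suc i)
        (S b : ℕ) (b+3S : b + S * 3 ≡ n) (R₀≤b : R₀ ≤ b) (b≤ : b ≤ R₀ + 2) where

        kf : ℕ
        kf = m * (i * 4)

        Ji≤k : J * m * 216 * c * i ≤ k
        Ji≤k = subst (λ d → d * i ≤ k) D-eq Di≤k

        J>0 : 1 ≤ J
        J>0 = *-mono-≤ (≤-trans (s≤s {0} {1} z≤n) (m≤n+m 2 R₀)) (s≤s {0} {1} z≤n)

        open Reserve (reserve n>0 compatible-U many-compatible U-links m m-eq kf J
          (exponential m m>0 i (n * (n * n)) (fourth-power n c k D i n≤ck k<Di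
            (≤-trans (<⇒≤ (s≤s⁻¹ (*-cancelˡ-< D (suc (c * D * (c * D) * (c * D))) (suc i) (≤-<-trans D-small k<Di)))) (n≤1+n i)) c>0))
          (reserve-room J m c i k n Ji≤k n-600 J>0 c>0))

        absorbers : List (Triple V)
        absorbers = flat (concat ℱ)

        sum-concat : ∀ (f : Gadget → ℕ) ℱ → sum f (concat ℱ) ≡ sum (λ F → sum f F) ℱ
        sum-concat f []      = refl
        sum-concat f (F ∷ ℱ) = trans (sum-++ f F (concat ℱ)) (cong (sum f F +_) (sum-concat f ℱ))

        sum-A : ∀ f → sum (hat f) absorbers ≡ sum (λ F → sum (hat (hat f)) F) ℱ
        sum-A f = trans (sum-flat (hat f) (concat ℱ)) (sum-concat (hat (hat f)) ℱ)

        size-A : size absorbers ≡ sum size ℱ * 3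
        size-A = trans (flat-size n>0 compatible-U many-compatible U-links m m-eq (concat ℱ)) (cong (_* 3) (sum-concat (λ _ → 1) ℱ))

        A-bound : size absorbers ≤ J * kf * 3
        A-bound = ≤-trans (≤-reflexive size-A) (*-monoˡ-≤ 3 small)

        A≤k : size absorbers ≤ k
        A≤k = absorber-count (size absorbers) J m i c k A-bound Ji≤k c>0

        A-small : size absorbers * n * 18 ≤ k * k
        A-small = absorber-size (size absorbers) J m i c k n A-bound Ji≤k (*-monoʳ-≤ (J * m * 216 * i) n≤ck)

        S≤ : S ≤ s + R₀
        S≤ = S-upper b S n s R₀ (≤-reflexive b+3S) tight R₀≤b

        module D′ = Dense vs h h-swap h-rot h-irr w w-edge complete covered s E adjacent-rich rich n-large k R₀ R₀ k>0 s-large E-small U-dense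
          R₀-small 2R₀≤k R₀-large S b b+3S S≤ (S-lower b S n k R₀ (≤-reflexive (sym b+3S)) b≤ n-600 R₀-hundred) R₀≤b

        tight-packing : Packing s
        tight-packing = finish (D′.initial absorbers A-small A≤k (inj₁ U-forty-one) n
            record { M = [] ; L = R ; part = λ f → trans (part f) (cong (_+ sum f R) (sym (sum-A f))) ; wedges = refl } (m≤m+n n 0))
          where
          State′ = D′.State absorbers A-small A≤k
          a = size absorbers
          complete-packing : ∀ m₁ → a + m₁ + (R₀ + 2) ≡ S → State′ m₁ → Packing s
          complete-packing m₁ eqS st = build (gather t L
              (absorbing-U s S a m₁ (R₀ + 2) b t (sum (λ x → ⟦ u x ⟧) L) (sum (λ x → ⟦ w x ⟧) L) (size L) n n-large b≤
                (≤-reflexive amt) (≤-reflexive eqS) (≤-reflexive (sym vertices)) (≤-reflexive b+3S) (≤-reflexive (sym U+W)) light)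
              (third s a m₁ t n (size L) n-large (≤-reflexive amt) (≤-reflexive (sym vertices))))
            where
            open D′.State st renaming (part to part₁; count to count₁)
            t = s ∸ (a + m₁)
            amt : a + m₁ + t ≡ s
            amt = m+[n∸m]≡n (late a m₁ S s R₀ (≤-reflexive (trans (+-assoc (a + m₁) R₀ 2) eqS)) S≤)
            build : Gathered L t → Packing s
            build G = record { M = N ++ M ; L = proj₁ split
                ; part = λ f → trans (part₁ f) (trans (cong₂ _+_ (sum-A f) (cong (sum (hat f) M +_) (proj₂ split f)))
                    (trans (a+[b+[c+d]]≡a+c+b+d (sum (λ F → sum (hat (hat f)) F) ℱ) (sum (hat f) M) (sum (hat f) Ts) (sum f (proj₁ split)))
                      (cong (_+ sum f (proj₁ split)) (sym (trans (sum-++ (hat f) N M) (cong (_+ sum (hat f) M) (balance f)))))))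
                ; count = trans (sum-++ (λ _ → 1) N M) (trans (cong₂ _+_ (trans countN (cong₂ _+_ (sym size-A) countT)) count₁) (trans (a+b+c≡a+c+b a t m₁) amt))
                ; proper = trans (sum-++ nonedge N M) (cong₂ _+_ edgesN proper) }
              where
              open Gathered G renaming (count to countT; good to goodT)
              open Absorbed (absorb n>0 compatible-U many-compatible U-links m m-eq ℱ Ts good goodT
                (≤-trans (≤-reflexive countT) (≤-trans (absorbing-count s S a m₁ (R₀ + 2) b t n n-large (≤-reflexive (sym b+3S)) b≤ (≤-reflexive (sym eqS)) (≤-reflexive amt)) (≤-reflexive (sym many)))))
                renaming (count to countN; proper to edgesN)
          finish : Σ ℕ (λ q → q ≤ Wn × State′ q) → Packing s
          finish (q , q≤W , st) = complete-packing (q + j) total (D′.steps absorbers A-small A≤k j q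
              (≤-trans (≤-trans (+-monoʳ-≤ (a + (q + j)) (m≤m+n R₀ 2)) (≤-reflexive total)) (n≤1+n S)) st)
            where
            aqR≤S : a + q + (R₀ + 2) ≤ S
            aqR≤S = early a q Wn U n S b (R₀ + 2) k q≤W (≤-reflexive Wn+U) U-four-fifths A≤k (≤-reflexive (sym b+3S)) b≤ R₀-hundred n-600
            j = S ∸ (a + q + (R₀ + 2))
            total : a + (q + j) + (R₀ + 2) ≡ S
            total = trans (a+[b+c]+d≡a+b+d+c a q j (R₀ + 2)) (m+[n∸m]≡n aqR≤S)

quotient : ∀ d → 0 < d → ∀ k → ∃[ i ] (d * i ≤ k × k < d * suc i)
quotient d d>0 zero    = 0 , ≤-reflexive (*-zeroʳ d) , ≤-trans d>0 (≤-reflexive (sym (*-identityʳ d)))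
quotient d d>0 (suc k) with quotient d d>0 k
... | i , lower , upper with suc k <? d * suc i
...   | yes lt = i , ≤-trans lower (n≤1+n k) , lt
...   | no ge  = suc i , ≮⇒≥ ge , ≤-<-trans upper (*-monoʳ-< d {{>-nonZero d>0}} ≤-refl)

private
  threshold-room : ∀ n c k R → (R * 6 + 233) * c ≤ k → (R * 6 + 233) * n ≤ (R * 6 + 233) * (c * k) → (R * 6 + 233) * n ≤ k * k
  threshold-room n c k R h1 h2 = certified (n ∷ c ∷ k ∷ R ∷ [])
    (((‵ 3 :* ♯ 6 :+ ♯ 233) :* ‵ 1 , ‵ 2) ∷ ((‵ 3 :* ♯ 6 :+ ♯ 233) :* ‵ 0 , (‵ 3 :* ♯ 6 :+ ♯ 233) :* (‵ 1 :* ‵ 2)) ∷ [])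
    ((‵ 2) ∷ (♯ 1) ∷ [])
    0 ((‵ 3 :* ♯ 6 :+ ♯ 233) :* ‵ 0) (‵ 2 :* ‵ 2) refl (h1 , h2 , tt)
  E-below : ∀ s n k E → E ≤ k * k → k * 200 ≤ s → k * 600 ≤ n → 1 ≤ k → 1 + E * 2 ≤ s * n
  E-below s n k E h1 h2 h3 h4 = certified (s ∷ n ∷ k ∷ E ∷ [])
    ((‵ 3 , ‵ 2 :* ‵ 2) ∷ (‵ 2 :* ♯ 200 , ‵ 0) ∷ (‵ 2 :* ♯ 600 , ‵ 1) ∷ (♯ 1 , ‵ 2) ∷ [])
    ((♯ 240000) ∷ (‵ 1 :* ♯ 3) ∷ (‵ 2 :* ♯ 400 :+ ♯ 200) ∷ (‵ 1 :* ♯ 200 :+ ♯ 120000) ∷ [])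
    119999 (♯ 1 :+ ‵ 3 :* ♯ 2) (‵ 0 :* ‵ 1) refl (h1 , h2 , h3 , h4 , tt)
  dense-U : ∀ X E n k Y → E ≤ k * k → n * 200 ≤ k * k → Y ≤ X + E * 4 + n * 200 → Y ≤ X + k * k * 5
  dense-U X E n k Y h1 h2 h3 = certified (X ∷ E ∷ n ∷ k ∷ Y ∷ [])
    ((‵ 1 , ‵ 3 :* ‵ 3) ∷ (‵ 2 :* ♯ 200 , ‵ 3 :* ‵ 3) ∷ (‵ 4 , ‵ 0 :+ ‵ 1 :* ♯ 4 :+ ‵ 2 :* ♯ 200) ∷ [])
    ((♯ 4) ∷ (♯ 1) ∷ (♯ 1) ∷ [])
    0 (‵ 4) (‵ 0 :+ ‵ 3 :* ‵ 3 :* ♯ 5) refl (h1 , h2 , h3 , tt)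

divisor threshold : ℕ → ℕ → ℕ
divisor m c = (c * c * 3 + 2) * 2 * m * 216 * c
threshold m c = divisor m c * suc (c * divisor m c * (c * divisor m c) * (c * divisor m c))
              + (c * c * 3 * 6 + 233) * c + c * c * 3 * 2 + 3

module _ {V : Set} (vs : List V) (h : V → V → V → Bool)
  (h-swap : ∀ x y z → h x y z ≡ h y x z) (h-rot : ∀ x y z → h x y z ≡ h y z x)
  (h-irr : ∀ x y → h x x y ≡ false)
  (w : V → Bool) (w-edge : ∀ x y z → h x y z ≡ true → ⟦ w x ⟧ + ⟦ w y ⟧ + ⟦ w z ⟧ ≤ 1)
  (complete : ∀ x → ∃[ vs′ ] (vs ≈ x ∷ vs′)) (covered : ∀ x → ∃[ p ] ∃[ q ] (h x p q ≡ true))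
  (s E : ℕ) (adjacent-rich : ∀ x y z → h x y z ≡ true → s * size vs * 4 ≤ degreeOf vs h x + degreeOf vs h y + E * 2)
  (rich : ∀ x → w x ≡ false → s * size vs * 2 ≤ degreeOf vs h x + E)
  (U-large : s * 2 ≤ sum (λ x → ⟦ not (w x) ⟧) vs) (n-large : s * 3 ≤ size vs)
  (m : ℕ) (m-eq : m ≡ 32767) (m>0 : 0 < m)
  (c k : ℕ) (c>0 : 1 ≤ c) (k-large : threshold m c ≤ k) (s-large : k * 200 ≤ s) (n≤ck : size vs ≤ c * k) (E-small : E ≤ k * k) where

  open Graph vs h h-swap h-rot h-irr using (n; Packing)

  packing : Packing s
  packing = [ sparse , (λ not-sparse → dense (<⇒≤ (≰⇒> not-sparse))) ]′ (toSum (U * U + E * 4 + n * 200 ≤? s * n * 2))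
    where
    U R₀ D : ℕ
    U = sum (λ x → ⟦ not (w x) ⟧) vs
    R₀ = c * c * 3
    D = divisor m c
    X Y Z : ℕ
    X = D * suc (c * D * (c * D) * (c * D))
    Y = (R₀ * 6 + 233) * c
    Z = R₀ * 2
    k>0 : 1 ≤ k
    k>0 = ≤-trans (s≤s z≤n) (≤-trans (m≤n+m 3 (X + Y + Z)) k-large)
    Y≤k : Y ≤ k
    Y≤k = ≤-trans (≤-trans (m≤n+m Y X) (≤-trans (m≤m+n _ Z) (m≤m+n _ 3))) k-large
    Z≤k : Z ≤ k
    Z≤k = ≤-trans (≤-trans (m≤n+m Z (X + Y)) (m≤m+n _ 3)) k-large
    X≤k : X ≤ k
    X≤k = ≤-trans (≤-trans (m≤m+n X Y) (≤-trans (m≤m+n _ Z) (m≤m+n _ 3))) k-large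
    n-room : (R₀ * 6 + 233) * n ≤ k * k
    n-room = threshold-room n c k R₀ Y≤k (*-monoʳ-≤ (R₀ * 6 + 233) n≤ck)
    n-600 : k * 600 ≤ n
    n-600 = ≤-trans (≤-reflexive (sym (*-assoc k 200 3))) (≤-trans (*-monoˡ-≤ 3 s-large) n-large)
    E-below′ : E * 2 < s * n
    E-below′ = E-below s n k E E-small s-large n-600 k>0
    sparse : U * U + E * 4 + n * 200 ≤ s * n * 2 → Packing s
    sparse = Ore.dense-packing vs h h-swap h-rot h-irr w w-edge complete covered s E adjacent-rich rich U-large n-large E-below′
    dense : s * n * 2 ≤ U * U + E * 4 + n * 200 → Packing s
    dense le = [ A.roomy R₀-small Z≤k , (λ few → tight (<⇒≤ (≰⇒> few))) ]′ (toSum (s * 3 + R₀ * 4 ≤? n))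
      where
      module A = Assembly vs h h-swap h-rot h-irr w w-edge complete covered s E adjacent-rich rich U-large n-large k c k>0 c>0 s-large n≤ck E-small
        (dense-U (U * U) E n k (s * n * 2) E-small (≤-trans (≤-trans (≤-reflexive (*-comm n 200)) (*-monoˡ-≤ n (≤-trans (m≤m+n 200 33) (m≤n+m 233 (R₀ * 6))))) n-room) le)
      R₀-small : (R₀ * 6 + 33) * n ≤ k * k
      R₀-small = ≤-trans (*-monoˡ-≤ n (+-monoʳ-≤ (R₀ * 6) (m≤m+n 33 200))) n-room
      R₀+2≤ : R₀ + 2 ≤ k * 10
      R₀+2≤ = ≤-trans (+-mono-≤ (≤-trans (m≤m*n R₀ 2) Z≤k) (≤-trans (≤-trans (n≤1+n 2) (m≤n+m 3 (X + Y + Z))) k-large))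
        (≤-trans (≤-reflexive (a+a≡a*2 k)) (*-monoʳ-≤ k (m≤m+n 2 8)))
      D>0 : 0 < D
      D>0 = *-mono-≤ (*-mono-≤ (*-mono-≤ (*-mono-≤ (≤-trans (s≤s {0} {1} z≤n) (m≤n+m 2 R₀)) (s≤s {0} {1} z≤n)) m>0) (s≤s {0} {215} z≤n)) c>0
      tight : n ≤ s * 3 + R₀ * 4 → Packing s
      tight near = go (quotient D D>0 k) (quotient 3 (s≤s z≤n) (n ∸ R₀))
        where
        R₀≤n : R₀ ≤ n
        R₀≤n = ≤-trans (≤-trans (m≤m*n R₀ 2) Z≤k) (≤-trans (m≤m*n k 600) n-600)
        go : ∃[ i ] (D * i ≤ k × k < D * suc i) → ∃[ S ] (3 * S ≤ n ∸ R₀ × n ∸ R₀ < 3 * suc S) → Packing s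
        go (i , lower , upper) (S , S-lower′ , S-upper′) = A.tight-packing R₀-small Z≤k near m m-eq m>0 D refl X≤k R₀+2≤ i lower upper
          S b (m∸n+n≡m S≤n) R₀≤b b≤
          where
          b = n ∸ S * 3
          S≤n : S * 3 ≤ n
          S≤n = ≤-trans (≤-reflexive (*-comm S 3)) (≤-trans S-lower′ (m∸n≤m n R₀))
          b-lower : ∀ S n R n′ b → 3 * S ≤ n′ → n′ + R ≤ n → n ≤ b + S * 3 → R ≤ b
          b-lower S n R n′ b h1 h2 h3 = certified (S ∷ n ∷ R ∷ n′ ∷ b ∷ [])
            ((♯ 3 :* ‵ 0 , ‵ 3) ∷ (‵ 3 :+ ‵ 2 , ‵ 1) ∷ (‵ 1 , ‵ 4 :+ ‵ 0 :* ♯ 3) ∷ [])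
            ((♯ 1) ∷ (♯ 1) ∷ (♯ 1) ∷ [])
            0 (‵ 2) (‵ 4) refl (h1 , h2 , h3 , tt)
          b-upper : ∀ S n R n′ b → 1 + n′ ≤ 3 * (1 + S) → n ≤ n′ + R → b + S * 3 ≤ n → b ≤ R + 2
          b-upper S n R n′ b h1 h2 h3 = certified (S ∷ n ∷ R ∷ n′ ∷ b ∷ [])
            ((♯ 1 :+ ‵ 3 , ♯ 3 :* (♯ 1 :+ ‵ 0)) ∷ (‵ 1 , ‵ 3 :+ ‵ 2) ∷ (‵ 4 :+ ‵ 0 :* ♯ 3 , ‵ 1) ∷ [])
            ((♯ 1) ∷ (♯ 1) ∷ (♯ 1) ∷ [])
            0 (‵ 4) (‵ 2 :+ ♯ 2) refl (h1 , h2 , h3 , tt)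
          R₀≤b : R₀ ≤ b
          R₀≤b = b-lower S n R₀ (n ∸ R₀) b S-lower′ (≤-reflexive (m∸n+n≡m R₀≤n)) (≤-reflexive (sym (m∸n+n≡m S≤n)))
          b≤ : b ≤ R₀ + 2
          b≤ = b-upper S n R₀ (n ∸ R₀) b S-upper′ (≤-reflexive (sym (m∸n+n≡m R₀≤n))) (≤-reflexive (m∸n+n≡m S≤n))

-- Hypergraphs as symmetric ternary relations

sum-tabulate : ∀ {n} (f : A → ℕ) (g : Fin n → A) → sum f (tabulate g) ≡ sum (f ∘ g) (allFin n)
sum-tabulate f g = trans (cong (sum f) (sym (map-tabulate (λ i → i) g))) (sum-map f g (allFin _))

δ : ∀ {n} → Fin n → Fin n → ℕ
δ x y = ⟦ does (x ≟ᶠ y) ⟧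

δ-refl : ∀ {n} (x : Fin n) → δ x x ≡ 1
δ-refl x = cong ⟦_⟧ (dec-true (x ≟ᶠ x) refl)

δ-≡ : ∀ {n} {x y : Fin n} → 0 < δ x y → x ≡ y
δ-≡ {x = x} {y} pos with x ≟ᶠ y
... | yes eq = eq

sum-δ : ∀ {n} (x : Fin n) → sum (δ x) (allFin n) ≡ 1
sum-δ {suc n} zero    = cong suc (trans (sum-tabulate {n = n} (δ (zero {n})) suc) (sum-0 (allFin n)))
sum-δ {suc n} (suc x) = trans (sum-tabulate (δ (suc x)) suc) (trans (sum-cong shift (allFin n)) (sum-δ x))
  where
  shift : ∀ y → δ (suc x) (suc y) ≡ δ x y
  shift y with x ≟ᶠ y
  ... | yes _ = refl
  ... | no  _ = refl

size-allFin : ∀ n → size (allFin n) ≡ n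
size-allFin n = trans (size≡length (allFin n)) (length-tabulate (λ i → i))

allFin-complete : ∀ {n} (x : Fin n) → ∃[ vs′ ] (allFin n ≈ x ∷ vs′)
allFin-complete {n} x with select-positive (δ x) (allFin n) (≤-reflexive (sym (sum-δ x)))
... | y , vs′ , pos , eq with δ-≡ {x = x} {y} pos
...   | refl = vs′ , eq

member : ∀ {n} (f : Fin n → ℕ) x → f x ≤ sum f (allFin n)
member f x = ≈-member f (allFin _) x (proj₁ (allFin-complete x)) (proj₂ (allFin-complete x))

two-members : ∀ {n} (f : Fin n → ℕ) → (∀ x → f x ≤ 1) → 1 < sum f (allFin n) → ∃[ x ] ∃[ y ] (x ≢ y × 0 < f x × 0 < f y)
two-members {n} f f≤1 big with select-positive f (allFin n) (<⇒≤ big)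
... | x , vs′ , pos , eq with select-positive f vs′ (+-cancelˡ-< 1 0 _ (<-≤-trans big (≤-trans (≤-reflexive (eq f)) (+-monoˡ-≤ _ (f≤1 x)))))
...   | y , vs″ , pos′ , eq′ = x , y , distinct , pos , pos′
  where
  distinct : x ≢ y
  distinct refl = <⇒≱ {1} {2} ≤-refl (≤-trans (≤-reflexive (sym (cong₂ _+_ (δ-refl x) (δ-refl x))))
    (≤-trans (+-monoʳ-≤ (δ x x) (≤-trans (m≤m+n _ (sum (δ x) vs″)) (≤-reflexive (sym (eq′ (δ x))))))
      (≤-reflexive (trans (sym (eq (δ x))) (sum-δ x)))))

μ : ∀ {n} → Subset n → Fin n → ℕ
μ e x = ⟦ lookup e x ⟧

∈⇒μ : ∀ {n} {e : Subset n} {x} → x ∈ e → μ e x ≡ 1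
∈⇒μ x∈e = cong ⟦_⟧ ([]=⇒lookup x∈e)

∣∣≡sum : ∀ {n} (e : Subset n) → ∣ e ∣ ≡ sum (μ e) (allFin n)
∣∣≡sum []          = refl
∣∣≡sum (true ∷ e)  = cong suc (trans (∣∣≡sum e) (sym (sum-tabulate (μ (true ∷ e)) suc)))
∣∣≡sum (false ∷ e) = trans (∣∣≡sum e) (sym (sum-tabulate (μ (false ∷ e)) suc))

superset : ∀ {n} (p : Subset n) k → ∣ p ∣ ≤ k → k ≤ n → ∃[ q ] (∣ q ∣ ≡ k × (∀ x → μ p x ≤ μ q x))
superset []          zero    _  _ = [] , refl , λ ()
superset (true ∷ p)  (suc k) (s≤s le) (s≤s k≤n) with superset p k le k≤n
... | q , size-q , sub = true ∷ q , cong suc size-q , λ { zero → ≤-refl ; (suc x) → sub x }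
superset (false ∷ p) zero    le _ = false ∷ p , n≤0⇒n≡0 le , λ x → ≤-refl
superset {suc n} (false ∷ p) (suc k) le (s≤s k≤n) with ∣ p ∣ ≤? k
... | yes le′ with superset p k le′ k≤n
...   | q , size-q , sub = true ∷ q , cong suc size-q , λ { zero → z≤n ; (suc x) → sub x }
superset {suc n} (false ∷ p) (suc k) le (s≤s k≤n) | no gt with superset p (suc k) le (≤-trans (≰⇒> gt) (≤-trans (≤-reflexive (∣∣≡sum p)) (≤-trans (sum-mono (λ x → ⟦⟧≤1 (lookup p x)) (allFin n)) (≤-reflexive (size-allFin n)))))
... | q , size-q , sub = false ∷ q , size-q , λ { zero → z≤n ; (suc x) → sub x }

sum-squeeze : ∀ {n} (f g : Fin n → ℕ) → (∀ x → f x ≤ g x) → sum g (allFin n) ≤ sum f (allFin n) → ∀ x → g x ≤ f x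
sum-squeeze {n} f g f≤g le x with allFin-complete x
... | vs′ , eq = +-cancelʳ-≤ (sum f vs′) _ _ (≤-trans (+-monoʳ-≤ (g x) (sum-mono f≤g vs′))
  (≤-trans (≤-reflexive (sym (eq g))) (≤-trans le (≤-reflexive (eq f)))))

three-elements : ∀ {n} (e : Subset n) → ∣ e ∣ ≡ 3 → ∀ x y z → x ≢ y → y ≢ z → x ≢ z → x ∈ e → y ∈ e → z ∈ e →
  ∀ r → μ e r ≡ δ x r + δ y r + δ z r
three-elements {n} e size-e x y z x≢y y≢z x≢z x∈e y∈e z∈e r =
  ≤-antisym (sum-squeeze f (μ e) below total r) (below r)
  where
  f : Fin n → ℕ
  f r = δ x r + δ y r + δ z r
  below : ∀ r → f r ≤ μ e r
  below r with x ≟ᶠ r | y ≟ᶠ r | z ≟ᶠ r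
  ... | yes refl | yes refl | _        = ⊥-elim (x≢y refl)
  ... | yes refl | no _     | yes refl = ⊥-elim (x≢z refl)
  ... | no _     | yes refl | yes refl = ⊥-elim (y≢z refl)
  ... | yes refl | no _     | no _     = ≤-reflexive (sym (∈⇒μ x∈e))
  ... | no _     | yes refl | no _     = ≤-reflexive (sym (∈⇒μ y∈e))
  ... | no _     | no _     | yes refl = ≤-reflexive (sym (∈⇒μ z∈e))
  ... | no _     | no _     | no _     = z≤n
  total : sum (μ e) (allFin n) ≤ sum f (allFin n)
  total = ≤-reflexive (trans (sym (∣∣≡sum e)) (trans size-e (sym (trans (sum-+ (λ r → δ x r + δ y r) (δ z) (allFin n))
    (cong₂ _+_ (trans (sum-+ (δ x) (δ y) (allFin n)) (cong₂ _+_ (sum-δ x) (sum-δ y))) (sum-δ z))))))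

⟦⟧-injective : ∀ {a b} → ⟦ a ⟧ ≡ ⟦ b ⟧ → a ≡ b
⟦⟧-injective {true}  {true}  _ = refl
⟦⟧-injective {false} {false} _ = refl

δ-sym : ∀ {n} (x y : Fin n) → δ x y ≡ δ y x
δ-sym x y with x ≟ᶠ y | y ≟ᶠ x
... | yes _    | yes _   = refl
... | no _     | no _    = refl
... | yes refl | no x≢x  = ⊥-elim (x≢x refl)
... | no x≢x   | yes refl = ⊥-elim (x≢x refl)

sum-positive : ∀ (g : A → ℕ) xs → 0 < sum g xs → Any (λ x → 0 < g x) xs
sum-positive g (x ∷ xs) pos with g x in eq
... | zero  = there (sum-positive g xs pos)
... | suc _ = here (≤-trans (s≤s z≤n) (≤-reflexive (sym eq)))

sum-member : ∀ (g : A → ℕ) {x xs} → x Mem.∈ xs → g x ≤ sum g xs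
sum-member g (here refl)           = m≤m+n _ _
sum-member g {xs = y ∷ _} (there i) = ≤-trans (sum-member g i) (m≤n+m _ (g y))

sum-at-most-one : ∀ (g : A → ℕ) {P : A → Set} → (∀ x → g x ≤ 1) → (∀ {x y} → P x → P y → 0 < g x → 0 < g y → x ≡ y) →
  ∀ {xs} → All P xs → Unique xs → sum g xs ≤ 1
sum-at-most-one g {P} g≤1 same [] [] = z≤n
sum-at-most-one g {P} g≤1 same {x ∷ xs} (px ∷ pxs) (x∉xs ∷ unique) with 0 <? g x
... | no none = ≤-trans (+-mono-≤ (≮⇒≥ none) (sum-at-most-one g g≤1 same pxs unique)) ≤-refl
... | yes pos = +-mono-≤ (g≤1 x) (≤-trans (sum-mono-All (All.zipWith (λ (py , x≢y) → ≮⇒≥ (x≢y ∘ same px py pos)) (pxs , x∉xs))) (≤-reflexive (sum-0 xs)))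

module Links {n : ℕ} (H : Hypergraph3 n) where

  V : Set
  V = Fin n

  Joined : V → V → V → Set
  Joined x y z = x ≢ y × y ≢ z × x ≢ z × Any (λ e → x ∈ e × y ∈ e × z ∈ e) (edges H)

  joined? : ∀ x y z → Dec (Joined x y z)
  joined? x y z = ¬? (x ≟ᶠ y) ×-dec ¬? (y ≟ᶠ z) ×-dec ¬? (x ≟ᶠ z) ×-dec any? (λ e → x ∈? e ×-dec y ∈? e ×-dec z ∈? e) (edges H)

  h : V → V → V → Bool
  h x y z = does (joined? x y z)

  h⇒ : ∀ {x y z} → h x y z ≡ true → Joined x y z
  h⇒ {x} {y} {z} = does-true (joined? x y z)
    where
    does-true : ∀ {P : Set} (P? : Dec P) → does P? ≡ true → P
    does-true (yes p) _ = p

  ⇒h : ∀ {x y z} → Joined x y z → h x y z ≡ true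
  ⇒h {x} {y} {z} p = dec-true (joined? x y z) p

  private
    map-Any : ∀ {P Q : Subset n → Set} → (∀ {e} → P e → Q e) → ∀ {es} → Any P es → Any Q es
    map-Any f (here p)  = here (f p)
    map-Any f (there p) = there (map-Any f p)

    swap : ∀ {x y z} → Joined x y z → Joined y x z
    swap (x≢y , y≢z , x≢z , e) = x≢y ∘ sym , x≢z , y≢z , map-Any (λ (a , b , c) → b , a , c) e

    rotate : ∀ {x y z} → Joined x y z → Joined y z x
    rotate (x≢y , y≢z , x≢z , e) = y≢z , x≢z ∘ sym , x≢y ∘ sym , map-Any (λ (a , b , c) → b , c , a) e

    same-does : ∀ {P Q : Set} (P? : Dec P) (Q? : Dec Q) → (P → Q) → (Q → P) → does P? ≡ does Q?
    same-does (yes p) (yes q) f g = refl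
    same-does (no ¬p) (no ¬q) f g = refl
    same-does (yes p) (no ¬q) f g = ⊥-elim (¬q (f p))
    same-does (no ¬p) (yes q) f g = ⊥-elim (¬p (g q))

  h-swap : ∀ x y z → h x y z ≡ h y x z
  h-swap x y z = same-does (joined? x y z) (joined? y x z) swap swap

  h-rot : ∀ x y z → h x y z ≡ h y z x
  h-rot x y z = same-does (joined? x y z) (joined? y z x) rotate (λ p → rotate (rotate p))

  h-irr : ∀ x y → h x x y ≡ false
  h-irr x y = dec-false (joined? x x y) (λ (x≢x , _) → x≢x refl)

  open Graph (allFin n) h h-swap h-rot h-irr using (degree; nonedge; Packing)

  completes : V → Subset n → V → V → ℕ
  completes x e p q = μ e x * (μ e p * ⟦ not (does (x ≟ᶠ p)) ⟧) * (μ e q * ⟦ not (does (x ≟ᶠ q) ∨ does (p ≟ᶠ q)) ⟧)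

  completes-≤1 : ∀ x e p q → completes x e p q ≤ 1
  completes-≤1 x e p q = *-mono-≤ (*-mono-≤ (⟦⟧≤1 (lookup e x)) (*-mono-≤ (⟦⟧≤1 (lookup e p)) (⟦⟧≤1 (not (does (x ≟ᶠ p)))))) (*-mono-≤ (⟦⟧≤1 (lookup e q)) (⟦⟧≤1 (not (does (x ≟ᶠ q) ∨ does (p ≟ᶠ q)))))

  completes-joined : ∀ x e p q → 0 < completes x e p q → x ≢ p × p ≢ q × x ≢ q × x ∈ e × p ∈ e × q ∈ e
  completes-joined x e p q pos with lookup e x in ex | lookup e p in ep | lookup e q in eq | x ≟ᶠ p | x ≟ᶠ q | p ≟ᶠ q
  ... | true  | true  | true  | no a  | no b  | no c  = a , c , b , lookup⇒[]= x e ex , lookup⇒[]= p e ep , lookup⇒[]= q e eq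
  ... | true  | true  | true  | no _  | no _  | yes _ = case pos of λ ()
  ... | true  | true  | true  | no _  | yes _ | _     = case pos of λ ()
  ... | true  | true  | true  | yes _ | _     | _     = case pos of λ ()
  ... | true  | true  | false | no _  | _     | _     = case pos of λ ()
  ... | true  | true  | false | yes _ | _     | _     = case pos of λ ()
  ... | true  | false | _     | _     | _     | _     = case pos of λ ()
  ... | false | _     | _     | _     | _     | _     = case pos of λ ()

  two-completions : ∀ x e → ∣ e ∣ ≡ 3 → x ∈ e → 2 ≤ sum (λ p → sum (completes x e p) (allFin n)) (allFin n)
  two-completions x e size-e x∈e = +-cancelʳ-≤ 1 2 _ (begin
    3                                   ≡⟨ sym (trans (sym (∣∣≡sum e)) size-e) ⟩
    sum (μ e) (allFin n)                ≤⟨ sum-mono outer (allFin n) ⟩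
    sum (λ p → sum (completes x e p) (allFin n) + δ x p) (allFin n) ≡⟨ sum-+ _ _ (allFin n) ⟩
    sum (λ p → sum (completes x e p) (allFin n)) (allFin n) + sum (δ x) (allFin n) ≡⟨ cong (sum (λ p → sum (completes x e p) (allFin n)) (allFin n) +_) (sum-δ x) ⟩
    sum (λ p → sum (completes x e p) (allFin n)) (allFin n) + 1 ∎)
    where
    open ≤-Reasoning
    inner : ∀ p → x ≢ p → μ e p ≡ 1 → 1 ≤ sum (completes x e p) (allFin n)
    inner p x≢p μp = +-cancelʳ-≤ 2 1 _ (begin
      3                                 ≡⟨ sym (trans (sym (∣∣≡sum e)) size-e) ⟩
      sum (μ e) (allFin n)              ≤⟨ sum-mono pointwise (allFin n) ⟩
      sum (λ q → completes x e p q + (δ x q + δ p q)) (allFin n) ≡⟨ trans (sum-+ _ _ (allFin n)) (cong (sum (completes x e p) (allFin n) +_) (trans (sum-+ (δ x) (δ p) (allFin n)) (cong₂ _+_ (sum-δ x) (sum-δ p)))) ⟩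
      sum (completes x e p) (allFin n) + 2 ∎)
      where
      pointwise : ∀ q → μ e q ≤ completes x e p q + (δ x q + δ p q)
      pointwise q rewrite ∈⇒μ x∈e | μp with x ≟ᶠ p | x ≟ᶠ q | p ≟ᶠ q
      ... | yes eq | _     | _     = ⊥-elim (x≢p eq)
      ... | no _   | yes _ | _     = ≤-trans (⟦⟧≤1 (lookup e q)) (≤-trans (s≤s z≤n) (m≤n+m _ (1 * (1 * 1) * (μ e q * 0))))
      ... | no _   | no _  | yes _ = ≤-trans (⟦⟧≤1 (lookup e q)) (m≤n+m 1 (1 * (1 * 1) * (μ e q * 0)))
      ... | no _   | no _  | no _  = ≤-trans (≤-reflexive (a≡1*[1*1]*[a*1] (μ e q))) (m≤m+n _ 0)
    outer : ∀ p → μ e p ≤ sum (completes x e p) (allFin n) + δ x p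
    outer p = [ (λ { refl → ≤-trans (⟦⟧≤1 (lookup e x)) (≤-trans (≤-reflexive (sym (δ-refl x))) (m≤n+m _ _)) })
              , (λ x≢p → go (lookup e p) refl x≢p) ]′ (toSum (x ≟ᶠ p))
      where
      go : ∀ b → lookup e p ≡ b → x ≢ p → μ e p ≤ sum (completes x e p) (allFin n) + δ x p
      go false eq _   = ≤-trans (≤-reflexive (cong ⟦_⟧ eq)) z≤n
      go true  eq x≢p = ≤-trans (≤-reflexive (cong ⟦_⟧ eq)) (≤-trans (inner p x≢p (cong ⟦_⟧ eq)) (m≤m+n _ _))

  same-edge : ∀ x p q {e f} → ∣ e ∣ ≡ 3 → ∣ f ∣ ≡ 3 → 0 < completes x e p q → 0 < completes x f p q → e ≡ f
  same-edge x p q {e} {f} size-e size-f in-e in-f with completes-joined x e p q in-e | completes-joined x f p q in-f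
  ... | x≢p , p≢q , x≢q , x∈e , p∈e , q∈e | _ , _ , _ , x∈f , p∈f , q∈f =
    trans (sym (tabulate∘lookup e)) (trans (tabulate-cong (λ r → ⟦⟧-injective (trans
      (three-elements e size-e x p q x≢p p≢q x≢q x∈e p∈e q∈e r)
      (sym (three-elements f size-f x p q x≢p p≢q x≢q x∈f p∈f q∈f r))))) (tabulate∘lookup f))

  completions-≤-link : ∀ x p q → sum (λ e → completes x e p q) (edges H) ≤ ⟦ h x p q ⟧
  completions-≤-link x p q = [ linked , (λ none → ≤-trans (≮⇒≥ none) z≤n) ]′ (toSum (0 <? sum (λ e → completes x e p q) (edges H)))
    where
    linked : 0 < sum (λ e → completes x e p q) (edges H) → sum (λ e → completes x e p q) (edges H) ≤ ⟦ h x p q ⟧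
    linked pos = ≤-trans
      (sum-at-most-one (λ e → completes x e p q) (λ e → completes-≤1 x e p q) (same-edge x p q) (uniform H) (unique H))
      (≤-reflexive (sym (cong ⟦_⟧ (⇒h (go (find (sum-positive (λ e → completes x e p q) (edges H) pos)))))))
      where
      go : (∃[ e ] (e Mem.∈ edges H × 0 < completes x e p q)) → Joined x p q
      go (e , e∈H , pos′) with completes-joined x e p q pos′
      ... | x≢p , p≢q , x≢q , members = x≢p , p≢q , x≢q , lose e∈H members

  deg-≤-completions : ∀ x {es} → All (λ e → ∣ e ∣ ≡ 3) es →
    length (filter (x ∈?_) es) * 2 ≤ sum (λ e → sum (λ p → sum (completes x e p) (allFin n)) (allFin n)) es
  deg-≤-completions x [] = z≤n
  deg-≤-completions x {e ∷ es} (size-e ∷ sizes) with x ∈? e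
  ... | yes x∈e = +-mono-≤ (two-completions x e size-e x∈e) (deg-≤-completions x sizes)
  ... | no _    = ≤-trans (deg-≤-completions x sizes) (m≤n+m _ (sum (λ p → sum (completes x e p) (allFin n)) (allFin n)))

  deg-≤-degree : ∀ x → deg H x * 2 ≤ degree x
  deg-≤-degree x = begin
    deg H x * 2
      ≤⟨ deg-≤-completions x (uniform H) ⟩
    sum (λ e → sum (λ p → sum (λ q → completes x e p q) (allFin n)) (allFin n)) (edges H)
      ≡⟨ sum-swap (λ e p → sum (λ q → completes x e p q) (allFin n)) (edges H) (allFin n) ⟩
    sum (λ p → sum (λ e → sum (λ q → completes x e p q) (allFin n)) (edges H)) (allFin n)
      ≡⟨ sum-cong (λ p → sum-swap (λ e q → completes x e p q) (edges H) (allFin n)) (allFin n) ⟩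
    sum (λ p → sum (λ q → sum (λ e → completes x e p q) (edges H)) (allFin n)) (allFin n)
      ≤⟨ sum-mono (λ p → sum-mono (completions-≤-link x p) (allFin n)) (allFin n) ⟩
    degree x ∎
    where open ≤-Reasoning

  h-covered : NoIsolated H → ∀ x → ∃[ p ] ∃[ q ] (h x p q ≡ true)
  h-covered no-isolated x with no-isolated x
  ... | e , e∈H , x∈e with select-positive (λ p → sum (completes x e p) (allFin n)) (allFin n)
                             (≤-trans (s≤s z≤n) (two-completions x e (All.lookup (uniform H) e∈H) x∈e))
  ...   | p , _ , pos , _ with select-positive (completes x e p) (allFin n) pos
  ...     | q , _ , pos′ , _ with completes-joined x e p q pos′
  ...       | x≢p , p≢q , x≢q , members = p , q , ⇒h (x≢p , p≢q , x≢q , lose e∈H members)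

  edges-of : ∀ M → (∀ r → sum (hat (λ v → δ v r)) M ≤ 1) → sum nonedge M ≡ 0 →
    ∃[ es ] (length es ≡ size M × All (_∈E H) es × AllPairs (λ e f → Empty (e ∩ f)) es × (∀ r → sum (λ e → μ e r) es ≡ sum (hat (λ v → δ v r)) M))
  edges-of [] _ _ = [] , refl , [] , [] , λ _ → refl
  edges-of ((x , y , z) ∷ M) disjoint no-nonedges = go (h⇒ {x} {y} {z} (not-true {h x y z} (m+n≡0⇒m≡0 _ no-nonedges)))
    (edges-of M (λ r → ≤-trans (m≤n+m _ (hat (λ v → δ v r) (x , y , z))) (disjoint r)) (m+n≡0⇒n≡0 (nonedge (x , y , z)) no-nonedges))
    where
    Result : List (Triple V) → Set
    Result M = ∃[ es ] (length es ≡ size M × All (_∈E H) es × AllPairs (λ e f → Empty (e ∩ f)) es × (∀ r → sum (λ e → μ e r) es ≡ sum (hat (λ v → δ v r)) M))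
    go : Joined x y z → Result M → Result ((x , y , z) ∷ M)
    go (x≢y , y≢z , x≢z , some) (es , count , in-H , pairwise , total) with find some
    ... | e , e∈H , x∈e , y∈e , z∈e = e ∷ es , cong suc count , e∈H ∷ in-H , All.tabulate apart ∷ pairwise
        , λ r → cong₂ _+_ (elements r) (total r)
      where
      elements : ∀ r → μ e r ≡ δ x r + δ y r + δ z r
      elements = three-elements e (All.lookup (uniform H) e∈H) x y z x≢y y≢z x≢z x∈e y∈e z∈e
      apart : ∀ {f} → f Mem.∈ es → Empty (e ∩ f)
      apart {f} f∈es (r , r∈e∩f) with x∈p∩q⁻ e f r∈e∩f
      ... | r∈e , r∈f = <⇒≱ {1} {2} ≤-refl (begin
        2                                   ≡⟨ cong₂ _+_ (sym (∈⇒μ r∈e)) (sym (∈⇒μ r∈f)) ⟩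
        μ e r + μ f r                       ≤⟨ +-monoʳ-≤ (μ e r) (sum-member (λ e → μ e r) f∈es) ⟩
        μ e r + sum (λ e → μ e r) es        ≡⟨ cong₂ _+_ (elements r) (total r) ⟩
        sum (hat (λ v → δ v r)) ((x , y , z) ∷ M) ≤⟨ disjoint r ⟩
        1                                   ∎)
        where open ≤-Reasoning

  matching : ∀ {s} → Packing s → HasMatching H s
  matching {s} packed = go (edges-of M (λ r → ≤-trans (m≤m+n _ (sum (λ v → δ v r) L))
      (≤-reflexive (trans (sym (part (λ v → δ v r))) (trans (sum-cong (λ v → δ-sym v r) (allFin n)) (sum-δ r))))) no-nonedges)
    where
    open Packing packed renaming (proper to no-nonedges)
    go : ∃[ es ] (length es ≡ size M × All (_∈E H) es × AllPairs (λ e f → Empty (e ∩ f)) es × (∀ r → sum (λ e → μ e r) es ≡ sum (hat (λ v → δ v r)) M)) → HasMatching H s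
    go (es , length-es , in-H , pairwise , _) = es , trans length-es count , in-H , pairwise

  doubled-ore : ∀ s N E a b A B → 1 + s * N * 2 ≤ a + b + E → a * 2 ≤ A → b * 2 ≤ B → s * N * 4 ≤ A + B + E * 2
  doubled-ore s N E a b A B h1 h2 h3 = certified (s ∷ N ∷ E ∷ a ∷ b ∷ A ∷ B ∷ [])
    ((♯ 1 :+ ‵ 0 :* ‵ 1 :* ♯ 2 , ‵ 3 :+ ‵ 4 :+ ‵ 2) ∷ (‵ 3 :* ♯ 2 , ‵ 5) ∷ (‵ 4 :* ♯ 2 , ‵ 6) ∷ [])
    ((♯ 2) ∷ (♯ 1) ∷ (♯ 1) ∷ [])
    0 (‵ 0 :* ‵ 1 :* ♯ 4) (‵ 5 :+ ‵ 6 :+ ‵ 2 :* ♯ 2) refl (h1 , h2 , h3 , tt)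
  two-poor : ∀ X E a b → 1 + a + E ≤ X * 2 → 1 + b + E ≤ X * 2 → X * 4 ≤ a + b + E * 2 → 1 ≤ 0
  two-poor X E a b h1 h2 h3 = certified (X ∷ E ∷ a ∷ b ∷ [])
    ((♯ 1 :+ ‵ 2 :+ ‵ 1 , ‵ 0 :* ♯ 2) ∷ (♯ 1 :+ ‵ 3 :+ ‵ 1 , ‵ 0 :* ♯ 2) ∷ (‵ 0 :* ♯ 4 , ‵ 2 :+ ‵ 3 :+ ‵ 1 :* ♯ 2) ∷ [])
    ((♯ 1) ∷ (♯ 1) ∷ (♯ 1) ∷ [])
    1 (♯ 1) (♯ 0) refl (h1 , h2 , h3 , tt)

  subgraph-or-matching : NoIsolated H → ∀ s E → 1 ≤ s → s * 3 ≤ n →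
    (∀ u v → u ≢ v → Adjacent H u v → s * size (allFin n) * 2 < deg H u + deg H v + E) →
    ∀ c k → 1 ≤ c → threshold 32767 c ≤ k → k * 200 ≤ s → n ≤ c * k → E ≤ k * k → SubgraphOfH2 H s ⊎ HasMatching H s
  subgraph-or-matching no-isolated s E s>0 s-small ore c k c>0 k-large s-large n≤ck E-small =
    [ (λ U-large → inj₂ (matching (packed U-large))) , (λ U-small → inj₁ (subgraph (≰⇒> U-small))) ]′
      (toSum (s * 2 ≤? sum (λ x → ⟦ not (w x) ⟧) (allFin n)))
    where
    N = size (allFin n)
    w : V → Bool
    w x = not (s * N * 2 ≤ᵇ degree x + E)
    not-false : ∀ {b} → not b ≡ false → b ≡ true
    not-false {true} _ = refl
    un-not : ∀ {b} → not b ≡ true → b ≡ false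
    un-not {false} _ = refl
    rich : ∀ x → w x ≡ false → s * N * 2 ≤ degree x + E
    rich x eq = ≤ᵇ⇒≤ _ _ (subst IsTrue (sym (not-false eq)) tt)
    poor : ∀ x → w x ≡ true → 1 + degree x + E ≤ s * N * 2
    poor x eq = ≰⇒> (λ le → subst IsTrue (un-not {s * N * 2 ≤ᵇ degree x + E} eq) (≤⇒≤ᵇ le))
    poor-apart : ∀ {x y} → x ≢ y → Adjacent H x y → w x ≡ true → w y ≡ true → ⊥
    poor-apart {x} {y} x≢y adjacent wx wy = case two-poor (s * N) E (degree x) (degree y) (poor x wx) (poor y wy)
      (doubled-ore s N E (deg H x) (deg H y) (degree x) (degree y) (ore x y x≢y adjacent) (deg-≤-degree x) (deg-≤-degree y)) of λ ()
    adjacent : ∀ {x y z} → h x y z ≡ true → x ≢ y × Adjacent H x y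
    adjacent {x} {y} {z} eq with h⇒ {x} {y} {z} eq
    ... | x≢y , _ , _ , some with find some
    ...   | e , e∈H , x∈e , y∈e , _ = x≢y , e , e∈H , x∈e , y∈e
    at-most-one : ∀ {a b c} → (a ≡ true → b ≡ true → ⊥) → (b ≡ true → c ≡ true → ⊥) → (c ≡ true → a ≡ true → ⊥) → ⟦ a ⟧ + ⟦ b ⟧ + ⟦ c ⟧ ≤ 1
    at-most-one {true}  {true}  {_}     f _ _ = ⊥-elim (f refl refl)
    at-most-one {true}  {false} {true}  _ _ f = ⊥-elim (f refl refl)
    at-most-one {true}  {false} {false} _ _ _ = ≤-refl
    at-most-one {false} {true}  {true}  _ f _ = ⊥-elim (f refl refl)
    at-most-one {false} {true}  {false} _ _ _ = ≤-refl
    at-most-one {false} {false} {true}  _ _ _ = ≤-refl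
    at-most-one {false} {false} {false} _ _ _ = z≤n
    poor-pair : ∀ x y z → h x y z ≡ true → w x ≡ true → w y ≡ true → ⊥
    poor-pair x y z eq with adjacent {x} {y} {z} eq
    ... | x≢y , adj = poor-apart x≢y adj
    w-edge : ∀ x y z → h x y z ≡ true → ⟦ w x ⟧ + ⟦ w y ⟧ + ⟦ w z ⟧ ≤ 1
    w-edge x y z eq = at-most-one (poor-pair x y z eq) (poor-pair y z x (trans (sym (h-rot x y z)) eq)) (poor-pair z x y (trans (h-rot z x y) eq))
    adjacent-rich : ∀ x y z → h x y z ≡ true → s * N * 4 ≤ degree x + degree y + E * 2
    adjacent-rich x y z eq with adjacent {x} {y} {z} eq
    ... | x≢y , adj = doubled-ore s N E (deg H x) (deg H y) (degree x) (degree y) (ore x y x≢y adj) (deg-≤-degree x) (deg-≤-degree y)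
    packed : s * 2 ≤ sum (λ x → ⟦ not (w x) ⟧) (allFin n) → Packing s
    packed U-large = packing (allFin n) h h-swap h-rot h-irr w w-edge allFin-complete (h-covered no-isolated) s E adjacent-rich rich U-large
      (≤-trans s-small (≤-reflexive (sym (size-allFin n)))) 32767 refl (s≤s z≤n) c k c>0 k-large s-large (≤-trans (≤-reflexive (size-allFin n)) n≤ck) E-small
    subgraph : sum (λ x → ⟦ not (w x) ⟧) (allFin n) < s * 2 → SubgraphOfH2 H s
    subgraph U-small = go (superset U (2 * s ∸ 1) U-size 2s-1≤n)
      where
      U : Subset n
      U = Vec.tabulate (not ∘ w)
      μ-U : ∀ x → μ U x ≡ ⟦ not (w x) ⟧
      μ-U x = cong ⟦_⟧ (lookup∘tabulate (not ∘ w) x)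
      U-size : ∣ U ∣ ≤ 2 * s ∸ 1
      U-size = ≤-trans (≤-reflexive (trans (∣∣≡sum U) (sum-cong μ-U (allFin n))))
        (m+n≤o⇒m≤o∸n _ (≤-trans (≤-reflexive (+-comm _ 1)) (≤-trans U-small (≤-reflexive (*-comm s 2)))))
      2s-1≤n : 2 * s ∸ 1 ≤ n
      2s-1≤n = ≤-trans (m∸n≤m (2 * s) 1) (≤-trans (≤-reflexive (*-comm 2 s)) (≤-trans (*-monoʳ-≤ s (n≤1+n 2)) s-small))
      go : ∃[ T ] (∣ T ∣ ≡ 2 * s ∸ 1 × (∀ x → μ U x ≤ μ T x)) → SubgraphOfH2 H s
      go (T , size-T , U⊆T) = T , size-T , λ e e∈H → +-cancelʳ-≤ 1 2 ∣ e ∩ T ∣ (begin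
        3 ≡⟨ sym (trans (sym (∣∣≡sum e)) (All.lookup (uniform H) e∈H)) ⟩
        sum (μ e) (allFin n) ≤⟨ sum-mono (split e) (allFin n) ⟩
        sum (λ x → μ (e ∩ T) x + μ e x * ⟦ w x ⟧) (allFin n) ≡⟨ sum-+ (μ (e ∩ T)) (λ x → μ e x * ⟦ w x ⟧) (allFin n) ⟩
        sum (μ (e ∩ T)) (allFin n) + sum (λ x → μ e x * ⟦ w x ⟧) (allFin n) ≤⟨ +-mono-≤ (≤-reflexive (sym (∣∣≡sum (e ∩ T)))) (few-poor e e∈H) ⟩
        ∣ e ∩ T ∣ + 1 ∎)
        where
        open ≤-Reasoning
        μ-∩ : ∀ e x → μ (e ∩ T) x ≡ μ e x * μ T x
        μ-∩ e x = trans (cong ⟦_⟧ (lookup-zipWith _∧_ x e T)) (⟦⟧-∧ (lookup e x) (lookup T x))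
        split : ∀ e x → μ e x ≤ μ (e ∩ T) x + μ e x * ⟦ w x ⟧
        split e x = begin
          μ e x                                     ≡⟨ bool (μ e x) (w x) ⟩
          μ e x * ⟦ not (w x) ⟧ + μ e x * ⟦ w x ⟧   ≤⟨ +-monoˡ-≤ _ (*-monoʳ-≤ (μ e x) (≤-trans (≤-reflexive (sym (μ-U x))) (U⊆T x))) ⟩
          μ e x * μ T x + μ e x * ⟦ w x ⟧           ≡⟨ cong (_+ μ e x * ⟦ w x ⟧) (sym (μ-∩ e x)) ⟩
          μ (e ∩ T) x + μ e x * ⟦ w x ⟧             ∎
          where
          bool : ∀ a b → a ≡ a * ⟦ not b ⟧ + a * ⟦ b ⟧
          bool a true  = sym (cong₂ _+_ (*-zeroʳ a) (*-identityʳ a))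
          bool a false = sym (trans (cong₂ _+_ (*-identityʳ a) (*-zeroʳ a)) (+-identityʳ a))
        few-poor : ∀ e → e ∈E H → sum (λ x → μ e x * ⟦ w x ⟧) (allFin n) ≤ 1
        few-poor e e∈H = ≮⇒≥ λ many → contradict (two-members (λ x → μ e x * ⟦ w x ⟧) (λ x → *-mono-≤ (⟦⟧≤1 (lookup e x)) (⟦⟧≤1 (w x))) many)
          where
          both : ∀ {a b} → 0 < ⟦ a ⟧ * ⟦ b ⟧ → a ≡ true × b ≡ true
          both {true} {true} _ = refl , refl
          contradict : ∃[ x ] ∃[ y ] (x ≢ y × 0 < μ e x * ⟦ w x ⟧ × 0 < μ e y * ⟦ w y ⟧) → ⊥
          contradict (x , y , x≢y , px , py) with both {lookup e x} px | both {lookup e y} py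
          ... | ex , wx | ey , wy = poor-apart x≢y (e , e∈H , lookup⇒[]= x e ex , lookup⇒[]= y e ey) wx wy

-- Rational parameters

ℕ→ℚᵘ : ∀ m → toℚᵘ (ℕ→ℚ m) ℚᵘ.≃ mkℚᵘ (ℤ.+ m) 0
ℕ→ℚᵘ m = ℚ.toℚᵘ-fromℚᵘ (mkℚᵘ (ℤ.+ m) 0)

slope-bound : ∀ τ n s → 0ℚ ℚ.< τ → τ ℚ.* ℕ→ℚ n ℚ.< ℕ→ℚ s → n ≤ ↧ₙ τ * s
slope-bound τ@(mkℚ (ℤ.+ zero) d _) n s (ℚ.*<* (ℤ.+<+ ())) _
slope-bound τ@(mkℚ ℤ.-[1+ p ] d _) n s (ℚ.*<* ()) _
slope-bound τ@(mkℚ (ℤ.+ suc p) d _) n s _ lt = begin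
  n                   ≤⟨ m≤n*m n (suc p) ⟩
  suc p * n           ≡⟨ sym (*-identityʳ _) ⟩
  suc p * n * 1       ≤⟨ <⇒≤ (ℤ.drop‿+<+ cast) ⟩
  s * (suc d * 1)     ≡⟨ trans (cong (s *_) (*-identityʳ (suc d))) (*-comm s (suc d)) ⟩
  suc d * s           ∎
  where
  open ≤-Reasoning
  lt′ : mkℚᵘ (ℤ.+ suc p) d ℚᵘ.* mkℚᵘ (ℤ.+ n) 0 ℚᵘ.< mkℚᵘ (ℤ.+ s) 0
  lt′ = ℚᵘ.<-respʳ-≃ (ℕ→ℚᵘ s) (ℚᵘ.<-respˡ-≃ (ℚᵘ.≃-trans (ℚ.toℚᵘ-homo-* τ (ℕ→ℚ n)) (ℚᵘ.*-congˡ {mkℚᵘ (ℤ.+ suc p) d} (ℕ→ℚᵘ n))) (ℚ.toℚᵘ-mono-< lt))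
  cast : ℤ.+ (suc p * n * 1) ℤ.< ℤ.+ (s * (suc d * 1))
  cast = subst₂ ℤ._<_ (trans (cong (ℤ._* ℤ.+ 1) (sym (ℤ.pos-* (suc p) n))) (sym (ℤ.pos-* (suc p * n) 1))) (sym (ℤ.pos-* s (suc d * 1))) (ℚᵘ.drop-*<* lt′)

clear-denominator : ∀ N ε a b c → ε ℚ.≤ fromℚᵘ (mkℚᵘ (ℤ.+ 1) N) → ℕ→ℚ a - ε ℚ.* ℕ→ℚ b ℚ.< ℕ→ℚ c → suc N * a < suc N * c + b
clear-denominator N ε a b c ε≤ lt = subst₂ _<_ (denominator-identity N a)
  (clear-denominator-identity N c b) (ℤ.drop‿+<+ (subst₂ ℤ._<_ (sym (ℤ.pos-* a _)) numerator (ℚᵘ.drop-*<* lt′)))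
  where
  numerator : (ℤ.+ c ℤ.* ℤ.+ (suc N * 1) ℤ.+ ℤ.+ 1 ℤ.* ℤ.+ b ℤ.* ℤ.+ 1) ℤ.* ℤ.+ 1 ≡ ℤ.+ ((c * (suc N * 1) + 1 * b * 1) * 1)
  numerator = sym (trans (ℤ.pos-* (c * (suc N * 1) + 1 * b * 1) 1) (cong (ℤ._* ℤ.+ 1) (trans (ℤ.pos-+ (c * (suc N * 1)) _)
    (cong₂ ℤ._+_ (ℤ.pos-* c _) (trans (ℤ.pos-* (1 * b) 1) (cong (ℤ._* ℤ.+ 1) (ℤ.pos-* 1 b)))))))
  below : ℕ→ℚ a ℚ.< ℕ→ℚ c ℚ.+ fromℚᵘ (mkℚᵘ (ℤ.+ 1) N) ℚ.* ℕ→ℚ b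
  below = begin-strict
    ℕ→ℚ a                                          ≡⟨ sym (ℚ.+-identityʳ _) ⟩
    ℕ→ℚ a ℚ.+ 0ℚ                                   ≡⟨ cong (ℕ→ℚ a ℚ.+_) (sym (ℚ.+-inverseˡ (ε ℚ.* ℕ→ℚ b))) ⟩
    ℕ→ℚ a ℚ.+ (ℚ.- (ε ℚ.* ℕ→ℚ b) ℚ.+ ε ℚ.* ℕ→ℚ b)  ≡⟨ sym (ℚ.+-assoc (ℕ→ℚ a) _ _) ⟩
    ℕ→ℚ a - ε ℚ.* ℕ→ℚ b ℚ.+ ε ℚ.* ℕ→ℚ b            <⟨ ℚ.+-monoˡ-< _ lt ⟩
    ℕ→ℚ c ℚ.+ ε ℚ.* ℕ→ℚ b                          ≤⟨ ℚ.+-monoʳ-≤ (ℕ→ℚ c) (ℚ.*-monoʳ-≤-nonNeg (ℕ→ℚ b) {{ℚ.normalize-nonNeg b 1}} ε≤) ⟩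
    ℕ→ℚ c ℚ.+ fromℚᵘ (mkℚᵘ (ℤ.+ 1) N) ℚ.* ℕ→ℚ b ∎
    where open ℚ.≤-Reasoning
  lt′ : mkℚᵘ (ℤ.+ a) 0 ℚᵘ.< mkℚᵘ (ℤ.+ c) 0 ℚᵘ.+ mkℚᵘ (ℤ.+ 1) N ℚᵘ.* mkℚᵘ (ℤ.+ b) 0
  lt′ = ℚᵘ.<-respˡ-≃ (ℕ→ℚᵘ a) (ℚᵘ.<-respʳ-≃ (ℚᵘ.≃-trans (ℚ.toℚᵘ-homo-+ (ℕ→ℚ c) (fromℚᵘ (mkℚᵘ (ℤ.+ 1) N) ℚ.* ℕ→ℚ b))
    (ℚᵘ.+-cong (ℕ→ℚᵘ c) (ℚᵘ.≃-trans (ℚ.toℚᵘ-homo-* (fromℚᵘ (mkℚᵘ (ℤ.+ 1) N)) (ℕ→ℚ b)) (ℚᵘ.*-cong (ℚ.toℚᵘ-fromℚᵘ (mkℚᵘ (ℤ.+ 1) N)) (ℕ→ℚᵘ b)))))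
    (ℚ.toℚᵘ-mono-< below))

private
  n-below : ∀ n q s k → n ≤ q * s → q * (1 + s) ≤ q * (200 * (1 + k)) → q ≤ q * k → n ≤ q * 400 * k
  n-below n q s k h1 h2 h3 = certified (n ∷ q ∷ s ∷ k ∷ [])
    ((‵ 0 , ‵ 1 :* ‵ 2) ∷ (‵ 1 :* (♯ 1 :+ ‵ 2) , ‵ 1 :* (♯ 200 :* (♯ 1 :+ ‵ 3))) ∷ (‵ 1 , ‵ 1 :* ‵ 3) ∷ [])
    ((♯ 1) ∷ (♯ 1) ∷ (♯ 199) ∷ [])
    0 (‵ 0) (‵ 1 :* ♯ 400 :* ‵ 3) refl (h1 , h2 , h3 , tt)
  E-twice : ∀ E c k → (1 + c * c * 2) * E ≤ (c * k) * (c * k) → c * c * 2 * E ≤ c * c * (k * k)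
  E-twice E c k h1 = certified (E ∷ c ∷ k ∷ [])
    (((♯ 1 :+ ‵ 1 :* ‵ 1 :* ♯ 2) :* ‵ 0 , (‵ 1 :* ‵ 2) :* (‵ 1 :* ‵ 2)) ∷ [])
    ((♯ 1) ∷ [])
    0 (‵ 1 :* ‵ 1 :* ♯ 2 :* ‵ 0) (‵ 1 :* ‵ 1 :* (‵ 2 :* ‵ 2)) refl (h1 , tt)
  E-bound : ∀ E k K → 2 * E ≤ K → 2 * k ≤ K → 1 ≤ k → 1 + E ≤ K
  E-bound E k K h1 h2 h3 = certified (E ∷ k ∷ K ∷ [])
    ((♯ 2 :* ‵ 0 , ‵ 2) ∷ (♯ 2 :* ‵ 1 , ‵ 2) ∷ (♯ 1 , ‵ 1) ∷ [])
    ((♯ 1) ∷ (♯ 1) ∷ (♯ 2) ∷ [])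
    1 (♯ 1 :+ ‵ 0) (‵ 2) refl (h1 , h2 , h3 , tt)
  scaled-ore : ∀ N s n E a b → N * (2 * s * n) + 1 ≤ N * (a + b) + n * n → n * n + 1 ≤ N * E → N * (s * n * 2) + 1 ≤ N * (a + b + E)
  scaled-ore N s n E a b h1 h2 = certified (N ∷ s ∷ n ∷ E ∷ a ∷ b ∷ [])
    ((‵ 0 :* (♯ 2 :* ‵ 1 :* ‵ 2) :+ ♯ 1 , ‵ 0 :* (‵ 4 :+ ‵ 5) :+ ‵ 2 :* ‵ 2) ∷ (‵ 2 :* ‵ 2 :+ ♯ 1 , ‵ 0 :* ‵ 3) ∷ [])
    ((♯ 1) ∷ (♯ 1) ∷ [])
    0 (‵ 0 :* (‵ 1 :* ‵ 2 :* ♯ 2) :+ ♯ 1) (‵ 0 :* (‵ 4 :+ ‵ 5 :+ ‵ 3)) refl (h1 , h2 , tt)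

threshold≥3 : ∀ m c → 3 ≤ threshold m c
threshold≥3 m c = m≤n+m 3 _

module _ (q C K : ℕ) (q>0 : 1 ≤ q) (C-large : q * 400 ≤ C) (K-large : threshold 32767 C ≤ K) where

  conclusion : ∀ n s → q * (200 * K) ≤ n → n ≤ q * s → 3 * s ≤ n →
    (H : Hypergraph3 n) → NoIsolated H →
    (∀ u v → u ≢ v → Adjacent H u v → suc (C * C * 2) * (2 * s * n) < suc (C * C * 2) * (deg H u + deg H v) + n * n) →
    SubgraphOfH2 H s ⊎ HasMatching H s
  conclusion n s n-large n≤qs s-small H no-isolated ore =
    go (quotient 200 (s≤s z≤n) s) (quotient (suc (C * C * 2)) (s≤s z≤n) (n * n))
    where
    go : ∃[ k ] (200 * k ≤ s × s < 200 * suc k) → ∃[ E ] (suc (C * C * 2) * E ≤ n * n × n * n < suc (C * C * 2) * suc E) →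
      SubgraphOfH2 H s ⊎ HasMatching H s
    go (k , s-lower , s-upper) (E , E-lower , E-upper) =
      Links.subgraph-or-matching H no-isolated s (suc E) s>0 (≤-trans (≤-reflexive (*-comm s 3)) s-small) ore′
        C k C>0 k-large (≤-trans (≤-reflexive (*-comm k 200)) s-lower) n≤Ck E-small
      where
      C>0 : 1 ≤ C
      C>0 = ≤-trans (*-mono-≤ q>0 (s≤s {0} {399} z≤n)) C-large
      k-large : threshold 32767 C ≤ k
      k-large = ≤-trans K-large (s≤s⁻¹ (*-cancelˡ-< 200 _ _ (≤-<-trans (*-cancelˡ-≤ q {{>-nonZero q>0}} (≤-trans n-large n≤qs)) s-upper)))
      k≥3 : 3 ≤ k
      k≥3 = ≤-trans (threshold≥3 32767 C) k-large
      k>0 : 1 ≤ k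
      k>0 = ≤-trans (s≤s z≤n) k≥3
      s>0 : 1 ≤ s
      s>0 = ≤-trans (*-mono-≤ (s≤s {0} {199} z≤n) k>0) s-lower
      n≤Ck : n ≤ C * k
      n≤Ck = ≤-trans (n-below n q s k n≤qs (*-monoʳ-≤ q s-upper) (≤-trans (≤-reflexive (sym (*-identityʳ q))) (*-monoʳ-≤ q k>0))) (*-monoˡ-≤ k C-large)
      CC>0 : 1 ≤ C * C
      CC>0 = *-mono-≤ C>0 C>0
      E-small : suc E ≤ k * k
      E-small = E-bound E k (k * k)
        (*-cancelˡ-≤ (C * C) {{>-nonZero CC>0}} (≤-trans (≤-reflexive (sym (*-assoc (C * C) 2 E)))
          (E-twice E C k (≤-trans E-lower (*-mono-≤ n≤Ck n≤Ck)))))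
        (*-monoˡ-≤ k (≤-trans (n≤1+n 2) k≥3)) k>0
      ore′ : ∀ u v → u ≢ v → Adjacent H u v → s * size (allFin n) * 2 < deg H u + deg H v + suc E
      ore′ u v u≢v adjacent = subst (λ m → s * m * 2 < deg H u + deg H v + suc E) (sym (size-allFin n))
        (*-cancelˡ-< (suc (C * C * 2)) _ _ (≤-trans (≤-reflexive (+-comm 1 _)) (scaled-ore (suc (C * C * 2)) s n (suc E) (deg H u) (deg H v)
          (≤-trans (≤-reflexive (+-comm _ 1)) (ore u v u≢v adjacent)) (≤-trans (≤-reflexive (+-comm _ 1)) E-upper))))

  choice : ∀ τ → (∀ n s → τ ℚ.* ℕ→ℚ n ℚ.< ℕ→ℚ s → n ≤ q * s) →
    Σ ℚ λ ε₀ → 0ℚ ℚ.< ε₀ × (∀ (ε : ℚ) → 0ℚ ℚ.< ε → ε ℚ.≤ ε₀ →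
    Σ ℕ λ n₀ → ∀ (n s : ℕ) → n ≥ n₀ →
    τ ℚ.* ℕ→ℚ n ℚ.< ℕ→ℚ s → 3 * s ≤ n →
    (H : Hypergraph3 n) → NoIsolated H →
    σ₂> H (ℕ→ℚ (2 * s * n) - ε ℚ.* ℕ→ℚ (n * n)) →
    SubgraphOfH2 H s ⊎ HasMatching H s)
  choice τ slope = fromℚᵘ (mkℚᵘ (ℤ.+ 1) (C * C * 2)) , ℚ.positive⁻¹ _ {{ℚ.normalize-pos 1 (suc (C * C * 2))}} , λ ε _ ε≤ →
    q * (200 * K) , λ n s n-large steep s-small H no-isolated ore →
    conclusion n s n-large (slope n s steep) s-small H no-isolated (λ u v u≢v adjacent →
      clear-denominator (C * C * 2) ε (2 * s * n) (n * n) (deg H u + deg H v) ε≤ (ore u v u≢v adjacent))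

theorem6 : Σ ℚ λ τ₀ → 0ℚ ℚ.< τ₀ × (∀ (τ : ℚ) → 0ℚ ℚ.< τ → τ ℚ.≤ τ₀ →
    Σ ℚ λ ε₀ → 0ℚ ℚ.< ε₀ × (∀ (ε : ℚ) → 0ℚ ℚ.< ε → ε ℚ.≤ ε₀ →
    Σ ℕ λ n₀ → ∀ (n s : ℕ) → n ≥ n₀ →
    τ ℚ.* ℕ→ℚ n ℚ.< ℕ→ℚ s → 3 * s ≤ n →
    (H : Hypergraph3 n) → NoIsolated H →
    σ₂> H (ℕ→ℚ (2 * s * n) - ε ℚ.* ℕ→ℚ (n * n)) →
    SubgraphOfH2 H s ⊎ HasMatching H s))
theorem6 = 1ℚ , ℚ.positive⁻¹ 1ℚ , λ τ τ>0 _ →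
  choice (↧ₙ τ) (↧ₙ τ * 400) (threshold 32767 (↧ₙ τ * 400)) (s≤s z≤n) ≤-refl ≤-refl τ (λ n s → slope-bound τ n s τ>0)
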